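{- Let $\mathbb{F}$ be a field and let $\Delta$ be a finite simplicial complex with $\operatorname{depth}_{\mathbb{F}}\Delta = d-1$, and let $r$ be a positive integer with $r<d/2$. Suppose $\Delta$ is shifted with respect to a vertex $a$, i.e. whenever $B\in\Delta$ and $w\in B$, also $(B\setminus\{w\})\cup\{a\}\in\Delta$. Then $\Delta$ is strictly $r$-EKR: every intersecting family of $r$-element faces of $\Delta$ that has maximum cardinality among all such intersecting families has a common element (i.e. $\bigcap_{A\in\mathcal{A}}A\neq\emptyset$).
   Context: A simplicial complex is a finite nonempty family of sets closed under taking subsets; its elements are faces, maximal faces are facets, and $\dim A=|A|-1$. A family $\mathcal{A}$ of sets is intersecting if $A\cap A'\neq\emptyset$ for all $A,A'\in\mathcal{A}$. The link of a face $A$ is $\operatorname{link}_\Delta A=\{B\in\Delta: A\cap B=\emptyset,\ A\cup B\in\Delta\}$. $\Delta$ is Cohen-Macaulay over $\mathbb{F}$ if $\tilde H_i(\operatorname{link}_\Delta A;\mathbb{F})=0$ for all $A\in\Delta$ and all $i<\dim\operatorname{link}_\Delta A$ (reduced simplicial homology). The $k$-dimensional skeleton of $\Delta$ is the subcomplex of faces of dimension at most $k$. The depth $\operatorname{depth}_{\mathbb{F}}\Delta$ is the largest $k$ such that the $k$-dimensional skeleton of $\Delta$ is Cohen-Macaulay over $\mathbb{F}$. -}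

module Defs where

open import Level using (Level; _⊔_; 0ℓ) renaming (suc to lsuc)
open import Data.Nat as ℕ using (ℕ; zero; suc; _<_; _≤_; _<ᵇ_)
open import Data.Bool using (Bool; true; false; if_then_else_; _∧_; not)
open import Data.Fin using (Fin; toℕ)
import Data.Fin
open import Data.Fin.Subset
  using (Subset; _⊆_; _∈_; _∉_; _∪_; _∩_; _-_; ⁅_⁆; ∣_∣; Nonempty)
open import Data.Fin.Subset.Properties using (_∈?_)
open import Data.Vec using (tabulate)
open import Data.Product using (Σ; ∃; _×_; _,_)
open import Data.List using (List; length)
import Data.List.Membership.Propositional as LM
open import Data.List.Relation.Unary.Unique.Propositional using (Unique)
open import Relation.Nullary using (¬_; does)
open import Relation.Binary.PropositionalEquality using (_≡_)
open import Algebra.Bundles using (CommutativeRing)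

record Field (c ℓ : Level) : Set (lsuc (c ⊔ ℓ)) where
  field
    commutativeRing : CommutativeRing c ℓ
  open CommutativeRing commutativeRing public
  field
    1≉0     : ¬ (1# ≈ 0#)
    inverse : ∀ x → ¬ (x ≈ 0#) → ∃ λ y → (x * y) ≈ 1#

record SimplicialComplex (n : ℕ) : Set where
  field
    face     : Subset n → Bool
    nonempty : ∃ λ A → face A ≡ true
    down     : ∀ A B → B ⊆ A → face A ≡ true → face B ≡ true

-- An arbitrary Bool-valued family of subsets (used for links/skeleta
-- before knowing they are complexes; all homology is defined on these).
Family : ℕ → Set
Family n = Subset n → Bool

link : ∀ {n} → Family n → Subset n → Family n
link Δ A B = (∣ A ∩ B ∣ ℕ.≡ᵇ 0) ∧ (Δ (A ∪ B))

-- The skeleton consisting of the faces with at most m elements,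
-- i.e. the (m-1)-dimensional skeleton.
skelSize : ∀ {n} → ℕ → Family n → Family n
skelSize m Δ B = (∣ B ∣ ℕ.≤ᵇ m) ∧ (Δ B)

-- "Δ has a face with at least m elements", i.e. m - 1 ≤ dim Δ.
HasFaceOfSize≥ : ∀ {n} → Family n → ℕ → Set
HasFaceOfSize≥ Δ m = ∃ λ B → Δ B ≡ true × m ≤ ∣ B ∣

-- Reduced simplicial homology over a field, via the augmented chain
-- complex (the empty face is the unique face of dimension -1).
-- A chain is a function Subset n → F; an i-chain is read off on the faces
-- with i+1 elements.  For a face σ and a vertex v ∉ σ with σ ∪ {v} a face,
-- the incidence number [σ ∪ {v} : σ] is (-1)^p, p = #{u ∈ σ : u < v}.

module Homology {c ℓ} (F : Field c ℓ) {n : ℕ} where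
  open Field F

  sumFin : ∀ {m} → (Fin m → Carrier) → Carrier
  sumFin {zero}  f = 0#
  sumFin {suc m} f = f Data.Fin.zero + sumFin (λ i → f (Data.Fin.suc i))


  negPow : ℕ → Carrier
  negPow zero    = 1#
  negPow (suc p) = - negPow p

  below : Fin n → Subset n
  below v = tabulate (λ u → toℕ u <ᵇ toℕ v)

  ∂ : Family n → (Subset n → Carrier) → Subset n → Carrier
  ∂ L ch σ = sumFin λ v →
    if (not (does (v ∈? σ))) ∧ (L (σ ∪ ⁅ v ⁆))
    then (negPow ∣ σ ∩ below v ∣) * ch (σ ∪ ⁅ v ⁆)
    else 0#

  -- H̃_{k-1}(L; F) = 0 : every (k-1)-cycle is a (k-1)-boundary.
  -- Here k = i + 1 ranges over ℕ, so i ranges over {-1, 0, 1, ...}.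
  ReducedHomologyVanishes : Family n → ℕ → Set (c ⊔ ℓ)
  ReducedHomologyVanishes L k =
    ∀ (ch : Subset n → Carrier) →
    (∀ σ → L σ ≡ true → suc ∣ σ ∣ ≡ k → ∂ L ch σ ≈ 0#) →
    ∃ λ (b : Subset n → Carrier) →
      ∀ τ → L τ ≡ true → ∣ τ ∣ ≡ k → ∂ L b τ ≈ ch τ

  -- Cohen–Macaulay over F: for every face A and every i < dim link A,
  -- H̃_i(link A; F) = 0.  With k = i + 1, "i < dim link A" means that
  -- link A has a face with more than k elements.
  CohenMacaulay : Family n → Set (c ⊔ ℓ)
  CohenMacaulay Δ =
    ∀ A → Δ A ≡ true → ∀ k → HasFaceOfSize≥ (link Δ A) (suc k) →
    ReducedHomologyVanishes (link Δ A) k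

  -- depth_F Δ = d - 1 : the (d-1)-skeleton is Cohen–Macaulay, d - 1 ≤ dim Δ,
  -- and no k-skeleton with d - 1 < k ≤ dim Δ is Cohen–Macaulay.
  DepthEq : Family n → ℕ → Set (c ⊔ ℓ)
  DepthEq Δ d =
    CohenMacaulay (skelSize d Δ) ×
    HasFaceOfSize≥ Δ d ×
    (∀ m → d < m → HasFaceOfSize≥ Δ m → ¬ CohenMacaulay (skelSize m Δ))

ShiftedWrt : ∀ {n} → Family n → Fin n → Set
ShiftedWrt Δ a = ∀ B w → Δ B ≡ true → w ∈ B → Δ ((B - w) ∪ ⁅ a ⁆) ≡ true

IsRFamily : ∀ {n} → Family n → ℕ → List (Subset n) → Set
IsRFamily Δ r 𝒜 = Unique 𝒜 × (∀ A → A LM.∈ 𝒜 → Δ A ≡ true × ∣ A ∣ ≡ r)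

Intersecting : ∀ {n} → List (Subset n) → Set
Intersecting 𝒜 = ∀ A A' → A LM.∈ 𝒜 → A' LM.∈ 𝒜 → Nonempty (A ∩ A')

IsMaxIntersecting : ∀ {n} → Family n → ℕ → List (Subset n) → Set
IsMaxIntersecting Δ r 𝒜 =
  IsRFamily Δ r 𝒜 × Intersecting 𝒜 ×
  (∀ ℬ → IsRFamily Δ r ℬ → Intersecting ℬ → length ℬ ≤ length 𝒜)

StrictlyEKR : ∀ {n} → Family n → ℕ → Set
StrictlyEKR Δ r =
  ∀ 𝒜 → IsMaxIntersecting Δ r 𝒜 → ∃ λ v → ∀ A → A LM.∈ 𝒜 → v ∈ A

-- Let P be the (d − 1)-skeleton of Δ.  Linear dependencies over ℚ can be made primitive over ℤ and then survive in F, so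
-- counting dimensions carries the vanishing of the homology of the links of P from F over to ℚ; moreover P is pure, and B ∪ {a}
-- is a face whenever the face B has fewer than d vertices.
-- Compress a maximum intersecting family 𝒜 towards a.  If 𝒜 is stable under all compressions, its members avoiding a meet
-- pairwise in two vertices and meet every A ∖ {a} with a ∈ A ∈ 𝒜.  Exterior algebraic shifting of the link of a preserves the
-- sizes of both families, these intersection properties, and (by the homology condition) the extendability of small faces; for
-- shifted complexes an induction shows that the two families together have fewer members than the link has faces with r − 1
-- vertices, unless the first is empty.  So a nonempty first family would make 𝒜 smaller than the star of a.
-- If on the other hand a compression of 𝒜 is the star of a, then strong connectivity of the link of a shows that 𝒜 is a star.
module Submission where

open import Algebra.Bundles using (CommutativeRing)
open import Data.Bool using (Bool; true; false; if_then_else_; _∧_; _∨_; not) renaming (_≟_ to _≟B_)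
open import Data.Bool.Properties using (∧-zeroʳ; ∧-identityʳ; ∨-zeroʳ)
open import Data.Empty using (⊥; ⊥-elim)
open import Data.Fin using (Fin; zero; suc; toℕ)
open import Data.Fin.Properties using (any?) renaming (_≟_ to _≟F_)
open import Data.Fin.Subset using (Subset; _∩_; _∪_; ⁅_⁆) renaming (⊥ to ∅)
open import Data.Fin.Subset.Properties using (∣p∣≤n; ∣⁅x⁆∣≡1)
open import Data.Integer as ℤ using (ℤ)
import Data.Integer.Properties as ℤₚ
open import Data.List using (List; length)
open import Data.Nat as ℕ using (ℕ; zero; suc; z≤n; s≤s; _≡ᵇ_)
import Data.Nat.Properties as ℕₚ
open import Data.Product using (∃; _×_; _,_; proj₁; proj₂)
open import Data.Rational as ℚ using (ℚ; 0ℚ; 1ℚ)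
import Data.Rational.Properties as ℚₚ
open import Data.Sum using (_⊎_; inj₁; inj₂)
open import Data.Unit using (tt)
open import Data.Vec using (Vec; []; _∷_; lookup; zipWith; _[_]≔_)
open import Data.Vec.Properties using (lookup-zipWith; lookup∘update; lookup∘update′)
open import Relation.Nullary using (¬_; Dec; yes; no; does)

-- Two obstacles shape the proof. The field `F` may be finite and its equality undecidable, whereas
-- shifting needs many distinct points and size estimates. Hence the passage to ℚ, and hence the
-- arguments under double negation; they are released at the end, because inequalities between
-- counts and the existence of a common element are decidable. Moreover, no generic flag of
-- functionals is at hand. An explicit flag, made of polynomials evaluated at distinct points,
-- yields extendability, but its leading words need not be shifted. Repeated moves with a large
-- scalar make them shifted, but carry no homological information. The bridge is numerical:
-- extendability is an extremal property of the numbers of leading words that avoid initial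
-- segments; moves can only lower these numbers, the face numbers are fixed, and so the extremal
-- values persist. With r = q + 1 and d = k + 1 the hypothesis 2r < d reads 2q + 2 ≤ k. It leaves a
-- vertex outside two sets of q + 1 vertices, and it lets a face with q + 1 vertices be enlarged by
-- a disjoint one with q vertices even after one more vertex is deleted.

module IntegerMap where

  open import Data.Integer using (+_; -[1+_]; _⊖_)
  open import Data.Maybe using (just; nothing)
  open import Relation.Binary.Definitions using (WeaklyDecidable)
  import Relation.Binary.PropositionalEquality as ≡
  import Algebra.Solver.Ring
  open import Algebra.Solver.Ring.AlmostCommutativeRing using (fromCommutativeRing; _-Raw-AlmostCommutative⟶_; Induced-equivalence)

  module FromℤTo {c ℓ} (R : CommutativeRing c ℓ) where
    open CommutativeRing R
    open import Algebra.Properties.Semiring.Mult semiring using (×-homo-+; ×1-homo-*) renaming (_×_ to _×ℕ_)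
    open import Algebra.Properties.Ring ring using (-‿distribˡ-*; -‿distribʳ-*; -‿involutive; -0#≈0#)
    open import Algebra.Properties.AbelianGroup +-abelianGroup using (⁻¹-∙-comm)
    open import Relation.Binary.Reasoning.Setoid setoid

    -- Beyond serving the ring solvers, this map reads integer chains both in ℚ and in the given
    -- field; a Bezout relation among the entries of a chain is preserved and keeps its image from
    -- vanishing.
    fromℤ : ℤ → Carrier
    fromℤ (+ n) = n ×ℕ 1#
    fromℤ -[1+ n ] = - (suc n ×ℕ 1#)

    fromℤ-⊖ : ∀ m n → fromℤ (m ⊖ n) ≈ m ×ℕ 1# + - (n ×ℕ 1#)
    fromℤ-⊖ m zero = sym (trans (+-congˡ -0#≈0#) (+-identityʳ _))
    fromℤ-⊖ zero (suc n) = sym (+-identityˡ _)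
    fromℤ-⊖ (suc m) (suc n) = begin
      fromℤ (suc m ⊖ suc n) ≡⟨ ≡.cong fromℤ (ℤₚ.[1+m]⊖[1+n]≡m⊖n m n) ⟩
      fromℤ (m ⊖ n) ≈⟨ fromℤ-⊖ m n ⟩
      a + - b ≈⟨ +-congʳ (+-identityˡ a) ⟨
      (0# + a) + - b ≈⟨ +-congʳ (+-congʳ (-‿inverseʳ 1#)) ⟨
      ((1# + - 1#) + a) + - b ≈⟨ +-congʳ (+-assoc 1# (- 1#) a) ⟩
      (1# + (- 1# + a)) + - b ≈⟨ +-congʳ (+-congˡ (+-comm (- 1#) a)) ⟩
      (1# + (a + - 1#)) + - b ≈⟨ +-congʳ (+-assoc 1# a (- 1#)) ⟨
      ((1# + a) + - 1#) + - b ≈⟨ +-assoc _ _ _ ⟩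
      (1# + a) + (- 1# + - b) ≈⟨ +-congˡ (⁻¹-∙-comm 1# b) ⟩
      (1# + a) + - (1# + b) ∎
      where
      a = m ×ℕ 1#
      b = n ×ℕ 1#

    fromℤ-+ : ∀ x y → fromℤ (x ℤ.+ y) ≈ fromℤ x + fromℤ y
    fromℤ-+ (+ m) (+ n) = ×-homo-+ 1# m n
    fromℤ-+ (+ m) -[1+ n ] = fromℤ-⊖ m (suc n)
    fromℤ-+ -[1+ m ] (+ n) = trans (fromℤ-⊖ n (suc m)) (+-comm _ _)
    fromℤ-+ -[1+ m ] -[1+ n ] = begin
      - (suc (suc (m ℕ.+ n)) ×ℕ 1#) ≡⟨ ≡.cong (λ k → - (k ×ℕ 1#)) (≡.cong suc (≡.sym (ℕₚ-+-suc m n))) ⟩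
      - ((suc m ℕ.+ suc n) ×ℕ 1#) ≈⟨ -‿cong (×-homo-+ 1# (suc m) (suc n)) ⟩
      - (suc m ×ℕ 1# + suc n ×ℕ 1#) ≈⟨ ⁻¹-∙-comm _ _ ⟨
      - (suc m ×ℕ 1#) + - (suc n ×ℕ 1#) ∎
      where
      open import Data.Nat.Properties using () renaming (+-suc to ℕₚ-+-suc)

    fromℤ-neg : ∀ x → fromℤ (ℤ.- x) ≈ - fromℤ x
    fromℤ-neg (+ zero) = sym -0#≈0#
    fromℤ-neg (+ suc n) = refl
    fromℤ-neg -[1+ n ] = sym (-‿involutive _)

    private
      posneg : ∀ m n → fromℤ (+ m ℤ.* (ℤ.- + n)) ≈ (m ×ℕ 1#) * - (n ×ℕ 1#)
      posneg m n = begin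
        fromℤ (+ m ℤ.* (ℤ.- + n)) ≡⟨ ≡.cong fromℤ (≡.sym (ℤₚ.neg-distribʳ-* (+ m) (+ n))) ⟩
        fromℤ (ℤ.- (+ m ℤ.* + n)) ≈⟨ fromℤ-neg (+ m ℤ.* + n) ⟩
        - fromℤ (+ m ℤ.* + n) ≡⟨ ≡.cong (λ z → - fromℤ z) (≡.sym (ℤₚ.pos-* m n)) ⟩
        - ((m ℕ.* n) ×ℕ 1#) ≈⟨ -‿cong (×1-homo-* m n) ⟩
        - ((m ×ℕ 1#) * (n ×ℕ 1#)) ≈⟨ -‿distribʳ-* _ _ ⟩
        (m ×ℕ 1#) * - (n ×ℕ 1#) ∎

    fromℤ-* : ∀ x y → fromℤ (x ℤ.* y) ≈ fromℤ x * fromℤ y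
    fromℤ-* (+ m) (+ n) = trans (reflexive (≡.cong fromℤ (≡.sym (ℤₚ.pos-* m n)))) (×1-homo-* m n)
    fromℤ-* (+ m) -[1+ n ] = posneg m (suc n)
    fromℤ-* -[1+ m ] (+ n) = begin
      fromℤ (-[1+ m ] ℤ.* + n) ≡⟨ ≡.cong fromℤ (ℤₚ.*-comm -[1+ m ] (+ n)) ⟩
      fromℤ (+ n ℤ.* -[1+ m ]) ≈⟨ posneg n (suc m) ⟩
      (n ×ℕ 1#) * - (suc m ×ℕ 1#) ≈⟨ *-comm _ _ ⟩
      - (suc m ×ℕ 1#) * (n ×ℕ 1#) ∎
    fromℤ-* -[1+ m ] -[1+ n ] = begin
      ((suc m ℕ.* suc n) ×ℕ 1#) ≈⟨ ×1-homo-* (suc m) (suc n) ⟩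
      (suc m ×ℕ 1#) * (suc n ×ℕ 1#) ≈⟨ -‿involutive _ ⟨
      - - ((suc m ×ℕ 1#) * (suc n ×ℕ 1#)) ≈⟨ -‿cong (-‿distribʳ-* _ _) ⟩
      - ((suc m ×ℕ 1#) * - (suc n ×ℕ 1#)) ≈⟨ -‿distribˡ-* _ _ ⟩
      - (suc m ×ℕ 1#) * - (suc n ×ℕ 1#) ∎

    fromℤ-1 : fromℤ (+ 1) ≈ 1#
    fromℤ-1 = +-identityʳ 1#

    private
      morphism : ℤ.+-*-rawRing -Raw-AlmostCommutative⟶ fromCommutativeRing R
      morphism = record
        { ⟦_⟧ = fromℤ ; +-homo = fromℤ-+ ; *-homo = fromℤ-*
        ; -‿homo = fromℤ-neg ; 0-homo = refl ; 1-homo = fromℤ-1 }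

      dec : WeaklyDecidable (Induced-equivalence morphism)
      dec x y with x ℤ.≟ y
      ... | yes ≡.refl = just refl
      ... | no _ = nothing

    -- The ring solver with integer coefficients, which compute even when R is abstract.
    module Solver = Algebra.Solver.Ring ℤ.+-*-rawRing (fromCommutativeRing R) morphism dec

-- Counting Boolean-valued families of subsets

module Counting where

  open import Data.List using ([]; _∷_; _++_; map)
  open import Data.List.Properties using (length-++; length-map)
  open import Data.List.Membership.Propositional using (_∈_)
  open import Data.List.Membership.Propositional.Properties using (∈-∃++; ∈-++⁺ˡ; ∈-++⁺ʳ; ∈-++⁻; ∈-map⁺; ∈-map⁻)
  open import Data.List.Relation.Unary.Any using (here; there)
  open import Data.List.Relation.Unary.All as All using (All; []; _∷_)
  import Data.List.Relation.Unary.All.Properties as Allₚ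
  open import Data.List.Relation.Unary.AllPairs using ([]; _∷_)
  open import Data.List.Relation.Unary.Unique.Propositional using (Unique)
  import Data.List.Relation.Unary.Unique.Propositional.Properties as Uniqueₚ
  open import Data.Nat using (_+_; _≤_; _<_)
  open import Data.Nat.Properties
  open import Data.Nat.Tactic.RingSolver using (solve-∀)
  open import Data.Vec using (_∷ʳ_)
  open import Data.Vec.Properties using (∷-injectiveʳ)
  open import Relation.Binary.PropositionalEquality

  ∧-true⁻ˡ : ∀ {a b} → a ∧ b ≡ true → a ≡ true
  ∧-true⁻ˡ {true} _ = refl

  ∧-true⁻ʳ : ∀ {a b} → a ∧ b ≡ true → b ≡ true
  ∧-true⁻ʳ {true} p = p

  ∧-true⁺ : ∀ {a b} → a ≡ true → b ≡ true → a ∧ b ≡ true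
  ∧-true⁺ refl refl = refl

  ∨-true⁻ : ∀ {a b} → a ∨ b ≡ true → a ≡ true ⊎ b ≡ true
  ∨-true⁻ {true} _ = inj₁ refl
  ∨-true⁻ {false} p = inj₂ p

  true≢false : ∀ {a} → a ≡ true → a ≡ false → ∀ {ℓ} {X : Set ℓ} → X
  true≢false refl ()

  ¬true⇒false : ∀ {a} → ¬ (a ≡ true) → a ≡ false
  ¬true⇒false {true} f = ⊥-elim (f refl)
  ¬true⇒false {false} f = refl

  bool-cases : ∀ a → a ≡ true ⊎ a ≡ false
  bool-cases true = inj₁ refl
  bool-cases false = inj₂ refl

  unique-⊆-length : ∀ {a} {A : Set a} {xs ys : List A} → Unique xs →
    (∀ {x} → x ∈ xs → x ∈ ys) → length xs ≤ length ys
  unique-⊆-length {xs = []} _ _ = z≤n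
  unique-⊆-length {A = A} {xs = x ∷ xs} {ys} (x∉xs ∷ uniq) sub with ∈-∃++ (sub (here refl))
  ... | as , bs , refl = begin
    suc (length xs) ≤⟨ s≤s (unique-⊆-length uniq sub′) ⟩
    suc (length (as ++ bs)) ≡⟨ cong suc (length-++ as) ⟩
    suc (length as + length bs) ≡⟨ +-suc (length as) (length bs) ⟨
    length as + suc (length bs) ≡⟨ length-++ as ⟨
    length (as ++ x ∷ bs) ∎
    where
    open ≤-Reasoning
    sub′ : ∀ {y} → y ∈ xs → y ∈ as ++ bs
    sub′ y∈ with ∈-++⁻ as (sub (there y∈))
    ... | inj₁ p = ∈-++⁺ˡ p
    ... | inj₂ (here refl) = ⊥-elim (All.lookup x∉xs y∈ refl)
    ... | inj₂ (there p) = ∈-++⁺ʳ as p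

  -- Recursion on the ground set makes the split at the first vertex hold by definition. `elems`
  -- ties this number to lengths of duplicate-free lists, the language of the theorem.
  count : ∀ {n} → (Subset n → Bool) → ℕ
  count {zero} P = if P [] then 1 else 0
  count {suc n} P = count (λ σ → P (false ∷ σ)) + count (λ σ → P (true ∷ σ))

  elems : ∀ {n} → (Subset n → Bool) → List (Subset n)
  elems {zero} P = if P [] then [] ∷ [] else []
  elems {suc n} P = map (false ∷_) (elems (λ σ → P (false ∷ σ))) ++ map (true ∷_) (elems (λ σ → P (true ∷ σ)))

  length-elems : ∀ {n} (P : Subset n → Bool) → length (elems P) ≡ count P
  length-elems {zero} P with P []
  ... | true = refl
  ... | false = refl
  length-elems {suc n} P = trans (length-++ (map (false ∷_) (elems (λ σ → P (false ∷ σ)))))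
    (cong₂ _+_ (trans (length-map (false ∷_) (elems (λ σ → P (false ∷ σ)))) (length-elems (λ σ → P (false ∷ σ))))
               (trans (length-map (true ∷_) (elems (λ σ → P (true ∷ σ)))) (length-elems (λ σ → P (true ∷ σ)))))

  ∈-elems⁺ : ∀ {n} (P : Subset n → Bool) {σ} → P σ ≡ true → σ ∈ elems P
  ∈-elems⁺ {zero} P {[]} p rewrite p = here refl
  ∈-elems⁺ {suc n} P {false ∷ σ} p = ∈-++⁺ˡ (∈-map⁺ (false ∷_) (∈-elems⁺ _ p))
  ∈-elems⁺ {suc n} P {true ∷ σ} p = ∈-++⁺ʳ _ (∈-map⁺ (true ∷_) (∈-elems⁺ _ p))

  ∈-elems⁻ : ∀ {n} (P : Subset n → Bool) {σ} → σ ∈ elems P → P σ ≡ true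
  ∈-elems⁻ {zero} P {[]} m with P []
  ... | true = refl
  ∈-elems⁻ {suc n} P {σ} m with ∈-++⁻ (map (false ∷_) (elems (λ τ → P (false ∷ τ)))) m
  ... | inj₁ q with ∈-map⁻ (false ∷_) q
  ...   | τ , τ∈ , refl = ∈-elems⁻ (λ τ → P (false ∷ τ)) τ∈
  ∈-elems⁻ {suc n} P {σ} m | inj₂ q with ∈-map⁻ (true ∷_) q
  ...   | τ , τ∈ , refl = ∈-elems⁻ (λ τ → P (true ∷ τ)) τ∈

  elems-unique : ∀ {n} (P : Subset n → Bool) → Unique (elems P)
  elems-unique {zero} P with P []
  ... | true = [] ∷ []
  ... | false = []
  elems-unique {suc n} P = Uniqueₚ.++⁺
    (Uniqueₚ.map⁺ ∷-injectiveʳ (elems-unique (λ σ → P (false ∷ σ))))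
    (Uniqueₚ.map⁺ ∷-injectiveʳ (elems-unique (λ σ → P (true ∷ σ))))
    disjoint
    where
    disjoint : ∀ {σ} → ¬ (σ ∈ map (false ∷_) (elems (λ τ → P (false ∷ τ))) × σ ∈ map (true ∷_) (elems (λ τ → P (true ∷ τ))))
    disjoint (p , q) with ∈-map⁻ (false ∷_) p | ∈-map⁻ (true ∷_) q
    ... | _ , _ , refl | _ , _ , ()

  private
    map-unique : ∀ {a b} {A : Set a} {B : Set b} (f : A → B) (xs : List A) → Unique xs →
      (∀ {x y} → x ∈ xs → y ∈ xs → f x ≡ f y → x ≡ y) → Unique (map f xs)
    map-unique f [] _ _ = []
    map-unique f (x ∷ xs) (x∉ ∷ u) inj =
      Allₚ.map⁺ (All.tabulate (λ y∈ eq → All.lookup x∉ y∈ (inj (here refl) (there y∈) eq)))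
      ∷ map-unique f xs u (λ p q → inj (there p) (there q))

  -- Injectivity is asked on the members of `P` only, so that inserting or removing a fixed vertex
  -- can serve as `f`, although it is not injective on all subsets.
  count-injection : ∀ {m n} {P : Subset m → Bool} {Q : Subset n → Bool} (f : Subset m → Subset n) →
    (∀ σ → P σ ≡ true → Q (f σ) ≡ true) →
    (∀ σ τ → P σ ≡ true → P τ ≡ true → f σ ≡ f τ → σ ≡ τ) →
    count P ≤ count Q
  count-injection {P = P} {Q} f into inj = subst₂ _≤_
    (trans (length-map f (elems P)) (length-elems P)) (length-elems Q)
    (unique-⊆-length
      (map-unique f (elems P) (elems-unique P) (λ p q → inj _ _ (∈-elems⁻ P p) (∈-elems⁻ P q)))
      sub)
    where
    sub : ∀ {τ} → τ ∈ map f (elems P) → τ ∈ elems Q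
    sub m with ∈-map⁻ f m
    ... | σ , σ∈ , refl = ∈-elems⁺ Q (into σ (∈-elems⁻ P σ∈))

  count-mono : ∀ {n} {P Q : Subset n → Bool} → (∀ σ → P σ ≡ true → Q σ ≡ true) → count P ≤ count Q
  count-mono sub = count-injection (λ σ → σ) sub (λ _ _ _ _ eq → eq)

  count-cong : ∀ {n} {P Q : Subset n → Bool} → (∀ σ → P σ ≡ Q σ) → count P ≡ count Q
  count-cong eq = ≤-antisym (count-mono (λ σ p → trans (sym (eq σ)) p)) (count-mono (λ σ p → trans (eq σ) p))

  count-none : ∀ {n} {P : Subset n → Bool} → (∀ σ → P σ ≡ false) → count P ≡ 0
  count-none {zero} e rewrite e [] = refl
  count-none {suc n} e = cong₂ _+_ (count-none (λ σ → e (false ∷ σ))) (count-none (λ σ → e (true ∷ σ)))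

  count-pos : ∀ {n} (P : Subset n → Bool) {σ} → P σ ≡ true → 0 < count P
  count-pos {zero} P {[]} p rewrite p = s≤s z≤n
  count-pos {suc n} P {false ∷ σ} p = ≤-trans (count-pos (λ τ → P (false ∷ τ)) p) (m≤m+n _ _)
  count-pos {suc n} P {true ∷ σ} p = ≤-trans (count-pos (λ τ → P (true ∷ τ)) p) (m≤n+m _ _)

  count-split : ∀ {n} (P Q : Subset n → Bool) →
    count (λ σ → P σ ∧ Q σ) + count (λ σ → P σ ∧ not (Q σ)) ≡ count P
  count-split {zero} P Q with P [] | Q []
  ... | true | true = refl
  ... | true | false = refl
  ... | false | _ = refl
  count-split {suc n} P Q = trans
    (interchange (count (λ σ → P (false ∷ σ) ∧ Q (false ∷ σ))) (count (λ σ → P (true ∷ σ) ∧ Q (true ∷ σ)))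
      (count (λ σ → P (false ∷ σ) ∧ not (Q (false ∷ σ)))) (count (λ σ → P (true ∷ σ) ∧ not (Q (true ∷ σ)))))
    (cong₂ _+_ (count-split (λ σ → P (false ∷ σ)) (λ σ → Q (false ∷ σ)))
               (count-split (λ σ → P (true ∷ σ)) (λ σ → Q (true ∷ σ))))
    where
    interchange : ∀ a b c d → (a + b) + (c + d) ≡ (a + c) + (b + d)
    interchange = solve-∀

  count-strict : ∀ {n} {P Q : Subset n → Bool} → (∀ σ → P σ ≡ true → Q σ ≡ true) →
    ∀ σ → Q σ ≡ true → P σ ≡ false → count P < count Q
  count-strict {P = P} {Q} sub σ q p = begin-strict
    count P ≤⟨ count-mono (λ τ r → ∧-true⁺ (sub τ r) r) ⟩
    count (λ τ → Q τ ∧ P τ) <⟨ m<m+n _ (count-pos (λ τ → Q τ ∧ not (P τ)) {σ} (∧-true⁺ q (cong not p))) ⟩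
    count (λ τ → Q τ ∧ P τ) + count (λ τ → Q τ ∧ not (P τ)) ≡⟨ count-split Q P ⟩
    count Q ∎
    where open ≤-Reasoning

  count-disjoint : ∀ {n} {P Q R : Subset n → Bool} → (∀ σ → P σ ≡ true → R σ ≡ true) →
    (∀ σ → Q σ ≡ true → R σ ≡ true) → (∀ σ → P σ ≡ true → Q σ ≡ true → Data.Empty.⊥) →
    count P + count Q ≤ count R
  count-disjoint {P = P} {Q} {R} p q disj = begin
    count P + count Q ≤⟨ +-mono-≤ (count-mono (λ σ x → ∧-true⁺ (p σ x) x))
      (count-mono (λ σ y → ∧-true⁺ (q σ y) (cong not (¬true⇒false (λ x → disj σ x y))))) ⟩
    count (λ σ → R σ ∧ P σ) + count (λ σ → R σ ∧ not (P σ)) ≡⟨ count-split R P ⟩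
    count R ∎
    where open ≤-Reasoning

  -- Shiftedness favours early vertices, so the induction on shifted families deletes the last
  -- vertex, whereas `count` recurses on the first.
  count-snoc : ∀ {n} (P : Subset (suc n) → Bool) →
    count P ≡ count (λ σ → P (σ ∷ʳ false)) + count (λ σ → P (σ ∷ʳ true))
  count-snoc {zero} P = refl
  count-snoc {suc n} P = trans
    (cong₂ _+_ (count-snoc (λ σ → P (false ∷ σ))) (count-snoc (λ σ → P (true ∷ σ))))
    (interchange (count (λ σ → P (false ∷ (σ ∷ʳ false)))) (count (λ σ → P (false ∷ (σ ∷ʳ true))))
      (count (λ σ → P (true ∷ (σ ∷ʳ false)))) (count (λ σ → P (true ∷ (σ ∷ʳ true)))))
    where
    interchange : ∀ a b c d → (a + b) + (c + d) ≡ (a + c) + (b + d)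
    interchange = solve-∀

-- The counting inequality for shifted complexes

module ShiftedFamilies where

  open Counting
  open import Data.Fin.Subset using (∁; ∣_∣) renaming (⊤ to full)
  open import Data.Fin.Subset.Properties using (∣∁p∣≡n∸∣p∣; ∣⊤∣≡n; ∣p∣≡n⇒p≡⊤)
  open import Data.Nat using (_+_; _∸_; _*_; _≤_; _<_)
  open import Data.Nat.Properties
  open import Data.Vec using (_∷ʳ_)
  open import Relation.Binary.PropositionalEquality
  open import Relation.Nullary using (contradiction)

  private variable
    n : ℕ
    σ τ : Subset n

  ≡ᵇ-true⁺ : ∀ {m k} → m ≡ k → (m ≡ᵇ k) ≡ true
  ≡ᵇ-true⁺ {zero} refl = refl
  ≡ᵇ-true⁺ {suc m} refl = ≡ᵇ-true⁺ {m} refl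

  ≡ᵇ-true⁻ : ∀ {m k} → (m ≡ᵇ k) ≡ true → m ≡ k
  ≡ᵇ-true⁻ {zero} {zero} _ = refl
  ≡ᵇ-true⁻ {suc m} {suc k} p = cong suc (≡ᵇ-true⁻ p)

  data Add : ∀ {n} → Subset n → Subset n → Set where
    here  : Add {suc n} (false ∷ σ) (true ∷ σ)
    there : ∀ {b} → Add σ τ → Add {suc n} (b ∷ σ) (b ∷ τ)

  -- Adj σ τ: some element i + 1 of σ is replaced by i.
  data Adj : ∀ {n} → Subset n → Subset n → Set where
    here  : Adj {suc (suc n)} (false ∷ true ∷ σ) (true ∷ false ∷ σ)
    there : ∀ {b} → Adj σ τ → Adj {suc n} (b ∷ σ) (b ∷ τ)

  -- An element is traded for an arbitrary earlier non-element; in `here` the `Add` runs backwards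
  -- because it removes the old element.
  data Shift : ∀ {n} → Subset n → Subset n → Set where
    here  : Add τ σ → Shift {suc n} (false ∷ σ) (true ∷ τ)
    there : ∀ {b} → Shift σ τ → Shift {suc n} (b ∷ σ) (b ∷ τ)

  AdjClosed : (Subset n → Bool) → Set
  AdjClosed P = ∀ {σ τ} → Adj σ τ → P σ ≡ true → P τ ≡ true

  DownClosed : (Subset n → Bool) → Set
  DownClosed P = ∀ {σ τ} → Add σ τ → P τ ≡ true → P σ ≡ true

  -- The combinatorial remnant of depth: all that the induction on shifted families uses of the
  -- homological hypothesis.
  Extendable : ℕ → (Subset n → Bool) → Set
  Extendable e P = ∀ σ → P σ ≡ true → ∣ σ ∣ < e → ∃ λ τ → Add σ τ × P τ ≡ true

  add-size : Add σ τ → ∣ τ ∣ ≡ suc ∣ σ ∣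
  add-size here = refl
  add-size (there {b = true} a) = cong suc (add-size a)
  add-size (there {b = false} a) = add-size a

  -- A long move is a chain of adjacent ones. If the position after the target is occupied, its
  -- occupant moves first and the hole is filled afterwards; if it is free, the element first
  -- travels to it.
  shift-closed : (P : Subset n → Bool) → AdjClosed P → Shift σ τ → P σ ≡ true → P τ ≡ true
  shift-closed P adj (there {b = b} s) p = shift-closed (λ ρ → P (b ∷ ρ)) (λ a → adj (there a)) s p
  shift-closed P adj (here here) p = adj here p
  shift-closed P adj (here (there {b = true} a)) p =
    shift-closed (λ ρ → P (true ∷ ρ)) (λ a → adj (there a)) (here a) (adj here p)
  shift-closed P adj (here (there {b = false} a)) p =
    adj here (shift-closed (λ ρ → P (false ∷ ρ)) (λ a → adj (there a)) (here a) p)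

  size-snoc-false : (σ : Subset n) → ∣ σ ∷ʳ false ∣ ≡ ∣ σ ∣
  size-snoc-false [] = refl
  size-snoc-false (true ∷ σ) = cong suc (size-snoc-false σ)
  size-snoc-false (false ∷ σ) = size-snoc-false σ

  size-snoc-true : (σ : Subset n) → ∣ σ ∷ʳ true ∣ ≡ suc ∣ σ ∣
  size-snoc-true [] = refl
  size-snoc-true (true ∷ σ) = cong suc (size-snoc-true σ)
  size-snoc-true (false ∷ σ) = size-snoc-true σ

  ∩-snoc : (σ τ : Subset n) (a b : Bool) → (σ ∷ʳ a) ∩ (τ ∷ʳ b) ≡ (σ ∩ τ) ∷ʳ (a ∧ b)
  ∩-snoc [] [] a b = refl
  ∩-snoc (x ∷ σ) (y ∷ τ) a b = cong (x ∧ y ∷_) (∩-snoc σ τ a b)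

  add-snoc : ∀ {b} → Add σ τ → Add (σ ∷ʳ b) (τ ∷ʳ b)
  add-snoc here = here
  add-snoc (there a) = there (add-snoc a)

  add-last : (σ : Subset n) → Add (σ ∷ʳ false) (σ ∷ʳ true)
  add-last [] = here
  add-last (b ∷ σ) = there (add-last σ)

  add-snoc⁻ : ∀ (σ : Subset n) b {ρ} → Add (σ ∷ʳ b) ρ →
    (∃ λ τ → Add σ τ × ρ ≡ τ ∷ʳ b) ⊎ (b ≡ false × ρ ≡ σ ∷ʳ true)
  add-snoc⁻ [] false here = inj₂ (refl , refl)
  add-snoc⁻ [] b (there ())
  add-snoc⁻ (false ∷ σ) b here = inj₁ (true ∷ σ , here , refl)
  add-snoc⁻ (x ∷ σ) b (there a) with add-snoc⁻ σ b a
  ... | inj₁ (τ , a′ , refl) = inj₁ (x ∷ τ , there a′ , refl)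
  ... | inj₂ (refl , refl) = inj₂ (refl , refl)

  adj-snoc : ∀ {b} → Adj σ τ → Adj (σ ∷ʳ b) (τ ∷ʳ b)
  adj-snoc here = here
  adj-snoc (there a) = there (adj-snoc a)

  shift-last : Add σ τ → Shift (σ ∷ʳ true) (τ ∷ʳ false)
  shift-last {σ = false ∷ σ} here = here (add-last σ)
  shift-last (there a) = there (shift-last a)

  -- The inequality says that the union is not the whole ground set, but without mentioning the
  -- union, so that sizes alone establish it.
  add-avoiding : (σ τ : Subset n) → ∣ σ ∣ + ∣ τ ∣ < n + ∣ σ ∩ τ ∣ → ∃ λ ρ → Add σ ρ × ∣ ρ ∩ τ ∣ ≡ ∣ σ ∩ τ ∣
  add-avoiding [] [] ()
  add-avoiding (false ∷ σ) (false ∷ τ) _ = true ∷ σ , here , refl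
  add-avoiding {suc n} (true ∷ σ) (true ∷ τ) (s≤s lt)
    with add-avoiding σ τ (≤-pred (subst₂ _≤_ (cong suc (+-suc ∣ σ ∣ ∣ τ ∣)) (+-suc n ∣ σ ∩ τ ∣) lt))
  ... | ρ , a , eq = true ∷ ρ , there a , cong suc eq
  add-avoiding (true ∷ σ) (false ∷ τ) (s≤s lt) with add-avoiding σ τ lt
  ... | ρ , a , eq = true ∷ ρ , there a , eq
  add-avoiding {suc n} (false ∷ σ) (true ∷ τ) lt
    with add-avoiding σ τ (≤-pred (subst (_≤ suc (n + ∣ σ ∩ τ ∣)) (cong suc (+-suc ∣ σ ∣ ∣ τ ∣)) lt))
  ... | ρ , a , eq = false ∷ ρ , there a , eq

  add-missing : (σ : Subset n) → ∣ σ ∣ < n → ∃ λ τ → Add σ τ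
  add-missing (false ∷ σ) _ = true ∷ σ , here
  add-missing (true ∷ σ) (s≤s lt) with add-missing σ lt
  ... | τ , a = true ∷ τ , there a

  remove-one : (τ : Subset n) → 0 < ∣ τ ∣ → ∃ λ σ → Add σ τ
  remove-one (true ∷ τ) _ = false ∷ τ , here
  remove-one (false ∷ τ) lt with remove-one τ lt
  ... | σ , a = false ∷ σ , there a

  add-∩-mono : (ρ : Subset n) → Add σ τ → ∣ ρ ∩ σ ∣ ≤ ∣ ρ ∩ τ ∣
  add-∩-mono (true ∷ ρ) here = n≤1+n _
  add-∩-mono (false ∷ ρ) here = ≤-refl
  add-∩-mono (true ∷ ρ) (there {b = true} a) = s≤s (add-∩-mono ρ a)
  add-∩-mono (true ∷ ρ) (there {b = false} a) = add-∩-mono ρ a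
  add-∩-mono (false ∷ ρ) (there a) = add-∩-mono ρ a

  ∩-∁ : (σ : Subset n) → ∣ σ ∩ ∁ σ ∣ ≡ 0
  ∩-∁ [] = refl
  ∩-∁ (true ∷ σ) = ∩-∁ σ
  ∩-∁ (false ∷ σ) = ∩-∁ σ

  ∩-idem-size : (σ : Subset n) → ∣ σ ∩ σ ∣ ≡ ∣ σ ∣
  ∩-idem-size [] = refl
  ∩-idem-size (true ∷ σ) = cong suc (∩-idem-size σ)
  ∩-idem-size (false ∷ σ) = ∩-idem-size σ

  ∁-injective : {σ τ : Subset n} → ∁ σ ≡ ∁ τ → σ ≡ τ
  ∁-injective {σ = []} {[]} _ = refl
  ∁-injective {σ = true ∷ σ} {true ∷ τ} eq = cong (true ∷_) (∁-injective (∷-tail eq))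
    where ∷-tail : ∀ {n} {x y} {u v : Subset n} → x Vec.∷ u ≡ y ∷ v → u ≡ v
          ∷-tail refl = refl
  ∁-injective {σ = false ∷ σ} {false ∷ τ} eq = cong (false ∷_) (∁-injective (∷-tail eq))
    where ∷-tail : ∀ {n} {x y} {u v : Subset n} → x Vec.∷ u ≡ y ∷ v → u ≡ v
          ∷-tail refl = refl

  extendable-bound : ∀ {e} (P : Subset n → Bool) → Extendable e P → ∀ {σ} → P σ ≡ true → e ≤ n
  extendable-bound {n} {e} P ext {σ} p = go e σ p (m≤n+m e ∣ σ ∣)
    where
    go : ∀ k σ → P σ ≡ true → e ≤ ∣ σ ∣ + k → e ≤ n
    go k σ p le with e ≤? ∣ σ ∣
    ... | yes e≤ = ≤-trans e≤ (∣p∣≤n σ)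
    go zero σ p le | no e≰ = ⊥-elim (e≰ (subst (e ≤_) (+-identityʳ ∣ σ ∣) le))
    go (suc k) σ p le | no e≰ with ext σ p (≰⇒> e≰)
    ... | τ , a , q = go k τ q (subst (e ≤_) (trans (+-suc ∣ σ ∣ k) (cong (_+ k) (sym (add-size a)))) le)

  below-full : (P : Subset n → Bool) → DownClosed P → P full ≡ true → ∀ σ → P σ ≡ true
  below-full {n} P down pf σ = go n σ (m≤n+m n ∣ σ ∣)
    where
    go : ∀ k σ → n ≤ ∣ σ ∣ + k → P σ ≡ true
    go k σ le with ∣ σ ∣ ≟ n
    ... | yes eq = subst (λ ρ → P ρ ≡ true) (sym (∣p∣≡n⇒p≡⊤ eq)) pf
    go zero σ le | no ne = ⊥-elim (ne (≤-antisym (∣p∣≤n σ) (subst (n ≤_) (+-identityʳ ∣ σ ∣) le)))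
    go (suc k) σ le | no ne with add-missing σ (≤∧≢⇒< (∣p∣≤n σ) ne)
    ... | τ , a = down a (go k τ (subst (n ≤_) (trans (+-suc ∣ σ ∣ k) (cong (_+ k) (sym (add-size a)))) le))

  -- In the application `S` consists of the leading words of the link of `a`, `X` of those of the
  -- members avoiding `a`, and `Y` of those of the traces of the members through `a`. Asking for two
  -- common elements in `X2` is what makes the condition survive on members through the last vertex
  -- once that vertex is dropped.
  record Config (n q : ℕ) (S X Y : Subset n → Bool) : Set where
    field
      down  : DownClosed S
      shift : AdjClosed S
      ext   : Extendable (2 * q + 2) S
      X⊆S   : ∀ σ → X σ ≡ true → S σ ≡ true
      Xsize : ∀ σ → X σ ≡ true → ∣ σ ∣ ≡ suc q
      Xshift : AdjClosed X
      X2    : ∀ σ τ → X σ ≡ true → X τ ≡ true → 2 ≤ ∣ σ ∩ τ ∣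
      Y⊆S   : ∀ σ → Y σ ≡ true → S σ ≡ true
      Ysize : ∀ σ → Y σ ≡ true → ∣ σ ∣ ≡ q
      XY    : ∀ σ τ → X σ ≡ true → Y τ ≡ true → 1 ≤ ∣ σ ∩ τ ∣

  ofSize : ℕ → (Subset n → Bool) → Subset n → Bool
  ofSize q S σ = S σ ∧ (∣ σ ∣ ≡ᵇ q)

  private
    2*-suc : ∀ q → 2 * suc q + 2 ≡ suc (suc (2 * q + 2))
    2*-suc q = cong (_+ 2) (*-suc 2 q)

    empty? : (P : Subset n → Bool) → (∃ λ σ → P σ ≡ true) ⊎ (∀ σ → P σ ≡ false)
    empty? {zero} P with P [] in eq
    ... | true = inj₁ ([] , eq)
    ... | false = inj₂ λ { [] → eq }
    empty? {suc n} P with empty? (λ σ → P (false ∷ σ)) | empty? (λ σ → P (true ∷ σ))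
    ... | inj₁ (σ , p) | _ = inj₁ (false ∷ σ , p)
    ... | inj₂ _ | inj₁ (σ , p) = inj₁ (true ∷ σ , p)
    ... | inj₂ f | inj₂ g = inj₂ λ { (false ∷ σ) → f σ ; (true ∷ σ) → g σ }

  -- Induction on n, deleting the last vertex: the members containing it give a configuration
  -- for q - 1 in the link, the others one in the deletion, which is still extendable unless S
  -- is the full simplex on 2q + 2 vertices; there complementation does the job.
  shifted-bound : ∀ n q {S X Y : Subset n → Bool} → Config n q S X Y → ∀ {σ} → X σ ≡ true →
    count X + count Y < count (ofSize q S)
  -- A singleton cannot meet itself in two elements.
  shifted-bound n zero cfg {σ} x = contradiction
    (subst (2 ≤_) (trans (∩-idem-size σ) (Config.Xsize cfg σ x)) (Config.X2 cfg σ σ x x)) (λ { (s≤s ()) })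
  shifted-bound zero (suc q) cfg {[]} x with Config.Xsize cfg [] x
  ... | ()
  shifted-bound (suc n) (suc q) {S} {X} {Y} cfg {σ₀} x₀ = begin-strict
    count X + count Y ≡⟨ cong₂ _+_ (count-snoc X) (count-snoc Y) ⟩
    (count X₀ + count X₁) + (count Y₀ + count Y₁) ≡⟨ interchange (count X₀) (count X₁) (count Y₀) (count Y₁) ⟩
    (count X₀ + count Y₀) + (count X₁ + count Y₁) <⟨ total ⟩
    count (ofSize (suc q) S₀) + count (ofSize q S₁) ≡⟨ cong₂ _+_ (count-cong eq₀) (count-cong eq₁) ⟨
    count (λ σ → ofSize (suc q) S (σ ∷ʳ false)) + count (λ σ → ofSize (suc q) S (σ ∷ʳ true)) ≡⟨ count-snoc (ofSize (suc q) S) ⟨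
    count (ofSize (suc q) S) ∎
    where
    open ≤-Reasoning
    open Config cfg
    open import Data.Nat.Tactic.RingSolver using (solve-∀)
    interchange : ∀ a b c d → (a + b) + (c + d) ≡ (a + c) + (b + d)
    interchange = solve-∀

    S₀ S₁ X₀ X₁ Y₀ Y₁ : Subset n → Bool
    S₀ σ = S (σ ∷ʳ false)
    S₁ σ = S (σ ∷ʳ true)
    X₀ σ = X (σ ∷ʳ false)
    X₁ σ = X (σ ∷ʳ true)
    Y₀ σ = Y (σ ∷ʳ false)
    Y₁ σ = Y (σ ∷ʳ true)

    eq₀ : ∀ σ → ofSize (suc q) S (σ ∷ʳ false) ≡ ofSize (suc q) S₀ σ
    eq₀ σ rewrite size-snoc-false σ = refl
    eq₁ : ∀ σ → ofSize (suc q) S (σ ∷ʳ true) ≡ ofSize q S₁ σ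
    eq₁ σ rewrite size-snoc-true σ = refl

    -- The parameter is `suc q` here, so faces extend to 2q + 4 of the n + 1 points; at least 2q + 3
    -- points remain besides the last one, more than two sets of q + 1 points can cover.
    n-big : 2 * q + 2 < n
    n-big = ≤-pred (subst (_≤ suc n) (2*-suc q) (extendable-bound S ext (X⊆S σ₀ x₀)))

    size₁ : ∀ σ → X₁ σ ≡ true → ∣ σ ∣ ≡ suc q
    size₁ σ x = suc-injective (trans (sym (size-snoc-true σ)) (Xsize _ x))

    sizeY₁ : ∀ σ → Y₁ σ ≡ true → ∣ σ ∣ ≡ q
    sizeY₁ σ y = suc-injective (trans (sym (size-snoc-true σ)) (Ysize _ y))

    moved : ∀ {σ τ} → Add σ τ → X₁ σ ≡ true → X₀ τ ≡ true
    moved a x = shift-closed X Xshift (shift-last a) x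

    -- If the two sets met in at most one point besides the last, moving the last vertex of one of
    -- them to a point outside both would give two members of `X` with at most one common point.
    X₁-2 : ∀ σ τ → X₁ σ ≡ true → X₁ τ ≡ true → 2 ≤ ∣ σ ∩ τ ∣
    X₁-2 σ τ x y with 2 ≤? ∣ σ ∩ τ ∣
    ... | yes le = le
    ... | no nle with add-avoiding σ τ room
      where
      room : ∣ σ ∣ + ∣ τ ∣ < n + ∣ σ ∩ τ ∣
      room = begin-strict
        ∣ σ ∣ + ∣ τ ∣ ≡⟨ cong₂ _+_ (size₁ σ x) (size₁ τ y) ⟩
        suc q + suc q ≡⟨ twice q ⟩
        2 * q + 2 <⟨ n-big ⟩
        n ≤⟨ m≤m+n n _ ⟩
        n + ∣ σ ∩ τ ∣ ∎
        where twice : ∀ q → suc q + suc q ≡ 2 * q + 2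
              twice = solve-∀
    ... | ρ , a , eq = ⊥-elim (nle (subst (2 ≤_)
        (trans (cong ∣_∣ (∩-snoc ρ τ false true)) (trans (size-snoc-false (ρ ∩ τ)) eq)) (X2 _ _ (moved a x) y)))

    X₁Y₁ : ∀ σ τ → X₁ σ ≡ true → Y₁ τ ≡ true → 1 ≤ ∣ σ ∩ τ ∣
    X₁Y₁ σ τ x y with add-avoiding σ τ room
      where
      room : ∣ σ ∣ + ∣ τ ∣ < n + ∣ σ ∩ τ ∣
      room = begin-strict
        ∣ σ ∣ + ∣ τ ∣ ≡⟨ cong₂ _+_ (size₁ σ x) (sizeY₁ τ y) ⟩
        suc q + q <⟨ n<1+n _ ⟩
        suc (suc q + q) ≡⟨ twice q ⟩
        2 * q + 2 ≤⟨ <⇒≤ n-big ⟩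
        n ≤⟨ m≤m+n n _ ⟩
        n + ∣ σ ∩ τ ∣ ∎
        where twice : ∀ q → suc (suc q + q) ≡ 2 * q + 2
              twice = solve-∀
    ... | ρ , a , eq = subst (1 ≤_)
        (trans (cong ∣_∣ (∩-snoc ρ τ false true)) (trans (size-snoc-false (ρ ∩ τ)) eq)) (XY _ _ (moved a x) y)

    ext₁ : Extendable (2 * q + 2) S₁
    ext₁ σ s lt with ext (σ ∷ʳ true) s (subst₂ _<_ (sym (size-snoc-true σ)) (sym (2*-suc q)) (s≤s (m≤n⇒m≤1+n lt)))
    ... | ρ , a , s′ with add-snoc⁻ σ true a
    ...   | inj₁ (τ , a′ , refl) = τ , a′ , s′
    ...   | inj₂ (() , _)

    cfg₁ : Config n q S₁ X₁ Y₁
    cfg₁ = record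
      { down = λ a → down (add-snoc a) ; shift = λ a → shift (adj-snoc a) ; ext = ext₁
      ; X⊆S = λ σ → X⊆S _ ; Xsize = size₁ ; Xshift = λ a → Xshift (adj-snoc a) ; X2 = X₁-2
      ; Y⊆S = λ σ → Y⊆S _ ; Ysize = sizeY₁ ; XY = X₁Y₁ }

    Y₁≤ : count Y₁ ≤ count (ofSize q S₁)
    Y₁≤ = count-mono (λ σ y → ∧-true⁺ (Y⊆S _ y) (≡ᵇ-true⁺ (sizeY₁ σ y)))

    part₁ : count X₁ + count Y₁ ≤ count (ofSize q S₁)
    part₁ with empty? X₁
    ... | inj₁ (σ , x) = <⇒≤ (shifted-bound n q cfg₁ x)
    ... | inj₂ none = ≤-trans (+-monoˡ-≤ (count Y₁) (count-mono {P = X₁} {Q = λ _ → false} (λ σ x → true≢false x (none σ))))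
                        (≤-trans (≤-reflexive (cong (_+ count Y₁) (count-false {n}))) Y₁≤)
      where
      count-false : ∀ {m} → count {m} (λ _ → false) ≡ 0
      count-false {zero} = refl
      count-false {suc m} rewrite count-false {m} = refl

    X₀-nonempty : ∃ λ σ → X₀ σ ≡ true
    X₀-nonempty with empty? X₀ | empty? X₁
    ... | inj₁ p | _ = p
    ... | inj₂ _ | inj₁ (σ , x) with add-missing σ (subst (_< n) (sym (size₁ σ x)) (≤-trans (s≤s (≤-trans (s≤s (m≤n*m q 2)) (≤-reflexive (+-comm 1 (2 * q))))) (≤-trans (≤-reflexive (sym (+-suc (2 * q) 1))) (<⇒≤ n-big))))
    ...   | τ , a = τ , moved a x
    X₀-nonempty | inj₂ f | inj₂ g = ⊥-elim (nowhere _ σ₀ x₀ f g)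
      where
      nowhere : ∀ {m} (P : Subset (suc m) → Bool) σ → P σ ≡ true → (∀ τ → P (τ ∷ʳ false) ≡ false) → (∀ τ → P (τ ∷ʳ true) ≡ false) → ⊥
      nowhere {m} P σ p f g = n≮0 (subst (0 <_) (trans (count-snoc P) (cong₂ _+_ (count-none f) (count-none g))) (count-pos P p))

    cfg₀ : Extendable (2 * suc q + 2) S₀ → Config n (suc q) S₀ X₀ Y₀
    cfg₀ ext = record
      { down = λ a → down (add-snoc a) ; shift = λ a → shift (adj-snoc a) ; ext = ext
      ; X⊆S = λ σ → X⊆S _ ; Xsize = λ σ x → trans (sym (size-snoc-false σ)) (Xsize _ x)
      ; Xshift = λ a → Xshift (adj-snoc a)
      ; X2 = λ σ τ x y → subst (2 ≤_) (trans (cong ∣_∣ (∩-snoc σ τ false false)) (size-snoc-false (σ ∩ τ))) (X2 _ _ x y)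
      ; Y⊆S = λ σ → Y⊆S _ ; Ysize = λ σ y → trans (sym (size-snoc-false σ)) (Ysize _ y)
      ; XY = λ σ τ x y → subst (1 ≤_) (trans (cong ∣_∣ (∩-snoc σ τ false false)) (size-snoc-false (σ ∩ τ))) (XY _ _ x y) }

    -- If the given extension uses the last vertex, shiftedness replaces this vertex by a missing
    -- one; the only obstruction is a `σ` without missing points.
    ext₀ : (∀ σ → ∣ σ ∣ ≡ n → ∣ σ ∣ < 2 * suc q + 2 → S (σ ∷ʳ true) ≡ true → ⊥) → Extendable (2 * suc q + 2) S₀
    ext₀ not-full σ s lt with ext (σ ∷ʳ false) s (subst (_< 2 * suc q + 2) (sym (size-snoc-false σ)) lt)
    ... | ρ , a , s′ with add-snoc⁻ σ false a
    ...   | inj₁ (τ , a′ , refl) = τ , a′ , s′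
    ...   | inj₂ (_ , refl) with ∣ σ ∣ ≟ n
    ...     | yes eq = ⊥-elim (not-full σ eq lt s′)
    ...     | no ne with add-missing σ (≤∧≢⇒< (∣p∣≤n σ) ne)
    ...       | τ , a′ = τ , a′ , shift-closed S shift (shift-last a′) s′

    total : (count X₀ + count Y₀) + (count X₁ + count Y₁) < count (ofSize (suc q) S₀) + count (ofSize q S₁)
    total with n ≟ suc (2 * q + 2) | bool-cases (S (full ∷ʳ true))
    -- Now `S` is the full simplex on 2q + 4 points. The full face of the deletion has too few
    -- vertices and cannot grow, so the induction does not apply to the deletion.
    ... | yes n≡ | inj₁ sfull = result
      where
      everything : ∀ σ → S σ ≡ true
      everything = below-full S down (subst (λ ρ → S ρ ≡ true) (∣p∣≡n⇒p≡⊤ (trans (size-snoc-true (full {n})) (cong suc (∣⊤∣≡n n)))) sfull)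
      sizeX₀ : ∀ σ → X₀ σ ≡ true → ∣ σ ∣ ≡ suc (suc q)
      sizeX₀ σ x = trans (sym (size-snoc-false σ)) (Xsize _ x)
      co-size : ∀ σ → X₀ σ ≡ true → ∣ ∁ σ ∣ ≡ suc q
      co-size σ x = trans (∣∁p∣≡n∸∣p∣ σ) (trans (cong₂ _∸_ (trans n≡ (arith q)) (sizeX₀ σ x)) (m+n∸n≡m (suc q) (suc (suc q))))
        where arith : ∀ q → suc (2 * q + 2) ≡ suc q + suc (suc q)
              arith = solve-∀
      -- Among the 2q + 3 remaining points, complements of members of `X₀` have q + 1 points, the
      -- size of members of `Y₀`. Such a complement is disjoint from a member of `X`, hence not in
      -- `Y₀`.
      part₀ : count X₀ + count Y₀ ≤ count (ofSize (suc q) S₀)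
      part₀ = ≤-trans
        (+-monoˡ-≤ (count Y₀) (count-injection {Q = λ τ → X₀ (∁ τ)} ∁ (λ σ x → trans (cong X₀ (∁∁ σ)) x) (λ _ _ _ _ → ∁-injective)))
        (count-disjoint {P = λ τ → X₀ (∁ τ)}
          (λ τ x → ∧-true⁺ (everything _) (≡ᵇ-true⁺ (trans (cong ∣_∣ (sym (∁∁ τ))) (co-size _ x))))
          (λ τ y → ∧-true⁺ (Y⊆S _ y) (≡ᵇ-true⁺ (trans (sym (size-snoc-false τ)) (Ysize _ y))))
          (λ τ x y → n≮0 (subst (0 <_)
            (trans (cong ∣_∣ (∩-snoc (∁ τ) τ false false)) (trans (size-snoc-false (∁ τ ∩ τ))
              (trans (cong (λ ρ → ∣ ∁ τ ∩ ρ ∣) (sym (∁∁ τ))) (∩-∁ (∁ τ))))) (XY _ _ x y))))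
        where
        ∁∁ : ∀ {m} (σ : Subset m) → ∁ (∁ σ) ≡ σ
        ∁∁ [] = refl
        ∁∁ (true ∷ σ) = cong (true ∷_) (∁∁ σ)
        ∁∁ (false ∷ σ) = cong (false ∷_) (∁∁ σ)
      -- The strictness missing in `part₀` is recovered here: if `X₁` is empty, take a member of
      -- `X₀` and q points of its complement; together with the last vertex they form a face
      -- disjoint from that member, hence outside `Y`.
      strict₁ : count X₁ + count Y₁ < count (ofSize q S₁)
      strict₁ with empty? X₁ | X₀-nonempty
      ... | inj₁ (σ , x) | _ = shifted-bound n q cfg₁ x
      ... | inj₂ none | σ , x with remove-one (∁ σ) (subst (0 <_) (sym (co-size σ x)) (s≤s z≤n))
      ...   | B , a = ≤-trans (s≤s (≤-reflexive (cong (_+ count Y₁) (count-none none))))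
                (count-strict (λ σ y → ∧-true⁺ (Y⊆S _ y) (≡ᵇ-true⁺ (sizeY₁ σ y))) B
                  (∧-true⁺ (everything _) (≡ᵇ-true⁺ (suc-injective (trans (sym (add-size a)) (co-size σ x)))))
                  (¬true⇒false (λ y → n≮0 (≤-trans (XY _ _ x y) (≤-trans
                    (≤-reflexive (trans (cong ∣_∣ (∩-snoc σ B false true)) (size-snoc-false (σ ∩ B))))
                    (≤-trans (add-∩-mono σ a) (≤-reflexive (∩-∁ σ))))))))
      result : (count X₀ + count Y₀) + (count X₁ + count Y₁) < count (ofSize (suc q) S₀) + count (ofSize q S₁)
      result = +-mono-≤-< part₀ strict₁
    ... | yes n≡ | inj₂ ¬full = +-mono-<-≤ (shifted-bound n (suc q) (cfg₀ (ext₀ λ σ eq _ s → true≢false (subst (λ ρ → S (ρ ∷ʳ true) ≡ true) (∣p∣≡n⇒p≡⊤ eq) s) ¬full)) (proj₂ X₀-nonempty)) part₁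
    ... | no n≢ | _ = +-mono-<-≤ (shifted-bound n (suc q) (cfg₀ (ext₀ λ σ eq lt _ →
      n≢ (≤-antisym (≤-pred (≤-trans (≤-trans (≤-reflexive (cong suc (sym eq))) lt) (≤-reflexive (2*-suc q)))) n-big))) (proj₂ X₀-nonempty)) part₁

-- The exterior algebra over ℚ in coordinates

module Exterior where

  open IntegerMap
  open import Data.Integer using (+_)
  open import Data.Vec using (map)
  open import Level using (0ℓ)
  open import Relation.Binary.PropositionalEquality

  private variable
    n : ℕ

  infix 5 _∥_

  -- A model of the exterior algebra of ℚⁿ: u ∥ v stands for u + e₀ ∧ v.
  data Λ : ℕ → Set where
    sc  : ℚ → Λ zero
    _∥_ : Λ n → Λ n → Λ (suc n)

  infixl 6 _⊕_
  infixl 7 _⊗_ _·_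
  infix 8 ⊝_

  -- ⊗ is the coordinatewise product; it serves to express scalars and to run the ring solver.
  _⊕_ _⊗_ : Λ n → Λ n → Λ n
  _⊕_ (sc u) (sc v) = sc (u ℚ.+ v)
  _⊕_ (u ∥ v) (u′ ∥ v′) = u ⊕ u′ ∥ v ⊕ v′
  _⊗_ (sc u) (sc v) = sc (u ℚ.* v)
  _⊗_ (u ∥ v) (u′ ∥ v′) = u ⊗ u′ ∥ v ⊗ v′

  ⊝_ : Λ n → Λ n
  ⊝_ (sc u) = sc (ℚ.- u)
  ⊝_ (u ∥ v) = ⊝ u ∥ ⊝ v

  κ : ℚ → Λ n
  κ {zero} a = sc a
  κ {suc n} a = κ a ∥ κ a

  𝟎 𝟏 : Λ n
  𝟎 = κ 0ℚ
  𝟏 = κ 1ℚ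

  _·_ : ℚ → Λ n → Λ n
  a · u = κ a ⊗ u

  κ-+ : ∀ a b → κ {n} (a ℚ.+ b) ≡ κ a ⊕ κ b
  κ-+ {zero} a b = refl
  κ-+ {suc n} a b = cong₂ _∥_ (κ-+ a b) (κ-+ a b)

  κ-* : ∀ a b → κ {n} (a ℚ.* b) ≡ κ a ⊗ κ b
  κ-* {zero} a b = refl
  κ-* {suc n} a b = cong₂ _∥_ (κ-* a b) (κ-* a b)

  κ-neg : ∀ a → κ {n} (ℚ.- a) ≡ ⊝ κ a
  κ-neg {zero} a = refl
  κ-neg {suc n} a = cong₂ _∥_ (κ-neg a) (κ-neg a)

  private
    ⊕-assoc : (u v w : Λ n) → (u ⊕ v) ⊕ w ≡ u ⊕ (v ⊕ w)
    ⊕-assoc (sc u) (sc v) (sc w) = cong sc (ℚₚ.+-assoc u v w)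
    ⊕-assoc (a ∥ b) (c ∥ d) (e ∥ f) = cong₂ _∥_ (⊕-assoc a c e) (⊕-assoc b d f)

    ⊗-assoc : (u v w : Λ n) → (u ⊗ v) ⊗ w ≡ u ⊗ (v ⊗ w)
    ⊗-assoc (sc u) (sc v) (sc w) = cong sc (ℚₚ.*-assoc u v w)
    ⊗-assoc (a ∥ b) (c ∥ d) (e ∥ f) = cong₂ _∥_ (⊗-assoc a c e) (⊗-assoc b d f)

    ⊕-comm : (u v : Λ n) → u ⊕ v ≡ v ⊕ u
    ⊕-comm (sc u) (sc v) = cong sc (ℚₚ.+-comm u v)
    ⊕-comm (a ∥ b) (c ∥ d) = cong₂ _∥_ (⊕-comm a c) (⊕-comm b d)

    ⊗-comm : (u v : Λ n) → u ⊗ v ≡ v ⊗ u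
    ⊗-comm (sc u) (sc v) = cong sc (ℚₚ.*-comm u v)
    ⊗-comm (a ∥ b) (c ∥ d) = cong₂ _∥_ (⊗-comm a c) (⊗-comm b d)

    ⊕-idˡ : (u : Λ n) → 𝟎 ⊕ u ≡ u
    ⊕-idˡ (sc u) = cong sc (ℚₚ.+-identityˡ u)
    ⊕-idˡ (a ∥ b) = cong₂ _∥_ (⊕-idˡ a) (⊕-idˡ b)

    ⊗-idˡ : (u : Λ n) → 𝟏 ⊗ u ≡ u
    ⊗-idˡ (sc u) = cong sc (ℚₚ.*-identityˡ u)
    ⊗-idˡ (a ∥ b) = cong₂ _∥_ (⊗-idˡ a) (⊗-idˡ b)

    ⊝-invˡ : (u : Λ n) → ⊝ u ⊕ u ≡ 𝟎
    ⊝-invˡ (sc u) = cong sc (ℚₚ.+-inverseˡ u)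
    ⊝-invˡ (a ∥ b) = cong₂ _∥_ (⊝-invˡ a) (⊝-invˡ b)

    distribˡ : (u v w : Λ n) → u ⊗ (v ⊕ w) ≡ (u ⊗ v) ⊕ (u ⊗ w)
    distribˡ (sc u) (sc v) (sc w) = cong sc (ℚₚ.*-distribˡ-+ u v w)
    distribˡ (a ∥ b) (c ∥ d) (e ∥ f) = cong₂ _∥_ (distribˡ a c e) (distribˡ b d f)

  Λ-ring : ℕ → CommutativeRing 0ℓ 0ℓ
  Λ-ring n = record
    { Carrier = Λ n ; _≈_ = _≡_ ; _+_ = _⊕_ ; _*_ = _⊗_ ; -_ = ⊝_ ; 0# = 𝟎 ; 1# = 𝟏
    ; isCommutativeRing = record
      { isRing = record
        { +-isAbelianGroup = record
          { isGroup = record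
            { isMonoid = record
              { isSemigroup = record
                { isMagma = record { isEquivalence = isEquivalence ; ∙-cong = cong₂ _⊕_ }
                ; assoc = ⊕-assoc }
              ; identity = ⊕-idˡ , λ u → trans (⊕-comm u 𝟎) (⊕-idˡ u) }
            ; inverse = ⊝-invˡ , (λ u → trans (⊕-comm u (⊝ u)) (⊝-invˡ u))
            ; ⁻¹-cong = cong ⊝_ }
          ; comm = ⊕-comm }
        ; *-cong = cong₂ _⊗_ ; *-assoc = ⊗-assoc
        ; *-identity = ⊗-idˡ , (λ u → trans (⊗-comm u 𝟏) (⊗-idˡ u))
        ; distrib = distribˡ , λ u v w → trans (⊗-comm (v ⊕ w) u) (trans (distribˡ u v w) (cong₂ _⊕_ (⊗-comm u v) (⊗-comm u w))) }
      ; *-comm = ⊗-comm } }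

  module _ {n : ℕ} where
    open FromℤTo (Λ-ring n) public using (module Solver)
    open Solver public using (solve; _:=_; _:+_; _:*_; :-_; _:-_; con)
    open CommutativeRing (Λ-ring n) public using ()
      renaming (+-identityˡ to ⊕-identityˡ; +-identityʳ to ⊕-identityʳ; zeroʳ to ⊗-zeroʳ; zeroˡ to ⊗-zeroˡ;
                -‿inverseʳ to ⊝-inverseʳ; -‿inverseˡ to ⊝-inverseˡ; *-identityˡ to ⊗-identityˡ)
    open import Algebra.Properties.Ring (CommutativeRing.ring (Λ-ring n)) public using ()
      renaming (-0#≈0# to ⊝𝟎; -‿involutive to ⊝-involutive)

  :0 : ∀ {n k} → Solver.Polynomial {n} k
  :0 {n} = con {n} (+ 0)

  a·𝟎 : ∀ a → a · 𝟎 {n} ≡ 𝟎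
  a·𝟎 a = ⊗-zeroʳ (κ a)

  0·u : (u : Λ n) → 0ℚ · u ≡ 𝟎
  0·u = ⊗-zeroˡ

  1·u : (u : Λ n) → 1ℚ · u ≡ u
  1·u = ⊗-identityˡ

  ·-· : ∀ a b (u : Λ n) → a · (b · u) ≡ (a ℚ.* b) · u
  ·-· a b u = trans (sym (CommutativeRing.*-assoc (Λ-ring _) (κ a) (κ b) u)) (cong (_⊗ u) (sym (κ-* a b)))

  ⊕-cancel : {u v : Λ n} → u ⊕ v ≡ 𝟎 → u ≡ ⊝ v
  ⊕-cancel {n} {u} {v} p = trans (solve 2 (λ x y → x := (x :+ y) :+ :- y) refl u v)
    (trans (cong (_⊕ ⊝ v) p) (⊕-identityˡ (⊝ v)))

  infix 4 _≟Λ_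
  _≟Λ_ : (u v : Λ n) → Dec (u ≡ v)
  _≟Λ_ (sc u) (sc v) with u ℚₚ.≟ v
  ... | yes refl = yes refl
  ... | no p = no λ { refl → p refl }
  _≟Λ_ (u ∥ v) (u′ ∥ v′) with u ≟Λ u′ | v ≟Λ v′
  ... | yes refl | yes refl = yes refl
  ... | no p | _ = no λ { refl → p refl }
  ... | _ | no p = no λ { refl → p refl }

  at : Λ n → Subset n → ℚ
  at (sc u) [] = u
  at (u ∥ v) (false ∷ σ) = at u σ
  at (u ∥ v) (true ∷ σ) = at v σ

  e : Subset n → Λ n
  e [] = sc 1ℚ
  e (false ∷ σ) = e σ ∥ 𝟎
  e (true ∷ σ) = 𝟎 ∥ e σ

  at-ext : {u v : Λ n} → (∀ σ → at u σ ≡ at v σ) → u ≡ v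
  at-ext {u = sc _} {sc _} p = cong sc (p [])
  at-ext {u = _ ∥ _} {_ ∥ _} p = cong₂ _∥_ (at-ext (λ σ → p (false ∷ σ))) (at-ext (λ σ → p (true ∷ σ)))

  at-⊕ : (u v : Λ n) (σ : Subset n) → at (u ⊕ v) σ ≡ at u σ ℚ.+ at v σ
  at-⊕ (sc u) (sc v) [] = refl
  at-⊕ (u ∥ v) (u′ ∥ v′) (false ∷ σ) = at-⊕ u u′ σ
  at-⊕ (u ∥ v) (u′ ∥ v′) (true ∷ σ) = at-⊕ v v′ σ

  at-κ : ∀ a (σ : Subset n) → at (κ a) σ ≡ a
  at-κ a [] = refl
  at-κ a (false ∷ σ) = at-κ a σ
  at-κ a (true ∷ σ) = at-κ a σ

  at-⊗ : (u v : Λ n) (σ : Subset n) → at (u ⊗ v) σ ≡ at u σ ℚ.* at v σ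
  at-⊗ (sc u) (sc v) [] = refl
  at-⊗ (u ∥ v) (u′ ∥ v′) (false ∷ σ) = at-⊗ u u′ σ
  at-⊗ (u ∥ v) (u′ ∥ v′) (true ∷ σ) = at-⊗ v v′ σ

  at-· : ∀ a (u : Λ n) σ → at (a · u) σ ≡ a ℚ.* at u σ
  at-· a u σ = trans (at-⊗ (κ a) u σ) (cong (ℚ._* at u σ) (at-κ a σ))

  at-⊝ : (u : Λ n) (σ : Subset n) → at (⊝ u) σ ≡ ℚ.- at u σ
  at-⊝ (sc u) [] = refl
  at-⊝ (u ∥ v) (false ∷ σ) = at-⊝ u σ
  at-⊝ (u ∥ v) (true ∷ σ) = at-⊝ v σ

  at-e-same : (σ : Subset n) → at (e σ) σ ≡ 1ℚ
  at-e-same [] = refl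
  at-e-same (false ∷ σ) = at-e-same σ
  at-e-same (true ∷ σ) = at-e-same σ

  at-e-other : {σ τ : Subset n} → σ ≢ τ → at (e σ) τ ≡ 0ℚ
  at-e-other {σ = []} {[]} p with () ← p refl
  at-e-other {σ = false ∷ σ} {false ∷ τ} p = at-e-other (λ q → p (cong (false ∷_) q))
  at-e-other {σ = false ∷ σ} {true ∷ τ} p = at-κ 0ℚ τ
  at-e-other {σ = true ∷ σ} {false ∷ τ} p = at-κ 0ℚ τ
  at-e-other {σ = true ∷ σ} {true ∷ τ} p = at-e-other (λ q → p (cong (true ∷_) q))

  sumS : ∀ {k} → (Subset k → Λ n) → Λ n
  sumS {k = zero} f = f []
  sumS {k = suc k} f = sumS (λ σ → f (false ∷ σ)) ⊕ sumS (λ σ → f (true ∷ σ))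

  record Linear {m n} (L : Λ m → Λ n) : Set where
    field
      lin-⊕ : ∀ u v → L (u ⊕ v) ≡ L u ⊕ L v
      lin-· : ∀ a u → L (a · u) ≡ a · L u

    lin-𝟎 : L 𝟎 ≡ 𝟎
    lin-𝟎 = trans (cong L (sym (0·u 𝟎))) (trans (lin-· 0ℚ 𝟎) (0·u (L 𝟎)))

    lin-⊝ : ∀ u → L (⊝ u) ≡ ⊝ L u
    lin-⊝ u = ⊕-cancel (trans (sym (lin-⊕ (⊝ u) u)) (trans (cong L (⊝-inverseˡ u)) lin-𝟎))

    lin-sumS : ∀ {k} (f : Subset k → Λ m) → L (sumS f) ≡ sumS (λ σ → L (f σ))
    lin-sumS {zero} f = refl
    lin-sumS {suc k} f = trans (lin-⊕ _ _) (cong₂ _⊕_ (lin-sumS (λ σ → f (false ∷ σ))) (lin-sumS (λ σ → f (true ∷ σ))))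

  open Linear public

  sumS-cong : ∀ {k} {f g : Subset k → Λ n} → (∀ σ → f σ ≡ g σ) → sumS f ≡ sumS g
  sumS-cong {k = zero} p = p []
  sumS-cong {k = suc k} p = cong₂ _⊕_ (sumS-cong (λ σ → p (false ∷ σ))) (sumS-cong (λ σ → p (true ∷ σ)))

  sumS-𝟎 : ∀ {k} {f : Subset k → Λ n} → (∀ σ → f σ ≡ 𝟎) → sumS f ≡ 𝟎
  sumS-𝟎 {k = zero} p = p []
  sumS-𝟎 {k = suc k} p = trans (cong₂ _⊕_ (sumS-𝟎 (λ σ → p (false ∷ σ))) (sumS-𝟎 (λ σ → p (true ∷ σ)))) (⊕-identityˡ 𝟎)

  sumS-⊕ : ∀ {k} (f g : Subset k → Λ n) → sumS (λ σ → f σ ⊕ g σ) ≡ sumS f ⊕ sumS g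
  sumS-⊕ {k = zero} f g = refl
  sumS-⊕ {k = suc k} f g = trans (cong₂ _⊕_ (sumS-⊕ (λ σ → f (false ∷ σ)) (λ σ → g (false ∷ σ))) (sumS-⊕ (λ σ → f (true ∷ σ)) (λ σ → g (true ∷ σ))))
    (solve 4 (λ a b c d → (a :+ b) :+ (c :+ d) := (a :+ c) :+ (b :+ d)) refl
      (sumS (λ σ → f (false ∷ σ))) (sumS (λ σ → g (false ∷ σ))) (sumS (λ σ → f (true ∷ σ))) (sumS (λ σ → g (true ∷ σ))))

  sumS-· : ∀ {k} a (f : Subset k → Λ n) → sumS (λ σ → a · f σ) ≡ a · sumS f
  sumS-· {k = zero} a f = refl
  sumS-· {k = suc k} a f = trans (cong₂ _⊕_ (sumS-· a (λ σ → f (false ∷ σ))) (sumS-· a (λ σ → f (true ∷ σ)))) (sym (CommutativeRing.distribˡ (Λ-ring _) _ _ _))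

  pair-linear : ∀ {m n} {L M : Λ m → Λ n} → Linear L → Linear M → Linear {m} {suc n} (λ u → L u ∥ M u)
  pair-linear l m = record { lin-⊕ = λ u v → cong₂ _∥_ (lin-⊕ l u v) (lin-⊕ m u v)
                           ; lin-· = λ a u → cong₂ _∥_ (lin-· l a u) (lin-· m a u) }

  expand : (u : Λ n) → u ≡ sumS (λ σ → at u σ · e σ)
  expand (sc u) = cong sc (sym (ℚₚ.*-identityʳ u))
  expand {suc n} (u ∥ v) = trans
    (cong₂ _∥_ (trans (expand u) (sym (⊕-identityʳ _))) (trans (expand v) (sym (⊕-identityˡ _))))
    (cong₂ _⊕_ (trans (cong (sumS (λ σ → at u σ · e σ) ∥_) (sym (sumS-𝟎 (λ σ → a·𝟎 (at u σ))))) (pair (λ σ → at u σ · e σ) (λ σ → at u σ · 𝟎)))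
               (trans (cong (_∥ sumS (λ σ → at v σ · e σ)) (sym (sumS-𝟎 (λ σ → a·𝟎 (at v σ))))) (pair (λ σ → at v σ · 𝟎) (λ σ → at v σ · e σ))))
    where
    pair : ∀ {k} (f g : Subset k → Λ n) → (sumS f ∥ sumS g) ≡ sumS (λ σ → f σ ∥ g σ)
    pair {zero} f g = refl
    pair {suc k} f g = cong₂ _⊕_ (pair (λ σ → f (false ∷ σ)) (λ σ → g (false ∷ σ))) (pair (λ σ → f (true ∷ σ)) (λ σ → g (true ∷ σ)))

  id-linear : Linear {n} {n} (λ u → u)
  id-linear = record { lin-⊕ = λ _ _ → refl ; lin-· = λ _ _ → refl }

  ∘-linear : ∀ {k m n} {L : Λ m → Λ n} {M : Λ k → Λ m} → Linear L → Linear M → Linear (λ u → L (M u))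
  ∘-linear {L = L} l m = record
    { lin-⊕ = λ u v → trans (cong L (lin-⊕ m u v)) (lin-⊕ l _ _)
    ; lin-· = λ a u → trans (cong L (lin-· m a u)) (lin-· l a _) }

  ⊕-linear : ∀ {m n} {L M : Λ m → Λ n} → Linear L → Linear M → Linear (λ u → L u ⊕ M u)
  ⊕-linear {L = L} {M} l m = record
    { lin-⊕ = λ u v → trans (cong₂ _⊕_ (lin-⊕ l u v) (lin-⊕ m u v))
        (solve 4 (λ a b c d → (a :+ b) :+ (c :+ d) := (a :+ c) :+ (b :+ d)) refl (L u) (L v) (M u) (M v))
    ; lin-· = λ a u → trans (cong₂ _⊕_ (lin-· l a u) (lin-· m a u)) (sym (CommutativeRing.distribˡ (Λ-ring _) _ _ _)) }

  scale-linear : ∀ b → Linear {n} {n} (b ·_)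
  scale-linear b = record
    { lin-⊕ = λ u v → CommutativeRing.distribˡ (Λ-ring _) _ _ _
    ; lin-· = λ a u → solve 3 (λ b a u → b :* (a :* u) := a :* (b :* u)) refl (κ b) (κ a) u }

  ⊝-linear : Linear {n} {n} ⊝_
  ⊝-linear = record
    { lin-⊕ = λ u v → solve 2 (λ u v → :- (u :+ v) := :- u :+ :- v) refl u v
    ; lin-· = λ a u → solve 2 (λ a u → :- (a :* u) := a :* (:- u)) refl (κ a) u }

  private
    fst snd : Λ (suc n) → Λ n
    fst (u ∥ v) = u
    snd (u ∥ v) = v
    fst-linear : Linear {suc n} {n} fst
    fst-linear = record { lin-⊕ = λ { (_ ∥ _) (_ ∥ _) → refl } ; lin-· = λ { _ (_ ∥ _) → refl } }
    snd-linear : Linear {suc n} {n} snd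
    snd-linear = record { lin-⊕ = λ { (_ ∥ _) (_ ∥ _) → refl } ; lin-· = λ { _ (_ ∥ _) → refl } }
    linear-≗ : ∀ {m n} {L M : Λ m → Λ n} → (∀ u → L u ≡ M u) → Linear M → Linear L
    linear-≗ p l = record
      { lin-⊕ = λ u v → trans (p _) (trans (lin-⊕ l u v) (sym (cong₂ _⊕_ (p u) (p v))))
      ; lin-· = λ a u → trans (p _) (trans (lin-· l a u) (cong (a ·_) (sym (p u)))) }
    zero-linear : ∀ {m n} → Linear {m} {n} (λ _ → 𝟎)
    zero-linear = record { lin-⊕ = λ _ _ → sym (⊕-identityˡ 𝟎) ; lin-· = λ a _ → sym (a·𝟎 a) }

  -- Contraction with the functional φ.
  i : Vec ℚ n → Λ n → Λ n
  i [] u = 𝟎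
  i (a ∷ φ) (u ∥ v) = i φ u ⊕ a · v ∥ ⊝ i φ v

  -- Contraction with a coordinate functional, kept apart from `i` so that it computes without
  -- scalars. On chains it extracts the part through a vertex, with that vertex removed.
  δ : Fin n → Λ n → Λ n
  δ zero (u ∥ v) = v ∥ 𝟎
  δ (suc x) (u ∥ v) = δ x u ∥ ⊝ δ x v

  -- Exterior multiplication by a basis vector.
  ε : Fin n → Λ n → Λ n
  ε zero (u ∥ v) = 𝟎 ∥ u
  ε (suc x) (u ∥ v) = ε x u ∥ ⊝ ε x v

  i-linear : (φ : Vec ℚ n) → Linear (i φ)
  i-linear [] = zero-linear
  i-linear (a ∷ φ) = linear-≗ (λ { (_ ∥ _) → refl }) (pair-linear
    (⊕-linear (∘-linear (i-linear φ) fst-linear) (∘-linear (scale-linear a) snd-linear))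
    (∘-linear ⊝-linear (∘-linear (i-linear φ) snd-linear)))

  δ-linear : (x : Fin n) → Linear (δ x)
  δ-linear zero = linear-≗ (λ { (_ ∥ _) → refl }) (pair-linear snd-linear zero-linear)
  δ-linear (suc x) = linear-≗ (λ { (_ ∥ _) → refl })
    (pair-linear (∘-linear (δ-linear x) fst-linear) (∘-linear ⊝-linear (∘-linear (δ-linear x) snd-linear)))

  ε-linear : (x : Fin n) → Linear (ε x)
  ε-linear zero = linear-≗ (λ { (_ ∥ _) → refl }) (pair-linear zero-linear fst-linear)
  ε-linear (suc x) = linear-≗ (λ { (_ ∥ _) → refl })
    (pair-linear (∘-linear (ε-linear x) fst-linear) (∘-linear ⊝-linear (∘-linear (ε-linear x) snd-linear)))

  i-+ : (φ ψ : Vec ℚ n) (u : Λ n) → i (zipWith ℚ._+_ φ ψ) u ≡ i φ u ⊕ i ψ u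
  i-+ [] [] u = cong sc (sym (ℚₚ.+-identityˡ 0ℚ))
  i-+ (a ∷ φ) (b ∷ ψ) (u ∥ v) = cong₂ _∥_
    (trans (cong₂ _⊕_ (i-+ φ ψ u) (cong (_⊗ v) (κ-+ a b)))
      (solve 5 (λ x y a b v → (x :+ y) :+ (a :+ b) :* v := (x :+ a :* v) :+ (y :+ b :* v)) refl (i φ u) (i ψ u) (κ a) (κ b) v))
    (trans (cong ⊝_ (i-+ φ ψ v)) (lin-⊕ ⊝-linear _ _))

  i-* : (a : ℚ) (φ : Vec ℚ n) (u : Λ n) → i (map (a ℚ.*_) φ) u ≡ a · i φ u
  i-* a [] u = cong sc (sym (ℚₚ.*-zeroʳ a))
  i-* a (b ∷ φ) (u ∥ v) = cong₂ _∥_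
    (trans (cong₂ _⊕_ (i-* a φ u) (cong (_⊗ v) (κ-* a b)))
      (solve 4 (λ a x b v → a :* x :+ (a :* b) :* v := a :* (x :+ b :* v)) refl (κ a) (i φ u) (κ b) v))
    (trans (cong ⊝_ (i-* a φ v)) (lin-· ⊝-linear a _))

  i-i : (φ : Vec ℚ n) (u : Λ n) → i φ (i φ u) ≡ 𝟎
  i-i [] u = refl
  i-i (a ∷ φ) (u ∥ v) = cong₂ _∥_
    (trans (cong (_⊕ a · ⊝ i φ v) (trans (lin-⊕ (i-linear φ) _ _) (cong₂ _⊕_ (i-i φ u) (lin-· (i-linear φ) a v))))
      (solve 2 (λ a x → (:0 :+ a :* x) :+ a :* (:- x) := :0) refl (κ a) (i φ v)))
    (trans (cong ⊝_ (trans (lin-⊝ (i-linear φ) _) (cong ⊝_ (i-i φ v)))) (⊝-involutive 𝟎))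

  i-anticomm : (φ ψ : Vec ℚ n) (u : Λ n) → i φ (i ψ u) ≡ ⊝ i ψ (i φ u)
  i-anticomm [] [] u = refl
  i-anticomm (a ∷ φ) (b ∷ ψ) (u ∥ v) = cong₂ _∥_
    (trans (cong (_⊕ a · ⊝ i ψ v) (trans (lin-⊕ (i-linear φ) _ _) (cong₂ _⊕_ (i-anticomm φ ψ u) (lin-· (i-linear φ) b v))))
      (trans (solve 5 (λ x a b y z → (:- x :+ b :* y) :+ a :* (:- z) := :- ((x :+ a :* z) :+ b :* (:- y))) refl
          (i ψ (i φ u)) (κ a) (κ b) (i φ v) (i ψ v))
        (cong (λ w → ⊝ (w ⊕ b · ⊝ i φ v)) (sym (trans (lin-⊕ (i-linear ψ) _ _) (cong (i ψ (i φ u) ⊕_) (lin-· (i-linear ψ) a v)))))))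
    (cong ⊝_ (trans (lin-⊝ (i-linear φ) _) (trans (cong ⊝_ (i-anticomm φ ψ v)) (cong ⊝_ (sym (lin-⊝ (i-linear ψ) _))))))

  i-δ : (φ : Vec ℚ n) (x : Fin n) (u : Λ n) → i φ (δ x u) ≡ ⊝ δ x (i φ u)
  i-δ (a ∷ φ) zero (u ∥ v) = cong₂ _∥_
    (trans (cong (i φ v ⊕_) (a·𝟎 a)) (trans (⊕-identityʳ _) (sym (⊝-involutive _))))
    (cong ⊝_ (lin-𝟎 (i-linear φ)))
  i-δ (a ∷ φ) (suc x) (u ∥ v) = cong₂ _∥_
    (trans (cong (_⊕ a · ⊝ δ x v) (i-δ φ x u))
      (trans (solve 3 (λ p a q → :- p :+ a :* (:- q) := :- (p :+ a :* q)) refl (δ x (i φ u)) (κ a) (δ x v))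
        (cong ⊝_ (sym (trans (lin-⊕ (δ-linear x) _ _) (cong (δ x (i φ u) ⊕_) (lin-· (δ-linear x) a v)))))))
    (cong ⊝_ (trans (lin-⊝ (i-linear φ) _) (trans (cong ⊝_ (i-δ φ x v)) (cong ⊝_ (sym (lin-⊝ (δ-linear x) _))))))

  -- The Cartan relation. Where the functional vanishes at `x` the two operators anticommute, which
  -- later separates the part of a cycle through `x` from the rest.
  i-ε : (φ : Vec ℚ n) (x : Fin n) (u : Λ n) → i φ (ε x u) ≡ lookup φ x · u ⊕ ⊝ ε x (i φ u)
  i-ε (a ∷ φ) zero (u ∥ v) = cong₂ _∥_
    (trans (cong (_⊕ a · u) (lin-𝟎 (i-linear φ)))
      (solve 2 (λ a u → :0 :+ a :* u := a :* u :+ :- :0) refl (κ a) u))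
    (solve 3 (λ x a v → :- x := a :* v :+ :- (x :+ a :* v)) refl (i φ u) (κ a) v)
  i-ε (a ∷ φ) (suc x) (u ∥ v) = cong₂ _∥_
    (trans (cong (_⊕ a · ⊝ ε x v) (i-ε φ x u))
      (trans (solve 4 (λ l p a q → (l :+ :- p) :+ a :* (:- q) := l :+ :- (p :+ a :* q)) refl (lookup φ x · u) (ε x (i φ u)) (κ a) (ε x v))
        (cong (λ w → lookup φ x · u ⊕ ⊝ w) (sym (trans (lin-⊕ (ε-linear x) _ _) (cong (ε x (i φ u) ⊕_) (lin-· (ε-linear x) a v)))))))
    (trans (cong ⊝_ (trans (lin-⊝ (i-linear φ) _) (cong ⊝_ (i-ε φ x v))))
      (trans (solve 2 (λ l p → :- (:- (l :+ :- p)) := l :+ :- (:- (:- p))) refl (lookup φ x · v) (ε x (i φ v)))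
        (cong (λ w → lookup φ x · v ⊕ ⊝ (⊝ w)) (sym (lin-⊝ (ε-linear x) _)))))

  -- The first summand is the part of `u` on sets avoiding `x`, the second the part on sets through
  -- `x`.
  δ-ε : (x : Fin n) (u : Λ n) → δ x (ε x u) ⊕ ε x (δ x u) ≡ u
  δ-ε zero (u ∥ v) = cong₂ _∥_ (⊕-identityʳ u) (⊕-identityˡ v)
  δ-ε (suc x) (u ∥ v) = cong₂ _∥_ (δ-ε x u)
    (trans (cong₂ (λ p q → ⊝ p ⊕ ⊝ q) (lin-⊝ (δ-linear x) _) (lin-⊝ (ε-linear x) _))
      (trans (solve 2 (λ p q → :- (:- p) :+ :- (:- q) := p :+ q) refl (δ x (ε x v)) (ε x (δ x v))) (δ-ε x v)))

  -- The grading involution.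
  bar : Λ n → Λ n
  bar (sc u) = sc u
  bar (u ∥ v) = bar u ∥ ⊝ bar v

  bar-linear : Linear {n} {n} bar
  bar-linear {zero} = linear-≗ (λ { (sc _) → refl }) id-linear
  bar-linear {suc n} = linear-≗ (λ { (_ ∥ _) → refl })
    (pair-linear (∘-linear bar-linear fst-linear) (∘-linear ⊝-linear (∘-linear bar-linear snd-linear)))

  bar-bar : (u : Λ n) → bar (bar u) ≡ u
  bar-bar (sc u) = refl
  bar-bar (u ∥ v) = cong₂ _∥_ (bar-bar u) (trans (cong ⊝_ (lin-⊝ bar-linear _)) (trans (⊝-involutive _) (bar-bar v)))

  bar-i : (φ : Vec ℚ n) (u : Λ n) → bar (i φ u) ≡ ⊝ i φ (bar u)
  bar-i [] u = refl
  bar-i (a ∷ φ) (u ∥ v) = cong₂ _∥_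
    (trans (lin-⊕ bar-linear _ _) (trans (cong₂ _⊕_ (bar-i φ u) (lin-· bar-linear a v))
      (solve 3 (λ x a y → :- x :+ a :* y := :- (x :+ a :* (:- y))) refl (i φ (bar u)) (κ a) (bar v))))
    (cong ⊝_ (trans (lin-⊝ bar-linear _) (cong ⊝_ (trans (bar-i φ v) (sym (lin-⊝ (i-linear φ) _))))))

  infixl 7 _∧Λ_
  -- In the last component `bar` is the sign incurred by moving e₀ past `u`.
  _∧Λ_ : Λ n → Λ n → Λ n
  _∧Λ_ (sc u) (sc w) = sc (u ℚ.* w)
  _∧Λ_ (u ∥ v) (u′ ∥ v′) = u ∧Λ u′ ∥ v ∧Λ u′ ⊕ bar u ∧Λ v′

  ∧-linearˡ : (w : Λ n) → Linear (_∧Λ w)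
  ∧-linearˡ (sc w) = record { lin-⊕ = λ { (sc u) (sc v) → cong sc (ℚₚ.*-distribʳ-+ w u v) } ; lin-· = λ { a (sc u) → cong sc (ℚₚ.*-assoc a u w) } }
  ∧-linearˡ (u′ ∥ v′) = linear-≗ (λ { (_ ∥ _) → refl }) (pair-linear (∘-linear (∧-linearˡ u′) fst-linear)
    (⊕-linear (∘-linear (∧-linearˡ u′) snd-linear) (∘-linear (∧-linearˡ v′) (∘-linear bar-linear fst-linear))))

  ∧-linearʳ : (w : Λ n) → Linear (w ∧Λ_)
  ∧-linearʳ (sc w) = record { lin-⊕ = λ { (sc u) (sc v) → cong sc (ℚₚ.*-distribˡ-+ w u v) }
    ; lin-· = λ { a (sc u) → cong sc (trans (sym (ℚₚ.*-assoc w a u)) (trans (cong (ℚ._* u) (ℚₚ.*-comm w a)) (ℚₚ.*-assoc a w u))) } }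
  ∧-linearʳ (u ∥ v) = linear-≗ (λ { (_ ∥ _) → refl }) (pair-linear (∘-linear (∧-linearʳ u) fst-linear)
    (⊕-linear (∘-linear (∧-linearʳ v) fst-linear) (∘-linear (∧-linearʳ (bar u)) snd-linear)))

  bar-∧ : (u w : Λ n) → bar (u ∧Λ w) ≡ bar u ∧Λ bar w
  bar-∧ (sc u) (sc w) = refl
  bar-∧ (u ∥ v) (u′ ∥ v′) = cong₂ _∥_ (bar-∧ u u′)
    (trans (cong ⊝_ (trans (lin-⊕ bar-linear _ _) (cong₂ _⊕_ (bar-∧ v u′) (bar-∧ (bar u) v′))))
      (trans (lin-⊕ ⊝-linear _ _) (cong₂ _⊕_ (sym (lin-⊝ (∧-linearˡ (bar u′)) _)) (sym (lin-⊝ (∧-linearʳ (bar (bar u))) _)))))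

  -- This antiderivation rule makes coordinates with respect to any flag multiplicative, so that
  -- vanishing products keep vanishing when the flag changes.
  i-∧ : (φ : Vec ℚ n) (u w : Λ n) → i φ (u ∧Λ w) ≡ i φ u ∧Λ w ⊕ bar u ∧Λ i φ w
  i-∧ [] (sc u) (sc w) = cong sc (sym (trans (cong₂ ℚ._+_ (ℚₚ.*-zeroˡ w) (ℚₚ.*-zeroʳ u)) (ℚₚ.+-identityˡ 0ℚ)))
  i-∧ (a ∷ φ) (u ∥ v) (u′ ∥ v′) = cong₂ _∥_ first second
    where
    first : i φ (u ∧Λ u′) ⊕ a · (v ∧Λ u′ ⊕ bar u ∧Λ v′) ≡ (i φ u ⊕ a · v) ∧Λ u′ ⊕ bar u ∧Λ (i φ u′ ⊕ a · v′)
    first = trans (cong (_⊕ a · (v ∧Λ u′ ⊕ bar u ∧Λ v′)) (i-∧ φ u u′))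
      (trans (solve 5 (λ p q a r s → (p :+ q) :+ a :* (r :+ s) := (p :+ a :* r) :+ (q :+ a :* s)) refl
          (i φ u ∧Λ u′) (bar u ∧Λ i φ u′) (κ a) (v ∧Λ u′) (bar u ∧Λ v′))
        (sym (cong₂ _⊕_ (trans (lin-⊕ (∧-linearˡ u′) _ _) (cong (i φ u ∧Λ u′ ⊕_) (lin-· (∧-linearˡ u′) a v)))
                        (trans (lin-⊕ (∧-linearʳ (bar u)) _ _) (cong (bar u ∧Λ i φ u′ ⊕_) (lin-· (∧-linearʳ (bar u)) a v′))))))
    second : ⊝ i φ (v ∧Λ u′ ⊕ bar u ∧Λ v′) ≡
      ((⊝ i φ v) ∧Λ u′ ⊕ bar (i φ u ⊕ a · v) ∧Λ v′) ⊕ ((⊝ bar v) ∧Λ (i φ u′ ⊕ a · v′) ⊕ bar (bar u) ∧Λ (⊝ i φ v′))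
    second = trans (cong ⊝_ (trans (lin-⊕ (i-linear φ) _ _) (cong₂ _⊕_ (i-∧ φ v u′) (i-∧ φ (bar u) v′))))
      (trans (solve 6 (λ p q r s a t → :- ((p :+ q) :+ (r :+ s)) := (:- p :+ (:- r :+ a :* t)) :+ (:- (q :+ a :* t) :+ :- s)) refl
          (i φ v ∧Λ u′) (bar v ∧Λ i φ u′) (i φ (bar u) ∧Λ v′) (bar (bar u) ∧Λ i φ v′) (κ a) (bar v ∧Λ v′))
        (sym (cong₂ _⊕_
          (cong₂ _⊕_ (lin-⊝ (∧-linearˡ u′) _)
            (trans (cong (_∧Λ v′) (trans (lin-⊕ bar-linear _ _) (cong₂ _⊕_ (bar-i φ u) (lin-· bar-linear a v))))
              (trans (lin-⊕ (∧-linearˡ v′) _ _) (cong₂ _⊕_ (lin-⊝ (∧-linearˡ v′) _) (lin-· (∧-linearˡ v′) a _)))))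
          (cong₂ _⊕_
            (trans (lin-⊝ (∧-linearˡ _) _) (cong ⊝_ (trans (lin-⊕ (∧-linearʳ (bar v)) _ _) (cong (bar v ∧Λ i φ u′ ⊕_) (lin-· (∧-linearʳ (bar v)) a v′)))))
            (lin-⊝ (∧-linearʳ (bar (bar u))) _)))))

-- Polynomial maps on a space of polynomials

module PolynomialMaps where

  open IntegerMap
  open Exterior
  open import Data.List using ([]; _∷_)
  open import Data.List.Membership.Propositional using (_∉_) renaming (_∈_ to _∈ˡ_)
  open import Data.List.Relation.Unary.Any using (here; there)
  open import Data.Rational using (_+_; _*_; -_; _-_; ≢-nonZero; _≤_; _<_)
  open import Data.Vec using (map; replicate)
  open import Relation.Binary.PropositionalEquality

  module ℚSolver = FromℤTo.Solver ℚₚ.+-*-commutativeRing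
  open ℚSolver using () renaming (solve to qsolve; _:=_ to _:≡_; _:+_ to _+:_; _:*_ to _*:_; :-_ to -:_; con to qcon)

  private variable
    m n : ℕ

  inverseʳ : ∀ {a} → a ≢ 0ℚ → ∃ λ b → a * b ≡ 1ℚ
  inverseʳ {a} a≢0 = ℚ.1/_ a {{≢-nonZero a≢0}} , ℚₚ.*-inverseʳ a {{≢-nonZero a≢0}}

  ·-cancel : ∀ {a} {u : Λ n} → a ≢ 0ℚ → a · u ≡ 𝟎 → u ≡ 𝟎
  ·-cancel {a = a} {u} a≢0 p with inverseʳ a≢0
  ... | b , ab = begin
    u ≡⟨ 1·u u ⟨
    1ℚ · u ≡⟨ cong (_· u) (trans (ℚₚ.*-comm b a) ab) ⟨
    (b * a) · u ≡⟨ ·-· b a u ⟨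
    b · (a · u) ≡⟨ cong (b ·_) p ⟩
    b · 𝟎 ≡⟨ a·𝟎 b ⟩
    𝟎 ∎
    where open ≡-Reasoning

  *-nonzero : ∀ {a b} → a ≢ 0ℚ → b ≢ 0ℚ → a * b ≢ 0ℚ
  *-nonzero {a} {b} a≢0 b≢0 p with inverseʳ a≢0
  ... | c , ac = b≢0 (begin
    b ≡⟨ ℚₚ.*-identityˡ b ⟨
    1ℚ * b ≡⟨ cong (_* b) ac ⟨
    (a * c) * b ≡⟨ qsolve 3 (λ a c b → (a *: c) *: b :≡ c *: (a *: b)) refl a c b ⟩
    c * (a * b) ≡⟨ cong (c *_) p ⟩
    c * 0ℚ ≡⟨ ℚₚ.*-zeroʳ c ⟩
    0ℚ ∎)
    where open ≡-Reasoning

  a-b≢0 : ∀ {a b} → a ≢ b → a - b ≢ 0ℚ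
  a-b≢0 {a} {b} a≢b p = a≢b (trans (qsolve 2 (λ a b → a :≡ (a +: -: b) +: b) refl a b)
    (trans (cong (_+ b) p) (ℚₚ.+-identityˡ b)))

  infixl 6 _+v_
  infixl 7 _*v_
  _+v_ : Vec ℚ m → Vec ℚ m → Vec ℚ m
  _+v_ = zipWith _+_

  _*v_ : ℚ → Vec ℚ m → Vec ℚ m
  a *v q = map (a *_) q

  0v : Vec ℚ m
  0v = replicate _ 0ℚ

  -- A vector is read as the coefficients of a polynomial of degree less than `m`, constant term
  -- first. These polynomials are the parameters on which all later chains depend.
  ev : Vec ℚ m → ℚ → ℚ
  ev [] x = 0ℚ
  ev (a ∷ q) x = a + x * ev q x

  ev-+ : (q r : Vec ℚ m) (x : ℚ) → ev (q +v r) x ≡ ev q x + ev r x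
  ev-+ [] [] x = sym (ℚₚ.+-identityˡ 0ℚ)
  ev-+ (a ∷ q) (b ∷ r) x = trans (cong (λ z → a + b + x * z) (ev-+ q r x))
    (qsolve 5 (λ a b x y z → (a +: b) +: x *: (y +: z) :≡ (a +: x *: y) +: (b +: x *: z)) refl a b x (ev q x) (ev r x))

  ev-* : (c : ℚ) (q : Vec ℚ m) (x : ℚ) → ev (c *v q) x ≡ c * ev q x
  ev-* c [] x = sym (ℚₚ.*-zeroʳ c)
  ev-* c (a ∷ q) x = trans (cong (λ z → c * a + x * z) (ev-* c q x))
    (qsolve 4 (λ c a x y → c *: a +: x *: (c *: y) :≡ c *: (a +: x *: y)) refl c a x (ev q x))

  addHead : ℚ → Vec ℚ (suc m) → Vec ℚ (suc m)
  addHead a (b ∷ q) = a + b ∷ q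

  -- Multiplication and division by X - w of polynomials given by their coefficients.
  mulBy : ℚ → Vec ℚ m → Vec ℚ (suc m)
  mulBy w [] = 0ℚ ∷ []
  mulBy w (a ∷ q) = - (w * a) ∷ addHead a (mulBy w q)

  divBy : ℚ → Vec ℚ (suc m) → Vec ℚ m
  divBy w (a ∷ []) = []
  divBy w (a ∷ b ∷ q) = ev (b ∷ q) w ∷ divBy w (b ∷ q)

  ev-addHead : ∀ a (q : Vec ℚ (suc m)) x → ev (addHead a q) x ≡ a + ev q x
  ev-addHead a (b ∷ q) x = ℚₚ.+-assoc a b _

  ev-mulBy : ∀ w (q : Vec ℚ m) x → ev (mulBy w q) x ≡ (x - w) * ev q x
  ev-mulBy w [] x = qsolve 2 (λ x w → qcon (ℤ.+ 0) +: x *: qcon (ℤ.+ 0) :≡ (x +: -: w) *: qcon (ℤ.+ 0)) refl x w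
  ev-mulBy w (a ∷ q) x = trans (cong (λ z → - (w * a) + x * z) (trans (ev-addHead a (mulBy w q) x) (cong (a +_) (ev-mulBy w q x))))
    (qsolve 4 (λ w a x y → -: (w *: a) +: x *: (a +: (x +: -: w) *: y) :≡ (x +: -: w) *: (a +: x *: y)) refl w a x (ev q x))

  divBy-head : ∀ w a b (q : Vec ℚ m) → divBy w (a ∷ q) ≡ divBy w (b ∷ q)
  divBy-head w a b [] = refl
  divBy-head w a b (c ∷ q) = refl

  divBy-mulBy : ∀ w (q : Vec ℚ m) → divBy w (mulBy w q) ≡ q
  divBy-mulBy w [] = refl
  divBy-mulBy w (a ∷ q) with mulBy w q | divBy-mulBy w q | ev-mulBy w q w
  ... | b ∷ r | dm | ev0 = cong₂ _∷_
    (trans (trans (ℚₚ.+-assoc a b _) (cong (λ z → a + z) ev0)) (qsolve 3 (λ a w y → a +: (w +: -: w) *: y :≡ a) refl a w (ev q w)))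
    (trans (divBy-head w (a + b) b r) dm)

  -- Horner's scheme: the coefficients of the quotient are the values at `w` of the successive
  -- tails, and the value of the whole polynomial is the remainder.
  divide : ∀ w (q : Vec ℚ (suc m)) → q ≡ addHead (ev q w) (mulBy w (divBy w q))
  divide w (a ∷ []) = cong (_∷ []) (qsolve 2 (λ a w → a :≡ (a +: w *: qcon (ℤ.+ 0)) +: qcon (ℤ.+ 0)) refl a w)
  divide w (a ∷ b ∷ q) = cong₂ _∷_
    (qsolve 3 (λ a w y → a :≡ (a +: w *: y) +: -: (w *: y)) refl a w (ev (b ∷ q) w))
    (divide w (b ∷ q))

  record Form (f : Vec ℚ m → ℚ) : Set where
    field
      form-+ : ∀ q r → f (q +v r) ≡ f q + f r
      form-* : ∀ c q → f (c *v q) ≡ c * f q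
  open Form public

  ev-form : ∀ x → Form {m} (λ q → ev q x)
  ev-form x = record { form-+ = λ q r → ev-+ q r x ; form-* = λ c q → ev-* c q x }

  scale-form : ∀ {f : Vec ℚ m → ℚ} c → Form f → Form (λ q → c * f q)
  scale-form {f = f} c l = record
    { form-+ = λ q r → trans (cong (c *_) (form-+ l q r)) (ℚₚ.*-distribˡ-+ c _ _)
    ; form-* = λ a q → trans (cong (c *_) (form-* l a q)) (qsolve 3 (λ c a x → c *: (a *: x) :≡ a *: (c *: x)) refl c a (f q)) }

  one : Vec ℚ (suc m)
  one = 1ℚ ∷ 0v

  addHead-+ : ∀ s (q : Vec ℚ (suc m)) → addHead s q ≡ q +v s *v one
  addHead-+ s (b ∷ q) = cong₂ _∷_ (trans (ℚₚ.+-comm s b) (cong (b +_) (sym (ℚₚ.*-identityʳ s)))) (tail q)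
    where
    tail : ∀ {k} (q : Vec ℚ k) → q ≡ q +v s *v 0v
    tail [] = refl
    tail (x ∷ q) = cong₂ _∷_ (sym (trans (cong (x +_) (ℚₚ.*-zeroʳ s)) (ℚₚ.+-identityʳ x))) (tail q)

  form-addHead : ∀ {f : Vec ℚ (suc m) → ℚ} → Form f → ∀ s q → f (addHead s q) ≡ f q + s * f one
  form-addHead {f = f} l s q = trans (cong f (addHead-+ s q)) (trans (form-+ l q _) (cong (f q +_) (form-* l s one)))

  -- Poly S t f: f is a homogeneous polynomial map of degree t with coefficients in S.
  data Poly {m n} (S : Λ n → Set) : ℕ → (Vec ℚ m → Λ n) → Set where
    con : ∀ {f u} → S u → (∀ q → f q ≡ u) → Poly S 0 f
    zer : ∀ {f t} → (∀ q → f q ≡ 𝟎) → Poly S t f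
    add : ∀ {f g h t} → Poly S t f → Poly S t g → (∀ q → h q ≡ f q ⊕ g q) → Poly S t h
    mul : ∀ {l f h t} → Form l → Poly S t f → (∀ q → h q ≡ l q · f q) → Poly S (suc t) h

  record Subspace (S : Λ n → Set) : Set where
    field
      sub-𝟎 : S 𝟎
      sub-⊕ : ∀ {u v} → S u → S v → S (u ⊕ v)
      sub-· : ∀ a {u} → S u → S (a · u)

    sub-⊝ : ∀ {u} → S u → S (⊝ u)
    sub-⊝ {u} s = subst S (trans (cong (_⊗ u) (κ-neg 1ℚ)) (solve 2 (λ o u → (:- o) :* u := :- (o :* u)) refl 𝟏 u ∙ cong ⊝_ (1·u u))) (sub-· (- 1ℚ) s)
      where _∙_ = trans

    sub-sumS : ∀ {k} {f : Subset k → Λ n} → (∀ σ → S (f σ)) → S (sumS f)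
    sub-sumS {zero} s = s []
    sub-sumS {suc k} s = sub-⊕ (sub-sumS (λ σ → s (false ∷ σ))) (sub-sumS (λ σ → s (true ∷ σ)))
  open Subspace public

  module _ {S : Λ n → Set} where

    poly-cong : ∀ {t} {f g : Vec ℚ m → Λ n} → (∀ q → g q ≡ f q) → Poly S t f → Poly S t g
    poly-cong e (con s p) = con s (λ q → trans (e q) (p q))
    poly-cong e (zer p) = zer (λ q → trans (e q) (p q))
    poly-cong e (add a b p) = add a b (λ q → trans (e q) (p q))
    poly-cong e (mul l a p) = mul l a (λ q → trans (e q) (p q))

    poly-value : ∀ {t} {f : Vec ℚ m → Λ n} → Subspace S → Poly S t f → ∀ q → S (f q)
    poly-value sub (con s p) q = subst S (sym (p q)) s
    poly-value sub (zer p) q = subst S (sym (p q)) (sub-𝟎 sub)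
    poly-value sub (add a b p) q = subst S (sym (p q)) (sub-⊕ sub (poly-value sub a q) (poly-value sub b q))
    poly-value sub (mul l a p) q = subst S (sym (p q)) (sub-· sub _ (poly-value sub a q))

    poly-map : ∀ {k} {S′ : Λ k → Set} {L : Λ n → Λ k} → Linear L → (∀ {u} → S u → S′ (L u)) →
      ∀ {t} {f : Vec ℚ m → Λ n} → Poly S t f → Poly S′ t (λ q → L (f q))
    poly-map {L = L} lin into (con s p) = con (into s) (λ q → cong L (p q))
    poly-map {L = L} lin into (zer p) = zer (λ q → trans (cong L (p q)) (lin-𝟎 lin))
    poly-map {L = L} lin into (add a b p) = add (poly-map lin into a) (poly-map lin into b) (λ q → trans (cong L (p q)) (lin-⊕ lin _ _))
    poly-map {L = L} lin into (mul l a p) = mul l (poly-map lin into a) (λ q → trans (cong L (p q)) (lin-· lin _ _))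

    poly-pull : ∀ {k} (A : Vec ℚ k → Vec ℚ m) → (∀ {l} → Form l → Form (λ q → l (A q))) →
      ∀ {t} {f : Vec ℚ m → Λ n} → Poly S t f → Poly S t (λ q → f (A q))
    poly-pull A pull (con s p) = con s (λ q → p (A q))
    poly-pull A pull (zer p) = zer (λ q → p (A q))
    poly-pull A pull (add a b p) = add (poly-pull A pull a) (poly-pull A pull b) (λ q → p (A q))
    poly-pull A pull (mul l a p) = mul (pull l) (poly-pull A pull a) (λ q → p (A q))

    poly-const : ∀ {f : Vec ℚ m → Λ n} → Poly S 0 f → ∀ q r → f q ≡ f r
    poly-const (con s p) q r = trans (p q) (sym (p r))
    poly-const (zer p) q r = trans (p q) (sym (p r))
    poly-const (add a b p) q r = trans (p q) (trans (cong₂ _⊕_ (poly-const a q r) (poly-const b q r)) (sym (p r)))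

    -- The restriction to the multiples of X - w determines f up to a multiple of evaluation at w.
    poly-divide : Subspace S → ∀ w {t} {f : Vec ℚ (suc m) → Λ n} → Poly S (suc t) f →
      ∃ λ g → Poly S t g × (∀ q → f q ≡ ev q w · g q ⊕ f (mulBy w (divBy w q)))
    poly-divide sub w (zer p) = (λ _ → 𝟎) , zer (λ _ → refl) ,
      λ q → trans (p q) (sym (trans (cong₂ _⊕_ (a·𝟎 _) (p _)) (⊕-identityˡ 𝟎)))
    poly-divide sub w (add {f} {g} a b p) with poly-divide sub w a | poly-divide sub w b
    ... | f₁ , P₁ , e₁ | g₁ , Q₁ , e₂ = (λ q → f₁ q ⊕ g₁ q) , add P₁ Q₁ (λ _ → refl) ,
      λ q → trans (p q) (trans (cong₂ _⊕_ (e₁ q) (e₂ q))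
        (trans (solve 5 (λ x a b c d → (x :* a :+ b) :+ (x :* c :+ d) := x :* (a :+ c) :+ (b :+ d)) refl (κ (ev q w)) (f₁ q) (f _) (g₁ q) (g _))
          (cong (ev q w · (f₁ q ⊕ g₁ q) ⊕_) (sym (p _)))))
    -- Writing π q for q minus its value at w, a multiple of X - w, a form satisfies l(q) = l(π q) +
    -- q(w) l(1). In this clause the other factor has degree 0 and takes the same value at q and π
    -- q; in the next one it is divided recursively.
    poly-divide sub w {zero} (mul {l} {f} {h} fl a p) =
      (λ q → l one · f q) , poly-map (scale-linear (l one)) (sub-· sub (l one)) a ,
      λ q → trans (p q) (trans (cong (_· f q) (split q))
        (trans (cong (_⊗ f q) (κ-+ _ _))
          (trans (solve 3 (λ x y u → (x :+ y) :* u := y :* u :+ x :* u) refl (κ (l (π q))) (κ (ev q w * l one)) (f q))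
            (cong₂ _⊕_ (sym (·-· (ev q w) (l one) (f q))) (trans (cong (l (π q) ·_) (poly-const a q (π q))) (sym (p (π q))))))))
      where
      π : Vec ℚ (suc _) → Vec ℚ (suc _)
      π q = mulBy w (divBy w q)
      split : ∀ q → l q ≡ l (π q) + ev q w * l one
      split q = trans (cong l (divide w q)) (form-addHead fl (ev q w) (π q))
    poly-divide {m} sub w {suc t} (mul {l} {f} {h} fl a p) with poly-divide sub w a
    ... | g , P , e = (λ q → l one · f q ⊕ l (π q) · g q) ,
      add (poly-map (scale-linear (l one)) (sub-· sub (l one)) a) (mul lπ-form P (λ _ → refl)) (λ _ → refl) ,
      λ q → trans (p q) (trans (cong (_· f q) (split q)) (trans (cong (_⊗ f q) (κ-+ _ _))
        (trans (cong (λ z → (κ (l (π q)) ⊕ z) ⊗ f q) (κ-* (ev q w) (l one)))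
        (trans (solve 4 (λ x y o u → (x :+ y :* o) :* u := y :* (o :* u) :+ x :* u) refl (κ (l (π q))) (κ (ev q w)) (κ (l one)) (f q))
        (trans (cong (λ z → ev q w · (l one · f q) ⊕ l (π q) · z) (e q))
        (trans (solve 5 (λ y a x g b → y :* a :+ x :* (y :* g :+ b) := y :* (a :+ x :* g) :+ x :* b) refl (κ (ev q w)) (l one · f q) (κ (l (π q))) (g q) (f (π q)))
          (cong (ev q w · (l one · f q ⊕ l (π q) · g q) ⊕_) (sym (p (π q))))))))))
      where
      π : Vec ℚ (suc m) → Vec ℚ (suc m)
      π q = mulBy w (divBy w q)
      split : ∀ q → l q ≡ l (π q) + ev q w * l one
      split q = trans (cong l (divide w q)) (form-addHead fl (ev q w) (π q))
      lπ : ∀ q → l (π q) ≡ l q + (- l one) * ev q w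
      lπ q = trans (qsolve 2 (λ x y → x :≡ (x +: y) +: -: y) refl (l (π q)) (ev q w * l one))
        (trans (cong (_+ - (ev q w * l one)) (sym (split q))) (cong (l q +_) (qsolve 2 (λ x y → -: (x *: y) :≡ (-: y) *: x) refl (ev q w) (l one))))
      lπ-form : Form (λ q → l (π q))
      lπ-form = record
        { form-+ = λ q r → trans (lπ _) (trans (cong₂ (λ x y → x + (- l one) * y) (form-+ fl q r) (ev-+ q r w))
            (trans (qsolve 5 (λ a b c x y → (a +: b) +: c *: (x +: y) :≡ (a +: c *: x) +: (b +: c *: y)) refl (l q) (l r) (- l one) (ev q w) (ev r w))
              (sym (cong₂ _+_ (lπ q) (lπ r)))))
        ; form-* = λ c q → trans (lπ _) (trans (cong₂ (λ x y → x + (- l one) * y) (form-* fl c q) (ev-* c q w))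
            (trans (qsolve 4 (λ c a o x → c *: a +: o *: (c *: x) :≡ c *: (a +: o *: x)) refl c (l q) (- l one) (ev q w))
              (cong (c *_) (sym (lπ q))))) }

  mulBy-+ : ∀ w (q r : Vec ℚ m) → mulBy w (q +v r) ≡ mulBy w q +v mulBy w r
  mulBy-+ w [] [] = refl
  mulBy-+ w (a ∷ q) (b ∷ r) = cong₂ _∷_
    (qsolve 3 (λ w a b → -: (w *: (a +: b)) :≡ -: (w *: a) +: -: (w *: b)) refl w a b)
    (trans (cong (addHead (a + b)) (mulBy-+ w q r)) (heads (mulBy w q) (mulBy w r)))
    where
    heads : ∀ {k} (x y : Vec ℚ (suc k)) → addHead (a + b) (x +v y) ≡ addHead a x +v addHead b y
    heads (c ∷ x) (d ∷ y) = cong (_∷ (x +v y)) (qsolve 4 (λ a b c d → (a +: b) +: (c +: d) :≡ (a +: c) +: (b +: d)) refl a b c d)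

  mulBy-* : ∀ w c (q : Vec ℚ m) → mulBy w (c *v q) ≡ c *v mulBy w q
  mulBy-* w c [] = cong (_∷ []) (sym (ℚₚ.*-zeroʳ c))
  mulBy-* w c (a ∷ q) = cong₂ _∷_
    (qsolve 3 (λ w a c → -: (w *: (c *: a)) :≡ c *: (-: (w *: a))) refl w a c)
    (trans (cong (addHead (c * a)) (mulBy-* w c q)) (heads (mulBy w q)))
    where
    heads : ∀ {k} (x : Vec ℚ (suc k)) → addHead (c * a) (c *v x) ≡ c *v addHead a x
    heads (d ∷ x) = cong (_∷ (c *v x)) (sym (ℚₚ.*-distribˡ-+ c a d))

  divBy-+ : ∀ w (q r : Vec ℚ (suc m)) → divBy w (q +v r) ≡ divBy w q +v divBy w r
  divBy-+ w (a ∷ []) (b ∷ []) = refl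
  divBy-+ w (a ∷ c ∷ q) (b ∷ d ∷ r) = cong₂ _∷_ (ev-+ (c ∷ q) (d ∷ r) w) (divBy-+ w (c ∷ q) (d ∷ r))

  divBy-* : ∀ w c (q : Vec ℚ (suc m)) → divBy w (c *v q) ≡ c *v divBy w q
  divBy-* w c (a ∷ []) = refl
  divBy-* w c (a ∷ b ∷ q) = cong₂ _∷_ (ev-* c (b ∷ q) w) (divBy-* w c (b ∷ q))

  pull-mulBy : ∀ w {l : Vec ℚ (suc m) → ℚ} → Form l → Form (λ q → l (mulBy w q))
  pull-mulBy w {l} f = record
    { form-+ = λ q r → trans (cong l (mulBy-+ w q r)) (form-+ f _ _)
    ; form-* = λ c q → trans (cong l (mulBy-* w c q)) (form-* f c _) }

  pull-divBy : ∀ w {l : Vec ℚ m → ℚ} → Form l → Form (λ q → l (divBy w q))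
  pull-divBy w {l} f = record
    { form-+ = λ q r → trans (cong l (divBy-+ w q r)) (form-+ f _ _)
    ; form-* = λ c q → trans (cong l (divBy-* w c q)) (form-* f c _) }

  fresh : (xs : List ℚ) → ∃ λ s → s ∉ xs
  fresh xs = bound xs + 1ℚ , λ s∈ → ℚₚ.<⇒≢ (lt s∈) refl
    where
    bound : List ℚ → ℚ
    bound [] = 0ℚ
    bound (x ∷ xs) = ℚ.∣ x ∣ + bound xs
    nonneg : ∀ xs → 0ℚ ≤ bound xs
    nonneg [] = ℚₚ.≤-refl
    nonneg (x ∷ xs) = ℚₚ.+-mono-≤ (ℚₚ.0≤∣p∣ x) (nonneg xs)
    below : ∀ {x} xs → x ∈ˡ xs → x ≤ bound xs
    below (x ∷ xs) (here refl) = subst (_≤ ℚ.∣ x ∣ + bound xs) (ℚₚ.+-identityʳ x) (ℚₚ.+-mono-≤ (≤∣∣ x) (nonneg xs))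
      where
      ≤∣∣ : ∀ p → p ≤ ℚ.∣ p ∣
      ≤∣∣ p with ℚₚ.≤-total 0ℚ p
      ... | inj₁ 0≤p = ℚₚ.≤-reflexive (sym (ℚₚ.0≤p⇒∣p∣≡p 0≤p))
      ... | inj₂ p≤0 = ℚₚ.≤-trans p≤0 (ℚₚ.0≤∣p∣ p)
    below (y ∷ xs) (there x∈) = subst (_≤ ℚ.∣ y ∣ + bound xs) (ℚₚ.+-identityˡ _) (ℚₚ.+-mono-≤ (ℚₚ.0≤∣p∣ y) (below xs x∈))
    lt : ∀ {x} → x ∈ˡ xs → x < bound xs + 1ℚ
    lt x∈ = ℚₚ.≤-<-trans (below xs x∈) (subst (_< bound xs + 1ℚ) (ℚₚ.+-identityʳ _) (ℚₚ.+-monoʳ-< (bound xs) (ℚₚ.positive⁻¹ 1ℚ)))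

  -- Polynomial maps in one variable of degree at most t, in Horner form.
  data Horner {n} : ℕ → (ℚ → Λ n) → Set where
    con : ∀ {h u} → (∀ s → h s ≡ u) → Horner 0 h
    hor : ∀ {h k u t} → Horner t k → (∀ s → h s ≡ u ⊕ s · k s) → Horner (suc t) h

  horner-cong : ∀ {t} {h k : ℚ → Λ n} → (∀ s → k s ≡ h s) → Horner t h → Horner t k
  horner-cong e (con p) = con (λ s → trans (e s) (p s))
  horner-cong e (hor a p) = hor a (λ s → trans (e s) (p s))

  horner-𝟎 : ∀ t {h : ℚ → Λ n} → (∀ s → h s ≡ 𝟎) → Horner t h
  horner-𝟎 zero p = con p
  horner-𝟎 (suc t) p = hor (horner-𝟎 t (λ s → refl)) (λ s → trans (p s) (sym (trans (cong (𝟎 ⊕_) (a·𝟎 s)) (⊕-identityˡ 𝟎))))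

  horner-lift : ∀ {t} {h : ℚ → Λ n} → Horner t h → Horner (suc t) h
  horner-lift (con p) = hor (con (λ _ → refl)) (λ s → trans (p s) (sym (trans (cong (_ ⊕_) (a·𝟎 s)) (⊕-identityʳ _))))
  horner-lift (hor a p) = hor (horner-lift a) p

  horner-add : ∀ {t} {h k : ℚ → Λ n} → Horner t h → Horner t k → Horner t (λ s → h s ⊕ k s)
  horner-add (con p) (con q) = con (λ s → cong₂ _⊕_ (p s) (q s))
  horner-add (hor {k = h} {u} a p) (hor {k = k} {v} b q) = hor (horner-add a b) (λ s → trans (cong₂ _⊕_ (p s) (q s))
    (solve 5 (λ u x h v k → (u :+ x :* h) :+ (v :+ x :* k) := (u :+ v) :+ x :* (h :+ k)) refl u (κ s) (h s) v (k s)))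

  horner-scale : ∀ {t} {h : ℚ → Λ n} c → Horner t h → Horner t (λ s → c · h s)
  horner-scale c (con p) = con (λ s → cong (c ·_) (p s))
  horner-scale c (hor {k = k} {u} a p) = hor (horner-scale c a) (λ s → trans (cong (c ·_) (p s))
    (solve 4 (λ c u x k → c :* (u :+ x :* k) := c :* u :+ x :* (c :* k)) refl (κ c) u (κ s) (k s)))

  horner-divide : ∀ {t} {h : ℚ → Λ n} → Horner (suc t) h → ∀ r → ∃ λ k → Horner t k × (∀ s → h s ≡ h r ⊕ (s - r) · k s)
  horner-divide {h = h} (hor {k = k} {u} (con {u = v} p) e) r = k , con p , λ s →
    trans (trans (e s) (cong (λ z → u ⊕ s · z) (p s)))
      (trans (solve 4 (λ u x y v → u :+ x :* v := (u :+ y :* v) :+ (x :+ :- y) :* v) refl u (κ s) (κ r) v)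
        (cong₂ _⊕_ (sym (trans (e r) (cong (λ z → u ⊕ r · z) (p r)))) (cong₂ _⊗_ (sym (trans (κ-+ s (- r)) (cong (κ s ⊕_) (κ-neg r)))) (sym (p s)))))
  horner-divide {h = h} (hor {k = k} {u} a@(hor _ _) e) r with horner-divide a r
  ... | k₂ , b , e₂ = (λ s → k s ⊕ r · k₂ s) , horner-add a (horner-lift (horner-scale r b)) , λ s →
    trans (e s) (trans (rearrange s)
      (cong₂ _⊕_ (sym (e r)) (cong (_⊗ (k s ⊕ r · k₂ s)) (sym (trans (κ-+ s (- r)) (cong (κ s ⊕_) (κ-neg r)))))))
    where
    rearrange : ∀ s → u ⊕ s · k s ≡ (u ⊕ r · k r) ⊕ (κ s ⊕ ⊝ κ r) ⊗ (k s ⊕ r · k₂ s)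
    rearrange s = trans (solve 4 (λ u x y a → u :+ x :* a := (u :+ (x :+ :- y) :* a) :+ y :* a) refl u (κ s) (κ r) (k s))
      (trans (cong (λ z → (u ⊕ (κ s ⊕ ⊝ κ r) ⊗ k s) ⊕ r · z) (trans (e₂ s) (cong (λ z → k r ⊕ z ⊗ k₂ s) (trans (κ-+ s (- r)) (cong (κ s ⊕_) (κ-neg r))))))
        (solve 6 (λ u x y a b c → (u :+ (x :+ :- y) :* a) :+ y :* (b :+ (x :+ :- y) :* c) := (u :+ y :* b) :+ (x :+ :- y) :* (a :+ y :* c)) refl
          u (κ s) (κ r) (k s) (k r) (k₂ s)))

  -- Divide by s - r for a fresh root `r`; the quotient vanishes off the list enlarged by `r`, and
  -- its degree is smaller. In degree 0 one good point suffices.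
  horner-vanish : ∀ {t} {h : ℚ → Λ n} → Horner t h → ∀ bad → (∀ s → s ∉ bad → h s ≡ 𝟎) → ∀ s → h s ≡ 𝟎
  horner-vanish (con p) bad van s with fresh bad
  ... | r , r∉ = trans (p s) (trans (sym (p r)) (van r r∉))
  horner-vanish {h = h} a@(hor _ _) bad van s with fresh bad
  ... | r , r∉ with horner-divide a r
  ... | k , b , e = trans (e s) (trans (cong₂ _⊕_ (van r r∉) (trans (cong ((s - r) ·_) (horner-vanish b (r ∷ bad) k-van s)) (a·𝟎 _))) (⊕-identityˡ 𝟎))
    where
    k-van : ∀ t → t ∉ r ∷ bad → k t ≡ 𝟎
    k-van t t∉ = ·-cancel (a-b≢0 (λ eq → t∉ (here eq)))
      (trans (sym (⊕-identityˡ _)) (trans (cong (_⊕ (t - r) · k t) (sym (van r r∉))) (trans (sym (e t)) (van t (λ t∈ → t∉ (there t∈))))))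

  poly-horner : ∀ {S : Λ n → Set} {t} {f : Vec ℚ (suc m) → Λ n} → Poly S t f → ∀ q → Horner t (λ s → f (addHead s q))
  poly-horner (con s p) q = con (λ s → p _)
  poly-horner {t = t} (zer p) q = horner-𝟎 t (λ s → p _)
  poly-horner (add a b p) q = horner-cong (λ s → p _) (horner-add (poly-horner a q) (poly-horner b q))
  poly-horner (mul {l} {f} fl a p) q = horner-cong eq
    (horner-add (horner-lift (horner-scale (l q) (poly-horner a q)))
                (hor {u = 𝟎} (horner-scale (l one) (poly-horner a q)) (λ s → sym (⊕-identityˡ _))))
    where
    eq : ∀ s → _ ≡ l q · f (addHead s q) ⊕ s · (l one · f (addHead s q))
    eq s = trans (p _) (trans (cong (_· f (addHead s q)) (form-addHead fl s q))
      (trans (cong (_⊗ f (addHead s q)) (trans (κ-+ _ _) (cong (κ (l q) ⊕_) (κ-* s (l one)))))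
        (solve 4 (λ a s o u → (a :+ s :* o) :* u := a :* u :+ s :* (o :* u)) refl (κ (l q)) (κ s) (κ (l one)) (f (addHead s q)))))

  -- Vary the constant coefficient of `q`: evaluation at `w` is nonzero except for one value of the
  -- parameter, while `g` is a polynomial in it. So `g` vanishes along the whole line, in particular
  -- at `q`.
  ev-cancel : ∀ {S : Λ n → Set} {t} {g : Vec ℚ (suc m) → Λ n} → Poly S t g → ∀ w → (∀ q → ev q w · g q ≡ 𝟎) → ∀ q → g q ≡ 𝟎
  ev-cancel {g = g} P w van q = trans (cong g (sym (addHead-0 q)))
    (horner-vanish (poly-horner P q) (- ev q w ∷ []) off 0ℚ)
    where
    addHead-0 : ∀ {k} (q : Vec ℚ (suc k)) → addHead 0ℚ q ≡ q
    addHead-0 (b ∷ q) = cong (_∷ q) (ℚₚ.+-identityˡ b)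
    off : ∀ s → s ∉ - ev q w ∷ [] → g (addHead s q) ≡ 𝟎
    off s s∉ = ·-cancel (λ z → s∉ (here (trans (qsolve 2 (λ s y → s :≡ (s +: y) +: -: y) refl s (ev q w))
        (trans (cong (_+ - ev q w) (trans (sym (ev-addHead s q w)) z)) (ℚₚ.+-identityˡ _))))) (van (addHead s q))

-- Rational depth through fillings of cycles

module Depth where

  open IntegerMap
  open Counting
  open ShiftedFamilies using (Add; here; there; DownClosed; add-size)
  open Exterior
  open PolynomialMaps
  open import Data.Bool.Properties using (∧-comm; ∧-assoc)
  open import Data.Fin.Subset using (∣_∣)
  open import Data.List using ([]; _∷_)
  open import Data.Nat using () renaming (_≤_ to _≤ℕ_)
  open import Data.Rational using (_+_; _*_; -_; _-_)
  open import Data.Sum using (map₁)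
  open import Data.Unit using (⊤)
  open import Data.Vec using (replicate)
  open import Data.Vec.Properties using (≡-dec)
  open import Relation.Binary.PropositionalEquality

  open ℚSolver using () renaming (solve to qsolve; _:=_ to _:≡_; _:+_ to _+:_; _:*_ to _*:_; :-_ to -:_)

  private variable
    m n c : ℕ
    σ τ : Subset n
    x : Fin n

  data AddAt : ∀ {n} → Fin n → Subset n → Subset n → Set where
    here  : AddAt {suc n} zero (false ∷ σ) (true ∷ σ)
    there : ∀ {b} → AddAt x σ τ → AddAt {suc n} (suc x) (b ∷ σ) (b ∷ τ)

  addAt⇒add : AddAt x σ τ → Add σ τ
  addAt⇒add here = here
  addAt⇒add (there a) = there (addAt⇒add a)

  add⇒addAt : Add σ τ → ∃ λ x → AddAt x σ τ
  add⇒addAt here = zero , here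
  add⇒addAt (there a) with add⇒addAt a
  ... | x , b = suc x , there b

  addAt-∉ : AddAt x σ τ → lookup σ x ≡ false
  addAt-∉ here = refl
  addAt-∉ (there a) = addAt-∉ a

  addAt-∈ : AddAt x σ τ → lookup τ x ≡ true
  addAt-∈ here = refl
  addAt-∈ (there a) = addAt-∈ a

  addAt-τ : AddAt x σ τ → τ ≡ σ [ x ]≔ true
  addAt-τ here = refl
  addAt-τ (there a) = cong (_ ∷_) (addAt-τ a)

  addAt-σ : AddAt x σ τ → σ ≡ τ [ x ]≔ false
  addAt-σ here = refl
  addAt-σ (there a) = cong (_ ∷_) (addAt-σ a)

  addAt-insert : (x : Fin n) (σ : Subset n) → lookup σ x ≡ false → AddAt x σ (σ [ x ]≔ true)
  addAt-insert zero (false ∷ σ) refl = here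
  addAt-insert (suc x) (b ∷ σ) p = there (addAt-insert x σ p)

  addAt-remove : (x : Fin n) (τ : Subset n) → lookup τ x ≡ true → AddAt x (τ [ x ]≔ false) τ
  addAt-remove zero (true ∷ τ) refl = here
  addAt-remove (suc x) (b ∷ τ) p = there (addAt-remove x τ p)

  addAt-update : ∀ {y b} → x ≢ y → AddAt x σ τ → AddAt x (σ [ y ]≔ b) (τ [ y ]≔ b)
  addAt-update {y = zero} ne here = ⊥-elim (ne refl)
  addAt-update {y = suc y} ne here = here
  addAt-update {y = zero} ne (there a) = there a
  addAt-update {y = suc y} ne (there a) = there (addAt-update (λ p → ne (cong suc p)) a)

  -- A disjunction at every coordinate rather than an implication from nonvanishing: it can be
  -- matched on, and it defines a subspace for every `P`.
  record Sup (P : Subset n → Set) (u : Λ n) : Set where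
    constructor mkSup
    field sup : ∀ σ → P σ ⊎ at u σ ≡ 0ℚ
  open Sup public

  Chain : (Subset n → Bool) → ℕ → Λ n → Set
  Chain L c = Sup (λ σ → L σ ≡ true × ∣ σ ∣ ≡ c)

  sup-subspace : {P : Subset n → Set} → Subspace (Sup P)
  sup-subspace {P = P} = record
    { sub-𝟎 = mkSup λ σ → inj₂ (at-κ 0ℚ σ)
    ; sub-⊕ = λ {u} {v} s t → mkSup λ σ → plus u v σ (sup s σ) (sup t σ)
    ; sub-· = λ a {u} s → mkSup λ σ → times a u σ (sup s σ) }
    where
    plus : ∀ u v σ → P σ ⊎ at u σ ≡ 0ℚ → P σ ⊎ at v σ ≡ 0ℚ → P σ ⊎ at (u ⊕ v) σ ≡ 0ℚ
    plus u v σ (inj₁ p) _ = inj₁ p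
    plus u v σ (inj₂ _) (inj₁ p) = inj₁ p
    plus u v σ (inj₂ p) (inj₂ q) = inj₂ (trans (at-⊕ u v σ) (trans (cong₂ _+_ p q) (ℚₚ.+-identityˡ 0ℚ)))
    times : ∀ a u σ → P σ ⊎ at u σ ≡ 0ℚ → P σ ⊎ at (a · u) σ ≡ 0ℚ
    times a u σ (inj₁ p) = inj₁ p
    times a u σ (inj₂ p) = inj₂ (trans (at-· a u σ) (trans (cong (a *_) p) (ℚₚ.*-zeroʳ a)))

  sup-mono : {P Q : Subset n → Set} {u : Λ n} → (∀ σ → P σ → Q σ) → Sup P u → Sup Q u
  sup-mono {u = u} f s = mkSup λ σ → map₁ (f σ) (sup s σ)

  sup-empty : {P : Subset n → Set} {u : Λ n} → (∀ σ → ¬ P σ) → Sup P u → u ≡ 𝟎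
  sup-empty none s = at-ext λ σ → trans (zero-at σ) (sym (at-κ 0ℚ σ))
    where
    zero-at : ∀ σ → _ ≡ 0ℚ
    zero-at σ with sup s σ
    ... | inj₁ p = ⊥-elim (none σ p)
    ... | inj₂ q = q

  sup-at-i : (φ : Vec ℚ n) {P Q : Subset n → Set} {u : Λ n} →
    (∀ {σ τ} → Add σ τ → P τ → Q σ) →
    (∀ σ → P σ ⊎ at u σ ≡ 0ℚ) → ∀ σ → Q σ ⊎ at (i φ u) σ ≡ 0ℚ
  sup-at-i [] f s [] = inj₂ refl
  sup-at-i (a ∷ φ) {P} {Q} {u ∥ v} f s (false ∷ σ)
    with sup-at-i φ {λ ρ → P (false ∷ ρ)} {λ ρ → Q (false ∷ ρ)} {u} (λ d → f (there d)) (λ ρ → s (false ∷ ρ)) σ | s (true ∷ σ)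
  ... | inj₁ q | _ = inj₁ q
  ... | inj₂ _ | inj₁ p = inj₁ (f here p)
  ... | inj₂ p | inj₂ q = inj₂ (trans (at-⊕ (i φ u) (a · v) σ) (trans (cong₂ _+_ p (trans (at-· a v σ) (trans (cong (a *_) q) (ℚₚ.*-zeroʳ a)))) (ℚₚ.+-identityˡ 0ℚ)))
  sup-at-i (a ∷ φ) {P} {Q} {u ∥ v} f s (true ∷ σ)
    with sup-at-i φ {λ ρ → P (true ∷ ρ)} {λ ρ → Q (true ∷ ρ)} {v} (λ d → f (there d)) (λ ρ → s (true ∷ ρ)) σ
  ... | inj₁ q = inj₁ q
  ... | inj₂ p = inj₂ (trans (at-⊝ (i φ v) σ) (cong -_ p))

  sup-at-δ : (x : Fin n) {P Q : Subset n → Set} {u : Λ n} →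
    (∀ {σ τ} → AddAt x σ τ → P τ → Q σ) →
    (∀ σ → P σ ⊎ at u σ ≡ 0ℚ) → ∀ σ → Q σ ⊎ at (δ x u) σ ≡ 0ℚ
  sup-at-δ zero {u = u ∥ v} f s (false ∷ σ) with s (true ∷ σ)
  ... | inj₁ p = inj₁ (f here p)
  ... | inj₂ q = inj₂ q
  sup-at-δ zero {u = u ∥ v} f s (true ∷ σ) = inj₂ (at-κ 0ℚ σ)
  sup-at-δ (suc x) {P} {Q} {u ∥ v} f s (false ∷ σ) =
    sup-at-δ x {λ ρ → P (false ∷ ρ)} {λ ρ → Q (false ∷ ρ)} (λ d → f (there d)) (λ ρ → s (false ∷ ρ)) σ
  sup-at-δ (suc x) {P} {Q} {u ∥ v} f s (true ∷ σ)
    with sup-at-δ x {λ ρ → P (true ∷ ρ)} {λ ρ → Q (true ∷ ρ)} {v} (λ d → f (there d)) (λ ρ → s (true ∷ ρ)) σ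
  ... | inj₁ q = inj₁ q
  ... | inj₂ p = inj₂ (trans (at-⊝ (δ x v) σ) (cong -_ p))

  sup-at-ε : (x : Fin n) {P Q : Subset n → Set} {u : Λ n} →
    (∀ {σ τ} → AddAt x σ τ → P σ → Q τ) →
    (∀ σ → P σ ⊎ at u σ ≡ 0ℚ) → ∀ σ → Q σ ⊎ at (ε x u) σ ≡ 0ℚ
  sup-at-ε zero {u = u ∥ v} f s (true ∷ σ) with s (false ∷ σ)
  ... | inj₁ p = inj₁ (f here p)
  ... | inj₂ q = inj₂ q
  sup-at-ε zero {u = u ∥ v} f s (false ∷ σ) = inj₂ (at-κ 0ℚ σ)
  sup-at-ε (suc x) {P} {Q} {u ∥ v} f s (false ∷ σ) =
    sup-at-ε x {λ ρ → P (false ∷ ρ)} {λ ρ → Q (false ∷ ρ)} (λ d → f (there d)) (λ ρ → s (false ∷ ρ)) σ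
  sup-at-ε (suc x) {P} {Q} {u ∥ v} f s (true ∷ σ)
    with sup-at-ε x {λ ρ → P (true ∷ ρ)} {λ ρ → Q (true ∷ ρ)} {v} (λ d → f (there d)) (λ ρ → s (true ∷ ρ)) σ
  ... | inj₁ q = inj₁ q
  ... | inj₂ p = inj₂ (trans (at-⊝ (ε x v) σ) (cong -_ p))

  sup-i : (φ : Vec ℚ n) {P Q : Subset n → Set} {u : Λ n} →
    (∀ {σ τ} → Add σ τ → P τ → Q σ) → Sup P u → Sup Q (i φ u)
  sup-i φ f s = mkSup (sup-at-i φ f (sup s))

  sup-δ : (x : Fin n) {P Q : Subset n → Set} {u : Λ n} →
    (∀ {σ τ} → AddAt x σ τ → P τ → Q σ) → Sup P u → Sup Q (δ x u)
  sup-δ x f s = mkSup (sup-at-δ x f (sup s))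

  sup-ε : (x : Fin n) {P Q : Subset n → Set} {u : Λ n} →
    (∀ {σ τ} → AddAt x σ τ → P σ → Q τ) → Sup P u → Sup Q (ε x u)
  sup-ε x f s = mkSup (sup-at-ε x f (sup s))

  chain-e : {L : Subset n → Bool} → L σ ≡ true → ∣ σ ∣ ≡ c → Chain L c (e σ)
  chain-e {σ = σ} {c = c} {L} p q = mkSup at-τ
    where
    at-τ : ∀ τ → (L τ ≡ true × ∣ τ ∣ ≡ c) ⊎ at (e σ) τ ≡ 0ℚ
    at-τ τ with ≡-dec _≟B_ σ τ
    ... | yes refl = inj₁ (p , q)
    ... | no ne = inj₂ (at-e-other ne)

  -- Link and deletion stay on the same ground set and merely exclude `x`, so chains of all three
  -- families live in one space. The link of a non-vertex of a complex has no face, not even the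
  -- empty one.
  lk del : (Subset n → Bool) → Fin n → Subset n → Bool
  lk L x σ = not (lookup σ x) ∧ L (σ [ x ]≔ true)
  del L x σ = not (lookup σ x) ∧ L σ

  not-true : ∀ {b} → not b ≡ true → b ≡ false
  not-true {false} _ = refl

  lk-down : {L : Subset n → Bool} → DownClosed L → DownClosed (lk L x)
  lk-down {x = x} {L} down {σ} {τ} a p with add⇒addAt a
  ... | y , b = ∧-true⁺ (cong not σx) (down (addAt⇒add (addAt-update y≢x b)) (∧-true⁻ʳ p))
    where
    τx : lookup τ x ≡ false
    τx = not-true (∧-true⁻ˡ p)
    y≢x : y ≢ x
    y≢x refl = true≢false (addAt-∈ b) τx
    σx : lookup σ x ≡ false
    σx = trans (cong (λ ρ → lookup ρ x) (addAt-σ b)) (trans (lookup∘update′ (λ e → y≢x (sym e)) τ false) τx)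

  del-down : {L : Subset n → Bool} → DownClosed L → DownClosed (del L x)
  del-down {x = x} {L} down {σ} {τ} a p with add⇒addAt a
  ... | y , b = ∧-true⁺ (cong not σx) (down a (∧-true⁻ʳ p))
    where
    τx : lookup τ x ≡ false
    τx = not-true (∧-true⁻ˡ p)
    y≢x : y ≢ x
    y≢x refl = true≢false (addAt-∈ b) τx
    σx : lookup σ x ≡ false
    σx = trans (cong (λ ρ → lookup ρ x) (addAt-σ b)) (trans (lookup∘update′ (λ e → y≢x (sym e)) τ false) τx)

  lk⊆del : {L : Subset n → Bool} → DownClosed L → ∀ σ → lk L x σ ≡ true → del L x σ ≡ true
  lk⊆del {x = x} down σ p = ∧-true⁺ (∧-true⁻ˡ p) (down (addAt⇒add (addAt-insert x σ (not-true (∧-true⁻ˡ p)))) (∧-true⁻ʳ p))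

  chain-i : {L : Subset n → Bool} {u : Λ n} → DownClosed L → ∀ φ → Chain L (suc c) u → Chain L c (i φ u)
  chain-i down φ = sup-i φ λ a (p , q) → down a p , ℕₚ.suc-injective (trans (sym (add-size a)) q)

  chain-δ : {L : Subset n → Bool} {u : Λ n} → ∀ x → Chain L (suc c) u → Chain (lk L x) c (δ x u)
  chain-δ {L = L} x = sup-δ x λ a (p , q) →
    ∧-true⁺ (cong not (addAt-∉ a)) (trans (cong L (sym (addAt-τ a))) p) , ℕₚ.suc-injective (trans (sym (add-size (addAt⇒add a))) q)

  chain-δ-zero : {L : Subset n → Bool} {u : Λ n} → ∀ x → Chain L 0 u → δ x u ≡ 𝟎
  chain-δ-zero x s = sup-empty (λ _ ()) (sup-δ x {Q = λ _ → ⊥} (λ a (p , q) → ℕₚ.1+n≢0 (trans (sym (add-size (addAt⇒add a))) q)) s)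

  chain-ε : {L : Subset n → Bool} {u : Λ n} → ∀ x → Chain (lk L x) c u → Chain L (suc c) (ε x u)
  chain-ε {L = L} x = sup-ε x λ a (p , q) →
    trans (cong L (addAt-τ a)) (∧-true⁻ʳ p) , trans (add-size (addAt⇒add a)) (cong suc q)

  chain-δε : {L : Subset n → Bool} {u : Λ n} → ∀ x → Chain L c u → Chain (del L x) c (δ x (ε x u))
  chain-δε {c = c} {L = L} x s = sup-δ x {P = λ τ → ∃ λ σ → AddAt x σ τ × L σ ≡ true × ∣ σ ∣ ≡ c}
    (λ { a (ρ , b , p , q) → subst (λ ρ → del L x ρ ≡ true × ∣ ρ ∣ ≡ c) (trans (addAt-σ b) (sym (addAt-σ a))) (∧-true⁺ (cong not (addAt-∉ b)) p , q) })
    (sup-ε x (λ a pq → _ , a , pq) s)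

  chain-del-δ : {L : Subset n → Bool} {u : Λ n} → ∀ x → Chain (del L x) c u → δ x u ≡ 𝟎
  chain-del-δ x s = sup-empty (λ _ ()) (sup-δ x {Q = λ _ → ⊥} (λ a (p , q) → true≢false (addAt-∈ a) (not-true (∧-true⁻ˡ p))) s)

  ones : Vec ℚ n
  ones = replicate _ 1ℚ

  lookup-ones : (x : Fin n) → lookup ones x ≡ 1ℚ
  lookup-ones zero = refl
  lookup-ones (suc x) = lookup-ones x

  1≢0 : 1ℚ ≢ 0ℚ
  1≢0 ()

  -- Vanishing of the rational reduced homology in dimension c - 1, since `i ones` is the simplicial
  -- boundary. A linear choice of fillings is recorded because fillings of cycles depending on
  -- parameters will be expanded through the matrix of `h`.
  record Section (L : Subset n → Bool) (c : ℕ) : Set where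
    field
      h      : Λ n → Λ n
      linear : Linear h
      into   : ∀ {u} → Chain L c u → Chain L (suc c) (h u)
      bounds : ∀ {u} → Chain L c u → i ones u ≡ 𝟎 → i ones (h u) ≡ u

  -- Links of faces are reached as iterated links of vertices: for a face with j vertices, cycles on
  -- sets of fewer than k - j vertices of its link bound. Links of non-vertices satisfy the
  -- condition trivially by `depth-empty`.
  Depth≥ : (Subset n → Bool) → ℕ → Set
  Depth≥ L zero = ⊤
  Depth≥ L (suc k) = (∀ c → c ≤ℕ k → Section L c) × (∀ x → Depth≥ (lk L x) k)

  section-cong : {L L′ : Subset n → Bool} → (∀ σ → L σ ≡ L′ σ) → Section L c → Section L′ c
  section-cong eq s = record
    { h = h ; linear = linear
    ; into = λ ch → sup-mono (λ σ (p , q) → trans (sym (eq σ)) p , q) (into (sup-mono (λ σ (p , q) → trans (eq σ) p , q) ch))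
    ; bounds = λ ch → bounds (sup-mono (λ σ (p , q) → trans (eq σ) p , q) ch) }
    where open Section s

  depth-cong : ∀ k {L L′ : Subset n → Bool} → (∀ σ → L σ ≡ L′ σ) → Depth≥ L k → Depth≥ L′ k
  depth-cong zero eq d = tt
  depth-cong (suc k) eq (sec , lks) = (λ c le → section-cong eq (sec c le)) ,
    λ x → depth-cong k (λ σ → cong (not (lookup σ x) ∧_) (eq _)) (lks x)

  section-empty : {L : Subset n → Bool} → (∀ σ → L σ ≡ false) → Section L c
  section-empty none = record
    { h = λ u → u ; linear = id-linear
    ; into = λ ch → subst (Chain _ _) (sym (is-zero ch)) (sub-𝟎 sup-subspace)
    ; bounds = λ ch _ → trans (cong (i ones) (is-zero ch)) (trans (lin-𝟎 (i-linear ones)) (sym (is-zero ch))) }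
    where
    is-zero : ∀ {c u} → Chain _ c u → u ≡ 𝟎
    is-zero = sup-empty (λ σ (p , _) → true≢false p (none σ))

  depth-empty : ∀ k {L : Subset n → Bool} → (∀ σ → L σ ≡ false) → Depth≥ L k
  depth-empty zero none = tt
  depth-empty (suc k) none = (λ c _ → section-empty none) ,
    λ x → depth-empty k (λ σ → trans (cong (not (lookup σ x) ∧_) (none _)) (∧-zeroʳ _))

  -- Fill the cycle in `L` by a chain `b`. As its boundary avoids `x`, the part `δ x b` is a cycle
  -- of the link; replacing the cone over it with apex `x` by a filling inside the link turns `b`
  -- into a filling that avoids `x`.
  section-del : {L : Subset n → Bool} → DownClosed L → ∀ x → Section L c → Section (lk L x) c → Section (del L x) c
  section-del {c = c} {L = L} down x s t = record
    { h = λ u → δ x (ε x (S.h u)) ⊕ T.h (δ x (S.h u))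
    ; linear = ⊕-linear (∘-linear (δ-linear x) (∘-linear (ε-linear x) S.linear)) (∘-linear T.linear (∘-linear (δ-linear x) S.linear))
    ; into = λ ch → sub-⊕ sup-subspace (chain-δε x (S.into (weaken ch)))
        (sup-mono (λ σ (p , q) → lk⊆del down σ p , q) (T.into (chain-δ x (S.into (weaken ch)))))
    ; bounds = bounds′ }
    where
    module S = Section s
    module T = Section t
    weaken : ∀ {c u} → Chain (del L x) c u → Chain L c u
    weaken = sup-mono (λ σ (p , q) → ∧-true⁻ʳ p , q)
    bounds′ : ∀ {u} → Chain (del L x) c u → i ones u ≡ 𝟎 → i ones (δ x (ε x (S.h u)) ⊕ T.h (δ x (S.h u))) ≡ u
    bounds′ {u} ch cyc = begin
      i ones (δ x (ε x b) ⊕ T.h b₁) ≡⟨ lin-⊕ (i-linear ones) _ _ ⟩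
      i ones (δ x (ε x b)) ⊕ i ones (T.h b₁) ≡⟨ cong₂ _⊕_ (trans (i-δ ones x (ε x b)) (cong (λ z → ⊝ δ x z) (i-ε ones x b))) (T.bounds (chain-δ x (S.into (weaken ch))) b₁-cycle) ⟩
      ⊝ δ x (lookup ones x · b ⊕ ⊝ ε x (i ones b)) ⊕ b₁ ≡⟨ cong (λ z → ⊝ z ⊕ b₁) (trans (lin-⊕ (δ-linear x) _ _) (cong₂ _⊕_ (trans (lin-· (δ-linear x) _ b) (trans (cong (_· b₁) (lookup-ones x)) (1·u b₁))) (lin-⊝ (δ-linear x) _))) ⟩
      ⊝ (b₁ ⊕ ⊝ δ x (ε x (i ones b))) ⊕ b₁ ≡⟨ solve 2 (λ p q → :- (p :+ :- q) :+ p := q) refl b₁ (δ x (ε x (i ones b))) ⟩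
      δ x (ε x (i ones b)) ≡⟨ cong (λ z → δ x (ε x z)) ib ⟩
      δ x (ε x u) ≡⟨ trans (sym (⊕-identityʳ _)) (cong (δ x (ε x u) ⊕_) (sym (trans (cong (ε x) (chain-del-δ x ch)) (lin-𝟎 (ε-linear x))))) ⟩
      δ x (ε x u) ⊕ ε x (δ x u) ≡⟨ δ-ε x u ⟩
      u ∎
      where
      open ≡-Reasoning
      b = S.h u
      b₁ = δ x b
      ib : i ones b ≡ u
      ib = S.bounds (weaken ch) cyc
      b₁-cycle : i ones b₁ ≡ 𝟎
      b₁-cycle = trans (i-δ ones x b) (trans (cong (λ z → ⊝ δ x z) ib) (trans (cong ⊝_ (chain-del-δ x ch)) ⊝𝟎))

  -- One unit is lost because fillings in the deletion use fillings in the link of `x`. For the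
  -- recursion, deleting `x` commutes with the link of another vertex, and the link of `x` in the
  -- deletion is void.
  depth-del : ∀ k {L : Subset n → Bool} → DownClosed L → ∀ x → Depth≥ L (suc k) → Depth≥ (del L x) k
  depth-del zero down x d = tt
  depth-del (suc k) {L} down x (sec , lks) = (λ c le → section-del down x (sec c (ℕₚ.m≤n⇒m≤1+n le)) (proj₁ (lks x) c le)) , links
    where
    links : ∀ y → Depth≥ (lk (del L x) y) k
    links y with x ≟F y
    ... | yes refl = depth-empty k λ σ → trans (cong (λ z → not (lookup σ x) ∧ (not z ∧ L (σ [ x ]≔ true))) (lookup∘update x σ true)) (∧-zeroʳ _)
    ... | no x≢y = depth-cong k swap (depth-del k (lk-down down) x (lks y))
      where
      swap : ∀ σ → del (lk L y) x σ ≡ lk (del L x) y σ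
      swap σ = trans (sym (∧-assoc (not (lookup σ x)) _ _)) (trans (cong (_∧ L (σ [ y ]≔ true)) (∧-comm (not (lookup σ x)) _))
        (trans (∧-assoc (not (lookup σ y)) _ _) (cong (λ z → not (lookup σ y) ∧ (not z ∧ L (σ [ y ]≔ true))) (sym (lookup∘update′ x≢y σ true)))))

-- Weighted boundaries depending on a polynomial

module Exactness where

  open IntegerMap
  open Counting
  open ShiftedFamilies using (here; there)
  open Exterior
  open PolynomialMaps
  open Depth
  open import Data.Fin.Subset using (∣_∣)
  open import Data.List using ([]; _∷_)
  open import Data.List.Relation.Unary.Any using (here; there)
  open import Data.Nat using () renaming (_+_ to _+ℕ_)
  open import Data.Rational using (_+_; _*_; -_; _-_)
  open import Data.Vec using (tail)
  open import Function using (_∘_)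
  open import Relation.Binary.PropositionalEquality

  open ℚSolver using () renaming (solve to qsolve; _:=_ to _:≡_; _:+_ to _+:_; _:*_ to _*:_; :-_ to -:_)

  private variable
    m n c : ℕ
    σ τ : Subset n
    x : Fin n

  mkΛ : (Subset n → ℚ) → Λ n
  mkΛ {zero} w = sc (w [])
  mkΛ {suc n} w = mkΛ (λ σ → w (false ∷ σ)) ∥ mkΛ (λ σ → w (true ∷ σ))

  at-mkΛ : (w : Subset n → ℚ) (σ : Subset n) → at (mkΛ w) σ ≡ w σ
  at-mkΛ w [] = refl
  at-mkΛ w (false ∷ σ) = at-mkΛ (λ σ → w (false ∷ σ)) σ
  at-mkΛ w (true ∷ σ) = at-mkΛ (λ σ → w (true ∷ σ)) σ

  -- Rescaling the basis conjugates contractions into one another.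
  i-rescale : (φ ψ : Vec ℚ n) (w w′ : Subset n → ℚ) (u : Λ n) →
    (∀ {x σ τ} → AddAt x σ τ → lookup φ x * w τ ≡ w′ σ * lookup ψ x ⊎ at u τ ≡ 0ℚ) →
    i φ (mkΛ w ⊗ u) ≡ mkΛ w′ ⊗ i ψ u
  i-rescale [] [] w w′ (sc u) H = cong sc (sym (ℚₚ.*-zeroʳ (w′ [])))
  i-rescale (a ∷ φ) (b ∷ ψ) w w′ (u ∥ v) H = cong₂ _∥_
    (trans (cong₂ _⊕_ (i-rescale φ ψ (w ∘ (false ∷_)) (w′ ∘ (false ∷_)) u (λ d → H (there d))) heads)
      (sym (distrib-⊗ (mkΛ (w′ ∘ (false ∷_))) (i ψ u) (b · v))))
    (trans (cong ⊝_ (i-rescale φ ψ (w ∘ (true ∷_)) (w′ ∘ (true ∷_)) v (λ d → H (there d))))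
      (solve 2 (λ p q → :- (p :* q) := p :* (:- q)) refl (mkΛ (w′ ∘ (true ∷_))) (i ψ v)))
    where
    distrib-⊗ : ∀ {k} (p q r : Λ k) → p ⊗ (q ⊕ r) ≡ p ⊗ q ⊕ p ⊗ r
    distrib-⊗ p q r = solve 3 (λ p q r → p :* (q :+ r) := p :* q :+ p :* r) refl p q r
    heads : a · (mkΛ (w ∘ (true ∷_)) ⊗ v) ≡ mkΛ (w′ ∘ (false ∷_)) ⊗ (b · v)
    heads = at-ext λ σ → trans (at-· a (mkΛ (w ∘ (true ∷_)) ⊗ v) σ) (trans (cong (a *_) (trans (at-⊗ (mkΛ (w ∘ (true ∷_))) v σ) (cong (_* at v σ) (at-mkΛ (w ∘ (true ∷_)) σ))))
      (trans (middle σ (H (here {σ = σ}))) (sym (trans (at-⊗ (mkΛ (w′ ∘ (false ∷_))) (b · v) σ) (cong₂ _*_ (at-mkΛ (w′ ∘ (false ∷_)) σ) (at-· b v σ))))))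
      where
      middle : ∀ σ → a * w (true ∷ σ) ≡ w′ (false ∷ σ) * b ⊎ at v σ ≡ 0ℚ → a * (w (true ∷ σ) * at v σ) ≡ w′ (false ∷ σ) * (b * at v σ)
      middle σ (inj₁ p) = trans (sym (ℚₚ.*-assoc a (w (true ∷ σ)) (at v σ))) (trans (cong (_* at v σ) p) (ℚₚ.*-assoc (w′ (false ∷ σ)) b (at v σ)))
      middle σ (inj₂ p) rewrite p | ℚₚ.*-zeroʳ (w (true ∷ σ)) | ℚₚ.*-zeroʳ a | ℚₚ.*-zeroʳ b = sym (ℚₚ.*-zeroʳ (w′ (false ∷ σ)))

  prodIn prodOut : (Fin n → ℚ) → Subset n → ℚ
  prodIn y [] = 1ℚ
  prodIn y (true ∷ σ) = y zero * prodIn (y ∘ suc) σ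
  prodIn y (false ∷ σ) = prodIn (y ∘ suc) σ
  prodOut y [] = 1ℚ
  prodOut y (true ∷ σ) = prodOut (y ∘ suc) σ
  prodOut y (false ∷ σ) = y zero * prodOut (y ∘ suc) σ

  prodAll : (Fin n → ℚ) → ℚ
  prodAll {zero} y = 1ℚ
  prodAll {suc n} y = y zero * prodAll (y ∘ suc)

  prodIn-add : ∀ (y : Fin n → ℚ) → AddAt x σ τ → prodIn y τ ≡ y x * prodIn y σ
  prodIn-add y here = refl
  prodIn-add {x = suc x} {σ = _ ∷ σ} y (there {b = true} d) = trans (cong (y zero *_) (prodIn-add (y ∘ suc) d))
    (qsolve 3 (λ a b c → a *: (b *: c) :≡ b *: (a *: c)) refl (y zero) (y (suc x)) (prodIn (y ∘ suc) σ))
  prodIn-add y (there {b = false} d) = prodIn-add (y ∘ suc) d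

  prodOut-add : ∀ (y : Fin n → ℚ) → AddAt x σ τ → prodOut y σ ≡ y x * prodOut y τ
  prodOut-add y here = refl
  prodOut-add {x = suc x} {τ = _ ∷ τ} y (there {b = false} d) = trans (cong (y zero *_) (prodOut-add (y ∘ suc) d))
    (qsolve 3 (λ a b c → a *: (b *: c) :≡ b *: (a *: c)) refl (y zero) (y (suc x)) (prodOut (y ∘ suc) τ))
  prodOut-add y (there {b = true} d) = prodOut-add (y ∘ suc) d

  prodOut-prodIn : (y : Fin n → ℚ) (σ : Subset n) → prodOut y σ * prodIn y σ ≡ prodAll y
  prodOut-prodIn y [] = ℚₚ.*-identityˡ 1ℚ
  prodOut-prodIn y (true ∷ σ) = trans (qsolve 3 (λ a b c → a *: (b *: c) :≡ b *: (a *: c)) refl (prodOut (y ∘ suc) σ) (y zero) _) (cong (y zero *_) (prodOut-prodIn (y ∘ suc) σ))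
  prodOut-prodIn y (false ∷ σ) = trans (ℚₚ.*-assoc (y zero) _ _) (cong (y zero *_) (prodOut-prodIn (y ∘ suc) σ))

  prodIn-* : (y z : Fin n → ℚ) (σ : Subset n) → prodIn (λ x → y x * z x) σ ≡ prodIn y σ * prodIn z σ
  prodIn-* y z [] = sym (ℚₚ.*-identityˡ 1ℚ)
  prodIn-* y z (true ∷ σ) = trans (cong (y zero * z zero *_) (prodIn-* (y ∘ suc) (z ∘ suc) σ))
    (qsolve 4 (λ a b c d → (a *: b) *: (c *: d) :≡ (a *: c) *: (b *: d)) refl (y zero) (z zero) _ _)
  prodIn-* y z (false ∷ σ) = prodIn-* (y ∘ suc) (z ∘ suc) σ

  prodIn-inverse : (y z : Fin n → ℚ) (σ : Subset n) → (∀ {x ρ} → AddAt x ρ σ → z x * y x ≡ 1ℚ) → prodIn z σ * prodIn y σ ≡ 1ℚ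
  prodIn-inverse y z σ H = trans (sym (prodIn-* z y σ)) (all-one (λ x → z x * y x) σ H)
    where
    all-one : ∀ {k} (y : Fin k → ℚ) σ → (∀ {x ρ} → AddAt x ρ σ → y x ≡ 1ℚ) → prodIn y σ ≡ 1ℚ
    all-one y [] H = refl
    all-one y (true ∷ σ) H = trans (cong₂ _*_ (H here) (all-one (y ∘ suc) σ (λ d → H (there d)))) (ℚₚ.*-identityˡ 1ℚ)
    all-one y (false ∷ σ) H = all-one (y ∘ suc) σ (λ d → H (there d))

  cosize : Subset n → ℕ
  cosize [] = 0
  cosize (true ∷ σ) = cosize σ
  cosize (false ∷ σ) = suc (cosize σ)

  cosize+size : (σ : Subset n) → cosize σ +ℕ ∣ σ ∣ ≡ n
  cosize+size [] = refl
  cosize+size (true ∷ σ) = trans (ℕₚ.+-suc _ _) (cong suc (cosize+size σ))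
  cosize+size (false ∷ σ) = cong suc (cosize+size σ)

  module _ {n : ℕ} {S : Λ n → Set} where

    poly-prodIn : ∀ {k} {y : Vec ℚ m → Fin k → ℚ} → (∀ x → Form (λ q → y q x)) → ∀ {t} {f : Vec ℚ m → Λ n} → Poly S t f →
      ∀ σ → Poly S (∣ σ ∣ +ℕ t) (λ q → prodIn (y q) σ · f q)
    poly-prodIn forms P [] = poly-cong (λ q → 1·u _) P
    poly-prodIn forms P (true ∷ σ) = mul (forms zero) (poly-prodIn (λ x → forms (suc x)) P σ) (λ q → sym (·-· _ _ _))
    poly-prodIn forms P (false ∷ σ) = poly-prodIn (λ x → forms (suc x)) P σ

    poly-prodOut : ∀ {k} {y : Vec ℚ m → Fin k → ℚ} → (∀ x → Form (λ q → y q x)) → ∀ {t} {f : Vec ℚ m → Λ n} → Poly S t f →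
      ∀ σ → Poly S (cosize σ +ℕ t) (λ q → prodOut (y q) σ · f q)
    poly-prodOut forms P [] = poly-cong (λ q → 1·u _) P
    poly-prodOut forms P (false ∷ σ) = mul (forms zero) (poly-prodOut (λ x → forms (suc x)) P σ) (λ q → sym (·-· _ _ _))
    poly-prodOut forms P (true ∷ σ) = poly-prodOut (λ x → forms (suc x)) P σ

    poly-sumS : ∀ {k t} {f : Subset k → Vec ℚ m → Λ n} → (∀ σ → Poly S t (f σ)) → Poly S t (λ q → sumS (λ σ → f σ q))
    poly-sumS {k = zero} P = P []
    poly-sumS {k = suc k} P = add (poly-sumS (λ σ → P (false ∷ σ))) (poly-sumS (λ σ → P (true ∷ σ))) (λ q → refl)

    poly-linear : (g : Vec ℚ m → Λ n) → (∀ q r → g (q +v r) ≡ g q ⊕ g r) → (∀ a q → g (a *v q) ≡ a · g q) →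
      (∀ q → S (g q)) → Poly S 1 g
    poly-linear {zero} g g+ g* s = zer λ { [] → trans (g* 0ℚ []) (0·u _) }
    poly-linear {suc m} g g+ g* s = add
      (mul head-form (con (s one) (λ q → refl)) (λ q → refl))
      (poly-pull tail tail-form (poly-linear (λ q → g (0ℚ ∷ q)) (λ q r → trans (cong (λ z → g (z ∷ (q +v r))) (sym (ℚₚ.+-identityˡ 0ℚ))) (g+ _ _))
        (λ a q → trans (cong (λ z → g (z ∷ (a *v q))) (sym (ℚₚ.*-zeroʳ a))) (g* a _)) (λ q → s _)))
      (λ { (a ∷ q) → trans (cong g (cong₂ _∷_ (trans (sym (ℚₚ.*-identityʳ a)) (sym (ℚₚ.+-identityʳ _))) (split a q)))
                       (trans (g+ (a *v one) (0ℚ ∷ q)) (cong (_⊕ g (0ℚ ∷ q)) (g* a one))) })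
      where
      head-form : Form {suc m} (λ { (a ∷ q) → a })
      head-form = record { form-+ = λ { (a ∷ q) (b ∷ r) → refl } ; form-* = λ { c (a ∷ q) → refl } }
      tail-form : ∀ {l : Vec ℚ m → ℚ} → Form l → Form {suc m} (λ q → l (tail q))
      tail-form f = record { form-+ = λ { (a ∷ q) (b ∷ r) → form-+ f q r } ; form-* = λ { c (a ∷ q) → form-* f c q } }
      split : ∀ {k} a (q : Vec ℚ k) → q ≡ a *v 0v +v q
      split a [] = refl
      split a (b ∷ q) = cong₂ _∷_ (sym (trans (cong (_+ b) (ℚₚ.*-zeroʳ a)) (ℚₚ.+-identityˡ b))) (split a q)

  -- Made total by the value 0 at 0; the cancellation law is used only at vertices of faces, where
  -- the weights do not vanish.
  inv : ℚ → ℚ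
  inv a with a ℚₚ.≟ 0ℚ
  ... | yes _ = 0ℚ
  ... | no a≢0 = proj₁ (inverseʳ a≢0)

  inv-* : ∀ {a} → a ≢ 0ℚ → inv a * a ≡ 1ℚ
  inv-* {a} a≢0 with a ℚₚ.≟ 0ℚ
  ... | yes p = ⊥-elim (a≢0 p)
  ... | no a≢0′ = trans (ℚₚ.*-comm _ a) (proj₂ (inverseʳ a≢0′))

  -- Asked at vertices of faces only: multiplication by X - w annihilates the weight of a vertex
  -- placed at `w`, and the argument then continues with families that no longer contain this
  -- vertex.
  record NonVanishing (p : Vec ℚ n) (L : Subset n → Bool) : Set where
    constructor nonvan
    field value≢0 : ∀ {x σ τ} → AddAt x σ τ → L τ ≡ true → lookup p x ≢ 0ℚ
  open NonVanishing public

  -- The vertices are placed at distinct points of the line; a polynomial q then acts by contraction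
  -- with the functional whose value at a vertex is p times the value of q there.
  module AtPoints {n : ℕ} (pts : Vec ℚ (suc n)) (distinct : ∀ {x y} → lookup pts x ≡ lookup pts y → x ≡ y) where

    infixl 7 _⋆_
    _⋆_ : Vec ℚ (suc n) → ℚ → Vec ℚ (suc n)
    p ⋆ w = zipWith (λ a x → a * (x - w)) p pts

    wt : Vec ℚ (suc n) → Vec ℚ m → Vec ℚ (suc n)
    wt p q = zipWith (λ a x → a * ev q x) p pts

    lookup-wt : ∀ p (q : Vec ℚ m) x → lookup (wt p q) x ≡ lookup p x * ev q (lookup pts x)
    lookup-wt p q x = lookup-zipWith (λ a x → a * ev q x) x p pts

    private
      zip-cong : ∀ {k} {f g : ℚ → ℚ → ℚ} → (∀ a b → f a b ≡ g a b) → (u v : Vec ℚ k) → zipWith f u v ≡ zipWith g u v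
      zip-cong e [] [] = refl
      zip-cong e (a ∷ u) (b ∷ v) = cong₂ _∷_ (e a b) (zip-cong e u v)
      zip-+ : ∀ {k} (f g : ℚ → ℚ → ℚ) (u v : Vec ℚ k) → zipWith (λ a b → f a b + g a b) u v ≡ zipWith f u v +v zipWith g u v
      zip-+ f g [] [] = refl
      zip-+ f g (a ∷ u) (b ∷ v) = cong (_ ∷_) (zip-+ f g u v)
      zip-* : ∀ {k} c (g : ℚ → ℚ → ℚ) (u v : Vec ℚ k) → zipWith (λ a b → c * g a b) u v ≡ c *v zipWith g u v
      zip-* c g [] [] = refl
      zip-* c g (a ∷ u) (b ∷ v) = cong (_ ∷_) (zip-* c g u v)
      zip-assoc : ∀ {k} (f g h : ℚ → ℚ → ℚ) (u v : Vec ℚ k) → (∀ a b → f (g a b) b ≡ h a b) → zipWith f (zipWith g u v) v ≡ zipWith h u v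
      zip-assoc f g h [] [] e = refl
      zip-assoc f g h (a ∷ u) (b ∷ v) e = cong₂ _∷_ (e a b) (zip-assoc f g h u v e)

    wt-+ : ∀ p (q r : Vec ℚ m) → wt p (q +v r) ≡ wt p q +v wt p r
    wt-+ p q r = trans (zip-cong (λ a x → trans (cong (a *_) (ev-+ q r x)) (ℚₚ.*-distribˡ-+ a _ _)) p pts) (zip-+ _ _ p pts)

    wt-* : ∀ p c (q : Vec ℚ m) → wt p (c *v q) ≡ c *v wt p q
    wt-* p c q = trans (zip-cong (λ a x → trans (cong (a *_) (ev-* c q x)) (qsolve 3 (λ a c y → a *: (c *: y) :≡ c *: (a *: y)) refl a c (ev q x))) p pts) (zip-* c _ p pts)

    wt-⋆ : ∀ p w (q : Vec ℚ m) → wt (p ⋆ w) q ≡ wt p (mulBy w q)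
    wt-⋆ p w q = zip-assoc _ _ _ p pts (λ a x → trans (ℚₚ.*-assoc a (x - w) _) (cong (a *_) (sym (ev-mulBy w q x))))

    ∂ : Vec ℚ (suc n) → (Vec ℚ m → Λ (suc n)) → Vec ℚ m → Λ (suc n)
    ∂ p f q = i (wt p q) (f q)

    poly-∂ : ∀ p {S S′ : Λ (suc n) → Set} → Subspace S′ → (∀ φ {u} → S u → S′ (i φ u)) → ∀ {t} {f : Vec ℚ m → Λ (suc n)} → Poly S t f → Poly S′ (suc t) (∂ p f)
    poly-∂ p sub into (con {u = u} s e) = poly-cong (λ q → cong (i (wt p q)) (e q))
      (poly-linear (λ q → i (wt p q) u)
        (λ q r → trans (cong (λ z → i z u) (wt-+ p q r)) (i-+ (wt p q) (wt p r) u))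
        (λ a q → trans (cong (λ z → i z u) (wt-* p a q)) (i-* a (wt p q) u))
        (λ q → into (wt p q) s))
    poly-∂ p sub into (zer e) = zer (λ q → trans (cong (i (wt p q)) (e q)) (lin-𝟎 (i-linear (wt p q))))
    poly-∂ p sub into (add a b e) = add (poly-∂ p sub into a) (poly-∂ p sub into b) (λ q → trans (cong (i (wt p q)) (e q)) (lin-⊕ (i-linear (wt p q)) _ _))
    poly-∂ p sub into (mul l a e) = mul l (poly-∂ p sub into a) (λ q → trans (cong (i (wt p q)) (e q)) (lin-· (i-linear (wt p q)) _ _))

    evs : Vec ℚ m → Fin (suc n) → ℚ
    evs q x = ev q (lookup pts x)

    -- The product of all evaluations at the vertices annihilates homology.
    annihilate : ∀ {L : Subset (suc n) → Bool} {p} → NonVanishing p L → Section L c → ∀ {t} {g : Vec ℚ m → Λ (suc n)} →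
      Poly (Chain L c) t g → (∀ q → ∂ p g q ≡ 𝟎) →
      ∃ λ b → Poly (Chain L (suc c)) (n +ℕ t) b × (∀ q → ∂ p b q ≡ prodAll (evs q) · g q)
    annihilate {c} {m} {L} {p} nv sec {t} {g} P cyc = b , poly , boundary
      where
      open Section sec
      p⁻¹ : Fin (suc n) → ℚ
      p⁻¹ x = inv (lookup p x)
      -- Rescaling the coordinate at `σ` by `win` turns contraction with `wt p q` into the
      -- simplicial boundary. `wout` undoes this and multiplies by the values of `q` at all points,
      -- which clears the denominators in `q`.
      win wout : Vec ℚ m → Subset (suc n) → ℚ
      win q = prodIn (λ x → lookup p x * evs q x)
      wout q τ = prodIn p⁻¹ τ * prodOut (evs q) τ
      R R′ : Vec ℚ m → Λ (suc n) → Λ (suc n)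
      R q u = mkΛ (win q) ⊗ u
      R′ q u = mkΛ (wout q) ⊗ u
      R-cycle : ∀ q → i ones (R q (g q)) ≡ 𝟎
      R-cycle q = trans (i-rescale ones (wt p q) (win q) (win q) (g q)
          (λ {x} {σ} {τ} d → inj₁ (trans (cong (_* win q τ) (lookup-ones x)) (trans (ℚₚ.*-identityˡ _)
            (trans (prodIn-add (λ x → lookup p x * evs q x) d) (trans (ℚₚ.*-comm (lookup p x * evs q x) (win q σ)) (cong (win q σ *_) (sym (lookup-wt p q x)))))))))
        (trans (cong (mkΛ (win q) ⊗_) (cyc q)) (⊗-zeroʳ _))
      R-chain : ∀ q → Chain L c (R q (g q))
      R-chain q = mkSup λ σ → scaled σ (sup (poly-value sup-subspace P q) σ)
        where
        scaled : ∀ σ → (L σ ≡ true × ∣ σ ∣ ≡ c) ⊎ at (g q) σ ≡ 0ℚ → (L σ ≡ true × ∣ σ ∣ ≡ c) ⊎ at (R q (g q)) σ ≡ 0ℚ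
        scaled σ (inj₁ z) = inj₁ z
        scaled σ (inj₂ z) = inj₂ (trans (at-⊗ (mkΛ (win q)) (g q) σ) (trans (cong (at (mkΛ (win q)) σ *_) z) (ℚₚ.*-zeroʳ (at (mkΛ (win q)) σ))))
      R′R : ∀ q → R′ q (R q (g q)) ≡ prodAll (evs q) · g q
      R′R q = at-ext λ σ → trans (at-⊗ (mkΛ (wout q)) (R q (g q)) σ) (trans (cong₂ _*_ (at-mkΛ (wout q) σ) (trans (at-⊗ (mkΛ (win q)) (g q) σ) (cong (_* at (g q) σ) (at-mkΛ (win q) σ))))
        (trans (value σ (sup (poly-value sup-subspace P q) σ)) (sym (at-· (prodAll (evs q)) (g q) σ))))
        where
        value : ∀ σ → (L σ ≡ true × ∣ σ ∣ ≡ c) ⊎ at (g q) σ ≡ 0ℚ → wout q σ * (win q σ * at (g q) σ) ≡ prodAll (evs q) * at (g q) σ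
        value σ (inj₂ z) rewrite z | ℚₚ.*-zeroʳ (win q σ) | ℚₚ.*-zeroʳ (wout q σ) = sym (ℚₚ.*-zeroʳ (prodAll (evs q)))
        value σ (inj₁ (l , _)) = trans (cong (λ z → wout q σ * (z * at (g q) σ)) (prodIn-* (lookup p) (evs q) σ))
          (trans (qsolve 5 (λ a b c d u → (a *: b) *: ((c *: d) *: u) :≡ ((a *: c) *: (b *: d)) *: u) refl (prodIn p⁻¹ σ) (prodOut (evs q) σ) (prodIn (lookup p) σ) (prodIn (evs q) σ) (at (g q) σ))
            (cong (_* at (g q) σ) (trans (cong₂ _*_ (prodIn-inverse (lookup p) p⁻¹ σ (λ d → inv-* (value≢0 nv d l))) (prodOut-prodIn (evs q) σ)) (ℚₚ.*-identityˡ (prodAll (evs q))))))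
      boundary′ : ∀ q → i (wt p q) (R′ q (h (R q (g q)))) ≡ prodAll (evs q) · g q
      boundary′ q = trans (i-rescale (wt p q) ones (wout q) (wout q) (h (R q (g q))) weights)
        (trans (cong (R′ q) (bounds (R-chain q) (R-cycle q))) (R′R q))
        where
        weights : ∀ {x σ τ} → AddAt x σ τ → lookup (wt p q) x * wout q τ ≡ wout q σ * lookup ones x ⊎ at (h (R q (g q))) τ ≡ 0ℚ
        weights {x} {σ} {τ} d with sup (into (R-chain q)) τ
        ... | inj₂ z = inj₂ z
        ... | inj₁ (l , _) = inj₁ (trans (cong₂ (λ z w → z * (w * prodOut (evs q) τ)) (lookup-wt p q x) (prodIn-add p⁻¹ d))
          (trans (qsolve 5 (λ a b c d e → (a *: b) *: ((c *: d) *: e) :≡ (c *: a) *: (d *: (b *: e))) refl (lookup p x) (evs q x) (p⁻¹ x) (prodIn p⁻¹ σ) (prodOut (evs q) τ))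
            (trans (cong₂ (λ z w → z * (prodIn p⁻¹ σ * w)) (inv-* (value≢0 nv d l)) (sym (prodOut-add (evs q) d)))
              (trans (ℚₚ.*-identityˡ (wout q σ)) (trans (sym (ℚₚ.*-identityʳ (wout q σ))) (cong (wout q σ *_) (sym (lookup-ones x))))))))
      -- The filling `R′ (h (R g))` is expanded over the matrix entries of `h`, since only the
      -- expanded sum is visibly polynomial in `q`.
      M : Subset (suc n) → Subset (suc n) → Λ (suc n) → Λ (suc n)
      M σ τ u = (at u σ * at (h (e σ)) τ) · e τ
      term : Subset (suc n) → Subset (suc n) → Vec ℚ m → Λ (suc n)
      term σ τ q = prodOut (evs q) τ · (prodIn (λ x → lookup p x * evs q x) σ · (prodIn p⁻¹ τ · M σ τ (g q)))
      b : Vec ℚ m → Λ (suc n)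
      b q = sumS (λ σ → sumS (λ τ → term σ τ q))
      b-eq : ∀ q → b q ≡ R′ q (h (R q (g q)))
      b-eq q = sym (begin
        R′ q (h (R q (g q))) ≡⟨ cong (λ z → R′ q (h z)) (trans (expand (R q (g q))) (sumS-cong (λ σ → cong (_· e σ) (trans (at-⊗ (mkΛ (win q)) (g q) σ) (cong (_* at (g q) σ) (at-mkΛ (win q) σ)))))) ⟩
        R′ q (h (sumS (λ σ → (win q σ * at (g q) σ) · e σ))) ≡⟨ cong (R′ q) (trans (lin-sumS linear (λ σ → (win q σ * at (g q) σ) · e σ)) (sumS-cong (λ σ → lin-· linear (win q σ * at (g q) σ) (e σ)))) ⟩
        R′ q (sumS (λ σ → (win q σ * at (g q) σ) · h (e σ))) ≡⟨ lin-sumS R′-linear (λ σ → (win q σ * at (g q) σ) · h (e σ)) ⟩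
        sumS (λ σ → R′ q ((win q σ * at (g q) σ) · h (e σ))) ≡⟨ sumS-cong (λ σ → trans (lin-· R′-linear (win q σ * at (g q) σ) (h (e σ))) (trans (cong ((win q σ * at (g q) σ) ·_) (expand (R′ q (h (e σ))))) (sym (sumS-· (win q σ * at (g q) σ) (λ τ → at (R′ q (h (e σ))) τ · e τ))))) ⟩
        sumS (λ σ → sumS (λ τ → (win q σ * at (g q) σ) · (at (R′ q (h (e σ))) τ · e τ))) ≡⟨ sumS-cong (λ σ → sumS-cong (λ τ → entry σ τ)) ⟩
        b q ∎)
        where
        open ≡-Reasoning
        R′-linear : Linear (R′ q)
        R′-linear = record
          { lin-⊕ = λ u v → solve 3 (λ w u v → w :* (u :+ v) := w :* u :+ w :* v) refl (mkΛ (wout q)) u v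
          ; lin-· = λ a u → solve 3 (λ w a u → w :* (a :* u) := a :* (w :* u)) refl (mkΛ (wout q)) (κ a) u }
        entry : ∀ σ τ → (win q σ * at (g q) σ) · (at (R′ q (h (e σ))) τ · e τ) ≡ term σ τ q
        entry σ τ = trans (·-· _ _ (e τ)) (trans (cong (_· e τ) (trans
            (cong ((win q σ * at (g q) σ) *_) (trans (at-⊗ (mkΛ (wout q)) (h (e σ)) τ) (cong (_* at (h (e σ)) τ) (at-mkΛ (wout q) τ))))
            (qsolve 5 (λ a b c d e → (a *: b) *: ((c *: d) *: e) :≡ d *: (a *: (c *: (b *: e)))) refl (win q σ) (at (g q) σ) (prodIn p⁻¹ τ) (prodOut (evs q) τ) (at (h (e σ)) τ))))
          (sym (trans (cong (λ z → prodOut (evs q) τ · (win q σ · z)) (·-· _ _ _)) (trans (cong (prodOut (evs q) τ ·_) (·-· _ _ _)) (·-· _ _ _)))))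
      M-linear : ∀ σ τ → Linear (M σ τ)
      M-linear σ τ = record
        { lin-⊕ = λ u v → trans (cong (_· e τ) (trans (cong (_* at (h (e σ)) τ) (at-⊕ u v σ)) (ℚₚ.*-distribʳ-+ (at (h (e σ)) τ) (at u σ) (at v σ))))
            (trans (cong (_⊗ e τ) (κ-+ _ _)) (solve 3 (λ a b u → (a :+ b) :* u := a :* u :+ b :* u) refl _ _ (e τ)))
        ; lin-· = λ a u → trans (cong (_· e τ) (trans (cong (_* at (h (e σ)) τ) (at-· a u σ)) (ℚₚ.*-assoc a _ _))) (sym (·-· a _ (e τ))) }
      M-into : ∀ σ τ {u} → Chain L c u → Chain L (suc c) (M σ τ u)
      M-into σ τ {u} ch with sup ch σ
      ... | inj₂ z = subst (Chain L (suc c)) (sym (trans (cong (_· e τ) (trans (cong (_* at (h (e σ)) τ) z) (ℚₚ.*-zeroˡ (at (h (e σ)) τ)))) (0·u (e τ)))) (sub-𝟎 sup-subspace)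
      ... | inj₁ (l , s) with sup (into (chain-e {L = L} l s)) τ
      ...   | inj₁ (l′ , s′) = sub-· sup-subspace _ (chain-e {L = L} l′ s′)
      ...   | inj₂ z = subst (Chain L (suc c)) (sym (trans (cong (_· e τ) (trans (cong (at u σ *_) z) (ℚₚ.*-zeroʳ (at u σ)))) (0·u (e τ)))) (sub-𝟎 sup-subspace)
      M-zero : ∀ σ τ {u} → Chain L c u → ¬ (∣ σ ∣ ≡ c × ∣ τ ∣ ≡ suc c) → M σ τ u ≡ 𝟎
      M-zero σ τ {u} ch bad with sup ch σ
      ... | inj₂ z = trans (cong (_· e τ) (trans (cong (_* at (h (e σ)) τ) z) (ℚₚ.*-zeroˡ (at (h (e σ)) τ)))) (0·u (e τ))
      ... | inj₁ (l , s) with sup (into (chain-e {L = L} l s)) τ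
      ...   | inj₁ (_ , s′) = ⊥-elim (bad (s , s′))
      ...   | inj₂ z = trans (cong (_· e τ) (trans (cong (at u σ *_) z) (ℚₚ.*-zeroʳ (at u σ)))) (0·u (e τ))
      poly-term : ∀ σ τ → Poly (Chain L (suc c)) (n +ℕ t) (term σ τ)
      poly-term σ τ with ∣ σ ∣ ℕ.≟ c | ∣ τ ∣ ℕ.≟ suc c
      ... | yes refl | yes s′ = subst (λ k → Poly (Chain L (suc c)) k (term σ τ)) degree
        (poly-prodOut (λ x → ev-form (lookup pts x)) (poly-prodIn (λ x → scale-form (lookup p x) (ev-form (lookup pts x)))
          (poly-map (∘-linear (scale-linear (prodIn p⁻¹ τ)) (M-linear σ τ)) (λ ch → sub-· sup-subspace _ (M-into σ τ ch)) P) σ) τ)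
        where
        -- There are c factors from `σ` and (n + 1) - (c + 1) from the complement of `τ`, n in all.
        -- Pairs of other sizes contribute 0, so the sum is homogeneous.
        degree : cosize τ +ℕ (∣ σ ∣ +ℕ t) ≡ n +ℕ t
        degree = trans (sym (ℕₚ.+-assoc (cosize τ) _ t)) (cong (_+ℕ t) (ℕₚ.suc-injective (trans (sym (ℕₚ.+-suc (cosize τ) ∣ σ ∣)) (trans (cong (cosize τ +ℕ_) (sym s′)) (cosize+size τ)))))
      ... | no ne | _ = zer λ q → term-zero q (M-zero σ τ (poly-value sup-subspace P q) (λ (s , _) → ne s))
        where
        term-zero : ∀ q → M σ τ (g q) ≡ 𝟎 → term σ τ q ≡ 𝟎
        term-zero q z = trans (cong (λ w → prodOut (evs q) τ · (win q σ · w)) (trans (cong (prodIn p⁻¹ τ ·_) z) (a·𝟎 _))) (trans (cong (prodOut (evs q) τ ·_) (a·𝟎 _)) (a·𝟎 _))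
      ... | yes _ | no ne = zer λ q → term-zero q (M-zero σ τ (poly-value sup-subspace P q) (λ (_ , s) → ne s))
        where
        term-zero : ∀ q → M σ τ (g q) ≡ 𝟎 → term σ τ q ≡ 𝟎
        term-zero q z = trans (cong (λ w → prodOut (evs q) τ · (win q σ · w)) (trans (cong (prodIn p⁻¹ τ ·_) z) (a·𝟎 _))) (trans (cong (prodOut (evs q) τ ·_) (a·𝟎 _)) (a·𝟎 _))
      poly : Poly (Chain L (suc c)) (n +ℕ t) b
      poly = poly-sumS (λ σ → poly-sumS (λ τ → poly-term σ τ))
      boundary : ∀ q → ∂ p b q ≡ prodAll (evs q) · g q
      boundary q = trans (cong (i (wt p q)) (b-eq q)) (boundary′ q)

-- Exactness of the polynomial complex

module Acyclic where

  open IntegerMap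
  open Counting
  open ShiftedFamilies using (here; there; DownClosed)
  open Exterior
  open PolynomialMaps
  open Depth
  open Exactness
  open import Data.List using ([]; _∷_)
  open import Data.List.Relation.Unary.Any using (here; there)
  open import Data.List.Membership.Propositional using () renaming (_∈_ to _∈ˡ_)
  open import Data.Nat using () renaming (_+_ to _+ℕ_; _≤_ to _≤ℕ_)
  open import Data.Rational using (_*_; -_; _-_)
  open import Data.Unit using (⊤)
  open import Data.Vec using (toList)
  open import Relation.Binary.PropositionalEquality

  open ℚSolver using () renaming (solve to qsolve; _:=_ to _:≡_; _:+_ to _+:_; _:*_ to _*:_; :-_ to -:_)

  private variable
    m : ℕ

  module Solution {n : ℕ} (pts : Vec ℚ (suc n)) (distinct : ∀ {x y} → lookup pts x ≡ lookup pts y → x ≡ y) where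
    open AtPoints pts distinct

    lookup-⋆ : ∀ p w x → lookup (p ⋆ w) x ≡ lookup p x * (lookup pts x - w)
    lookup-⋆ p w x = lookup-zipWith (λ a x → a * (x - w)) x p pts

    nonvanishing-⋆ : ∀ {L L′ : Subset (suc n) → Bool} {p w} → NonVanishing p L →
      (∀ {x σ τ} → AddAt x σ τ → L′ τ ≡ true → (∃ λ σ′ → ∃ λ τ′ → AddAt x σ′ τ′ × L τ′ ≡ true) × lookup pts x ≢ w) →
      NonVanishing (p ⋆ w) L′
    nonvanishing-⋆ {L} {L′} {p} {w} nv f = nonvan λ {x} d l z → go x z (f d l)
      where
      go : ∀ x → lookup (p ⋆ w) x ≡ 0ℚ → (∃ λ σ′ → ∃ λ τ′ → AddAt x σ′ τ′ × L τ′ ≡ true) × lookup pts x ≢ w → ⊥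
      go x z ((_ , _ , d′ , l′) , ne) = *-nonzero (value≢0 nv d′ l′) (a-b≢0 ne) (trans (sym (lookup-⋆ p w x)) z)

    Bounds : ∀ {L : Subset (suc n) → Bool} {c} (p : Vec ℚ (suc n)) (t : ℕ) → (Vec ℚ m → Λ (suc n)) → Set
    Bounds {m} {L} {c} p t f = ∃ λ b → Poly {m} (Chain L (suc c)) t b × (∀ q → ∂ p b q ≡ f q)

    -- The differential contracts with the functional of the variable polynomial `q`; it lowers the
    -- size of faces and raises the polynomial degree by one. Treating all `q` with `m` coefficients
    -- at once makes the homology a module over polynomial functions of `q`. Only cycles of positive
    -- degree are claimed to bound.
    Exact : ℕ → Set
    Exact m = ∀ {L : Subset (suc n) → Bool} {k p c} → DownClosed L → Depth≥ L k → c +ℕ m ≤ℕ k → NonVanishing p L →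
      ∀ {t} {f : Vec ℚ m → Λ (suc n)} → Poly (Chain L c) (suc t) f → (∀ q → ∂ p f q ≡ 𝟎) → Bounds {L = L} {c} p t f

    -- Three properties of this module force it to vanish: evaluation at a vertex acts surjectively,
    -- evaluation at a point off the vertices acts injectively, and high degrees vanish. The first
    -- two come from restricting to multiples of X - w, which have one coefficient less to choose.
    module Step {m : ℕ} (IH : Exact m) {L : Subset (suc n) → Bool} {k : ℕ} {p : Vec ℚ (suc n)} (down : DownClosed L) (dep : Depth≥ L (suc k)) (nv : NonVanishing p L) where

      restrict : ∀ w {S : Λ (suc n) → Set} {t} {f : Vec ℚ (suc m) → Λ (suc n)} → Poly S t f → Poly S t (λ q → f (mulBy w q))
      restrict w = poly-pull (mulBy w) (pull-mulBy w)

      extend : ∀ w {S : Λ (suc n) → Set} {t} {f : Vec ℚ m → Λ (suc n)} → Poly S t f → Poly S t (λ q → f (divBy w q))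
      extend w = poly-pull (divBy w) (pull-divBy w)

      ∂-mulBy : ∀ w (q : Vec ℚ m) u → i (wt (p ⋆ w) q) u ≡ i (wt p (mulBy w q)) u
      ∂-mulBy w q u = cong (λ z → i z u) (wt-⋆ p w q)

      ∂∂ : ∀ {c t} {b : Vec ℚ (suc m) → Λ (suc n)} → Poly (Chain L (suc c)) t b → Poly (Chain L c) (suc t) (∂ p b)
      ∂∂ B = poly-∂ p sup-subspace (λ φ → chain-i down φ) B

      -- If f bounds after restriction to the multiples of X - w, then f = ∂ b + ev w · g with a cycle g.
      split : ∀ {c} w {t} {f : Vec ℚ (suc m) → Λ (suc n)} → Poly (Chain L c) (suc t) f → (∀ q → ∂ p f q ≡ 𝟎) →
        Bounds {L = L} {c} (p ⋆ w) t (λ q → f (mulBy w q)) →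
        ∃ λ b → Poly (Chain L (suc c)) t b × ∃ λ g → Poly (Chain L c) t g × (∀ q → ∂ p g q ≡ 𝟎) × (∀ q → f q ≡ ev q w · g q ⊕ ∂ p b q)
      split {c} w {t} {f} P cyc (b′ , B′ , e′) = b , extend w B′ , g , G , g-cycle , decomposition
        where
        b : Vec ℚ (suc m) → Λ (suc n)
        b q = b′ (divBy w q)
        F : Poly (Chain L c) (suc t) (λ q → f q ⊕ ⊝ ∂ p b q)
        F = add P (poly-map ⊝-linear (sub-⊝ sup-subspace) (∂∂ (extend w B′))) (λ _ → refl)
        divided : ∃ λ g → Poly (Chain L c) t g × (∀ q → f q ⊕ ⊝ ∂ p b q ≡ ev q w · g q ⊕ (f (mulBy w (divBy w q)) ⊕ ⊝ ∂ p b (mulBy w (divBy w q))))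
        divided = poly-divide sup-subspace w F
        g : Vec ℚ (suc m) → Λ (suc n)
        g = proj₁ divided
        G : Poly (Chain L c) t g
        G = proj₁ (proj₂ divided)
        div : ∀ q → f q ⊕ ⊝ ∂ p b q ≡ ev q w · g q ⊕ (f (mulBy w (divBy w q)) ⊕ ⊝ ∂ p b (mulBy w (divBy w q)))
        div = proj₂ (proj₂ divided)
        vanishes : ∀ q → f (mulBy w q) ⊕ ⊝ ∂ p b (mulBy w q) ≡ 𝟎
        vanishes q = trans (cong (λ z → f (mulBy w q) ⊕ ⊝ z) (trans (cong (λ z → i (wt p (mulBy w q)) (b′ z)) (divBy-mulBy w q)) (trans (sym (∂-mulBy w q (b′ q))) (e′ q)))) (⊝-inverseʳ (f (mulBy w q)))
        div′ : ∀ q → f q ⊕ ⊝ ∂ p b q ≡ ev q w · g q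
        div′ q = trans (div q) (trans (cong (ev q w · g q ⊕_) (vanishes (divBy w q))) (⊕-identityʳ _))
        decomposition : ∀ q → f q ≡ ev q w · g q ⊕ ∂ p b q
        decomposition q = trans (solve 2 (λ x y → x := (x :+ :- y) :+ y) refl (f q) (∂ p b q)) (cong (_⊕ ∂ p b q) (div′ q))
        g-cycle : ∀ q → ∂ p g q ≡ 𝟎
        g-cycle = ev-cancel (poly-∂ p {S′ = λ _ → ⊤} (record { sub-𝟎 = tt ; sub-⊕ = λ _ _ → tt ; sub-· = λ _ _ → tt }) (λ _ _ → tt) G) w λ q →
          trans (sym (lin-· (i-linear (wt p q)) (ev q w) (g q))) (trans (cong (i (wt p q)) (sym (div′ q)))
            (trans (lin-⊕ (i-linear (wt p q)) _ _) (trans (cong₂ _⊕_ (cyc q) (trans (lin-⊝ (i-linear (wt p q)) _) (trans (cong ⊝_ (i-i (wt p q) (b q))) ⊝𝟎))) (⊕-identityˡ 𝟎))))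

      -- On multiples of X - w, with `w` the point of `x`, the weight at `x` is zero. The
      -- differential then respects the splitting of a cycle into a part in the deletion and `x`
      -- times a part in the link; both bound by the induction on `m`, and `split` converts this
      -- into divisibility.
      surjective : ∀ {c} → c +ℕ suc m ≤ℕ suc k → ∀ x {t} {f : Vec ℚ (suc m) → Λ (suc n)} → Poly (Chain L c) (suc t) f → (∀ q → ∂ p f q ≡ 𝟎) →
        ∃ λ b → Poly (Chain L (suc c)) t b × ∃ λ g → Poly (Chain L c) t g × (∀ q → ∂ p g q ≡ 𝟎) × (∀ q → f q ≡ evs q x · g q ⊕ ∂ p b q)
      surjective {c} le x {t} {f} P cyc = split w P cyc (assemble deletion (link c le′ (restrict w P)))
        where
        w = lookup pts x
        p′ = p ⋆ w
        le′ : c +ℕ m ≤ℕ k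
        le′ = ℕₚ.≤-pred (subst (_≤ℕ suc k) (ℕₚ.+-suc c m) le)
        f′ f₀ f₁ : Vec ℚ m → Λ (suc n)
        f′ q = f (mulBy w q)
        f₀ q = δ x (ε x (f′ q))
        f₁ q = δ x (f′ q)
        cyc′ : ∀ q → ∂ p′ f′ q ≡ 𝟎
        cyc′ q = trans (∂-mulBy w q (f′ q)) (cyc (mulBy w q))
        at-x : ∀ q → lookup (wt p′ q) x ≡ 0ℚ
        at-x q = trans (lookup-wt p′ q x) (trans (cong (_* evs q x) (trans (lookup-⋆ p w x) (trans (cong (lookup p x *_) (ℚₚ.+-inverseʳ w)) (ℚₚ.*-zeroʳ (lookup p x))))) (ℚₚ.*-zeroˡ (evs q x)))
        i-ε′ : ∀ q u → i (wt p′ q) (ε x u) ≡ ⊝ ε x (i (wt p′ q) u)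
        i-ε′ q u = trans (i-ε (wt p′ q) x u) (trans (cong (λ z → z · u ⊕ ⊝ ε x (i (wt p′ q) u)) (at-x q)) (trans (cong (_⊕ ⊝ ε x (i (wt p′ q) u)) (0·u u)) (⊕-identityˡ _)))
        cyc₀ : ∀ q → ∂ p′ f₀ q ≡ 𝟎
        cyc₀ q = trans (i-δ (wt p′ q) x (ε x (f′ q))) (trans (cong (λ z → ⊝ δ x z) (trans (i-ε′ q (f′ q)) (cong (λ z → ⊝ ε x z) (cyc′ q))))
          (trans (cong (λ z → ⊝ δ x (⊝ z)) (lin-𝟎 (ε-linear x))) (trans (cong (λ z → ⊝ δ x z) ⊝𝟎) (trans (cong ⊝_ (lin-𝟎 (δ-linear x))) ⊝𝟎))))
        cyc₁ : ∀ q → ∂ p′ f₁ q ≡ 𝟎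
        cyc₁ q = trans (i-δ (wt p′ q) x (f′ q)) (trans (cong (λ z → ⊝ δ x z) (cyc′ q)) (trans (cong ⊝_ (lin-𝟎 (δ-linear x))) ⊝𝟎))
        pts≢ : ∀ {y} → y ≢ x → lookup pts y ≢ w
        pts≢ ne eq = ne (distinct eq)
        deletion : Bounds {L = del L x} {c} p′ t f₀
        deletion = IH (del-down down) (depth-del k down x dep) le′
          (nonvanishing-⋆ nv (λ d l → (_ , _ , d , ∧-true⁻ʳ l) , pts≢ λ { refl → true≢false (addAt-∈ d) (not-true (∧-true⁻ˡ l)) }))
          (poly-map (∘-linear (δ-linear x) (ε-linear x)) (chain-δε x) (restrict w P)) cyc₀
        nv-link : NonVanishing p′ (lk L x)
        nv-link = nonvanishing-⋆ nv (λ {y} d l → let y≢x = λ { refl → true≢false (addAt-∈ d) (not-true (∧-true⁻ˡ l)) } in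
          (_ , _ , addAt-update y≢x d , ∧-true⁻ʳ l) , pts≢ y≢x)
        link : ∀ c → c +ℕ m ≤ℕ k → Poly (Chain L c) (suc t) f′ → ∃ λ b → Poly (Chain L (suc c)) t (λ q → ε x (b q)) × (∀ q → ∂ p′ b q ≡ f₁ q)
        -- A chain on the empty face has no part through `x`, so the zero filling serves.
        link zero le P′ = (λ _ → 𝟎) , zer (λ q → lin-𝟎 (ε-linear x)) ,
          λ q → trans (lin-𝟎 (i-linear (wt p′ q))) (sym (chain-δ-zero x (poly-value sup-subspace P′ q)))
        link (suc c) le P′ = wrap (IH (lk-down down) (proj₂ dep x) (ℕₚ.≤-trans (ℕₚ.n≤1+n _) le) nv-link (poly-map (δ-linear x) (chain-δ x) P′) cyc₁)
          where
          wrap : Bounds {L = lk L x} {c} p′ t f₁ → ∃ λ b → Poly (Chain L (suc (suc c))) t (λ q → ε x (b q)) × (∀ q → ∂ p′ b q ≡ f₁ q)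
          wrap (b₁ , B₁ , e₁) = b₁ , poly-map (ε-linear x) (chain-ε x) B₁ , e₁
        assemble : Bounds {L = del L x} {c} p′ t f₀ → (∃ λ b → Poly (Chain L (suc c)) t (λ q → ε x (b q)) × (∀ q → ∂ p′ b q ≡ f₁ q)) → Bounds {L = L} {c} p′ t f′
        assemble (b₀ , B₀ , e₀) (b₁ , B₁ , e₁) = b′ , B′ , bounds′
          where
          b′ : Vec ℚ m → Λ (suc n)
          -- The minus sign compensates the anticommutation of the contraction with `ε x`.
          b′ q = b₀ q ⊕ ⊝ ε x (b₁ q)
          B′ : Poly (Chain L (suc c)) t b′
          B′ = add (poly-map id-linear (sup-mono (λ σ (l , s) → ∧-true⁻ʳ l , s)) B₀)
            (poly-map ⊝-linear (sub-⊝ sup-subspace) B₁) (λ _ → refl)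
          bounds′ : ∀ q → ∂ p′ b′ q ≡ f′ q
          bounds′ q = trans (lin-⊕ (i-linear (wt p′ q)) (b₀ q) (⊝ ε x (b₁ q))) (trans (cong₂ _⊕_ (e₀ q)
              (trans (lin-⊝ (i-linear (wt p′ q)) (ε x (b₁ q))) (trans (cong ⊝_ (i-ε′ q (b₁ q))) (trans (⊝-involutive (ε x (i (wt p′ q) (b₁ q)))) (cong (ε x) (e₁ q))))))
            (δ-ε x (f′ q)))

      -- A filling `b` of the product with evaluation at `w` is a cycle on multiples of X - w and
      -- bounds there by induction, in size c + 1. After subtracting that boundary, `b` is divisible
      -- by the evaluation, and the quotient fills `f`.
      injective : ∀ {c} → c +ℕ suc m ≤ℕ suc k → ∀ w → (∀ x → lookup pts x ≢ w) → ∀ {t} {f : Vec ℚ (suc m) → Λ (suc n)} → Poly (Chain L c) (suc t) f →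
        Bounds {L = L} {c} p (suc t) (λ q → ev q w · f q) → Bounds {L = L} {c} p t f
      injective {c} le w fresh {t} {f} P (b , B , e) =
        g , G , λ q → trans (sym (⊕-identityʳ _)) (trans (cong (∂ p g q ⊕_) (sym (difference-zero q))) (solve 2 (λ x y → x :+ (y :+ :- x) := y) refl (∂ p g q) (f q)))
        where
        b-restricted : Bounds {L = L} {suc c} (p ⋆ w) t (λ q → b (mulBy w q))
        b-restricted = IH down dep (subst (_≤ℕ suc k) (ℕₚ.+-suc c m) le) (nonvanishing-⋆ nv (λ d l → (_ , _ , d , l) , fresh _)) (restrict w B)
          λ q → trans (∂-mulBy w q (b (mulBy w q))) (trans (e (mulBy w q)) (trans (cong (_· f (mulBy w q)) (trans (ev-mulBy w q w) (trans (cong (_* ev q w) (ℚₚ.+-inverseʳ w)) (ℚₚ.*-zeroˡ (ev q w))))) (0·u (f (mulBy w q)))))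
        u : Vec ℚ (suc m) → Λ (suc n)
        u q = proj₁ b-restricted (divBy w q)
        difference : Poly (Chain L (suc c)) (suc t) (λ q → b q ⊕ ⊝ ∂ p u q)
        difference = add B (poly-map ⊝-linear (sub-⊝ sup-subspace) (∂∂ (extend w (proj₁ (proj₂ b-restricted))))) (λ _ → refl)
        divided : ∃ λ g → Poly (Chain L (suc c)) t g × (∀ q → b q ⊕ ⊝ ∂ p u q ≡ ev q w · g q ⊕ (b (mulBy w (divBy w q)) ⊕ ⊝ ∂ p u (mulBy w (divBy w q))))
        divided = poly-divide sup-subspace w difference
        g : Vec ℚ (suc m) → Λ (suc n)
        g = proj₁ divided
        G : Poly (Chain L (suc c)) t g
        G = proj₁ (proj₂ divided)
        div : ∀ q → b q ⊕ ⊝ ∂ p u q ≡ ev q w · g q ⊕ (b (mulBy w (divBy w q)) ⊕ ⊝ ∂ p u (mulBy w (divBy w q)))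
        div = proj₂ (proj₂ divided)
        vanishes : ∀ q → b (mulBy w q) ⊕ ⊝ ∂ p u (mulBy w q) ≡ 𝟎
        vanishes q = trans (cong (λ z → b (mulBy w q) ⊕ ⊝ z) (trans (cong (λ z → i (wt p (mulBy w q)) (proj₁ b-restricted z)) (divBy-mulBy w q))
          (trans (sym (∂-mulBy w q (proj₁ b-restricted q))) (proj₂ (proj₂ b-restricted) q)))) (⊝-inverseʳ (b (mulBy w q)))
        div′ : ∀ q → b q ⊕ ⊝ ∂ p u q ≡ ev q w · g q
        div′ q = trans (div q) (trans (cong (ev q w · g q ⊕_) (vanishes (divBy w q))) (⊕-identityʳ _))
        scaled : ∀ q → ev q w · f q ≡ ev q w · ∂ p g q
        scaled q = trans (sym (e q)) (trans (sym (⊕-identityʳ _)) (trans (cong (∂ p b q ⊕_) (sym (trans (lin-⊝ (i-linear (wt p q)) _) (trans (cong ⊝_ (i-i (wt p q) (u q))) ⊝𝟎))))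
          (trans (sym (lin-⊕ (i-linear (wt p q)) _ _)) (trans (cong (i (wt p q)) (div′ q)) (lin-· (i-linear (wt p q)) (ev q w) (g q))))))
        difference-zero : ∀ q → f q ⊕ ⊝ ∂ p g q ≡ 𝟎
        difference-zero = ev-cancel (add P (poly-map ⊝-linear (sub-⊝ sup-subspace) (∂∂ G)) (λ _ → refl)) w λ q →
          trans (solve 3 (λ a x y → a :* (x :+ :- y) := a :* x :+ :- (a :* y)) refl (κ (ev q w)) (f q) (∂ p g q))
            (trans (cong (_⊕ ⊝ (ev q w · ∂ p g q)) (scaled q)) (⊝-inverseʳ _))

      factor : ∀ {c} → c +ℕ suc m ≤ℕ suc k → ∀ j (xs : Fin j → Fin (suc n)) {t} {f : Vec ℚ (suc m) → Λ (suc n)} →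
        Poly (Chain L c) (suc (j +ℕ t)) f → (∀ q → ∂ p f q ≡ 𝟎) →
        ∃ λ b → Poly (Chain L (suc c)) (j +ℕ t) b × ∃ λ g → Poly (Chain L c) (suc t) g × (∀ q → ∂ p g q ≡ 𝟎) ×
          (∀ q → f q ≡ prodAll (λ y → evs q (xs y)) · g q ⊕ ∂ p b q)
      factor le zero xs {f = f} P cyc = (λ _ → 𝟎) , zer (λ _ → refl) , f , P , cyc ,
        λ q → sym (trans (cong₂ _⊕_ (1·u (f q)) (lin-𝟎 (i-linear (wt p q)))) (⊕-identityʳ (f q)))
      factor {c} le (suc j) xs {t} {f} P cyc = combine (surjective le (xs zero) P cyc)
        where
        combine : (∃ λ b → Poly (Chain L (suc c)) (suc (j +ℕ t)) b × ∃ λ g → Poly (Chain L c) (suc (j +ℕ t)) g × (∀ q → ∂ p g q ≡ 𝟎) × (∀ q → f q ≡ evs q (xs zero) · g q ⊕ ∂ p b q)) →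
          ∃ λ b → Poly (Chain L (suc c)) (suc (j +ℕ t)) b × ∃ λ g → Poly (Chain L c) (suc t) g × (∀ q → ∂ p g q ≡ 𝟎) ×
            (∀ q → f q ≡ prodAll (λ y → evs q (xs y)) · g q ⊕ ∂ p b q)
        combine (b , B , g , G , g-cyc , e₁) = combine′ (factor le j (λ y → xs (suc y)) G g-cyc)
          where
          combine′ : (∃ λ b′ → Poly (Chain L (suc c)) (j +ℕ t) b′ × ∃ λ g′ → Poly (Chain L c) (suc t) g′ × (∀ q → ∂ p g′ q ≡ 𝟎) ×
              (∀ q → g q ≡ prodAll (λ y → evs q (xs (suc y))) · g′ q ⊕ ∂ p b′ q)) →
            ∃ λ b → Poly (Chain L (suc c)) (suc (j +ℕ t)) b × ∃ λ g → Poly (Chain L c) (suc t) g × (∀ q → ∂ p g q ≡ 𝟎) ×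
              (∀ q → f q ≡ prodAll (λ y → evs q (xs y)) · g q ⊕ ∂ p b q)
          combine′ (b′ , B′ , g′ , G′ , g′-cyc , e₂) = (λ q → evs q (xs zero) · b′ q ⊕ b q) ,
            add (mul (ev-form (lookup pts (xs zero))) B′ (λ _ → refl)) B (λ _ → refl) , g′ , G′ , g′-cyc ,
            λ q → trans (e₁ q) (trans (cong (λ z → evs q (xs zero) · z ⊕ ∂ p b q) (e₂ q))
              (trans (solve 5 (λ a π g d b → a :* (π :* g :+ d) :+ b := (a :* π) :* g :+ (a :* d :+ b)) refl
                  (κ (evs q (xs zero))) (κ (prodAll (λ y → evs q (xs (suc y))))) (g′ q) (∂ p b′ q) (∂ p b q))
                (cong₂ _⊕_ (cong (_⊗ g′ q) (sym (κ-* (evs q (xs zero)) (prodAll (λ y → evs q (xs (suc y)))))))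
                  (sym (trans (lin-⊕ (i-linear (wt p q)) (evs q (xs zero) · b′ q) (b q)) (cong (_⊕ ∂ p b q) (lin-· (i-linear (wt p q)) (evs q (xs zero)) (b′ q))))))))

      -- Up to a boundary one evaluation factor is split off for each of the n + 1 vertices; the
      -- product of all of them annihilates homology by `annihilate`.
      high-degree : ∀ {c} → c +ℕ suc m ≤ℕ suc k → ∀ {t} {f : Vec ℚ (suc m) → Λ (suc n)} →
        Poly (Chain L c) (suc (suc n +ℕ t)) f → (∀ q → ∂ p f q ≡ 𝟎) → Bounds {L = L} {c} p (suc n +ℕ t) f
      high-degree {c} le {t} {f} P cyc = combine (factor le (suc n) (λ y → y) P cyc)
        where
        c≤k : c ≤ℕ k
        c≤k = ℕₚ.≤-trans (ℕₚ.m≤m+n c m) (ℕₚ.≤-pred (subst (_≤ℕ suc k) (ℕₚ.+-suc c m) le))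
        combine : (∃ λ b → Poly (Chain L (suc c)) (suc n +ℕ t) b × ∃ λ g → Poly (Chain L c) (suc t) g × (∀ q → ∂ p g q ≡ 𝟎) × (∀ q → f q ≡ prodAll (evs q) · g q ⊕ ∂ p b q)) →
          Bounds {L = L} {c} p (suc n +ℕ t) f
        combine (b , B , g , G , g-cyc , e) = combine′ (annihilate nv (proj₁ dep c c≤k) G g-cyc)
          where
          combine′ : (∃ λ b → Poly (Chain L (suc c)) (n +ℕ suc t) b × (∀ q → ∂ p b q ≡ prodAll (evs q) · g q)) → Bounds {L = L} {c} p (suc n +ℕ t) f
          combine′ (b′ , B′ , e′) = (λ q → b′ q ⊕ b q) , add (subst (λ d → Poly (Chain L (suc c)) d b′) (ℕₚ.+-suc n t) B′) B (λ _ → refl) ,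
            λ q → trans (lin-⊕ (i-linear (wt p q)) (b′ q) (b q)) (trans (cong (_⊕ ∂ p b q) (e′ q)) (sym (e q)))

      pw : ℚ → ℕ → (Vec ℚ (suc m) → Λ (suc n)) → Vec ℚ (suc m) → Λ (suc n)
      pw w zero f q = f q
      pw w (suc j) f q = ev q w · pw w j f q

      poly-pw : ∀ w j {c t} {f : Vec ℚ (suc m) → Λ (suc n)} → Poly (Chain L c) (suc t) f → Poly (Chain L c) (suc (j +ℕ t)) (pw w j f)
      poly-pw w zero P = P
      poly-pw w (suc j) P = mul (ev-form w) (poly-pw w j P) (λ _ → refl)

      pw-cycle : ∀ w j {f : Vec ℚ (suc m) → Λ (suc n)} → (∀ q → ∂ p f q ≡ 𝟎) → ∀ q → ∂ p (pw w j f) q ≡ 𝟎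
      pw-cycle w zero cyc q = cyc q
      pw-cycle w (suc j) {f} cyc q = trans (lin-· (i-linear (wt p q)) (ev q w) (pw w j f q)) (trans (cong (ev q w ·_) (pw-cycle w j cyc q)) (a·𝟎 (ev q w)))

      -- Multiply by n + 1 evaluations at a fresh point to reach a degree where every cycle bounds,
      -- then cancel them one at a time by `injective`.
      step : ∀ {c} → c +ℕ suc m ≤ℕ suc k → ∀ {t} {f : Vec ℚ (suc m) → Λ (suc n)} →
        Poly (Chain L c) (suc t) f → (∀ q → ∂ p f q ≡ 𝟎) → Bounds {L = L} {c} p t f
      step {c} le {t} {f} P cyc = descend (suc n) (high-degree le (poly-pw w (suc n) P) (pw-cycle w (suc n) cyc))
        where
        w = proj₁ (fresh (toList pts))
        w-fresh : ∀ x → lookup pts x ≢ w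
        w-fresh x eq = proj₂ (fresh (toList pts)) (subst (_∈ˡ toList pts) eq (∈-toList pts x))
          where
          ∈-toList : ∀ {k} (v : Vec ℚ k) x → lookup v x ∈ˡ toList v
          ∈-toList (a ∷ v) zero = here refl
          ∈-toList (a ∷ v) (suc x) = there (∈-toList v x)
        descend : ∀ j → Bounds {L = L} {c} p (j +ℕ t) (pw w j f) → Bounds {L = L} {c} p t f
        descend zero b = b
        descend (suc j) b = descend j (injective le w w-fresh (poly-pw w j P) b)

    poly-point : ∀ {S : Λ (suc n) → Set} {t} {f : Vec ℚ 0 → Λ (suc n)} → Poly S (suc t) f → ∀ q → f q ≡ 𝟎
    poly-point (zer e) q = e q
    poly-point (add a b e) q = trans (e q) (trans (cong₂ _⊕_ (poly-point a q) (poly-point b q)) (⊕-identityˡ 𝟎))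
    poly-point (mul {l} {f} fl a e) [] = trans (e []) (trans (cong (_· f []) (trans (form-* fl 0ℚ []) (ℚₚ.*-zeroˡ (l [])))) (0·u (f [])))

    exact : ∀ m → Exact m
    exact zero {p = p} down dep le nv {f = f} P cyc = (λ _ → 𝟎) , zer (λ _ → refl) , λ q → trans (lin-𝟎 (i-linear (wt p q))) (sym (poly-point P q))
    exact (suc m) {k = zero} {c = c} down dep le nv P cyc = ⊥-elim (ℕₚ.n≮0 (ℕₚ.≤-trans (ℕₚ.m≤n+m (suc m) c) le))
    exact (suc m) {k = suc k} down dep le nv P cyc = Step.step (exact m) down dep nv le P cyc

-- Dimension counts over a field without decidable equality

module LinearAlgebra where

  open import Defs
  open IntegerMap
  open Counting
  open import Data.List using ([]; _∷_)
  open import Data.List.Membership.Propositional using (_∈_)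
  open import Data.List.Relation.Unary.Any using (here; there)
  open import Data.Nat using () renaming (_≤_ to _≤ℕ_)
  open import Data.Vec.Properties using (≡-dec)
  open import Relation.Binary.PropositionalEquality as ≡ using (_≡_; _≢_; cong; subst)
  import Level

  infixl 1 _>>=_
  _>>=_ : ∀ {a b} {A : Set a} {B : Set b} → ¬ ¬ A → (A → ¬ ¬ B) → ¬ ¬ B
  (m >>= f) k = m λ a → f a k

  return : ∀ {a} {A : Set a} → A → ¬ ¬ A
  return a k = k a

  em : ∀ {a} {A : Set a} → ¬ ¬ (Dec A)
  em k = k (no λ a → k (yes a))

  ¬¬-subsets : ∀ {m a} {Q : Subset m → Set a} → (∀ σ → ¬ ¬ Q σ) → ¬ ¬ (∀ σ → Q σ)
  ¬¬-subsets {zero} f = f [] >>= λ q → return λ { [] → q }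
  ¬¬-subsets {suc m} f = ¬¬-subsets (λ σ → f (false ∷ σ)) >>= λ p → ¬¬-subsets (λ σ → f (true ∷ σ)) >>= λ q →
    return λ { (false ∷ σ) → p σ ; (true ∷ σ) → q σ }

  -- Subspaces are given as predicates; this makes a property of words countable. Double negation
  -- passes through the quantifier because there are finitely many subsets.
  ¬¬-mask : ∀ {m a} (Q : Subset m → Set a) → ¬ ¬ (∃ λ (I : Subset m → Bool) → ∀ σ → (I σ ≡ true → Q σ) × (Q σ → I σ ≡ true))
  ¬¬-mask Q = ¬¬-subsets (λ σ → em {A = Q σ}) >>= λ d → return ((λ σ → bit (d σ)) , λ σ → spec (d σ))
    where
    bit : ∀ {a} {A : Set a} → Dec A → Bool
    bit (yes _) = true
    bit (no _) = false
    spec : ∀ {a} {A : Set a} (d : Dec A) → (bit d ≡ true → A) × (A → bit d ≡ true)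
    spec (yes a) = (λ _ → a) , λ _ → ≡.refl
    spec (no na) = (λ ()) , λ a → ⊥-elim (na a)

  _≟S_ : ∀ {m} (σ τ : Subset m) → Dec (σ ≡ τ)
  _≟S_ = ≡-dec _≟B_

  remove : ∀ {m} → (Subset m → Bool) → Subset m → Subset m → Bool
  remove I σ τ with σ ≟S τ
  ... | yes _ = false
  ... | no _ = I τ

  remove-same : ∀ {m} (I : Subset m → Bool) σ → remove I σ σ ≡ false
  remove-same I σ with σ ≟S σ
  ... | yes _ = ≡.refl
  ... | no ne = ⊥-elim (ne ≡.refl)

  remove-other : ∀ {m} (I : Subset m → Bool) {σ τ} → σ ≢ τ → remove I σ τ ≡ I τ
  remove-other I {σ} {τ} ne with σ ≟S τ
  ... | yes eq = ⊥-elim (ne eq)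
  ... | no _ = ≡.refl

  count-remove : ∀ {m} (I : Subset m → Bool) σ → count I ≤ℕ suc (count (remove I σ))
  count-remove {m} I σ = begin
    count I ≡⟨ count-split I (remove I σ) ⟨
    count (λ τ → I τ ∧ remove I σ τ) ℕ.+ count (λ τ → I τ ∧ not (remove I σ τ)) ≤⟨ ℕₚ.+-mono-≤ (count-mono {P = λ τ → I τ ∧ remove I σ τ} (λ τ p → ∧-true⁻ʳ {I τ} p)) small ⟩
    count (remove I σ) ℕ.+ 1 ≡⟨ ℕₚ.+-comm _ 1 ⟩
    suc (count (remove I σ)) ∎
    where
    open ℕₚ.≤-Reasoning
    only : ∀ τ → I τ ∧ not (remove I σ τ) ≡ true → σ ≡ τ
    only τ p with σ ≟S τ
    ... | yes eq = eq
    ... | no _ = contra (I τ) p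
      where
      contra : ∀ b → b ∧ not b ≡ true → σ ≡ τ
      contra true ()
      contra false ()
    small : count (λ τ → I τ ∧ not (remove I σ τ)) ≤ℕ 1
    small = count-injection {n = 0} {Q = λ _ → true} (λ _ → []) (λ _ _ → ≡.refl) (λ τ τ′ p q _ → ≡.trans (≡.sym (only τ p)) (only τ′ q))

  module Functions {a ℓ} (F : Field a ℓ) where
    open Field F
    open FromℤTo commutativeRing using (module Solver)
    open Solver using (solve; _:=_; _:+_; _:*_; :-_; con)

    Fn : ℕ → Set a
    Fn m = Subset m → Carrier

    Supported : ∀ {m} → (Subset m → Bool) → Fn m → Set ℓ
    Supported I c = ∀ σ → I σ ≡ false → c σ ≈ 0#

    record LinearFn {m l} (T : Fn m → Fn l) : Set (a Level.⊔ ℓ) where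
      field
        fn-cong : ∀ {c d} → (∀ σ → c σ ≈ d σ) → ∀ τ → T c τ ≈ T d τ
        fn-+ : ∀ c d τ → T (λ σ → c σ + d σ) τ ≈ T c τ + T d τ
        fn-* : ∀ x c τ → T (λ σ → x * c σ) τ ≈ x * T c τ
    open LinearFn public

    sumF : ∀ {m} → Fn m → Carrier
    sumF {zero} c = c []
    sumF {suc m} c = sumF (λ σ → c (false ∷ σ)) + sumF (λ σ → c (true ∷ σ))

    sumF-cong : ∀ {m} {c d : Fn m} → (∀ σ → c σ ≈ d σ) → sumF c ≈ sumF d
    sumF-cong {zero} e = e []
    sumF-cong {suc m} e = +-cong (sumF-cong (λ σ → e (false ∷ σ))) (sumF-cong (λ σ → e (true ∷ σ)))

    sumF-0 : ∀ {m} {c : Fn m} → (∀ σ → c σ ≈ 0#) → sumF c ≈ 0#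
    sumF-0 {zero} e = e []
    sumF-0 {suc m} e = trans (+-cong (sumF-0 (λ σ → e (false ∷ σ))) (sumF-0 (λ σ → e (true ∷ σ)))) (+-identityˡ 0#)

    sumF-+ : ∀ {m} (c d : Fn m) → sumF (λ σ → c σ + d σ) ≈ sumF c + sumF d
    sumF-+ {zero} c d = refl
    sumF-+ {suc m} c d = trans (+-cong (sumF-+ (λ σ → c (false ∷ σ)) (λ σ → d (false ∷ σ))) (sumF-+ (λ σ → c (true ∷ σ)) (λ σ → d (true ∷ σ))))
      (solve 4 (λ x y z w → (x :+ y) :+ (z :+ w) := (x :+ z) :+ (y :+ w)) refl _ _ _ _)

    sumF-* : ∀ {m} x (c : Fn m) → sumF (λ σ → x * c σ) ≈ x * sumF c
    sumF-* {zero} x c = refl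
    sumF-* {suc m} x c = trans (+-cong (sumF-* x (λ σ → c (false ∷ σ))) (sumF-* x (λ σ → c (true ∷ σ)))) (sym (distribˡ x _ _))

    basis : ∀ {m} → Subset m → Fn m
    basis [] [] = 1#
    basis (false ∷ σ) (false ∷ τ) = basis σ τ
    basis (true ∷ σ) (true ∷ τ) = basis σ τ
    basis (false ∷ σ) (true ∷ τ) = 0#
    basis (true ∷ σ) (false ∷ τ) = 0#

    basis-same : ∀ {m} (σ : Subset m) → basis σ σ ≈ 1#
    basis-same [] = refl
    basis-same (false ∷ σ) = basis-same σ
    basis-same (true ∷ σ) = basis-same σ

    basis-other : ∀ {m} {σ τ : Subset m} → σ ≢ τ → basis σ τ ≈ 0#
    basis-other {σ = []} {[]} ne = ⊥-elim (ne ≡.refl)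
    basis-other {σ = false ∷ σ} {false ∷ τ} ne = basis-other (λ e → ne (cong (false ∷_) e))
    basis-other {σ = true ∷ σ} {true ∷ τ} ne = basis-other (λ e → ne (cong (true ∷_) e))
    basis-other {σ = false ∷ σ} {true ∷ τ} ne = refl
    basis-other {σ = true ∷ σ} {false ∷ τ} ne = refl

    basis-supported : ∀ {m} (I : Subset m → Bool) {σ} → I σ ≡ true → Supported I (basis σ)
    basis-supported I {σ} p τ q = basis-other {σ = σ} {τ} λ { ≡.refl → true≢false p q }

    fn-0 : ∀ {m l} {T : Fn m → Fn l} → LinearFn T → ∀ {c} → (∀ σ → c σ ≈ 0#) → ∀ τ → T c τ ≈ 0#
    fn-0 {T = T} lin {c} z τ = trans (fn-cong lin (λ σ → trans (z σ) (sym (zeroˡ (c σ)))) τ) (trans (fn-* lin 0# c τ) (zeroˡ _))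

    private
      embed : ∀ {m} → Bool → Fn m → Fn (suc m)
      embed false c (false ∷ σ) = c σ
      embed false c (true ∷ σ) = 0#
      embed true c (false ∷ σ) = 0#
      embed true c (true ∷ σ) = c σ

      embed-linear : ∀ {m} b → LinearFn (embed {m} b)
      embed-linear false = record
        { fn-cong = λ { e (false ∷ σ) → e σ ; e (true ∷ σ) → refl }
        ; fn-+ = λ { c d (false ∷ σ) → refl ; c d (true ∷ σ) → sym (+-identityˡ 0#) }
        ; fn-* = λ { x c (false ∷ σ) → refl ; x c (true ∷ σ) → sym (zeroʳ x) } }
      embed-linear true = record
        { fn-cong = λ { e (true ∷ σ) → e σ ; e (false ∷ σ) → refl }
        ; fn-+ = λ { c d (true ∷ σ) → refl ; c d (false ∷ σ) → sym (+-identityˡ 0#) }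
        ; fn-* = λ { x c (true ∷ σ) → refl ; x c (false ∷ σ) → sym (zeroʳ x) } }

      embed-basis : ∀ {m} b (σ : Subset m) τ → embed b (basis σ) τ ≈ basis (b ∷ σ) τ
      embed-basis false σ (false ∷ τ) = refl
      embed-basis false σ (true ∷ τ) = refl
      embed-basis true σ (false ∷ τ) = refl
      embed-basis true σ (true ∷ τ) = refl

    ∘-linearFn : ∀ {k m l} {T : Fn m → Fn l} {U : Fn k → Fn m} → LinearFn T → LinearFn U → LinearFn (λ c → T (U c))
    ∘-linearFn t u = record
      { fn-cong = λ e → fn-cong t (fn-cong u e)
      ; fn-+ = λ c d τ → trans (fn-cong t (fn-+ u c d) τ) (fn-+ t _ _ τ)
      ; fn-* = λ x c τ → trans (fn-cong t (fn-* u x c) τ) (fn-* t x _ τ) }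

    fn-expand : ∀ {m l} {T : Fn m → Fn l} → LinearFn T → ∀ c τ → T c τ ≈ sumF (λ σ → c σ * T (basis σ) τ)
    fn-expand {zero} {T = T} lin c τ = trans (fn-cong lin (λ { [] → sym (*-identityʳ (c [])) }) τ) (fn-* lin (c []) (basis []) τ)
    fn-expand {suc m} {T = T} lin c τ = trans (fn-cong lin split τ) (trans (fn-+ lin _ _ τ) (+-cong (half false) (half true)))
      where
      split : ∀ σ → c σ ≈ embed false (λ ρ → c (false ∷ ρ)) σ + embed true (λ ρ → c (true ∷ ρ)) σ
      split (false ∷ σ) = sym (+-identityʳ _)
      split (true ∷ σ) = sym (+-identityˡ _)
      half : ∀ b → T (embed b (λ ρ → c (b ∷ ρ))) τ ≈ sumF (λ σ → c (b ∷ σ) * T (basis (b ∷ σ)) τ)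
      half b = trans (fn-expand (∘-linearFn lin (embed-linear b)) (λ ρ → c (b ∷ ρ)) τ)
        (sumF-cong (λ σ → *-congˡ (fn-cong lin (embed-basis b σ) τ)))

    private
      dimension′ : ∀ {m l} (I : Subset m → Bool) (xs : List (Subset l)) (T : Fn m → Fn l) → LinearFn T →
        (∀ c → Supported I c → (∀ {τ} → τ ∈ xs → T c τ ≈ 0#) → ∀ σ → ¬ ¬ (c σ ≈ 0#)) → ¬ ¬ (count I ≤ℕ length xs)
      dimension′ I [] T lin inj k = k (subst (_≤ℕ 0) (≡.sym (count-none {P = I} λ σ → ¬true⇒false λ p → inj (basis σ) (basis-supported I p) (λ ()) σ (λ z → 1≉0 (trans (sym (basis-same σ)) z)))) z≤n)
      dimension′ I (τ ∷ xs) T lin inj = em {A = ∃ λ σ → I σ ≡ true × ¬ (T (basis σ) τ ≈ 0#)} >>= cases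
        where
        cases : Dec (∃ λ σ → I σ ≡ true × ¬ (T (basis σ) τ ≈ 0#)) → ¬ ¬ (count I ≤ℕ suc (length xs))
        cases (no none) = ¬¬-subsets (λ σ → em {A = T (basis σ) τ ≈ 0#}) >>= λ dec →
          dimension′ I xs T lin (λ c sup z → inj c sup λ { (here ≡.refl) → vanish dec c sup ; (there p) → z p }) >>= λ le → return (ℕₚ.m≤n⇒m≤1+n le)
          where
          vanish : (∀ σ → Dec (T (basis σ) τ ≈ 0#)) → ∀ c → Supported I c → T c τ ≈ 0#
          vanish dec c sup = trans (fn-expand lin c τ) (sumF-0 term)
            where
            term : ∀ σ → c σ * T (basis σ) τ ≈ 0#
            term σ with dec σ
            ... | yes z = trans (*-congˡ z) (zeroʳ _)
            ... | no nz with I σ in eq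
            ...   | true = ⊥-elim (none (σ , eq , nz))
            ...   | false = trans (*-congʳ (sup σ eq)) (zeroˡ _)
        cases (yes (σ , σ∈ , nz)) with inverse (T (basis σ) τ) nz
        ... | y , ay = dimension′ (remove I σ) xs T′ lin′ inj′ >>= λ le → return (ℕₚ.≤-trans (count-remove I σ) (s≤s le))
          where
          -- Adds the multiple of the pivot vector that solves the equation at `τ`; other
          -- coordinates are unchanged.
          adjust : Fn _ → Fn _
          adjust c ρ = c ρ + - ((y * T c τ) * basis σ ρ)
          adjust-linear : LinearFn adjust
          adjust-linear = record
            { fn-cong = λ e ρ → +-cong (e ρ) (-‿cong (*-congʳ (*-congˡ (fn-cong lin e τ))))
            ; fn-+ = λ c d ρ → trans (+-congˡ (-‿cong (*-congʳ (*-congˡ (fn-+ lin c d τ)))))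
                (solve 6 (λ c d y t u b → (c :+ d) :+ :- ((y :* (t :+ u)) :* b) := (c :+ :- ((y :* t) :* b)) :+ (d :+ :- ((y :* u) :* b))) refl (c ρ) (d ρ) y (T c τ) (T d τ) (basis σ ρ))
            ; fn-* = λ x c ρ → trans (+-congˡ (-‿cong (*-congʳ (*-congˡ (fn-* lin x c τ)))))
                (solve 5 (λ x c y t b → x :* c :+ :- ((y :* (x :* t)) :* b) := x :* (c :+ :- ((y :* t) :* b))) refl x (c ρ) y (T c τ) (basis σ ρ)) }
          T′ : Fn _ → Fn _
          T′ c = T (adjust c)
          lin′ : LinearFn T′
          lin′ = ∘-linearFn lin adjust-linear
          killed : ∀ c → T (adjust c) τ ≈ 0#
          killed c = trans (fn-+ lin c (λ ρ → - ((y * T c τ) * basis σ ρ)) τ)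
            (trans (+-congˡ (trans (fn-cong lin (λ ρ → solve 2 (λ x b → :- (x :* b) := (:- x) :* b) refl (y * T c τ) (basis σ ρ)) τ) (fn-* lin (- (y * T c τ)) (basis σ) τ)))
              (trans (solve 3 (λ t y a → t :+ (:- (y :* t)) :* a := t :+ :- (t :* (a :* y))) refl (T c τ) y (T (basis σ) τ))
                (trans (+-congˡ (-‿cong (trans (*-congˡ ay) (*-identityʳ _)))) (-‿inverseʳ _))))
          inj′ : ∀ c → Supported (remove I σ) c → (∀ {τ′} → τ′ ∈ xs → T′ c τ′ ≈ 0#) → ∀ ρ → ¬ ¬ (c ρ ≈ 0#)
          inj′ c sup z ρ with σ ≟S ρ
          ... | yes ≡.refl = return (sup σ (remove-same I σ))
          ... | no ne = inj (adjust c) sup′ (λ { (here ≡.refl) → killed c ; (there p) → z p }) ρ >>= λ zero → return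
                (trans (sym (trans (+-congˡ (trans (-‿cong (trans (*-congˡ (basis-other ne)) (zeroʳ _))) (solve 0 (:- con (ℤ.+ 0) := con (ℤ.+ 0)) refl))) (+-identityʳ _))) zero)
            where
            sup′ : Supported I (adjust c)
            sup′ ρ′ q with σ ≟S ρ′
            ... | yes ≡.refl = true≢false σ∈ q
            ... | no ne′ = trans (+-cong (sup ρ′ (≡.trans (remove-other I ne′) q)) (-‿cong (trans (*-congˡ (basis-other ne′)) (zeroʳ _))))
                    (solve 0 (con (ℤ.+ 0) :+ :- con (ℤ.+ 0) := con (ℤ.+ 0)) refl)

    -- Comparison of natural numbers is decidable, so the elimination may take place under double
    -- negation and still give a plain inequality.
    dimension : ∀ {m l} (I : Subset m → Bool) (J : Subset l → Bool) (T : Fn m → Fn l) → LinearFn T →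
      (∀ c → Supported I c → (∀ τ → J τ ≡ true → T c τ ≈ 0#) → ∀ σ → ¬ ¬ (c σ ≈ 0#)) → count I ≤ℕ count J
    dimension I J T lin inj with count I ℕ.≤? count J
    ... | yes le = le
    ... | no nle = ⊥-elim (dimension′ I (elems J) T lin (λ c sup z → inj c sup (λ τ j → z (∈-elems⁺ J j)))
                     (λ le → nle (subst (count I ≤ℕ_) (length-elems J) le)))

-- Flags of functionals and leading words

module Leading where

  open import Defs using (Field)
  open IntegerMap
  open Counting
  open ShiftedFamilies using (here; there)
  open Exterior
  open PolynomialMaps
  open Depth
  open Exactness using (mkΛ; at-mkΛ)
  open LinearAlgebra
  open import Data.Fin.Subset using (∣_∣)
  open import Data.Nat using () renaming (_≤_ to _≤ℕ_)
  open import Data.Rational using (_+_; _*_; -_; _-_)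
  open import Relation.Binary.PropositionalEquality
  open import Level using (0ℓ)

  private variable
    k l m n : ℕ

  ℚ-field : Field 0ℓ 0ℓ
  ℚ-field = record
    { commutativeRing = ℚₚ.+-*-commutativeRing
    ; 1≉0 = λ ()
    ; inverse = λ x → inverseʳ }

  module ℚFn = Functions ℚ-field

  In : (Subset m → Bool) → Λ m → Set
  In I = Sup (λ σ → I σ ≡ true)

  mkΛ-⊕ : (c d : Subset m → ℚ) → mkΛ (λ σ → c σ + d σ) ≡ mkΛ c ⊕ mkΛ d
  mkΛ-⊕ c d = at-ext λ σ → trans (at-mkΛ _ σ) (sym (trans (at-⊕ (mkΛ c) (mkΛ d) σ) (cong₂ _+_ (at-mkΛ c σ) (at-mkΛ d σ))))

  mkΛ-· : ∀ a (c : Subset m → ℚ) → mkΛ (λ σ → a * c σ) ≡ a · mkΛ c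
  mkΛ-· a c = at-ext λ σ → trans (at-mkΛ _ σ) (sym (trans (at-· a (mkΛ c) σ) (cong (a *_) (at-mkΛ c σ))))

  dimension-Λ : (I : Subset m → Bool) (J : Subset l → Bool) (T : Λ m → Λ l) → Linear T →
    (∀ {c} → In I c → (∀ τ → J τ ≡ true → at (T c) τ ≡ 0ℚ) → c ≡ 𝟎) → count I ≤ℕ count J
  dimension-Λ I J T lin inj = ℚFn.dimension I J (λ c τ → at (T (mkΛ c)) τ)
    (record
      { fn-cong = λ {c} {d} e τ → cong (λ z → at (T z) τ) (at-ext λ σ → trans (at-mkΛ c σ) (trans (e σ) (sym (at-mkΛ d σ))))
      ; fn-+ = λ c d τ → trans (cong (λ z → at z τ) (trans (cong T (mkΛ-⊕ c d)) (lin-⊕ lin _ _))) (at-⊕ (T (mkΛ c)) (T (mkΛ d)) τ)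
      ; fn-* = λ a c τ → trans (cong (λ z → at z τ) (trans (cong T (mkΛ-· a c)) (lin-· lin a _))) (at-· a (T (mkΛ c)) τ) })
    (λ c sup z σ → return (trans (sym (at-mkΛ c σ)) (trans (cong (λ w → at w σ) (inj (mkSup λ τ → supported c sup τ) z)) (at-κ 0ℚ σ))))
    where
    supported : ∀ c → (∀ σ → I σ ≡ false → c σ ≡ 0ℚ) → ∀ τ → I τ ≡ true ⊎ at (mkΛ c) τ ≡ 0ℚ
    supported c sup τ with I τ in eq
    ... | true = inj₁ refl
    ... | false = inj₂ (trans (at-mkΛ c τ) (sup τ eq))

  -- Coordinates of u with respect to a flag of functionals: contract with φ for each chosen φ.
  coords : Vec (Vec ℚ n) m → Λ n → Λ m
  coords [] u = sc (at u ∅)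
  coords (φ ∷ φs) u = coords φs u ∥ coords φs (i φ u)

  coords-linear : (φs : Vec (Vec ℚ n) m) → Linear (coords φs)
  coords-linear [] = record { lin-⊕ = λ u v → cong sc (at-⊕ u v ∅) ; lin-· = λ a u → cong sc (at-· a u ∅) }
  coords-linear (φ ∷ φs) = pair-linear (coords-linear φs) (∘-linear (coords-linear φs) (i-linear φ))

  private
    at-∅-bar : (u : Λ n) → at (bar u) ∅ ≡ at u ∅
    at-∅-bar (sc a) = refl
    at-∅-bar (u ∥ v) = at-∅-bar u

    at-∅-∧ : (u w : Λ n) → at (u ∧Λ w) ∅ ≡ at u ∅ * at w ∅
    at-∅-∧ (sc a) (sc b) = refl
    at-∅-∧ (u ∥ v) (u′ ∥ v′) = at-∅-∧ u u′

  coords-bar : (φs : Vec (Vec ℚ n) m) (u : Λ n) → coords φs (bar u) ≡ bar (coords φs u)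
  coords-bar [] u = cong sc (at-∅-bar u)
  coords-bar (φ ∷ φs) u = cong₂ _∥_ (coords-bar φs u)
    (trans (cong (coords φs) (trans (sym (⊝-involutive (i φ (bar u)))) (cong ⊝_ (sym (bar-i φ u)))))
      (trans (lin-⊝ (coords-linear φs) (bar (i φ u))) (cong ⊝_ (coords-bar φs (i φ u)))))

  -- `coords` is the homomorphism of exterior algebras induced by the functionals of the flag; this
  -- transports intersection properties, encoded as vanishing products, to leading words.
  coords-∧ : (φs : Vec (Vec ℚ n) m) (u w : Λ n) → coords φs (u ∧Λ w) ≡ coords φs u ∧Λ coords φs w
  coords-∧ [] u w = cong sc (at-∅-∧ u w)
  coords-∧ (φ ∷ φs) u w = cong₂ _∥_ (coords-∧ φs u w)
    (trans (cong (coords φs) (i-∧ φ u w)) (trans (lin-⊕ (coords-linear φs) (i φ u ∧Λ w) (bar u ∧Λ i φ w))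
      (cong₂ _⊕_ (coords-∧ φs (i φ u) w) (trans (coords-∧ φs (bar u) (i φ w)) (cong (_∧Λ coords φs (i φ w)) (coords-bar φs u))))))

  coords-δ : (φs : Vec (Vec ℚ n) m) (x : Fin m) (u : Λ n) → coords φs (i (lookup φs x) u) ≡ δ x (coords φs u)
  coords-δ (φ ∷ φs) zero u = cong (coords φs (i φ u) ∥_) (trans (cong (coords φs) (i-i φ u)) (lin-𝟎 (coords-linear φs)))
  coords-δ (φ ∷ φs) (suc x) u = cong₂ _∥_ (coords-δ φs x u)
    (trans (cong (coords φs) (i-anticomm φ (lookup φs x) u)) (trans (lin-⊝ (coords-linear φs) _) (cong ⊝_ (coords-δ φs x (i φ u)))))

  -- The leading word of a vector: words are compared lexicographically with true before false.
  data Lead : ∀ {m} → Λ m → Subset m → Set where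
    lead-sc : ∀ {a} → a ≢ 0ℚ → Lead (sc a) []
    lead-t  : ∀ {m} {u v : Λ m} {σ} → Lead v σ → Lead (u ∥ v) (true ∷ σ)
    lead-f  : ∀ {m} {u v : Λ m} {σ} → v ≡ 𝟎 → Lead u σ → Lead (u ∥ v) (false ∷ σ)

  lead-nonzero : ∀ {u : Λ m} {σ} → Lead u σ → at u σ ≢ 0ℚ
  lead-nonzero (lead-sc p) = p
  lead-nonzero (lead-t l) = lead-nonzero l
  lead-nonzero (lead-f _ l) = lead-nonzero l

  lead-⊝ : ∀ {u : Λ m} {σ} → Lead u σ → Lead (⊝ u) σ
  lead-⊝ (lead-sc p) = lead-sc λ q → p (ℚₚ.neg-injective q)
  lead-⊝ (lead-t l) = lead-t (lead-⊝ l)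
  lead-⊝ (lead-f refl l) = lead-f ⊝𝟎 (lead-⊝ l)

  lead-bar : ∀ {u : Λ m} {σ} → Lead u σ → Lead (bar u) σ
  lead-bar (lead-sc p) = lead-sc p
  lead-bar (lead-t l) = lead-t (lead-⊝ (lead-bar l))
  lead-bar (lead-f refl l) = lead-f (trans (cong ⊝_ (lin-𝟎 bar-linear)) ⊝𝟎) (lead-bar l)

  lead-δ : ∀ {u : Λ m} {x σ τ} → Lead u τ → AddAt x σ τ → Lead (δ x u) σ
  lead-δ (lead-t l) here = lead-f refl l
  lead-δ (lead-t l) (there d) = lead-t (lead-⊝ (lead-δ l d))
  lead-δ {x = suc x} (lead-f refl l) (there d) = lead-f (trans (cong ⊝_ (lin-𝟎 (δ-linear x))) ⊝𝟎) (lead-δ l d)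

  ∥-injectiveˡ : ∀ {a b c d : Λ m} → a ∥ b ≡ c ∥ d → a ≡ c
  ∥-injectiveˡ refl = refl

  ∥-injectiveʳ : ∀ {a b c d : Λ m} → a ∥ b ≡ c ∥ d → b ≡ d
  ∥-injectiveʳ refl = refl

  bar-shift : {u w : Λ m} → bar u ∧Λ w ≡ 𝟎 → u ∧Λ bar w ≡ 𝟎
  bar-shift {u = u} {w} p = trans (cong (_∧Λ bar w) (sym (bar-bar u))) (trans (sym (bar-∧ (bar u) w)) (trans (cong bar p) (lin-𝟎 bar-linear)))

  -- If the words were disjoint, the product of the two leading terms would, up to sign, be a
  -- nonzero leading term of the product.
  leads-meet : ∀ {u w : Λ m} {σ τ} → Lead u σ → Lead w τ → u ∧Λ w ≡ 𝟎 → 1 ≤ℕ ∣ σ ∩ τ ∣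
  leads-meet {u = sc a} {sc b} (lead-sc p) (lead-sc q) z = ⊥-elim (*-nonzero p q (cong (λ w → at w []) z))
  leads-meet (lead-t l) (lead-t l′) z = s≤s z≤n
  leads-meet {u = u ∥ v} {u′ ∥ _} (lead-t l) (lead-f refl l′) z = leads-meet l l′
    (trans (sym (⊕-identityʳ _)) (trans (cong (v ∧Λ u′ ⊕_) (sym (lin-𝟎 (∧-linearʳ (bar u))))) (∥-injectiveʳ z)))
  leads-meet {u = u ∥ _} {u′ ∥ v′} (lead-f refl l) (lead-t l′) z = leads-meet l (lead-bar l′)
    (bar-shift {u = u} (trans (sym (⊕-identityˡ _)) (trans (cong (_⊕ bar u ∧Λ v′) (sym (lin-𝟎 (∧-linearˡ u′)))) (∥-injectiveʳ z))))
  leads-meet (lead-f refl l) (lead-f refl l′) z = leads-meet l l′ (∥-injectiveˡ z)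

  -- At the first common position, contraction strips this position from one factor; what follows
  -- still multiplies to zero, so `leads-meet` finds another common position.
  leads-meet-twice : ∀ {u w : Λ m} {σ τ} → Lead u σ → Lead w τ → u ∧Λ w ≡ 𝟎 → (∀ x → δ x u ∧Λ w ≡ 𝟎) → 2 ≤ℕ ∣ σ ∩ τ ∣
  leads-meet-twice {u = sc a} {sc b} (lead-sc p) (lead-sc q) z _ = ⊥-elim (*-nonzero p q (cong (λ w → at w []) z))
  leads-meet-twice {u = u ∥ v} {u′ ∥ v′} (lead-t l) (lead-t l′) z zs = s≤s (leads-meet (lead-bar l) l′
    (trans (sym (⊕-identityˡ _)) (trans (cong (_⊕ bar v ∧Λ v′) (sym (lin-𝟎 (∧-linearˡ u′)))) (∥-injectiveʳ (zs zero)))))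
  leads-meet-twice {u = u ∥ v} {u′ ∥ _} (lead-t l) (lead-f refl l′) z zs = leads-meet-twice l l′
    (trans (sym (⊕-identityʳ _)) (trans (cong (v ∧Λ u′ ⊕_) (sym (lin-𝟎 (∧-linearʳ (bar u))))) (∥-injectiveʳ z)))
    λ x → trans (sym (⊝-involutive _)) (trans (cong ⊝_ (trans (sym (lin-⊝ (∧-linearˡ u′) (δ x v))) (trans (sym (⊕-identityʳ _))
      (trans (cong ((⊝ δ x v) ∧Λ u′ ⊕_) (sym (lin-𝟎 (∧-linearʳ (bar (δ x u)))))) (∥-injectiveʳ (zs (suc x))))))) ⊝𝟎)
  leads-meet-twice {u = u ∥ _} {u′ ∥ v′} (lead-f refl l) (lead-t l′) z zs = leads-meet-twice l (lead-bar l′)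
    (bar-shift {u = u} (trans (sym (⊕-identityˡ _)) (trans (cong (_⊕ bar u ∧Λ v′) (sym (lin-𝟎 (∧-linearˡ u′)))) (∥-injectiveʳ z))))
    λ x → bar-shift {u = δ x u} (trans (sym (⊕-identityˡ _)) (trans (cong (_⊕ bar (δ x u) ∧Λ v′)
      (sym (trans (cong (_∧Λ u′) (trans (cong ⊝_ (lin-𝟎 (δ-linear x))) ⊝𝟎)) (lin-𝟎 (∧-linearˡ u′))))) (∥-injectiveʳ (zs (suc x)))))
  leads-meet-twice (lead-f refl l) (lead-f refl l′) z zs = leads-meet-twice l l′ (∥-injectiveˡ z) (λ x → ∥-injectiveˡ (zs (suc x)))

  -- The words in `I` are the pivot columns of an echelon form of `U`.
  record Leads (U : Λ m → Set) (I : Subset m → Bool) : Set where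
    field
      leads⁻ : ∀ {σ} → I σ ≡ true → ∃ λ w → U w × Lead w σ
      leads⁺ : ∀ {σ w} → U w → Lead w σ → I σ ≡ true
  open Leads public

  ¬¬-leads : (U : Λ m → Set) → ¬ ¬ (∃ λ I → Leads U I)
  ¬¬-leads U = ¬¬-mask (λ σ → ∃ λ w → U w × Lead w σ) >>= λ (I , spec) →
    return (I , record { leads⁻ = λ {σ} p → proj₁ (spec σ) p ; leads⁺ = λ {σ} u l → proj₂ (spec σ) (_ , u , l) })

  private
    U₀ U₁ : (Λ (suc m) → Set) → Λ m → Set
    U₀ U u = U (u ∥ 𝟎)
    U₁ U v = ∃ λ u → U (u ∥ v)

    sub₀ : {U : Λ (suc m) → Set} → Subspace U → Subspace (U₀ U)
    sub₀ {U = U} s = record { sub-𝟎 = sub-𝟎 s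
      ; sub-⊕ = λ {u} {v} p q → subst (λ z → U (u ⊕ v ∥ z)) (⊕-identityˡ 𝟎) (sub-⊕ s p q)
      ; sub-· = λ a {u} p → subst (λ z → U (a · u ∥ z)) (a·𝟎 a) (sub-· s a p) }

    sub₁ : {U : Λ (suc m) → Set} → Subspace U → Subspace (U₁ U)
    sub₁ s = record { sub-𝟎 = 𝟎 , sub-𝟎 s ; sub-⊕ = λ (u , p) (v , q) → u ⊕ v , sub-⊕ s p q ; sub-· = λ a (u , p) → a · u , sub-· s a p }

    leads₀ : {U : Λ (suc m) → Set} {I : Subset (suc m) → Bool} → Leads U I → Leads (U₀ U) (λ σ → I (false ∷ σ))
    leads₀ {U = U} {I} L = record { leads⁻ = λ p → back (leads⁻ L p) ; leads⁺ = λ u l → leads⁺ L u (lead-f refl l) }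
      where
      back : ∀ {σ} → (∃ λ w → U w × Lead w (false ∷ σ)) → ∃ λ w → U₀ U w × Lead w σ
      back (u ∥ _ , p , lead-f refl l) = u , p , l

    leads₁ : {U : Λ (suc m) → Set} {I : Subset (suc m) → Bool} → Leads U I → Leads (U₁ U) (λ σ → I (true ∷ σ))
    leads₁ {U = U} {I} L = record { leads⁻ = λ p → back (leads⁻ L p) ; leads⁺ = λ (u , p) l → leads⁺ L p (lead-t l) }
      where
      back : ∀ {σ} → (∃ λ w → U w × Lead w (true ∷ σ)) → ∃ λ w → U₁ U w × Lead w σ
      back (u ∥ v , p , lead-t l) = v , (u , p) , l

  leads-injective : {U : Λ m → Set} {I : Subset m → Bool} → Leads U I → ∀ {w} → U w → (∀ σ → I σ ≡ true → at w σ ≡ 0ℚ) → w ≡ 𝟎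
  leads-injective {zero} {U} {I} L {sc a} u z with a ℚₚ.≟ 0ℚ
  ... | yes p = cong sc p
  ... | no p = cong sc (z [] (leads⁺ L u (lead-sc p)))
  leads-injective {suc m} {U} {I} L {u ∥ v} p z = cong₂ _∥_
    (leads-injective (leads₀ L) (subst (λ y → U (u ∥ y)) v≡𝟎 p) (λ σ → z (false ∷ σ))) v≡𝟎
    where
    v≡𝟎 : v ≡ 𝟎
    v≡𝟎 = leads-injective (leads₁ L) (u , p) (λ σ → z (true ∷ σ))

  -- Lexicographic with `false` below `true`, so the leading word of a vector is the largest word in
  -- its support.
  lt : Subset m → Subset m → Bool
  lt [] [] = false
  lt (false ∷ σ) (false ∷ ρ) = lt σ ρ
  lt (false ∷ σ) (true ∷ ρ) = true
  lt (true ∷ σ) (false ∷ ρ) = false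
  lt (true ∷ σ) (true ∷ ρ) = lt σ ρ

  -- An echelon form truncated at `ρ`: the coordinates from `ρ` upwards are determined by the pivots
  -- among them. This permits comparing two flags segment by segment.
  leads-vanish : {U : Λ m → Set} {I : Subset m → Bool} → Leads U I → ∀ ρ {w} → U w →
    (∀ σ → I σ ≡ true → lt σ ρ ≡ false → at w σ ≡ 0ℚ) → ∀ σ → lt σ ρ ≡ false → at w σ ≡ 0ℚ
  leads-vanish {zero} L [] u z [] _ = subst (λ w → at w [] ≡ 0ℚ) (sym (leads-injective L u λ { [] p → z [] p refl })) refl
  leads-vanish {suc m} L (true ∷ ρ) {u ∥ v} p z (true ∷ σ) q = leads-vanish (leads₁ L) ρ (u , p) (λ σ → z (true ∷ σ)) σ q
  leads-vanish {suc m} {U} L (false ∷ ρ) {u ∥ v} p z σ q = go σ q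
    where
    v≡𝟎 : v ≡ 𝟎
    v≡𝟎 = leads-injective (leads₁ L) (u , p) (λ σ i → z (true ∷ σ) i refl)
    go : ∀ σ → lt σ (false ∷ ρ) ≡ false → at (u ∥ v) σ ≡ 0ℚ
    go (true ∷ σ) _ = trans (cong (λ y → at y σ) v≡𝟎) (at-κ 0ℚ σ)
    go (false ∷ σ) q = leads-vanish (leads₀ L) ρ (subst (λ y → U (u ∥ y)) v≡𝟎 p) (λ σ → z (false ∷ σ)) σ q

  -- Back substitution: values at words beginning with `true` are met first, then corrected by
  -- vectors of `U` supported on words beginning with `false`.
  leads-interpolate : {U : Λ m → Set} {I : Subset m → Bool} → Subspace U → Leads U I →
    ∀ (t : Subset m → ℚ) → ∃ λ w → U w × (∀ σ → I σ ≡ true → at w σ ≡ t σ)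
  leads-interpolate {zero} {U} {I} s L t with I [] in eq
  ... | false = 𝟎 , sub-𝟎 s , λ { [] p → true≢false p eq }
  ... | true with leads⁻ L eq
  ...   | sc a , u , lead-sc a≢0 = (t [] * inv-a) · sc a , sub-· s (t [] * inv-a) u ,
          λ { [] _ → trans (ℚₚ.*-assoc (t []) inv-a a) (trans (cong (t [] *_) (trans (ℚₚ.*-comm inv-a a) (proj₂ (inverseʳ a≢0)))) (ℚₚ.*-identityʳ (t []))) }
    where inv-a = proj₁ (inverseʳ a≢0)
  leads-interpolate {suc m} {U} {I} s L t = combine (leads-interpolate (sub₁ s) (leads₁ L) (λ σ → t (true ∷ σ)))
    where
    combine : (∃ λ w → U₁ U w × (∀ σ → I (true ∷ σ) ≡ true → at w σ ≡ t (true ∷ σ))) → ∃ λ w → U w × (∀ σ → I σ ≡ true → at w σ ≡ t σ)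
    combine (v , (u , p) , e₁) = combine′ (leads-interpolate (sub₀ s) (leads₀ L) (λ σ → t (false ∷ σ) + - at u σ))
      where
      combine′ : (∃ λ w → U₀ U w × (∀ σ → I (false ∷ σ) ≡ true → at w σ ≡ t (false ∷ σ) + - at u σ)) → ∃ λ w → U w × (∀ σ → I σ ≡ true → at w σ ≡ t σ)
      combine′ (d , q , e₀) = u ⊕ d ∥ v , subst (λ z → U (u ⊕ d ∥ z)) (⊕-identityʳ v) (sub-⊕ s p q) ,
        λ { (true ∷ σ) → e₁ σ
          ; (false ∷ σ) j → trans (at-⊕ u d σ) (trans (cong (at u σ +_) (e₀ σ j)) (cancel (at u σ) (t (false ∷ σ)))) }
        where
        cancel : ∀ a b → a + (b + - a) ≡ b
        cancel = ℚSolver.solve 2 (λ a b → a ℚSolver.:+ (b ℚSolver.:+ ℚSolver.:- a) ℚSolver.:= b) refl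

  module Reduced {U : Λ m → Set} {I : Subset m → Bool} (s : Subspace U) (L : Leads U I) where

    delta : Subset m → Subset m → ℚ
    delta λ′ σ = at (e λ′) σ

    reduced : Subset m → Λ m
    reduced σ with I σ
    ... | true = proj₁ (leads-interpolate s L (delta σ))
    ... | false = 𝟎

    reduced-in : ∀ σ → U (reduced σ)
    reduced-in σ with I σ
    ... | true = proj₁ (proj₂ (leads-interpolate s L (delta σ)))
    ... | false = sub-𝟎 s

    reduced-at : ∀ σ τ → I σ ≡ true → I τ ≡ true → at (reduced σ) τ ≡ at (e σ) τ
    reduced-at σ τ p q with I σ
    ... | true = proj₂ (proj₂ (leads-interpolate s L (delta σ))) τ q

    reduced-zero : ∀ σ → I σ ≡ false → reduced σ ≡ 𝟎
    reduced-zero σ p with I σ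
    ... | false = refl

    combination : Λ m → Λ m
    combination c = sumS (λ σ → at c σ · reduced σ)

    combination-linear : Linear combination
    combination-linear = record
      { lin-⊕ = λ c d → trans (sumS-cong (λ σ → trans (cong (_· reduced σ) (at-⊕ c d σ)) (trans (cong (_⊗ reduced σ) (κ-+ (at c σ) (at d σ)))
          (solve 3 (λ x y u → (x :+ y) :* u := x :* u :+ y :* u) refl (κ (at c σ)) (κ (at d σ)) (reduced σ))))) (sumS-⊕ (λ σ → at c σ · reduced σ) (λ σ → at d σ · reduced σ))
      ; lin-· = λ a c → trans (sumS-cong (λ σ → trans (cong (_· reduced σ) (at-· a c σ)) (sym (·-· a (at c σ) (reduced σ))))) (sumS-· a (λ σ → at c σ · reduced σ)) }

    combination-in : ∀ c → U (combination c)
    combination-in c = sub-sumS s (λ σ → sub-· s (at c σ) (reduced-in σ))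

    at-sumS : ∀ {j l} (f : Subset j → Λ l) τ → at (sumS f) τ ≡ at (sumS (λ σ → sc (at (f σ) τ))) []
    at-sumS {zero} f τ = refl
    at-sumS {suc j} f τ = trans (at-⊕ (sumS (λ σ → f (false ∷ σ))) (sumS (λ σ → f (true ∷ σ))) τ)
      (trans (cong₂ _+_ (at-sumS (λ σ → f (false ∷ σ)) τ) (at-sumS (λ σ → f (true ∷ σ)) τ))
        (sym (at-⊕ (sumS (λ σ → sc (at (f (false ∷ σ)) τ))) (sumS (λ σ → sc (at (f (true ∷ σ)) τ))) [])))

    combination-at : ∀ c τ → I τ ≡ true → at (combination c) τ ≡ at c τ
    combination-at c τ t = trans (at-sumS (λ σ → at c σ · reduced σ) τ)
      (trans (cong (λ z → at z []) (sumS-cong entry)) (trans (sym (at-sumS (λ σ → at c σ · e σ) τ)) (cong (λ z → at z τ) (sym (expand c)))))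
      where
      entry : ∀ σ → sc (at (at c σ · reduced σ) τ) ≡ sc (at (at c σ · e σ) τ)
      entry σ = cong sc (trans (at-· (at c σ) (reduced σ) τ) (trans (cong (at c σ *_) (same (bool-cases (I σ)))) (sym (at-· (at c σ) (e σ) τ))))
        where
        same : I σ ≡ true ⊎ I σ ≡ false → at (reduced σ) τ ≡ at (e σ) τ
        same (inj₁ p) = reduced-at σ τ p t
        same (inj₂ p) = trans (cong (λ z → at z τ) (reduced-zero σ p)) (trans (at-κ 0ℚ τ) (sym (at-e-other {σ = σ} {τ} λ { refl → true≢false t p })))

    combination-id : ∀ {w} → U w → combination w ≡ w
    combination-id {w} u = trans (solve 2 (λ x y → x := (x :+ :- y) :+ y) refl (combination w) w)
      (trans (cong (_⊕ w) (leads-injective L (sub-⊕ s (combination-in w) (sub-⊝ s u))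
        (λ σ p → trans (at-⊕ (combination w) (⊝ w) σ) (trans (cong₂ _+_ (combination-at w σ p) (at-⊝ w σ)) (ℚₚ.+-inverseʳ (at w σ)))))) (⊕-identityˡ w))

  Image : (φs : Vec (Vec ℚ n) m) → (Λ n → Set) → Λ m → Set
  Image φs V w = ∃ λ v → V v × coords φs v ≡ w

  image-subspace : (φs : Vec (Vec ℚ n) m) {V : Λ n → Set} → Subspace V → Subspace (Image φs V)
  image-subspace φs s = record
    { sub-𝟎 = 𝟎 , sub-𝟎 s , lin-𝟎 (coords-linear φs)
    ; sub-⊕ = λ (u , p , a) (v , q , b) → u ⊕ v , sub-⊕ s p q , trans (lin-⊕ (coords-linear φs) u v) (cong₂ _⊕_ a b)
    ; sub-· = λ x (u , p , a) → x · u , sub-· s x p , trans (lin-· (coords-linear φs) x u) (cong (x ·_) a) }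

  Separating : Vec (Vec ℚ n) m → Set
  Separating {n} φs = ∀ {u : Λ n} → coords φs u ≡ 𝟎 → u ≡ 𝟎

  leads-lower-bound : (φs : Vec (Vec ℚ n) m) → Separating φs → (P : Subset n → Bool) {I : Subset m → Bool} → Leads (Image φs (In P)) I → count P ≤ℕ count I
  leads-lower-bound φs sep P {I} L = dimension-Λ P I (coords φs) (coords-linear φs)
    (λ {c} c∈ z → sep (leads-injective L (c , c∈ , refl) z))

  leads-upper-bound : (φs : Vec (Vec ℚ n) m) → (P : Subset n → Bool) {I : Subset m → Bool} → Leads (Image φs (In P)) I → count I ≤ℕ count P
  leads-upper-bound {n} {m} φs P {I} L = dimension-Λ I P T T-linear inj
    where
    open Reduced (image-subspace φs (sup-subspace {P = λ σ → P σ ≡ true})) L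
    v : Subset m → Λ n
    v σ = proj₁ (reduced-in σ)
    T : Λ m → Λ n
    T c = sumS (λ σ → at c σ · v σ)
    T-linear : Linear T
    T-linear = record
      { lin-⊕ = λ c d → trans (sumS-cong (λ σ → trans (cong (_· v σ) (at-⊕ c d σ)) (trans (cong (_⊗ v σ) (κ-+ (at c σ) (at d σ)))
          (solve 3 (λ x y u → (x :+ y) :* u := x :* u :+ y :* u) refl (κ (at c σ)) (κ (at d σ)) (v σ))))) (sumS-⊕ (λ σ → at c σ · v σ) (λ σ → at d σ · v σ))
      ; lin-· = λ a c → trans (sumS-cong (λ σ → trans (cong (_· v σ) (at-· a c σ)) (sym (·-· a (at c σ) (v σ))))) (sumS-· a (λ σ → at c σ · v σ)) }
    coords-T : ∀ c → coords φs (T c) ≡ combination c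
    coords-T c = trans (lin-sumS (coords-linear φs) (λ σ → at c σ · v σ)) (sumS-cong (λ σ → trans (lin-· (coords-linear φs) (at c σ) (v σ)) (cong (at c σ ·_) (proj₂ (proj₂ (reduced-in σ))))))
    T-in : ∀ c → In P (T c)
    T-in c = sub-sumS sup-subspace (λ σ → sub-· sup-subspace (at c σ) (proj₁ (proj₂ (reduced-in σ))))
    inj : ∀ {c} → In I c → (∀ τ → P τ ≡ true → at (T c) τ ≡ 0ℚ) → c ≡ 𝟎
    inj {c} c∈ z = at-ext λ σ → trans (value σ (sup c∈ σ)) (sym (at-κ 0ℚ σ))
      where
      T≡𝟎 : T c ≡ 𝟎
      T≡𝟎 = at-ext λ τ → trans (vanish τ (sup (T-in c) τ)) (sym (at-κ 0ℚ τ))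
        where
        vanish : ∀ τ → P τ ≡ true ⊎ at (T c) τ ≡ 0ℚ → at (T c) τ ≡ 0ℚ
        vanish τ (inj₁ p) = z τ p
        vanish τ (inj₂ q) = q
      value : ∀ σ → I σ ≡ true ⊎ at c σ ≡ 0ℚ → at c σ ≡ 0ℚ
      value σ (inj₂ q) = q
      value σ (inj₁ p) = trans (sym (combination-at c σ p)) (trans (cong (λ w → at w σ) (trans (sym (coords-T c)) (trans (cong (coords φs) T≡𝟎) (lin-𝟎 (coords-linear φs))))) (at-κ 0ℚ σ))

-- Changing one functional of a flag by a large multiple

module Moves where

  open Counting
  open ShiftedFamilies using (Adj; here; there)
  open Exterior
  open PolynomialMaps
  open Depth
  open LinearAlgebra
  open Leading
  open import Data.Rational using (_+_; _*_; -_; _-_; ∣_∣; _≤_; _<_)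
  open import Relation.Binary.PropositionalEquality

  open ℚSolver using () renaming (solve to qsolve; _:=_ to _:≡_; _:+_ to _+:_; _:*_ to _*:_; :-_ to -:_; con to qcon)

  private variable
    m n : ℕ

  data Pos : ℕ → Set where
    here  : Pos (suc (suc m))
    there : Pos m → Pos (suc m)

  -- Swap p σ τ: at position p the word σ reads 01 and τ reads 10; elsewhere they agree.
  data Swap : ∀ {m} → Pos m → Subset m → Subset m → Set where
    here  : ∀ {σ : Subset m} → Swap here (false ∷ true ∷ σ) (true ∷ false ∷ σ)
    there : ∀ {p b} {σ τ : Subset m} → Swap p σ τ → Swap (there p) (b ∷ σ) (b ∷ τ)

  adj⇒swap : ∀ {σ τ : Subset m} → Adj σ τ → ∃ λ p → Swap p σ τ
  adj⇒swap here = here , here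
  adj⇒swap (there a) with adj⇒swap a
  ... | p , s = there p , there s

  -- Replacing the functional φ at position p by k φ + φ′, with φ′ the next one.
  move : ℚ → Pos m → Vec (Vec ℚ n) m → Vec (Vec ℚ n) m
  move k here (φ ∷ φ′ ∷ φs) = k *v φ +v φ′ ∷ φ′ ∷ φs
  move k (there p) (φ ∷ φs) = φ ∷ move k p φs

  -- The parts `a`, `b`, `c`, `d` hold the words beginning with 00, 01, 10, 11. The new functional
  -- adds `b` to the multiple of `c`; at 11 its second summand disappears, because φ′ contracted
  -- twice is zero.
  moveΛ : ℚ → Pos m → Λ m → Λ m
  moveΛ k here ((a ∥ b) ∥ (c ∥ d)) = (a ∥ b) ∥ (k · c ⊕ b ∥ k · d)
  moveΛ k (there p) (u ∥ v) = moveΛ k p u ∥ moveΛ k p v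

  coords-move : ∀ k (p : Pos m) (φs : Vec (Vec ℚ n) m) u → coords (move k p φs) u ≡ moveΛ k p (coords φs u)
  coords-move k here (φ ∷ φ′ ∷ φs) u = cong (coords (φ′ ∷ φs) u ∥_) (cong₂ _∥_
    (trans (cong (coords φs) (step u)) (trans (lin-⊕ (coords-linear φs) _ _) (cong (_⊕ coords φs (i φ′ u)) (lin-· (coords-linear φs) k (i φ u)))))
    (trans (cong (λ z → coords φs (i φ′ z)) (step u)) (trans (cong (coords φs) (trans (lin-⊕ (i-linear φ′) _ _)
      (trans (cong₂ _⊕_ (lin-· (i-linear φ′) k (i φ u)) (i-i φ′ u)) (⊕-identityʳ _)))) (lin-· (coords-linear φs) k (i φ′ (i φ u))))))
    where
    step : ∀ u → i (k *v φ +v φ′) u ≡ k · i φ u ⊕ i φ′ u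
    step u = trans (i-+ (k *v φ) φ′ u) (cong (_⊕ i φ′ u) (i-* k φ u))
  coords-move k (there p) (φ ∷ φs) u = cong₂ _∥_ (coords-move k p φs u) (coords-move k p φs (i φ u))

  moveΛ-injective : ∀ {k} → k ≢ 0ℚ → (p : Pos m) {w : Λ m} → moveΛ k p w ≡ 𝟎 → w ≡ 𝟎
  moveΛ-injective {k = k} k≢0 here {(a ∥ b) ∥ (c ∥ d)} z = cong₂ _∥_ (∥-injectiveˡ z) (cong₂ _∥_
    (·-cancel k≢0 (trans (sym (⊕-identityʳ _)) (trans (cong (k · c ⊕_) (sym (∥-injectiveʳ (∥-injectiveˡ z)))) (∥-injectiveˡ (∥-injectiveʳ z)))))
    (·-cancel k≢0 (∥-injectiveʳ (∥-injectiveʳ z))))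
  moveΛ-injective k≢0 (there p) {u ∥ v} z = cong₂ _∥_ (moveΛ-injective k≢0 p (∥-injectiveˡ z)) (moveΛ-injective k≢0 p (∥-injectiveʳ z))

  at-move : (p : Pos m) (τ : Subset m) →
    (∃ λ σ → Swap p σ τ × (∀ k w → at (moveΛ k p w) τ ≡ k * at w τ + at w σ)) ⊎
    (∀ {k w} → k ≢ 0ℚ → at (moveΛ k p w) τ ≡ 0ℚ → at w τ ≡ 0ℚ)
  at-move here (true ∷ false ∷ s) = inj₁ (false ∷ true ∷ s , here ,
    λ { k ((a ∥ b) ∥ (c ∥ d)) → trans (at-⊕ (k · c) b s) (cong (_+ at b s) (at-· k c s)) })
  at-move here (true ∷ true ∷ s) = inj₂ λ { {k} {(a ∥ b) ∥ (c ∥ d)} k≢0 z → cancel k≢0 (trans (sym (at-· k d s)) z) }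
    where
    cancel : ∀ {k x} → k ≢ 0ℚ → k * x ≡ 0ℚ → x ≡ 0ℚ
    cancel {k} {x} k≢0 z with x ℚₚ.≟ 0ℚ
    ... | yes p = p
    ... | no x≢0 = ⊥-elim (*-nonzero k≢0 x≢0 z)
  at-move here (false ∷ b ∷ s) = inj₂ λ { {k} {(a ∥ b) ∥ (c ∥ d)} _ z → z }
  at-move (there p) (false ∷ τ) with at-move p τ
  ... | inj₁ (σ , sw , f) = inj₁ (false ∷ σ , there sw , λ { k (u ∥ v) → f k u })
  ... | inj₂ f = inj₂ λ { {k} {u ∥ v} k≢0 z → f k≢0 z }
  at-move (there p) (true ∷ τ) with at-move p τ
  ... | inj₁ (σ , sw , f) = inj₁ (true ∷ σ , there sw , λ { k (u ∥ v) → f k v })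
  ... | inj₂ f = inj₂ λ { {k} {u ∥ v} k≢0 z → f k≢0 z }

  swap-unique : ∀ {p} {σ σ′ τ : Subset m} → Swap p σ τ → Swap p σ′ τ → σ ≡ σ′
  swap-unique here here = refl
  swap-unique (there a) (there b) = cong (_ ∷_) (swap-unique a b)

  swap-lt : ∀ {p} {σ τ : Subset m} → Swap p σ τ → lt σ τ ≡ true
  swap-lt here = refl
  swap-lt (there {b = true} s) = swap-lt s
  swap-lt (there {b = false} s) = swap-lt s

  swap-mono : ∀ {p} {σ τ σ′ τ′ : Subset m} → Swap p σ τ → Swap p σ′ τ′ → lt τ τ′ ≡ true → lt σ σ′ ≡ true
  swap-mono here here q = q
  swap-mono (there {b = true} s) (there {b = true} s′) q = swap-mono s s′ q
  swap-mono (there {b = false} s) (there {b = false} s′) q = swap-mono s s′ q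
  swap-mono (there {b = false} s) (there {b = true} s′) q = refl

  lt-irrefl : (σ : Subset m) → lt σ σ ≡ false
  lt-irrefl [] = refl
  lt-irrefl (true ∷ σ) = lt-irrefl σ
  lt-irrefl (false ∷ σ) = lt-irrefl σ

  lt-trans : {σ τ ρ : Subset m} → lt σ τ ≡ true → lt τ ρ ≡ true → lt σ ρ ≡ true
  lt-trans {σ = []} {[]} () _
  lt-trans {σ = false ∷ σ} {false ∷ τ} {false ∷ ρ} p q = lt-trans {σ = σ} p q
  lt-trans {σ = false ∷ σ} {b ∷ τ} {true ∷ ρ} p q = refl
  lt-trans {σ = false ∷ σ} {true ∷ τ} {false ∷ ρ} p ()
  lt-trans {σ = true ∷ σ} {false ∷ τ} () q
  lt-trans {σ = true ∷ σ} {true ∷ τ} {true ∷ ρ} p q = lt-trans {σ = σ} p q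

  lt-tri : (σ τ : Subset m) → lt σ τ ≡ false → σ ≢ τ → lt τ σ ≡ true
  lt-tri [] [] _ ne = ⊥-elim (ne refl)
  lt-tri (false ∷ σ) (false ∷ τ) p ne = lt-tri σ τ p (λ e → ne (cong (false ∷_) e))
  lt-tri (true ∷ σ) (false ∷ τ) p ne = refl
  lt-tri (true ∷ σ) (true ∷ τ) p ne = lt-tri σ τ p (λ e → ne (cong (true ∷_) e))

  sumQ : (Subset m → ℚ) → ℚ
  sumQ {zero} c = c []
  sumQ {suc m} c = sumQ (λ σ → c (false ∷ σ)) + sumQ (λ σ → c (true ∷ σ))

  sumQ-mono : {c d : Subset m → ℚ} → (∀ σ → c σ ≤ d σ) → sumQ c ≤ sumQ d
  sumQ-mono {zero} f = f []
  sumQ-mono {suc m} f = ℚₚ.+-mono-≤ (sumQ-mono (λ σ → f (false ∷ σ))) (sumQ-mono (λ σ → f (true ∷ σ)))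

  sumQ-* : ∀ a (c : Subset m → ℚ) → sumQ (λ σ → a * c σ) ≡ a * sumQ c
  sumQ-* {zero} a c = refl
  sumQ-* {suc m} a c = trans (cong₂ _+_ (sumQ-* a (λ σ → c (false ∷ σ))) (sumQ-* a (λ σ → c (true ∷ σ)))) (sym (ℚₚ.*-distribˡ-+ a _ _))

  sumQ-nonneg : {c : Subset m → ℚ} → (∀ σ → 0ℚ ≤ c σ) → 0ℚ ≤ sumQ c
  sumQ-nonneg {zero} f = f []
  sumQ-nonneg {suc m} f = ℚₚ.+-mono-≤ (sumQ-nonneg (λ σ → f (false ∷ σ))) (sumQ-nonneg (λ σ → f (true ∷ σ)))

  sumQ-term : {c : Subset m → ℚ} → (∀ σ → 0ℚ ≤ c σ) → ∀ σ → c σ ≤ sumQ c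
  sumQ-term f [] = ℚₚ.≤-refl
  sumQ-term {c = c} f (false ∷ σ) = ℚₚ.≤-trans (sumQ-term (λ σ → f (false ∷ σ)) σ) (subst (_≤ sumQ (λ σ → c (false ∷ σ)) + sumQ (λ σ → c (true ∷ σ))) (ℚₚ.+-identityʳ (sumQ (λ σ → c (false ∷ σ)))) (ℚₚ.+-monoʳ-≤ (sumQ (λ σ → c (false ∷ σ))) (sumQ-nonneg (λ σ → f (true ∷ σ)))))
  sumQ-term {c = c} f (true ∷ σ) = ℚₚ.≤-trans (sumQ-term (λ σ → f (true ∷ σ)) σ) (subst (_≤ sumQ (λ σ → c (false ∷ σ)) + sumQ (λ σ → c (true ∷ σ))) (ℚₚ.+-identityˡ (sumQ (λ σ → c (true ∷ σ)))) (ℚₚ.+-monoˡ-≤ (sumQ (λ σ → c (true ∷ σ))) (sumQ-nonneg (λ σ → f (false ∷ σ)))))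

  2^ : ℕ → ℚ
  2^ zero = 1ℚ
  2^ (suc m) = 2^ m + 2^ m

  2^-nonneg : ∀ m → 0ℚ ≤ 2^ m
  2^-nonneg zero = ℚₚ.nonNegative⁻¹ 1ℚ
  2^-nonneg (suc m) = ℚₚ.+-mono-≤ (2^-nonneg m) (2^-nonneg m)

  sumQ-const : ∀ m a → sumQ {m} (λ _ → a) ≡ 2^ m * a
  sumQ-const zero a = sym (ℚₚ.*-identityˡ a)
  sumQ-const (suc m) a = trans (cong₂ _+_ (sumQ-const m a) (sumQ-const m a)) (sym (ℚₚ.*-distribʳ-+ a (2^ m) (2^ m)))

  ∣at-sumS∣ : ∀ {j} (f : Subset j → Λ m) τ → ∣ at (sumS f) τ ∣ ≤ sumQ (λ σ → ∣ at (f σ) τ ∣)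
  ∣at-sumS∣ {j = zero} f τ = ℚₚ.≤-refl
  ∣at-sumS∣ {j = suc j} f τ = ℚₚ.≤-trans (ℚₚ.≤-reflexive (cong ∣_∣ (at-⊕ (sumS (λ σ → f (false ∷ σ))) (sumS (λ σ → f (true ∷ σ))) τ)))
    (ℚₚ.≤-trans (ℚₚ.∣p+q∣≤∣p∣+∣q∣ (at (sumS (λ σ → f (false ∷ σ))) τ) (at (sumS (λ σ → f (true ∷ σ))) τ)) (ℚₚ.+-mono-≤ (∣at-sumS∣ (λ σ → f (false ∷ σ)) τ) (∣at-sumS∣ (λ σ → f (true ∷ σ)) τ)))

  *-monoˡ : ∀ {a b c} → 0ℚ ≤ c → a ≤ b → c * a ≤ c * b
  *-monoˡ {c = c} 0≤c = ℚₚ.*-monoˡ-≤-nonNeg c {{ℚ.nonNegative 0≤c}}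

  *-monoʳ : ∀ {a b c} → 0ℚ ≤ c → a ≤ b → a * c ≤ b * c
  *-monoʳ {c = c} 0≤c = ℚₚ.*-monoʳ-≤-nonNeg c {{ℚ.nonNegative 0≤c}}

  *-nonneg : ∀ {a b} → 0ℚ ≤ a → 0ℚ ≤ b → 0ℚ ≤ a * b
  *-nonneg {a} {b} p q = subst (_≤ a * b) (ℚₚ.*-zeroʳ a) (*-monoˡ p q)

  ∣∣≤0 : ∀ {a} → ∣ a ∣ ≤ 0ℚ → a ≡ 0ℚ
  ∣∣≤0 {a} p = ℚₚ.∣p∣≡0⇒p≡0 a (ℚₚ.≤-antisym p (ℚₚ.0≤∣p∣ a))

  -- A quantitative substitute for genericity: `M` bounds the entries of the reduced basis, and a
  -- multiplier that is large compared with `M` makes the leading terms dominate. The coordinates at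
  -- `I` determine elements of `U`, so `norm` is a norm on `U`.
  module Estimate {U : Λ m → Set} {I : Subset m → Bool} (s : Subspace U) (L : Leads U I) where
    open Reduced s L

    M : ℚ
    M = sumQ (λ σ → sumQ (λ τ → ∣ at (reduced σ) τ ∣))

    entry≤M : ∀ σ τ → ∣ at (reduced σ) τ ∣ ≤ M
    entry≤M σ τ = ℚₚ.≤-trans (sumQ-term (λ τ → ℚₚ.0≤∣p∣ (at (reduced σ) τ)) τ)
      (sumQ-term {c = λ σ → sumQ (λ τ → ∣ at (reduced σ) τ ∣)} (λ σ → sumQ-nonneg (λ τ → ℚₚ.0≤∣p∣ (at (reduced σ) τ))) σ)

    0≤M : 0ℚ ≤ M
    0≤M = sumQ-nonneg (λ σ → sumQ-nonneg (λ τ → ℚₚ.0≤∣p∣ (at (reduced σ) τ)))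

    norm : Λ m → ℚ
    norm w = sumQ (λ σ → if I σ then ∣ at w σ ∣ else 0ℚ)

    weight : Λ m → Subset m → ℚ
    weight w σ = if I σ then ∣ at w σ ∣ else 0ℚ

    weight-nonneg : ∀ w σ → 0ℚ ≤ weight w σ
    weight-nonneg w σ with I σ
    ... | true = ℚₚ.0≤∣p∣ (at w σ)
    ... | false = ℚₚ.≤-refl

    weight-in : ∀ w {σ} → I σ ≡ true → weight w σ ≡ ∣ at w σ ∣
    weight-in w {σ} p = cong (λ b → if b then ∣ at w σ ∣ else 0ℚ) p

    weight-out : ∀ w {σ} → I σ ≡ false → weight w σ ≡ 0ℚ
    weight-out w {σ} p = cong (λ b → if b then ∣ at w σ ∣ else 0ℚ) p

    term-bound : ∀ w σ τ {B} → ∣ at (reduced σ) τ ∣ ≤ B → ∣ at (at w σ · reduced σ) τ ∣ ≤ B * weight w σ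
    term-bound w σ τ {B} le with I σ in eq
    ... | true = ℚₚ.≤-trans (ℚₚ.≤-reflexive (trans (cong ∣_∣ (at-· (at w σ) _ τ)) (trans (ℚₚ.∣p*q∣≡∣p∣*∣q∣ (at w σ) (at (proj₁ (leads-interpolate s L (delta σ))) τ)) (ℚₚ.*-comm ∣ at w σ ∣ _)))) (*-monoʳ (ℚₚ.0≤∣p∣ (at w σ)) le)
    ... | false = ℚₚ.≤-reflexive (trans (cong ∣_∣ (trans (cong (λ z → at z τ) (a·𝟎 (at w σ))) (at-κ 0ℚ τ))) (sym (ℚₚ.*-zeroʳ B)))

    bound : ∀ {w} → U w → ∀ τ → ∣ at w τ ∣ ≤ M * norm w
    bound {w} u τ = begin
      ∣ at w τ ∣ ≡⟨ cong (λ z → ∣ at z τ ∣) (combination-id u) ⟨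
      ∣ at (combination w) τ ∣ ≤⟨ ∣at-sumS∣ (λ σ → at w σ · reduced σ) τ ⟩
      sumQ (λ σ → ∣ at (at w σ · reduced σ) τ ∣) ≤⟨ sumQ-mono (λ σ → term-bound w σ τ (entry≤M σ τ)) ⟩
      sumQ (λ σ → M * weight w σ) ≡⟨ sumQ-* M (weight w) ⟩
      M * norm w ∎
      where open ℚₚ.≤-Reasoning

    norm-zero : ∀ {w} → U w → norm w ≤ 0ℚ → w ≡ 𝟎
    norm-zero {w} u le = leads-injective L u λ σ p → ∣∣≤0 (ℚₚ.≤-trans (subst (λ b → (if b then ∣ at w σ ∣ else 0ℚ) ≤ norm w) p (sumQ-term (weight-nonneg w) σ)) le)

    -- If k is large, the moved coordinates at I still determine the elements of U.
    module _ {k : ℚ} (p : Pos m) (big : 2^ m * M + 1ℚ ≤ k) where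

      private
        0<k : 0ℚ < k
        0<k = ℚₚ.<-≤-trans (ℚₚ.positive⁻¹ 1ℚ) (ℚₚ.≤-trans (subst (_≤ 2^ m * M + 1ℚ) (ℚₚ.+-identityˡ 1ℚ) (ℚₚ.+-monoˡ-≤ 1ℚ (*-nonneg (2^-nonneg m) 0≤M))) big)

      shrink : ∀ {X C} → 0ℚ ≤ X → C + 1ℚ ≤ k → k * X ≤ C * X → X ≤ 0ℚ
      shrink {X} {C} 0≤X C<k le = subst₂ _≤_ (qsolve 2 (λ c x → -: (c *: x) +: (c *: x +: x) :≡ x) refl C X) (ℚₚ.+-inverseˡ (C * X))
        (ℚₚ.+-monoʳ-≤ (- (C * X)) (ℚₚ.≤-trans (ℚₚ.≤-reflexive (trans (cong (C * X +_) (sym (ℚₚ.*-identityˡ X))) (sym (ℚₚ.*-distribʳ-+ X C 1ℚ)))) (ℚₚ.≤-trans (*-monoʳ 0≤X C<k) le)))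

      k≢0 : k ≢ 0ℚ
      k≢0 eq = ℚₚ.<⇒≢ 0<k (sym eq)

      k*∣∣ : ∀ {a b} → k * a + b ≡ 0ℚ → k * ∣ a ∣ ≡ ∣ b ∣
      k*∣∣ {a} {b} z = trans (cong (_* ∣ a ∣) (sym (ℚₚ.0≤p⇒∣p∣≡p (ℚₚ.<⇒≤ 0<k)))) (trans (sym (ℚₚ.∣p*q∣≡∣p∣*∣q∣ k a))
        (trans (cong ∣_∣ (trans (qsolve 2 (λ x y → x :≡ (x +: y) +: -: y) refl (k * a) b) (trans (cong (_+ - b) z) (ℚₚ.+-identityˡ (- b))))) (ℚₚ.∣-p∣≡∣p∣ b)))

      moved-bound : ∀ {w} → U w → ∀ σ → at (moveΛ k p w) σ ≡ 0ℚ → k * ∣ at w σ ∣ ≤ M * norm w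
      moved-bound {w} u σ z = go (at-move p σ)
        where
        go : (∃ λ σ′ → Swap p σ′ σ × (∀ k w → at (moveΛ k p w) σ ≡ k * at w σ + at w σ′)) ⊎ (∀ {k w} → k ≢ 0ℚ → at (moveΛ k p w) σ ≡ 0ℚ → at w σ ≡ 0ℚ) → k * ∣ at w σ ∣ ≤ M * norm w
        go (inj₁ (σ′ , _ , f)) = ℚₚ.≤-trans (ℚₚ.≤-reflexive (k*∣∣ (trans (sym (f k w)) z))) (bound u σ′)
        go (inj₂ f) = subst (_≤ M * norm w) (sym (trans (cong (λ y → k * ∣ y ∣) (f k≢0 z)) (ℚₚ.*-zeroʳ k))) (*-nonneg 0≤M (sumQ-nonneg (weight-nonneg w)))

      -- If the moved coordinate at σ is zero, then k times the old one is at most M times the norm.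
      -- Summed over at most 2^m words, k times the norm is at most 2^m M times the norm, which
      -- forces the norm to be zero.
      still-determined : ∀ {w} → U w → (∀ σ → I σ ≡ true → at (moveΛ k p w) σ ≡ 0ℚ) → w ≡ 𝟎
      still-determined {w} u z = norm-zero u (shrink {norm w} {2^ m * M} (sumQ-nonneg (weight-nonneg w)) big (begin
        k * norm w ≡⟨ sumQ-* k (weight w) ⟨
        sumQ (λ σ → k * weight w σ) ≤⟨ sumQ-mono each ⟩
        sumQ {m} (λ _ → M * norm w) ≡⟨ sumQ-const m _ ⟩
        2^ m * (M * norm w) ≡⟨ ℚₚ.*-assoc (2^ m) M (norm w) ⟨
        2^ m * M * norm w ∎))
        where
        open ℚₚ.≤-Reasoning
        each : ∀ σ → k * weight w σ ≤ M * norm w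
        each σ with I σ in eq
        ... | true = moved-bound u σ (z σ eq)
        ... | false = subst (_≤ M * norm w) (sym (ℚₚ.*-zeroʳ k)) (*-nonneg 0≤M (sumQ-nonneg (weight-nonneg w)))

      -- One may even exchange σ ∈ I for the larger word τ ∉ I.
      module _ {σ τ : Subset m} (sw : Swap p σ τ) (σ∈ : I σ ≡ true) (τ∉ : I τ ≡ false) (bigger : 2^ m * (M * (1ℚ + M * M)) + 1ℚ ≤ k) where

        -- Subtracting a multiple of the reduced vector of `σ` clears the coordinate at `σ` and
        -- keeps the others in `I`; the norm of the result measures `w` on `I` without `σ`.
        rest : Λ m → Λ m
        rest w = w ⊕ (- at w σ) · reduced σ

        rest-in : ∀ {w} → U w → U (rest w)
        rest-in {w} u = sub-⊕ s u (sub-· s (- at w σ) (reduced-in σ))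

        at-rest : ∀ w ρ → at (rest w) ρ ≡ at w ρ + - at w σ * at (reduced σ) ρ
        at-rest w ρ = trans (at-⊕ w _ ρ) (cong (at w ρ +_) (at-· (- at w σ) (reduced σ) ρ))

        at-rest-σ : ∀ w → at (rest w) σ ≡ 0ℚ
        at-rest-σ w = trans (at-rest w σ) (trans (cong (λ z → at w σ + - at w σ * z) (trans (reduced-at σ σ σ∈ σ∈) (at-e-same σ)))
          (trans (cong (at w σ +_) (ℚₚ.*-identityʳ (- at w σ))) (ℚₚ.+-inverseʳ (at w σ))))

        at-rest-I : ∀ w {ρ} → I ρ ≡ true → σ ≢ ρ → at (rest w) ρ ≡ at w ρ
        at-rest-I w {ρ} j ne = trans (at-rest w ρ) (trans (cong (λ z → at w ρ + - at w σ * z) (trans (reduced-at σ ρ σ∈ j) (at-e-other ne)))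
          (trans (cong (at w ρ +_) (ℚₚ.*-zeroʳ (- at w σ))) (ℚₚ.+-identityʳ (at w ρ))))

        reduced-above : ∀ {λ′ ρ} → I λ′ ≡ true → lt λ′ ρ ≡ true → at (reduced λ′) ρ ≡ 0ℚ
        reduced-above {λ′} {ρ} j less = leads-vanish L ρ (reduced-in λ′)
          (λ σ′ p q → trans (reduced-at λ′ σ′ j p) (at-e-other {σ = λ′} {σ′} λ { refl → true≢false less q })) ρ (lt-irrefl ρ)

        T₁ : Λ m → ℚ
        T₁ w = norm (rest w)

        0≤T₁ : ∀ w → 0ℚ ≤ T₁ w
        0≤T₁ w = sumQ-nonneg (weight-nonneg (rest w))

        exchange : ∀ {w} → U w → (∀ ρ → I ρ ≡ true → σ ≢ ρ → at (moveΛ k p w) ρ ≡ 0ℚ) → at (moveΛ k p w) τ ≡ 0ℚ → w ≡ 𝟎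
        exchange {w} u z zτ = begin-≡
          where
          open ℚₚ.≤-Reasoning
          -- The swap partner of `ρ` lies above `σ`, where the reduced vector of `σ` is zero. There
          -- `w` and `rest w` agree, so the bound involves `T₁` instead of the full norm.
          above : ∀ ρ → I ρ ≡ true → lt τ ρ ≡ true → k * ∣ at w ρ ∣ ≤ M * T₁ w
          above ρ j less = go (at-move p ρ)
            where
            ne : σ ≢ ρ
            ne refl = true≢false (lt-trans {σ = σ} {τ} {σ} (swap-lt sw) less) (lt-irrefl σ)
            go : (∃ λ σ′ → Swap p σ′ ρ × (∀ k w → at (moveΛ k p w) ρ ≡ k * at w ρ + at w σ′)) ⊎ (∀ {k w} → k ≢ 0ℚ → at (moveΛ k p w) ρ ≡ 0ℚ → at w ρ ≡ 0ℚ) → k * ∣ at w ρ ∣ ≤ M * T₁ w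
            go (inj₂ f) = subst (_≤ M * T₁ w) (sym (trans (cong (λ y → k * ∣ y ∣) (f k≢0 (z ρ j ne))) (ℚₚ.*-zeroʳ k))) (*-nonneg 0≤M (0≤T₁ w))
            go (inj₁ (ρ′ , sw′ , f)) = begin
              k * ∣ at w ρ ∣ ≡⟨ k*∣∣ (trans (sym (f k w)) (z ρ j ne)) ⟩
              ∣ at w ρ′ ∣ ≡⟨ cong ∣_∣ (sym (trans (at-rest w ρ′) (trans (cong (λ y → at w ρ′ + - at w σ * y) (reduced-above σ∈ (swap-mono sw sw′ less))) (trans (cong (at w ρ′ +_) (ℚₚ.*-zeroʳ (- at w σ))) (ℚₚ.+-identityʳ (at w ρ′)))))) ⟩
              ∣ at (rest w) ρ′ ∣ ≤⟨ bound (rest-in u) ρ′ ⟩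
              M * T₁ w ∎
          -- The vanishing moved coordinate at `τ` equates the entry at `σ`, in absolute value, with
          -- k times the entry at `τ`. Expand the latter in reduced vectors: only those with leading
          -- word above `τ` contribute, and `above` bounds their coefficients.
          at-σ : ∣ at w σ ∣ ≤ M * M * T₁ w
          at-σ = go (at-move p τ)
            where
            go : (∃ λ σ′ → Swap p σ′ τ × (∀ k w → at (moveΛ k p w) τ ≡ k * at w τ + at w σ′)) ⊎ (∀ {k w} → k ≢ 0ℚ → at (moveΛ k p w) τ ≡ 0ℚ → at w τ ≡ 0ℚ) → ∣ at w σ ∣ ≤ M * M * T₁ w
            -- This alternative is impossible at a word reading 10 at the position: e τ - e σ moved
            -- with k = 1 has coordinate 0 at `τ`, but coordinate 1 before.
            go (inj₂ f) = ⊥-elim (no-swap (f {1ℚ} {e τ ⊕ (- 1ℚ) · e σ} (λ ()) (moved-zero (at-move p τ))))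
              where
              τ≢σ : σ ≢ τ
              τ≢σ refl = true≢false σ∈ τ∉
              value : at (e τ ⊕ (- 1ℚ) · e σ) τ ≡ 1ℚ
              value = trans (at-⊕ (e τ) _ τ) (trans (cong₂ _+_ (at-e-same τ) (trans (at-· (- 1ℚ) (e σ) τ) (cong (- 1ℚ *_) (at-e-other τ≢σ)))) refl)
              no-swap : at (e τ ⊕ (- 1ℚ) · e σ) τ ≡ 0ℚ → ⊥
              no-swap q with trans (sym value) q
              ... | ()
              moved-zero : (∃ λ σ′ → Swap p σ′ τ × (∀ k w → at (moveΛ k p w) τ ≡ k * at w τ + at w σ′)) ⊎ (∀ {k w} → k ≢ 0ℚ → at (moveΛ k p w) τ ≡ 0ℚ → at w τ ≡ 0ℚ) → at (moveΛ 1ℚ p (e τ ⊕ (- 1ℚ) · e σ)) τ ≡ 0ℚ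
              moved-zero _ = trans (at-swap sw (e τ ⊕ (- 1ℚ) · e σ)) (trans (cong₂ (λ x y → 1ℚ * x + y) value
                  (trans (at-⊕ (e τ) _ σ) (cong₂ _+_ (at-e-other (λ q → τ≢σ (sym q))) (trans (at-· (- 1ℚ) (e σ) σ) (cong (- 1ℚ *_) (at-e-same σ)))))) refl)
                where
                at-swap : ∀ {m} {p : Pos m} {σ τ} → Swap p σ τ → ∀ w → at (moveΛ 1ℚ p w) τ ≡ 1ℚ * at w τ + at w σ
                at-swap (here {σ = s}) ((a ∥ b) ∥ (c ∥ d)) = trans (at-⊕ (1ℚ · c) b s) (cong (_+ at b s) (at-· 1ℚ c s))
                at-swap (there {b = true} sw) (u ∥ v) = at-swap sw v
                at-swap (there {b = false} sw) (u ∥ v) = at-swap sw u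
            go (inj₁ (σ′ , sw′ , f)) rewrite swap-unique sw′ sw = begin
              ∣ at w σ ∣ ≡⟨ k*∣∣ (trans (sym (f k w)) zτ) ⟨
              k * ∣ at w τ ∣ ≡⟨ cong (λ y → k * ∣ at y τ ∣) (combination-id u) ⟨
              k * ∣ at (combination w) τ ∣ ≤⟨ *-monoˡ (ℚₚ.<⇒≤ 0<k) (∣at-sumS∣ (λ ρ → at w ρ · reduced ρ) τ) ⟩
              k * sumQ (λ ρ → ∣ at (at w ρ · reduced ρ) τ ∣) ≡⟨ sumQ-* k (λ ρ → ∣ at (at w ρ · reduced ρ) τ ∣) ⟨
              sumQ (λ ρ → k * ∣ at (at w ρ · reduced ρ) τ ∣) ≤⟨ sumQ-mono each ⟩
              sumQ (λ ρ → (M * T₁ w) * ∣ at (reduced ρ) τ ∣) ≡⟨ sumQ-* (M * T₁ w) (λ ρ → ∣ at (reduced ρ) τ ∣) ⟩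
              (M * T₁ w) * sumQ (λ ρ → ∣ at (reduced ρ) τ ∣) ≤⟨ *-monoˡ (*-nonneg 0≤M (0≤T₁ w)) (sumQ-mono (λ ρ → sumQ-term (λ τ → ℚₚ.0≤∣p∣ (at (reduced ρ) τ)) τ)) ⟩
              (M * T₁ w) * M ≡⟨ qsolve 2 (λ m t → (m *: t) *: m :≡ (m *: m) *: t) refl M (T₁ w) ⟩
              M * M * T₁ w ∎
              where
              each : ∀ ρ → k * ∣ at (at w ρ · reduced ρ) τ ∣ ≤ (M * T₁ w) * ∣ at (reduced ρ) τ ∣
              each ρ = subst (_≤ (M * T₁ w) * ∣ at (reduced ρ) τ ∣) (sym (trans (cong (k *_) (trans (cong ∣_∣ (at-· (at w ρ) (reduced ρ) τ)) (ℚₚ.∣p*q∣≡∣p∣*∣q∣ (at w ρ) (at (reduced ρ) τ)))) (sym (ℚₚ.*-assoc k _ _)))) (cases (bool-cases (I ρ)) (bool-cases (lt τ ρ)))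
                where
                vanishing : at (reduced ρ) τ ≡ 0ℚ → k * ∣ at w ρ ∣ * ∣ at (reduced ρ) τ ∣ ≤ (M * T₁ w) * ∣ at (reduced ρ) τ ∣
                vanishing q rewrite q = ℚₚ.≤-reflexive (trans (ℚₚ.*-zeroʳ (k * ∣ at w ρ ∣)) (sym (ℚₚ.*-zeroʳ (M * T₁ w))))
                cases : I ρ ≡ true ⊎ I ρ ≡ false → lt τ ρ ≡ true ⊎ lt τ ρ ≡ false → k * ∣ at w ρ ∣ * ∣ at (reduced ρ) τ ∣ ≤ (M * T₁ w) * ∣ at (reduced ρ) τ ∣
                cases (inj₁ j) (inj₁ less) = *-monoʳ (ℚₚ.0≤∣p∣ (at (reduced ρ) τ)) (above ρ j less)
                cases (inj₁ j) (inj₂ nless) = vanishing (reduced-above j (lt-tri τ ρ nless λ { refl → true≢false j τ∉ }))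
                cases (inj₂ nj) _ = vanishing (trans (cong (λ y → at y τ) (reduced-zero ρ nj)) (at-κ 0ℚ τ))
          norm≤ : norm w ≤ (1ℚ + M * M) * T₁ w
          norm≤ = begin
            norm w ≤⟨ split ⟩
            T₁ w + ∣ at w σ ∣ ≤⟨ ℚₚ.+-monoʳ-≤ (T₁ w) at-σ ⟩
            T₁ w + M * M * T₁ w ≡⟨ trans (cong (_+ M * M * T₁ w) (sym (ℚₚ.*-identityˡ (T₁ w)))) (sym (ℚₚ.*-distribʳ-+ (T₁ w) 1ℚ (M * M))) ⟩
            (1ℚ + M * M) * T₁ w ∎
            where
            point : Subset m → ℚ
            point ρ = at (e σ) ρ * ∣ at w σ ∣
            sum-point : sumQ point ≡ ∣ at w σ ∣
            sum-point = go σ ∣ at w σ ∣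
              where
              zeros : ∀ {j} a → sumQ {j} (λ ρ → at (𝟎 {j}) ρ * a) ≡ 0ℚ
              zeros {zero} a = ℚₚ.*-zeroˡ a
              zeros {suc j} a = trans (cong₂ _+_ (zeros {j} a) (zeros {j} a)) (ℚₚ.+-identityˡ 0ℚ)
              go : ∀ {j} (σ : Subset j) a → sumQ (λ ρ → at (e σ) ρ * a) ≡ a
              go [] a = ℚₚ.*-identityˡ a
              go {suc j} (false ∷ σ) a = trans (cong₂ _+_ (go σ a) (zeros {j} a)) (ℚₚ.+-identityʳ a)
              go {suc j} (true ∷ σ) a = trans (cong₂ _+_ (zeros {j} a) (go σ a)) (ℚₚ.+-identityˡ a)
            sum-+ : ∀ {j} (c d : Subset j → ℚ) → sumQ (λ ρ → c ρ + d ρ) ≡ sumQ c + sumQ d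
            sum-+ {zero} c d = refl
            sum-+ {suc j} c d = trans (cong₂ _+_ (sum-+ (λ ρ → c (false ∷ ρ)) (λ ρ → d (false ∷ ρ))) (sum-+ (λ ρ → c (true ∷ ρ)) (λ ρ → d (true ∷ ρ))))
              (qsolve 4 (λ a b c d → (a +: b) +: (c +: d) :≡ (a +: c) +: (b +: d)) refl (sumQ (λ ρ → c (false ∷ ρ))) (sumQ (λ ρ → d (false ∷ ρ))) (sumQ (λ ρ → c (true ∷ ρ))) (sumQ (λ ρ → d (true ∷ ρ))))
            split : norm w ≤ T₁ w + ∣ at w σ ∣
            split = begin
              norm w ≤⟨ sumQ-mono pointwise ⟩
              sumQ (λ ρ → weight (rest w) ρ + point ρ) ≡⟨ sum-+ (weight (rest w)) point ⟩
              T₁ w + sumQ point ≡⟨ cong (T₁ w +_) sum-point ⟩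
              T₁ w + ∣ at w σ ∣ ∎
              where
              point-nonneg : ∀ ρ → 0ℚ ≤ point ρ
              point-nonneg ρ with σ ≟S ρ
              ... | yes refl = subst (0ℚ ≤_) (sym (trans (cong (_* ∣ at w σ ∣) (at-e-same σ)) (ℚₚ.*-identityˡ ∣ at w σ ∣))) (ℚₚ.0≤∣p∣ (at w σ))
              ... | no ne = ℚₚ.≤-reflexive (sym (trans (cong (_* ∣ at w σ ∣) (at-e-other ne)) (ℚₚ.*-zeroˡ ∣ at w σ ∣)))
              pointwise : ∀ ρ → weight w ρ ≤ weight (rest w) ρ + point ρ
              pointwise ρ = cases (bool-cases (I ρ)) (σ ≟S ρ)
                where
                cases : I ρ ≡ true ⊎ I ρ ≡ false → Dec (σ ≡ ρ) → weight w ρ ≤ weight (rest w) ρ + point ρ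
                cases (inj₂ nj) _ = subst₂ _≤_ (sym (weight-out w nj)) (sym (trans (cong (_+ point ρ) (weight-out (rest w) nj)) (ℚₚ.+-identityˡ (point ρ)))) (point-nonneg ρ)
                cases (inj₁ j) (yes refl) = ℚₚ.≤-reflexive (trans (weight-in w j) (sym (trans (cong₂ _+_ (trans (weight-in (rest w) j) (cong ∣_∣ (at-rest-σ w)))
                  (trans (cong (_* ∣ at w σ ∣) (at-e-same σ)) (ℚₚ.*-identityˡ ∣ at w σ ∣))) (ℚₚ.+-identityˡ ∣ at w σ ∣))))
                cases (inj₁ j) (no ne) = ℚₚ.≤-trans (ℚₚ.≤-reflexive (trans (weight-in w j) (trans (cong ∣_∣ (sym (at-rest-I w j ne))) (sym (trans (ℚₚ.+-identityʳ (weight (rest w) ρ)) (weight-in (rest w) j)))))) (ℚₚ.+-monoʳ-≤ (weight (rest w) ρ) (point-nonneg ρ))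
          -- Origin of the second threshold: 1 + M² compares the norm with `T₁`, a factor M comes
          -- from `moved-bound`, and 2^m counts the words.
          T₁≤0 : T₁ w ≤ 0ℚ
          T₁≤0 = shrink {T₁ w} {2^ m * (M * (1ℚ + M * M))} (0≤T₁ w) bigger (begin
            k * T₁ w ≡⟨ sumQ-* k (weight (rest w)) ⟨
            sumQ (λ ρ → k * weight (rest w) ρ) ≤⟨ sumQ-mono each ⟩
            sumQ {m} (λ _ → M * ((1ℚ + M * M) * T₁ w)) ≡⟨ sumQ-const m _ ⟩
            2^ m * (M * ((1ℚ + M * M) * T₁ w)) ≡⟨ qsolve 4 (λ a b c d → a *: (b *: (c *: d)) :≡ (a *: (b *: c)) *: d) refl (2^ m) M (1ℚ + M * M) (T₁ w) ⟩
            2^ m * (M * (1ℚ + M * M)) * T₁ w ∎)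
            where
            each : ∀ ρ → k * weight (rest w) ρ ≤ M * ((1ℚ + M * M) * T₁ w)
            each ρ = cases (bool-cases (I ρ)) (σ ≟S ρ)
              where
              0≤rhs : 0ℚ ≤ M * ((1ℚ + M * M) * T₁ w)
              0≤rhs = *-nonneg 0≤M (*-nonneg (ℚₚ.+-mono-≤ (ℚₚ.nonNegative⁻¹ 1ℚ) (*-nonneg 0≤M 0≤M)) (0≤T₁ w))
              cases : I ρ ≡ true ⊎ I ρ ≡ false → Dec (σ ≡ ρ) → k * weight (rest w) ρ ≤ M * ((1ℚ + M * M) * T₁ w)
              cases (inj₂ nj) _ = subst (_≤ M * ((1ℚ + M * M) * T₁ w)) (sym (trans (cong (k *_) (weight-out (rest w) nj)) (ℚₚ.*-zeroʳ k))) 0≤rhs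
              cases (inj₁ j) (yes refl) = subst (_≤ M * ((1ℚ + M * M) * T₁ w)) (sym (trans (cong (k *_) (trans (weight-in (rest w) j) (cong ∣_∣ (at-rest-σ w)))) (ℚₚ.*-zeroʳ k))) 0≤rhs
              cases (inj₁ j) (no ne) = ℚₚ.≤-trans (ℚₚ.≤-reflexive (cong (k *_) (trans (weight-in (rest w) j) (cong ∣_∣ (at-rest-I w j ne)))))
                (ℚₚ.≤-trans (moved-bound u ρ (z ρ j ne)) (*-monoˡ 0≤M norm≤))
          begin-≡ : w ≡ 𝟎
          begin-≡ = norm-zero u (ℚₚ.≤-trans norm≤ (subst ((1ℚ + M * M) * T₁ w ≤_) (ℚₚ.*-zeroʳ (1ℚ + M * M)) (*-monoˡ (ℚₚ.+-mono-≤ (ℚₚ.nonNegative⁻¹ 1ℚ) (*-nonneg 0≤M 0≤M)) T₁≤0)))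

-- Making several families of leading words shifted at once

module Shifting where

  open Counting
  open ShiftedFamilies using (Adj; AdjClosed; here; there)
  open Exterior
  open PolynomialMaps
  open Depth
  open LinearAlgebra
  open Leading
  open Moves
  open import Data.Nat using () renaming (_+_ to _+ℕ_; _≤_ to _≤ℕ_; _<_ to _<ℕ_)
  open import Data.Rational using (_+_; _*_; _≤_)
  open import Relation.Binary.PropositionalEquality

  private variable
    m n : ℕ

  below : Subset m → (Subset m → Bool) → Subset m → Bool
  below ρ I σ = I σ ∧ lt σ ρ

  moveΛ-𝟎 : ∀ k (p : Pos m) → moveΛ k p 𝟎 ≡ 𝟎
  moveΛ-𝟎 k here = cong (𝟎 ∥_) (cong₂ _∥_ (trans (cong (_⊕ 𝟎) (a·𝟎 k)) (⊕-identityˡ 𝟎)) (a·𝟎 k))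
  moveΛ-𝟎 k (there p) = cong₂ _∥_ (moveΛ-𝟎 k p) (moveΛ-𝟎 k p)

  -- Combinations of reduced vectors with leading words below `ρ` vanish at all words not below `ρ`.
  -- So among the coordinates in `J` only those below `ρ` can distinguish them, and dimensions
  -- compare.
  leads-after-move : (φs : Vec (Vec ℚ n) m) {V : Λ n → Set} → Subspace V → ∀ k p {I′ J : Subset m → Bool} →
    Leads (Image (move k p φs) V) I′ →
    (∀ {w} → Image φs V w → (∀ τ → J τ ≡ true → at (moveΛ k p w) τ ≡ 0ℚ) → w ≡ 𝟎) →
    ∀ ρ → count (below ρ I′) ≤ℕ count (below ρ J)
  leads-after-move {n} {m} φs {V} s k p {I′} {J} L′ determined ρ = dimension-Λ (below ρ I′) (below ρ J) combination combination-linear inj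
    where
    open Reduced (image-subspace (move k p φs) s) L′
    inj : ∀ {c} → In (below ρ I′) c → (∀ τ → below ρ J τ ≡ true → at (combination c) τ ≡ 0ℚ) → c ≡ 𝟎
    inj {c} c∈ z = at-ext λ σ → trans (value σ (sup c∈ σ)) (sym (at-κ 0ℚ σ))
      where
      w′∈ = combination-in c
      v = proj₁ w′∈
      moved : moveΛ k p (coords φs v) ≡ combination c
      moved = trans (sym (coords-move k p φs v)) (proj₂ (proj₂ w′∈))
      high : ∀ σ → I′ σ ≡ true → lt σ ρ ≡ false → at (combination c) σ ≡ 0ℚ
      high σ i nl = trans (combination-at c σ i) (off (sup c∈ σ))
        where
        off : below ρ I′ σ ≡ true ⊎ at c σ ≡ 0ℚ → at c σ ≡ 0ℚ
        off (inj₁ b) = true≢false (∧-true⁻ʳ {I′ σ} b) nl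
        off (inj₂ q) = q
      zero-w : coords φs v ≡ 𝟎
      zero-w = determined (v , proj₁ (proj₂ w′∈) , refl) λ τ j → trans (cong (λ y → at y τ) moved) (cases τ j (bool-cases (lt τ ρ)))
        where
        cases : ∀ τ → J τ ≡ true → lt τ ρ ≡ true ⊎ lt τ ρ ≡ false → at (combination c) τ ≡ 0ℚ
        cases τ j (inj₁ l) = z τ (∧-true⁺ j l)
        cases τ j (inj₂ nl) = leads-vanish L′ ρ w′∈ high τ nl
      value : ∀ σ → below ρ I′ σ ≡ true ⊎ at c σ ≡ 0ℚ → at c σ ≡ 0ℚ
      value σ (inj₂ q) = q
      value σ (inj₁ b) = trans (sym (combination-at c σ (∧-true⁻ˡ b))) (trans (cong (λ y → at y σ) (trans (sym moved) (trans (cong (moveΛ k p) zero-w) (moveΛ-𝟎 k p)))) (at-κ 0ℚ σ))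

  exchanged : (Subset m → Bool) → Subset m → Subset m → Subset m → Bool
  exchanged I σ τ ρ with τ ≟S ρ
  ... | yes _ = true
  ... | no _ = remove I σ ρ

  exchanged-τ : (I : Subset m → Bool) (σ τ : Subset m) → exchanged I σ τ τ ≡ true
  exchanged-τ I σ τ with τ ≟S τ
  ... | yes _ = refl
  ... | no ne = ⊥-elim (ne refl)

  exchanged-I : (I : Subset m → Bool) (σ τ : Subset m) {ρ : Subset m} → I ρ ≡ true → σ ≢ ρ → exchanged I σ τ ρ ≡ true
  exchanged-I I σ τ {ρ} j ne with τ ≟S ρ
  ... | yes _ = refl
  ... | no _ = trans (remove-other I ne) j

  exchanged⁻ : (I : Subset m → Bool) (σ τ : Subset m) {ρ : Subset m} → exchanged I σ τ ρ ≡ true → τ ≡ ρ ⊎ (I ρ ≡ true × σ ≢ ρ)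
  exchanged⁻ I σ τ {ρ} p with τ ≟S ρ
  ... | yes eq = inj₁ eq
  ... | no _ with σ ≟S ρ
  ...   | no ne = inj₂ (p , ne)

  exchanged-below-strict : (I : Subset m → Bool) {σ τ : Subset m} → lt σ τ ≡ true → I σ ≡ true →
    count (below τ (exchanged I σ τ)) <ℕ count (below τ I)
  exchanged-below-strict I {σ} {τ} less σ∈ = count-strict sub σ (∧-true⁺ σ∈ less) (¬true⇒false λ p → bad (exchanged⁻ I σ τ (∧-true⁻ˡ p)))
    where
    sub : ∀ ρ → below τ (exchanged I σ τ) ρ ≡ true → below τ I ρ ≡ true
    sub ρ p with exchanged⁻ I σ τ {ρ} (∧-true⁻ˡ p)
    ... | inj₁ refl = true≢false (∧-true⁻ʳ {exchanged I σ τ τ} p) (lt-irrefl τ)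
    ... | inj₂ (j , _) = ∧-true⁺ j (∧-true⁻ʳ {exchanged I σ τ ρ} p)
    bad : τ ≡ σ ⊎ (I σ ≡ true × σ ≢ σ) → ⊥
    bad (inj₁ refl) = true≢false less (lt-irrefl σ)
    bad (inj₂ (_ , ne)) = ne refl

  sumℕ : (Subset m → ℕ) → ℕ
  sumℕ {zero} f = f []
  sumℕ {suc m} f = sumℕ (λ σ → f (false ∷ σ)) +ℕ sumℕ (λ σ → f (true ∷ σ))

  sumℕ-mono : {f g : Subset m → ℕ} → (∀ σ → f σ ≤ℕ g σ) → sumℕ f ≤ℕ sumℕ g
  sumℕ-mono {zero} h = h []
  sumℕ-mono {suc m} h = ℕₚ.+-mono-≤ (sumℕ-mono (λ σ → h (false ∷ σ))) (sumℕ-mono (λ σ → h (true ∷ σ)))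

  sumℕ-strict : {f g : Subset m → ℕ} → (∀ σ → f σ ≤ℕ g σ) → ∀ σ → f σ <ℕ g σ → sumℕ f <ℕ sumℕ g
  sumℕ-strict h [] s = s
  sumℕ-strict h (false ∷ σ) s = ℕₚ.+-mono-<-≤ (sumℕ-strict (λ σ → h (false ∷ σ)) σ s) (sumℕ-mono (λ σ → h (true ∷ σ)))
  sumℕ-strict h (true ∷ σ) s = ℕₚ.+-mono-≤-< (sumℕ-mono (λ σ → h (false ∷ σ))) (sumℕ-strict (λ σ → h (true ∷ σ)) σ s)

  totalℕ : ∀ {N} → (Fin N → ℕ) → ℕ
  totalℕ {zero} f = 0
  totalℕ {suc N} f = f zero +ℕ totalℕ (λ j → f (suc j))

  totalℕ-mono : ∀ {N} {f g : Fin N → ℕ} → (∀ j → f j ≤ℕ g j) → totalℕ f ≤ℕ totalℕ g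
  totalℕ-mono {zero} h = z≤n
  totalℕ-mono {suc N} h = ℕₚ.+-mono-≤ (h zero) (totalℕ-mono (λ j → h (suc j)))

  totalℕ-strict : ∀ {N} {f g : Fin N → ℕ} → (∀ j → f j ≤ℕ g j) → ∀ j → f j <ℕ g j → totalℕ f <ℕ totalℕ g
  totalℕ-strict h zero s = ℕₚ.+-mono-<-≤ s (totalℕ-mono (λ j → h (suc j)))
  totalℕ-strict h (suc j) s = ℕₚ.+-mono-≤-< (h zero) (totalℕ-strict (λ j → h (suc j)) j s)

  totalℚ : ∀ {N} → (Fin N → ℚ) → ℚ
  totalℚ {zero} f = 0ℚ
  totalℚ {suc N} f = f zero + totalℚ (λ j → f (suc j))

  totalℚ-nonneg : ∀ {N} {f : Fin N → ℚ} → (∀ j → 0ℚ ≤ f j) → 0ℚ ≤ totalℚ f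
  totalℚ-nonneg {zero} h = ℚₚ.≤-refl
  totalℚ-nonneg {suc N} h = ℚₚ.+-mono-≤ (h zero) (totalℚ-nonneg (λ j → h (suc j)))

  totalℚ-term : ∀ {N} {f : Fin N → ℚ} → (∀ j → 0ℚ ≤ f j) → ∀ j → f j ≤ totalℚ f
  totalℚ-term {f = f} h zero = subst (_≤ f zero + totalℚ (λ j → f (suc j))) (ℚₚ.+-identityʳ (f zero)) (ℚₚ.+-monoʳ-≤ (f zero) (totalℚ-nonneg (λ j → h (suc j))))
  totalℚ-term {f = f} h (suc j) = ℚₚ.≤-trans (totalℚ-term (λ j → h (suc j)) j)
    (subst (_≤ f zero + totalℚ (λ j → f (suc j))) (ℚₚ.+-identityˡ _) (ℚₚ.+-monoˡ-≤ (totalℚ (λ j → f (suc j))) (h zero)))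

  ¬¬-fin : ∀ {N a} {Q : Fin N → Set a} → (∀ j → ¬ ¬ Q j) → ¬ ¬ (∀ j → Q j)
  ¬¬-fin {zero} f = return λ ()
  ¬¬-fin {suc N} f = f zero >>= λ q → ¬¬-fin (λ j → f (suc j)) >>= λ qs → return λ { zero → q ; (suc j) → qs j }

  module _ {n m N : ℕ} (V : Fin N → Λ n → Set) (sub : ∀ j → Subspace (V j)) where

    record State : Set where
      field
        flag : Vec (Vec ℚ n) m
        separating : Separating flag
        I : Fin N → Subset m → Bool
        isLeads : ∀ j → Leads (Image flag (V j)) (I j)
    open State public

    -- The leading words of the first state lie higher, measured on every initial segment of the
    -- lexicographic order.
    _⊑_ : State → State → Set
    s ⊑ t = ∀ j ρ → count (below ρ (I s j)) ≤ℕ count (below ρ (I t j))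

    Shifted : State → Set
    Shifted s = ∀ j → AdjClosed (I s j)

    private
      measure : State → ℕ
      measure s = totalℕ (λ j → sumℕ (λ ρ → count (below ρ (I s j))))

      Violation : State → Set
      Violation s = ∃ λ j → ∃ λ p → ∃ λ σ → ∃ λ τ → Swap p σ τ × I s j σ ≡ true × I s j τ ≡ false

      next : (s : State) → Violation s → ¬ ¬ (∃ λ t → t ⊑ s × measure t <ℕ measure s)
      next s (j₀ , p , σ , τ , sw , σ∈ , τ∉) = ¬¬-fin (λ j → ¬¬-leads (Image (move k p (flag s)) (V j))) >>= λ new → return (after new)
        where
        module E (j : Fin N) = Estimate (image-subspace (flag s) (sub j)) (isLeads s j)
        K₁ K₂ : Fin N → ℚ
        K₁ j = 2^ m * E.M j + 1ℚ
        K₂ j = 2^ m * (E.M j * (1ℚ + E.M j * E.M j)) + 1ℚ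
        0≤1 : 0ℚ ≤ 1ℚ
        0≤1 = ℚₚ.nonNegative⁻¹ 1ℚ
        0≤K₁ : ∀ j → 0ℚ ≤ K₁ j
        0≤K₁ j = ℚₚ.+-mono-≤ (*-nonneg (2^-nonneg m) (E.0≤M j)) 0≤1
        0≤K₂ : ∀ j → 0ℚ ≤ K₂ j
        0≤K₂ j = ℚₚ.+-mono-≤ (*-nonneg (2^-nonneg m) (*-nonneg (E.0≤M j) (ℚₚ.+-mono-≤ 0≤1 (*-nonneg (E.0≤M j) (E.0≤M j))))) 0≤1
        k : ℚ
        -- One multiplier must exceed both thresholds for every subspace; the thresholds are
        -- nonnegative, so their sum does.
        k = totalℚ K₁ + totalℚ K₂
        big₁ : ∀ j → K₁ j ≤ k
        big₁ j = ℚₚ.≤-trans (totalℚ-term 0≤K₁ j) (subst (_≤ k) (ℚₚ.+-identityʳ (totalℚ K₁)) (ℚₚ.+-monoʳ-≤ (totalℚ K₁) (totalℚ-nonneg 0≤K₂)))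
        big₂ : ∀ j → K₂ j ≤ k
        big₂ j = ℚₚ.≤-trans (totalℚ-term 0≤K₂ j) (subst (_≤ k) (ℚₚ.+-identityˡ (totalℚ K₂)) (ℚₚ.+-monoˡ-≤ (totalℚ K₂) (totalℚ-nonneg 0≤K₁)))
        after : (∀ j → ∃ λ I′ → Leads (Image (move k p (flag s)) (V j)) I′) → ∃ λ t → t ⊑ s × measure t <ℕ measure s
        after new = t , decreasing , totalℕ-strict (λ j → sumℕ-mono (decreasing j)) j₀ (sumℕ-strict (decreasing j₀) τ strict)
          where
          t : State
          t = record
            { flag = move k p (flag s)
            ; separating = λ {u} z → separating s (moveΛ-injective (E.k≢0 j₀ p (big₁ j₀)) p (trans (sym (coords-move k p (flag s) u)) z))
            ; I = λ j → proj₁ (new j)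
            ; isLeads = λ j → proj₂ (new j) }
          decreasing : t ⊑ s
          decreasing j = leads-after-move (flag s) (sub j) k p (proj₂ (new j)) (E.still-determined j p (big₁ j))
          strict : count (below τ (I t j₀)) <ℕ count (below τ (I s j₀))
          strict = ℕₚ.≤-<-trans (leads-after-move (flag s) (sub j₀) k p (proj₂ (new j₀))
              (λ {w} u z → E.exchange j₀ p (big₁ j₀) sw σ∈ τ∉ (big₂ j₀) u (λ ρ j ne → z ρ (exchanged-I (I s j₀) σ τ j ne)) (z τ (exchanged-τ (I s j₀) σ τ))) τ)
            (exchanged-below-strict (I s j₀) (swap-lt sw) σ∈)

      shift′ : ∀ fuel s → measure s ≤ℕ fuel → ¬ ¬ (∃ λ t → t ⊑ s × Shifted t)
      shift′ fuel s le = em {A = Violation s} >>= cases fuel le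
        where
        cases : ∀ fuel → measure s ≤ℕ fuel → Dec (Violation s) → ¬ ¬ (∃ λ t → t ⊑ s × Shifted t)
        cases fuel le (no none) = return (s , (λ j ρ → ℕₚ.≤-refl) , λ j {σ} {τ} a i → closed j a i (bool-cases (I s j τ)))
          where
          closed : ∀ j {σ τ} → Adj σ τ → I s j σ ≡ true → I s j τ ≡ true ⊎ I s j τ ≡ false → I s j τ ≡ true
          closed j a i (inj₁ q) = q
          closed j a i (inj₂ q) = ⊥-elim (none (j , proj₁ (adj⇒swap a) , _ , _ , proj₂ (adj⇒swap a) , i , q))
        cases zero le (yes v) = next s v >>= λ (t , _ , lt) → ⊥-elim (ℕₚ.n≮0 (ℕₚ.<-≤-trans lt le))
        cases (suc fuel) le (yes v) = next s v >>= λ (t , t⊑s , lt) → shift′ fuel t (ℕₚ.≤-pred (ℕₚ.<-≤-trans lt le)) >>=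
          λ (r , r⊑t , sh) → return (r , (λ j ρ → ℕₚ.≤-trans (r⊑t j ρ) (t⊑s j ρ)) , sh)

    -- Termination replaces genericity: a failure of shiftedness in any family is repaired by a move
    -- that raises no count below a word and strictly lowers one, so the sum of all these counts
    -- decreases.
    shift : ∀ s → ¬ ¬ (∃ λ t → t ⊑ s × Shifted t)
    shift s = shift′ (measure s) s ℕₚ.≤-refl

-- The explicit flag of Newton polynomials

module Newton where

  open Counting
  open ShiftedFamilies using (DownClosed)
  open Exterior
  open PolynomialMaps
  open Depth
  open Exactness
  open Acyclic
  open Leading
  open import Data.Nat using () renaming (_+_ to _+ℕ_; _≤_ to _≤ℕ_)
  open import Data.Rational using (_+_; _*_; -_; _-_)
  open import Data.Vec using (map)
  open import Relation.Binary.PropositionalEquality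

  open ℚSolver using () renaming (solve to qsolve; _:=_ to _:≡_; _:+_ to _+:_; _:*_ to _*:_; :-_ to -:_)

  private variable
    m n l : ℕ

  times : Vec ℚ n → Vec ℚ n → ℚ → Vec ℚ n
  times pts g w = zipWith (λ a x → a * (x - w)) g pts

  -- The functionals g, g (X - w₀), g (X - w₀)(X - w₁), ... evaluated at the points.
  newton : Vec ℚ n → Vec ℚ n → Vec ℚ l → Vec (Vec ℚ n) l
  newton pts g [] = []
  newton pts g (w ∷ ws) = g ∷ newton pts (times pts g w) ws

  newton-zero-head : ∀ x (pts g : Vec ℚ n) (ws : Vec ℚ l) → newton (x ∷ pts) (0ℚ ∷ g) ws ≡ map (0ℚ ∷_) (newton pts g ws)
  newton-zero-head x pts g [] = refl
  newton-zero-head x pts g (w ∷ ws) = cong ((0ℚ ∷ g) ∷_)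
    (trans (cong (λ z → newton (x ∷ pts) (z ∷ times pts g w) ws) (ℚₚ.*-zeroˡ (x - w))) (newton-zero-head x pts (times pts g w) ws))

  coords-zero-head : (φs : Vec (Vec ℚ n) m) (u v : Λ n) → coords (map (0ℚ ∷_) φs) (u ∥ v) ≡ coords φs u
  coords-zero-head [] u v = refl
  coords-zero-head (φ ∷ φs) u v = cong₂ _∥_ (coords-zero-head φs u v)
    (trans (coords-zero-head φs (i φ u ⊕ 0ℚ · v) (⊝ i φ v)) (cong (coords φs) (trans (cong (i φ u ⊕_) (0·u v)) (⊕-identityʳ (i φ u)))))

  -- Every functional after the first vanishes at the first point, so the later ones see only the
  -- part of a vector off that vertex and determine it by induction. Contraction with the first
  -- functional then brings the other part within their reach.
  newton-separating : (pts g : Vec ℚ n) → (∀ {x y} → lookup pts x ≡ lookup pts y → x ≡ y) → (∀ x → lookup g x ≢ 0ℚ) →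
    Separating (newton pts g pts)
  newton-separating [] [] distinct nz {sc a} z = z
  newton-separating (x ∷ pts) (a ∷ g) distinct nz {u ∥ v} z = cong₂ _∥_ u≡𝟎 v≡𝟎
    where
    g′ = times pts g x
    rest : newton (x ∷ pts) (times (x ∷ pts) (a ∷ g) x) pts ≡ map (0ℚ ∷_) (newton pts g′ pts)
    rest = trans (cong (λ y → newton (x ∷ pts) (y ∷ g′) pts) (trans (cong (a *_) (ℚₚ.+-inverseʳ x)) (ℚₚ.*-zeroʳ a))) (newton-zero-head x pts g′ pts)
    IH : Separating (newton pts g′ pts)
    IH = newton-separating pts g′ (λ {y} {y′} eq → suc-inj (distinct {suc y} {suc y′} eq)) λ y z → *-nonzero (nz (suc y))
        (a-b≢0 {lookup pts y} {x} (λ eq → zero≢suc (distinct {zero} {suc y} (sym eq)))) (trans (sym (lookup-times pts g y)) z)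
      where
      suc-inj : ∀ {k} {y y′ : Fin k} → suc y ≡ suc y′ → y ≡ y′
      suc-inj refl = refl
      zero≢suc : ∀ {k} {y : Fin k} → zero ≡ suc y → ⊥
      zero≢suc ()
      lookup-times : ∀ {k} (pts g : Vec ℚ k) y → lookup (times pts g x) y ≡ lookup g y * (lookup pts y - x)
      lookup-times (p ∷ pts) (b ∷ g) zero = refl
      lookup-times (p ∷ pts) (b ∷ g) (suc y) = lookup-times pts g y
    u≡𝟎 : u ≡ 𝟎
    u≡𝟎 = IH (trans (sym (coords-zero-head (newton pts g′ pts) u v)) (trans (cong (λ φs → coords φs (u ∥ v)) (sym rest)) (∥-injectiveˡ z)))
    v≡𝟎 : v ≡ 𝟎
    v≡𝟎 = ·-cancel (nz zero) (IH (trans (cong (coords (newton pts g′ pts)) (trans (sym (⊕-identityˡ (a · v))) (cong (_⊕ a · v) (sym (trans (cong (i g) u≡𝟎) (lin-𝟎 (i-linear g)))))))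
      (trans (sym (coords-zero-head (newton pts g′ pts) (i g u ⊕ a · v) (⊝ i g v))) (trans (cong (λ φs → coords φs (i (a ∷ g) (u ∥ v))) (sym rest)) (∥-injectiveʳ z)))))

  -- The coefficient of the highest admissible power: 1 on the Newton polynomial of that degree and
  -- 0 on the earlier ones.
  top : Vec ℚ (suc m) → ℚ
  top (a ∷ []) = a
  top (a ∷ b ∷ q) = top (b ∷ q)

  top-form : Form {suc m} top
  top-form {zero} = record { form-+ = λ { (a ∷ []) (b ∷ []) → refl } ; form-* = λ { c (a ∷ []) → refl } }
  top-form {suc m} = record { form-+ = λ { (a ∷ q@(_ ∷ _)) (b ∷ r@(_ ∷ _)) → form-+ top-form q r } ; form-* = λ { c (a ∷ q@(_ ∷ _)) → form-* top-form c q } }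

  top-mulBy : ∀ w (q : Vec ℚ (suc m)) → top (mulBy w q) ≡ top q
  top-mulBy w (a ∷ []) = ℚₚ.+-identityʳ a
  top-mulBy w (a ∷ b ∷ q) = trans (cong (λ r → top (addHead a r)) (refl {x = mulBy w (b ∷ q)})) (trans (head-irrelevant a (- (w * b)) (addHead b (mulBy w q))) (top-mulBy w (b ∷ q)))
    where
    head-irrelevant : ∀ {k} a c (r : Vec ℚ (suc k)) → top (a + c ∷ r) ≡ top (c ∷ r)
    head-irrelevant a c (d ∷ r) = refl

  module NewtonFlag {n : ℕ} (pts : Vec ℚ (suc n)) (distinct : ∀ {x y} → lookup pts x ≡ lookup pts y → x ≡ y) where
    open AtPoints pts distinct
    open Solution pts distinct

    KillTo : Vec ℚ (suc n) → Vec ℚ l → Fin l → Λ (suc n) → Set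
    KillTo g (w ∷ ws) zero u = i g u ≡ 𝟎
    KillTo g (w ∷ ws) (suc x) u = i g u ≡ 𝟎 × KillTo (g ⋆ w) ws x u

    Solves : Vec ℚ (suc n) → Vec ℚ l → Fin l → Λ (suc n) → Λ (suc n) → Set
    Solves g (w ∷ ws) zero b c = i g b ≡ c
    Solves g (w ∷ ws) (suc x) b c = i g b ≡ 𝟎 × Solves (g ⋆ w) ws x b c

    private
      wt-const : ∀ g a → wt g (a ∷ []) ≡ a *v g
      wt-const g a = go g pts
        where
        go : ∀ {k} (g p : Vec ℚ k) → zipWith (λ b x → b * (a + x * 0ℚ)) g p ≡ a *v g
        go [] [] = refl
        go (b ∷ g) (x ∷ p) = cong₂ _∷_ (trans (cong (λ z → b * (a + z)) (ℚₚ.*-zeroʳ x)) (trans (cong (b *_) (ℚₚ.+-identityʳ a)) (ℚₚ.*-comm b a))) (go g p)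

      wt-one : ∀ g → wt g (one {m}) ≡ g
      wt-one {m} g = go g pts
        where
        ev-0 : ∀ {k} x → ev (0v {k}) x ≡ 0ℚ
        ev-0 {zero} x = refl
        ev-0 {suc k} x = trans (cong (λ z → 0ℚ + x * z) (ev-0 {k} x)) (trans (ℚₚ.+-identityˡ (x * 0ℚ)) (ℚₚ.*-zeroʳ x))
        go : ∀ {k} (g p : Vec ℚ k) → zipWith (λ b x → b * ev (one {m}) x) g p ≡ g
        go [] [] = refl
        go (b ∷ g) (x ∷ p) = cong₂ _∷_ (trans (cong (λ z → b * (1ℚ + z)) (trans (cong (x *_) (ev-0 {m} x)) (ℚₚ.*-zeroʳ x))) (ℚₚ.*-identityʳ b)) (go g p)

      wt-addHead : ∀ g s (q : Vec ℚ (suc m)) u → i (wt g (addHead s q)) u ≡ i (wt g q) u ⊕ s · i g u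
      wt-addHead {m} g s q u = trans (cong (λ r → i (wt g r) u) (addHead-+ s q)) (trans (cong (λ r → i r u) (wt-+ g q (s *v one {m}))) (trans (i-+ (wt g q) (wt g (s *v one {m})) u)
        (cong (i (wt g q) u ⊕_) (trans (cong (λ r → i r u) (wt-* g s (one {m}))) (trans (i-* s (wt g (one {m})) u) (cong (λ r → s · i r u) (wt-one {m} g)))))))

    -- The Newton polynomials up to the x-th span all polynomials with that many coefficients, by
    -- repeated division.
    kill-all : ∀ g (ws : Vec ℚ l) x {u} → KillTo g ws x u → ∀ (q : Vec ℚ (suc (toℕ x))) → i (wt g q) u ≡ 𝟎
    kill-all g (w ∷ ws) zero {u} z (a ∷ []) = trans (cong (λ r → i r u) (wt-const g a)) (trans (i-* a g u) (trans (cong (a ·_) z) (a·𝟎 a)))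
    kill-all g (w ∷ ws) (suc x) {u} (z , zs) q = trans (cong (λ r → i (wt g r) u) (divide w q)) (trans (wt-addHead g (ev q w) (mulBy w (divBy w q)) u)
      (trans (cong₂ _⊕_ (trans (cong (λ r → i r u) (sym (wt-⋆ g w (divBy w q)))) (kill-all (g ⋆ w) ws x zs (divBy w q))) (trans (cong (ev q w ·_) z) (a·𝟎 (ev q w)))) (⊕-identityˡ 𝟎)))

    solves-all : ∀ g (ws : Vec ℚ l) x {b c} → (∀ (q : Vec ℚ (suc (toℕ x))) → i (wt g q) b ≡ top q · c) → Solves g ws x b c
    solves-all g (w ∷ ws) zero {b} {c} f = trans (cong (λ r → i r b) (sym (wt-one {0} g))) (trans (f (one {0})) (1·u c))
    solves-all g (w ∷ ws) (suc x) {b} {c} f =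
      trans (cong (λ r → i r b) (sym (wt-one {suc (toℕ x)} g))) (trans (f (one {suc (toℕ x)})) (trans (cong (_· c) (top-0v {toℕ x})) (0·u c))) ,
      solves-all (g ⋆ w) ws x (λ q → trans (cong (λ r → i r b) (wt-⋆ g w q)) (trans (f (mulBy w q)) (cong (_· c) (top-mulBy w q))))
      where
      top-0v : ∀ {k} → top (1ℚ ∷ 0v {suc k}) ≡ 0ℚ
      top-0v {zero} = refl
      top-0v {suc k} = top-0v {k}

    -- Apply exactness to the cycle sending `q` to `top q · u`, which has degree 1. Its filling has
    -- degree 0, so it is a single chain `b`; evaluating at the Newton polynomials shows that the
    -- earlier functionals kill `b` and the x-th maps it to `u`.
    flag-exact : ∀ {L : Subset (suc n) → Bool} {k c} → DownClosed L → Depth≥ L k → (ws : Vec ℚ l) (x : Fin l) → c +ℕ suc (toℕ x) ≤ℕ k →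
      ∀ {u} → Chain L c u → KillTo ones ws x u → ∃ λ b → Chain L (suc c) b × Solves ones ws x b u
    flag-exact {L = L} {k} {c} down dep ws x le {u} ch kill = finish (exact (suc (toℕ x)) {p = ones} down dep le (nonvan λ {y} _ _ z → 1≢0 (trans (sym (lookup-ones y)) z))
        (mul {f = λ _ → u} top-form (con ch (λ _ → refl)) (λ _ → refl)) (λ q → trans (lin-· (i-linear (wt ones q)) (top q) u) (trans (cong (top q ·_) (kill-all ones ws x kill q)) (a·𝟎 (top q)))))
      where
      finish : Bounds {suc (toℕ x)} {L} {c} ones 0 (λ q → top q · u) → ∃ λ b → Chain L (suc c) b × Solves ones ws x b u
      finish (b , B , e) = b one , poly-value sup-subspace B one ,
        solves-all ones ws x (λ q → trans (cong (i (wt ones q)) (poly-const B one q)) (e q))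

-- Exterior shifting and the bound for intersecting families

module ExteriorShift where

  open Counting
  open ShiftedFamilies using (Add; DownClosed; Extendable; Config; ofSize; shifted-bound; here; there; add-size; ≡ᵇ-true⁺; ≡ᵇ-true⁻)
  open Exterior
  open PolynomialMaps
  open Depth
  open LinearAlgebra
  open Leading
  open Moves
  open Shifting
  open Newton
  open import Data.Fin using (fromℕ<)
  open import Data.Fin.Properties using (toℕ-fromℕ<; toℕ-injective; toℕ<n)
  open import Data.Fin.Subset using (∣_∣)
  open import Data.Fin.Subset.Properties using (∣⊥∣≡0)
  open import Data.List using ([]; _∷_)
  open import Data.List.Membership.Propositional using () renaming (_∈_ to _∈ˡ_)
  import Data.List.Relation.Unary.Any as Any
  open import Data.Nat using () renaming (_+_ to _+ℕ_; _*_ to _*ℕ_; _≤_ to _≤ℕ_; _<_ to _<ℕ_)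
  open import Data.Sum using (map₁)
  open import Data.Vec using (toList)
  open import Data.Vec.Properties using ([]≔-idempotent; []≔-lookup)
  open import Relation.Binary.PropositionalEquality

  private variable
    m n l : ℕ

  points : ∀ n → Vec ℚ n
  points zero = []
  points (suc n) = proj₁ (fresh (toList (points n))) ∷ points n

  points-distinct : ∀ n {x y} → lookup (points n) x ≡ lookup (points n) y → x ≡ y
  points-distinct (suc n) {zero} {zero} _ = refl
  points-distinct (suc n) {suc x} {suc y} eq = cong suc (points-distinct n eq)
  points-distinct (suc n) {zero} {suc y} eq = ⊥-elim (proj₂ (fresh (toList (points n))) (subst (_∈ˡ toList (points n)) (sym eq) (∈-toList (points n) y)))
    where
    ∈-toList : ∀ {k} (v : Vec ℚ k) x → lookup v x ∈ˡ toList v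
    ∈-toList (a ∷ v) zero = Any.here refl
    ∈-toList (a ∷ v) (suc x) = Any.there (∈-toList v x)
  points-distinct (suc n) {suc x} {zero} eq = sym (points-distinct (suc n) {zero} {suc x} (sym eq))

  zeros : ℕ → Subset m → Bool
  zeros zero σ = true
  zeros (suc j) [] = true
  zeros (suc j) (b ∷ σ) = not b ∧ zeros j σ

  zeros-suc : (x : Fin m) (σ : Subset m) → zeros (suc (toℕ x)) σ ≡ zeros (toℕ x) σ ∧ not (lookup σ x)
  zeros-suc zero (true ∷ σ) = refl
  zeros-suc zero (false ∷ σ) = refl
  zeros-suc (suc x) (true ∷ σ) = refl
  zeros-suc (suc x) (false ∷ σ) = zeros-suc x σ

  private
    zeros-update : (x : Fin m) (σ : Subset m) (b : Bool) → zeros (toℕ x) (σ [ x ]≔ b) ≡ zeros (toℕ x) σ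
    zeros-update zero (c ∷ σ) b = refl
    zeros-update (suc x) (c ∷ σ) b = cong (not c ∧_) (zeros-update x σ b)

  zeros-drop : (x : Fin m) (σ : Subset m) → zeros (toℕ x) σ ≡ true → zeros (suc (toℕ x)) (σ [ x ]≔ false) ≡ true
  zeros-drop x σ p = trans (zeros-suc x (σ [ x ]≔ false)) (∧-true⁺ (trans (zeros-update x σ false) p) (cong not (lookup∘update x σ false)))

  zeros-raise : (x : Fin m) (σ : Subset m) → zeros (suc (toℕ x)) σ ≡ true → zeros (toℕ x) (σ [ x ]≔ true) ≡ true
  zeros-raise x σ p = trans (zeros-update x σ true) (∧-true⁻ˡ (trans (sym (zeros-suc x σ)) p))

  zeros-∉ : (x : Fin m) (σ : Subset m) → zeros (suc (toℕ x)) σ ≡ true → lookup σ x ≡ false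
  zeros-∉ x σ p = not-true (∧-true⁻ʳ {zeros (toℕ x) σ} (trans (sym (zeros-suc x σ)) p))

  -- Chosen so that the words below it are exactly those avoiding the positions up to `x`; thus
  -- `_⊑_` compares the numbers of such words.
  threshold : Fin m → Subset m
  threshold zero = true ∷ ∅
  threshold (suc x) = false ∷ threshold x

  lt-threshold : (x : Fin m) (σ : Subset m) → lt σ (threshold x) ≡ zeros (suc (toℕ x)) σ
  lt-threshold zero (false ∷ σ) = refl
  lt-threshold zero (true ∷ σ) = lt-∅ σ
    where
    lt-∅ : ∀ {k} (σ : Subset k) → lt σ ∅ ≡ false
    lt-∅ [] = refl
    lt-∅ (true ∷ σ) = refl
    lt-∅ (false ∷ σ) = lt-∅ σ
  lt-threshold (suc x) (true ∷ σ) = refl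
  lt-threshold (suc x) (false ∷ σ) = lt-threshold x σ

  sup-coords : (φs : Vec (Vec ℚ n) m) {c : ℕ} {u : Λ n} → Sup (λ σ → ∣ σ ∣ ≡ c) u → Sup (λ σ → ∣ σ ∣ ≡ c) (coords φs u)
  sup-coords φs s = mkSup (go φs s)
    where
    go : ∀ {n m} (φs : Vec (Vec ℚ n) m) {c} {u : Λ n} → Sup (λ σ → ∣ σ ∣ ≡ c) u → ∀ σ → ∣ σ ∣ ≡ c ⊎ at (coords φs u) σ ≡ 0ℚ
    go {n} [] s [] = map₁ (trans (sym (∣⊥∣≡0 n))) (sup s ∅)
    go (φ ∷ φs) s (false ∷ σ) = go φs s σ
    go (φ ∷ φs) {zero} {u} s (true ∷ σ) = inj₂ (trans (cong (λ w → at (coords φs w) σ) vanishes) (trans (cong (λ w → at w σ) (lin-𝟎 (coords-linear φs))) (at-κ 0ℚ σ)))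
      where
      vanishes : i φ u ≡ 𝟎
      vanishes = sup-empty (λ _ ()) (sup-i φ {Q = λ _ → ⊥} (λ a q → ℕₚ.1+n≢0 (trans (sym (add-size a)) q)) s)
    go (φ ∷ φs) {suc c} s (true ∷ σ) = map₁ (cong suc) (go φs (sup-i φ (λ a q → ℕₚ.suc-injective (trans (sym (add-size a)) q)) s) σ)

  -- Every word in the support is at most the leading one, so it begins with the same zeros.
  lead-zeros : ∀ {w : Λ m} {τ} → Lead w τ → ∀ (x : Fin m) → zeros (suc (toℕ x)) τ ≡ true → ∀ (y : Fin m) → toℕ y ≤ℕ toℕ x → δ y w ≡ 𝟎
  lead-zeros (lead-t l) x () y le
  lead-zeros (lead-f refl l) x z zero le = refl
  lead-zeros (lead-f refl l) (suc x) z (suc y) (s≤s le) = cong₂ _∥_ (lead-zeros l x z y le) (trans (cong ⊝_ (lin-𝟎 (δ-linear y))) ⊝𝟎)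

  lead-raise : ∀ {v w : Λ m} {τ} → Lead w τ → ∀ x → zeros (suc (toℕ x)) τ ≡ true → δ x v ≡ w → (∀ y → toℕ y <ℕ toℕ x → δ y v ≡ 𝟎) → Lead v (τ [ x ]≔ true)
  lead-raise {v = u ∥ v} {τ = false ∷ τ} (lead-f _ l) zero z refl zs = lead-t l
  lead-raise {v = u ∥ v} {τ = false ∷ τ} (lead-f _ l) (suc x) z refl zs = lead-f (∥-injectiveˡ (zs zero (s≤s z≤n)))
    (lead-raise l x z refl (λ y le → ∥-injectiveˡ (zs (suc y) (s≤s le))))

  module _ {n : ℕ} {L : Subset (suc n) → Bool} {k : ℕ} (down : DownClosed L) (dep : Depth≥ L k) (k≤n : k ≤ℕ suc n)
    {q} (q≤k : 2 *ℕ q +ℕ 2 ≤ℕ k) {A W : Subset (suc n) → Bool}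
    (A⊆L : ∀ σ → A σ ≡ true → L σ ≡ true × ∣ σ ∣ ≡ suc q) (W⊆L : ∀ σ → W σ ≡ true → L σ ≡ true × ∣ σ ∣ ≡ q)
    (A2 : ∀ σ τ → A σ ≡ true → A τ ≡ true → 2 ≤ℕ ∣ σ ∩ τ ∣) (AW : ∀ σ τ → A σ ≡ true → W τ ≡ true → 1 ≤ℕ ∣ σ ∩ τ ∣) where

    private
      N = suc n
      pts = points N
      distinct : ∀ {x y} → lookup pts x ≡ lookup pts y → x ≡ y
      distinct = points-distinct N
      open NewtonFlag pts distinct

      -- The faces of each size form subspaces of their own beside the span of `A`; all of them have
      -- to become shifted under one and the same flag. The traces `W` join at the final flag.
      V : Fin (suc (suc N)) → Λ N → Set
      V zero = In A
      V (suc c) = In (ofSize (toℕ c) L)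

      sub : ∀ j → Subspace (V j)
      sub zero = sup-subspace
      sub (suc c) = sup-subspace

      St : Set
      St = State {m = N} V sub

      to-chain : ∀ {c u} → In (ofSize c L) u → Chain L c u
      to-chain {c} = sup-mono (λ σ p → ∧-true⁻ˡ p , ≡ᵇ-true⁻ (∧-true⁻ʳ {L σ} p))

      from-chain : ∀ {c u} → Chain L c u → In (ofSize c L) u
      from-chain = sup-mono (λ σ (p , q) → ∧-true⁺ p (≡ᵇ-true⁺ q))

      sizeF : Subset N → Fin (suc N)
      sizeF σ = fromℕ< (s≤s (∣p∣≤n σ))

      toℕ-sizeF : ∀ σ → toℕ (sizeF σ) ≡ ∣ σ ∣
      toℕ-sizeF σ = toℕ-fromℕ< (s≤s (∣p∣≤n σ))

      module _ (s : St) where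

        -- The exterior shift of `L` with respect to the flag of `s`, assembled from the subspaces
        -- of the different sizes.
        IS : Subset N → Bool
        IS σ = I s (suc (sizeF σ)) σ

        lead-size : ∀ {c u σ} → Chain L c u → Lead (coords (flag s) u) σ → ∣ σ ∣ ≡ c
        lead-size {c} {u} {σ} ch l with sup (sup-coords (flag s) (sup-mono (λ _ (_ , q) → q) ch)) σ
        ... | inj₁ eq = eq
        ... | inj₂ z = ⊥-elim (lead-nonzero l z)

        IS⁻ : ∀ {σ} → IS σ ≡ true → ∃ λ u → Chain L ∣ σ ∣ u × Lead (coords (flag s) u) σ
        IS⁻ {σ} p = unpack (leads⁻ (isLeads s (suc (sizeF σ))) p)
          where
          unpack : (∃ λ w → Image (flag s) (V (suc (sizeF σ))) w × Lead w σ) → ∃ λ u → Chain L ∣ σ ∣ u × Lead (coords (flag s) u) σ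
          unpack (_ , (u , v , refl) , l) = u , subst (λ c → Chain L c u) (toℕ-sizeF σ) (to-chain v) , l

        IS⁺ : ∀ {c u σ} → Chain L c u → Lead (coords (flag s) u) σ → IS σ ≡ true
        IS⁺ {c} {u} {σ} ch l = leads⁺ (isLeads s (suc (sizeF σ))) (u , from-chain (subst (λ c → Chain L c u) (trans (sym (lead-size ch l)) (sym (toℕ-sizeF σ))) ch) , refl) l

        IC⇒IS : ∀ c {σ} → I s (suc c) σ ≡ true → IS σ ≡ true × ∣ σ ∣ ≡ toℕ c
        IC⇒IS c {σ} p = unpack (leads⁻ (isLeads s (suc c)) p)
          where
          unpack : (∃ λ w → Image (flag s) (V (suc c)) w × Lead w σ) → IS σ ≡ true × ∣ σ ∣ ≡ toℕ c
          unpack (_ , (u , v , refl) , l) = IS⁺ (to-chain v) l , lead-size (to-chain v) l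

        IS⇒IC : ∀ c {σ} → IS σ ≡ true → ∣ σ ∣ ≡ toℕ c → I s (suc c) σ ≡ true
        IS⇒IC c {σ} p eq = subst (λ c → I s (suc c) σ ≡ true) (toℕ-injective (trans (toℕ-sizeF σ) eq)) p

        -- Contraction with a functional of the flag keeps chains in `L` and deletes the
        -- corresponding position from the leading word.
        IS-down : DownClosed IS
        IS-down {σ} {τ} a p with add⇒addAt a
        ... | x , d = unpack (IS⁻ p)
          where
          unpack : (∃ λ u → Chain L ∣ τ ∣ u × Lead (coords (flag s) u) τ) → IS σ ≡ true
          unpack (u , ch , l) = IS⁺ (chain-i down (lookup (flag s) x) (subst (λ c → Chain L c u) (add-size a) ch))
            (subst (λ w → Lead w σ) (sym (coords-δ (flag s) x u)) (lead-δ l d))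

        zmask : ℕ → ℕ → Subset N → Bool
        zmask j c σ = (IS σ ∧ (∣ σ ∣ ≡ᵇ c)) ∧ zeros j σ

        -- These counts, together with `xc`, express extendability numerically: deleting position
        -- `x` always gives `xc≤z`, and equality means that every counted word can be raised at `x`.
        z : ℕ → ℕ → ℕ
        z j c = count (zmask j c)

        xc : Fin N → ℕ → ℕ
        xc x c = count (λ σ → zmask (toℕ x) c σ ∧ lookup σ x)

        z-split : ∀ x c → z (toℕ x) c ≡ z (suc (toℕ x)) c +ℕ xc x c
        z-split x c = trans (sym (count-split (zmask (toℕ x) c) (λ σ → lookup σ x))) (trans (ℕₚ.+-comm (xc x c) _) (cong (_+ℕ xc x c) (count-cong eq)))
          where
          eq : ∀ σ → zmask (toℕ x) c σ ∧ not (lookup σ x) ≡ zmask (suc (toℕ x)) c σ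
          eq σ = trans (∧-assoc (IS σ ∧ (∣ σ ∣ ≡ᵇ c)) (zeros (toℕ x) σ) (not (lookup σ x))) (cong ((IS σ ∧ (∣ σ ∣ ≡ᵇ c)) ∧_) (sym (zeros-suc x σ)))
            where open import Data.Bool.Properties using (∧-assoc)

        zmask⁻ : ∀ {j c σ} → zmask j c σ ≡ true → IS σ ≡ true × ∣ σ ∣ ≡ c × zeros j σ ≡ true
        zmask⁻ {j} {c} {σ} p = ∧-true⁻ˡ (∧-true⁻ˡ p) , ≡ᵇ-true⁻ (∧-true⁻ʳ {IS σ} (∧-true⁻ˡ p)) , ∧-true⁻ʳ {IS σ ∧ (∣ σ ∣ ≡ᵇ c)} p

        zmask⁺ : ∀ {j c σ} → IS σ ≡ true → ∣ σ ∣ ≡ c → zeros j σ ≡ true → zmask j c σ ≡ true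
        zmask⁺ p e r = ∧-true⁺ (∧-true⁺ p (≡ᵇ-true⁺ e)) r

        xc-zero : ∀ x → xc x 0 ≡ 0
        xc-zero x = ℕₚ.n≤0⇒n≡0 (subst (count (λ σ → zmask (toℕ x) 0 σ ∧ lookup σ x) ≤ℕ_) (count-none {N} (λ _ → refl)) (count-mono {Q = λ _ → false} λ σ p →
            ⊥-elim (ℕₚ.1+n≢0 (trans (sym (add-size (addAt⇒add (addAt-remove x σ (∧-true⁻ʳ {zmask (toℕ x) 0 σ} p))))) (proj₁ (proj₂ (zmask⁻ {toℕ x} (∧-true⁻ˡ p))))))))

        drop-into : ∀ x c σ → zmask (toℕ x) (suc c) σ ∧ lookup σ x ≡ true → zmask (suc (toℕ x)) c (σ [ x ]≔ false) ≡ true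
        drop-into x c σ p = zmask⁺ {suc (toℕ x)} (IS-down (addAt⇒add d) (proj₁ zp)) (ℕₚ.suc-injective (trans (sym (add-size (addAt⇒add d))) (proj₁ (proj₂ zp)))) (zeros-drop x σ (proj₂ (proj₂ zp)))
          where
          zp = zmask⁻ {toℕ x} {suc c} {σ} (∧-true⁻ˡ p)
          d = addAt-remove x σ (∧-true⁻ʳ {zmask (toℕ x) (suc c) σ} p)

        update-injective : ∀ (x : Fin N) {σ τ : Subset N} b {c} → lookup σ x ≡ c → lookup τ x ≡ c → σ [ x ]≔ b ≡ τ [ x ]≔ b → σ ≡ τ
        update-injective x {σ} {τ} b {c} p q eq = trans (sym (back σ p)) (trans (cong (_[ x ]≔ c) eq) (back τ q))
          where
          back : ∀ ρ → lookup ρ x ≡ c → (ρ [ x ]≔ b) [ x ]≔ c ≡ ρ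
          back ρ r = trans ([]≔-idempotent ρ x) (trans (cong (ρ [ x ]≔_) (sym r)) ([]≔-lookup ρ x))

        xc≤z : ∀ x c → xc x (suc c) ≤ℕ z (suc (toℕ x)) c
        xc≤z x c = count-injection {P = λ σ → zmask (toℕ x) (suc c) σ ∧ lookup σ x} {Q = zmask (suc (toℕ x)) c} (_[ x ]≔ false) (drop-into x c)
          (λ σ τ p q → update-injective x false (∧-true⁻ʳ {zmask (toℕ x) (suc c) σ} p) (∧-true⁻ʳ {zmask (toℕ x) (suc c) τ} q))

        -- Deleting `x` is an injection between the two sets counted; by the reverse inequality it
        -- is onto, so `τ` is hit, necessarily by `τ` with `x` inserted.
        raise-from-count : ∀ x c → z (suc (toℕ x)) c ≤ℕ xc x (suc c) → ∀ {τ} → IS τ ≡ true → ∣ τ ∣ ≡ c → zeros (suc (toℕ x)) τ ≡ true → IS (τ [ x ]≔ true) ≡ true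
        raise-from-count x c le {τ} p e zr with bool-cases (IS (τ [ x ]≔ true))
        ... | inj₁ yes-it-is = yes-it-is
        ... | inj₂ not-there = ⊥-elim (ℕₚ.<-irrefl refl (ℕₚ.≤-<-trans le (ℕₚ.≤-<-trans
              (count-injection {P = λ σ → zmask (toℕ x) (suc c) σ ∧ lookup σ x} {Q = remove (zmask (suc (toℕ x)) c) τ} (_[ x ]≔ false)
                (λ σ r → trans (remove-other (zmask (suc (toℕ x)) c) (avoid σ r)) (drop-into x c σ r))
                (λ σ τ p q → update-injective x false (∧-true⁻ʳ {zmask (toℕ x) (suc c) σ} p) (∧-true⁻ʳ {zmask (toℕ x) (suc c) τ} q)))
              (count-strict (λ σ r → sub-remove σ r) τ (zmask⁺ {suc (toℕ x)} p e zr) (remove-same (zmask (suc (toℕ x)) c) τ)))))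
          where
          avoid : ∀ σ → zmask (toℕ x) (suc c) σ ∧ lookup σ x ≡ true → τ ≢ σ [ x ]≔ false
          avoid σ r refl = true≢false (subst (λ ρ → IS ρ ≡ true) (sym (trans ([]≔-idempotent σ x) (trans (cong (σ [ x ]≔_) (sym (∧-true⁻ʳ {zmask (toℕ x) (suc c) σ} r))) ([]≔-lookup σ x))))
            (proj₁ (zmask⁻ {toℕ x} {suc c} {σ} (∧-true⁻ˡ r)))) not-there
          sub-remove : ∀ σ → remove (zmask (suc (toℕ x)) c) τ σ ≡ true → zmask (suc (toℕ x)) c σ ≡ true
          sub-remove σ r with τ ≟S σ
          ... | no _ = r

        -- A dimension count: the number of leading words of a given size does not depend on the
        -- flag. This starts the comparison of two flags.
        z-zero : ∀ (c : Fin (suc N)) → z 0 (toℕ c) ≡ count (ofSize (toℕ c) L)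
        z-zero c = trans (count-cong′ (λ σ p → let (a , b , _) = zmask⁻ {0} {toℕ c} {σ} p in IS⇒IC c a b) (λ σ p → let (a , b) = IC⇒IS c p in zmask⁺ {0} a b refl))
            (ℕₚ.≤-antisym (leads-upper-bound (flag s) (ofSize (toℕ c) L) (isLeads s (suc c))) (leads-lower-bound (flag s) (separating s) (ofSize (toℕ c) L) (isLeads s (suc c))))
          where
          count-cong′ : ∀ {P Q : Subset N → Bool} → (∀ σ → P σ ≡ true → Q σ ≡ true) → (∀ σ → Q σ ≡ true → P σ ≡ true) → count P ≡ count Q
          count-cong′ f g = ℕₚ.≤-antisym (count-mono f) (count-mono g)

        z-below : ∀ (x : Fin N) (c : Fin (suc N)) → z (suc (toℕ x)) (toℕ c) ≡ count (below (threshold x) (I s (suc c)))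
        z-below x c = ℕₚ.≤-antisym
          (count-mono (λ σ p → let (a , b , d) = zmask⁻ {suc (toℕ x)} {toℕ c} {σ} p in ∧-true⁺ (IS⇒IC c a b) (trans (lt-threshold x σ) d)))
          (count-mono (λ σ p → let (a , b) = IC⇒IS c (∧-true⁻ˡ p) in zmask⁺ {suc (toℕ x)} a b (trans (sym (lt-threshold x σ)) (∧-true⁻ʳ {I s (suc c) σ} p))))

      module _ (s : St) (newton-flag : flag s ≡ newton pts ones pts) where

        private
          kill : ∀ {l} g (ws : Vec ℚ l) x {u} → (∀ y → toℕ y ≤ℕ toℕ x → i (lookup (newton pts g ws) y) u ≡ 𝟎) → KillTo g ws x u
          kill g (w ∷ ws) zero f = f zero z≤n
          kill g (w ∷ ws) (suc x) f = f zero z≤n , kill _ ws x (λ y le → f (suc y) (s≤s le))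

          solved : ∀ {l} g (ws : Vec ℚ l) x {b u} → Solves g ws x b u → (∀ y → toℕ y <ℕ toℕ x → i (lookup (newton pts g ws) y) b ≡ 𝟎) × i (lookup (newton pts g ws) x) b ≡ u
          solved g (w ∷ ws) zero e = (λ y ()) , e
          solved g (w ∷ ws) (suc x) (e , es) = (λ { zero _ → e ; (suc y) (s≤s le) → proj₁ (solved _ ws x es) y le }) , proj₂ (solved _ ws x es)

        -- A chain leading with `τ` has coordinates without the positions up to `x`, so the
        -- functionals up to the x-th kill it. By `flag-exact` it is the image under the x-th
        -- functional of a chain killed by the earlier ones, and that chain leads with `τ` and `x`.
        raise : ∀ x {τ} → IS s τ ≡ true → zeros (suc (toℕ x)) τ ≡ true → ∣ τ ∣ +ℕ suc (toℕ x) ≤ℕ k → IS s (τ [ x ]≔ true) ≡ true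
        raise x {τ} p zr le = go (IS⁻ s p)
          where
          φs = newton pts ones pts
          go : (∃ λ u → Chain L ∣ τ ∣ u × Lead (coords (flag s) u) τ) → IS s (τ [ x ]≔ true) ≡ true
          go (u , ch , l) = finish (flag-exact down dep pts x le ch (kill ones pts x killed))
            where
            killed : ∀ y → toℕ y ≤ℕ toℕ x → i (lookup φs y) u ≡ 𝟎
            killed y y≤x = separating s (trans (cong (λ φ → coords (flag s) (i (lookup φ y) u)) (sym newton-flag)) (trans (coords-δ (flag s) y u) (lead-zeros l x zr y y≤x)))
            finish : (∃ λ b → Chain L (suc ∣ τ ∣) b × Solves ones pts x b u) → IS s (τ [ x ]≔ true) ≡ true
            finish (b , chb , sol) = IS⁺ s chb (lead-raise l x zr
              (trans (sym (coords-δ (flag s) x b)) (cong (coords (flag s)) (trans (cong (λ φ → i (lookup φ x) b) newton-flag) (proj₂ (solved ones pts x sol)))))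
              (λ y y<x → trans (sym (coords-δ (flag s) y b)) (trans (cong (coords (flag s)) (trans (cong (λ φ → i (lookup φ y) b) newton-flag) (proj₁ (solved ones pts x sol) y y<x))) (lin-𝟎 (coords-linear (flag s))))))

        z≤xc : ∀ x c → c +ℕ suc (toℕ x) ≤ℕ k → z s (suc (toℕ x)) c ≤ℕ xc s x (suc c)
        z≤xc x c le = count-injection {P = zmask s (suc (toℕ x)) c} {Q = λ σ → zmask s (toℕ x) (suc c) σ ∧ lookup σ x} (_[ x ]≔ true)
          (λ τ p → let (a , b , d) = zmask⁻ s {suc (toℕ x)} {c} {τ} p in
            ∧-true⁺ (zmask⁺ s {toℕ x} (raise x a d (subst (λ c → c +ℕ suc (toℕ x) ≤ℕ k) (sym b) le))
                (trans (add-size (addAt⇒add (addAt-insert x τ (zeros-∉ x τ d)))) (cong suc b)) (zeros-raise x τ d)) (lookup∘update x τ true))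
          (λ σ τ p q → update-injective s x true (zeros-∉ x σ (proj₂ (proj₂ (zmask⁻ s {suc (toℕ x)} {c} {σ} p)))) (zeros-∉ x τ (proj₂ (proj₂ (zmask⁻ s {suc (toℕ x)} {c} {τ} q)))))

      module _ (s t : St) (newton-flag : flag s ≡ newton pts ones pts) (t⊑s : _⊑_ V sub t s) where

        private
          z≤z : ∀ x c → c ≤ℕ N → z t (suc (toℕ x)) c ≤ℕ z s (suc (toℕ x)) c
          z≤z x c le = subst (λ c → z t (suc (toℕ x)) c ≤ℕ z s (suc (toℕ x)) c) (toℕ-fromℕ< (s≤s le))
            (subst₂ _≤ℕ_ (sym (z-below t x (fromℕ< (s≤s le)))) (sym (z-below s x (fromℕ< (s≤s le)))) (t⊑s (suc (fromℕ< (s≤s le))) (threshold x)))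

          squeeze : ∀ {a x a* x* b b*} → a +ℕ x ≡ a* +ℕ x* → a ≤ℕ a* → x ≤ℕ b → b ≤ℕ b* → b* ≤ℕ x* → a ≡ a* × b ≤ℕ x
          squeeze {a} {x} {a*} {x*} {b} {b*} e a≤ x≤ b≤ b*≤ = a≡ , ℕₚ.≤-trans (ℕₚ.≤-trans b≤ b*≤) x*≤x
            where
            x≤x* : x ≤ℕ x*
            x≤x* = ℕₚ.≤-trans x≤ (ℕₚ.≤-trans b≤ b*≤)
            x*≤x : x* ≤ℕ x
            x*≤x = ℕₚ.+-cancelˡ-≤ a x* x (ℕₚ.≤-trans (ℕₚ.+-monoˡ-≤ x* a≤) (ℕₚ.≤-reflexive (sym e)))
            a≡ : a ≡ a*
            a≡ = ℕₚ.≤-antisym a≤ (ℕₚ.+-cancelʳ-≤ x* a* a (ℕₚ.≤-trans (ℕₚ.≤-reflexive (sym e)) (ℕₚ.+-monoʳ-≤ a x≤x*)))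

          -- The state `s` carries the Newton flag and `t` the moved one. Moving can only lower `z`;
          -- then `xc` of `t` is at most `z` of `t`, at most `z` of `s`, at most `xc` of `s`. The
          -- sums agree by the previous position, so nothing can have dropped.
          step : ∀ x → (∀ c → c +ℕ toℕ x ≤ℕ k → z t (toℕ x) c ≡ z s (toℕ x) c) → ∀ c → suc c +ℕ toℕ x ≤ℕ k →
            z t (suc (toℕ x)) (suc c) ≡ z s (suc (toℕ x)) (suc c) × z t (suc (toℕ x)) c ≤ℕ xc t x (suc c)
          step x same c le = squeeze (trans (sym (z-split t x (suc c))) (trans (same (suc c) le) (z-split s x (suc c))))
            (z≤z x (suc c) sc≤N) (xc≤z t x c) (z≤z x c (ℕₚ.≤-trans (ℕₚ.n≤1+n c) sc≤N)) (z≤xc s newton-flag x c (ℕₚ.≤-trans (ℕₚ.≤-reflexive (ℕₚ.+-suc c (toℕ x))) le))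
            where
            sc≤N : suc c ≤ℕ N
            sc≤N = ℕₚ.≤-trans (ℕₚ.≤-trans (ℕₚ.m≤m+n (suc c) (toℕ x)) le) k≤n

          same : ∀ j → j ≤ℕ N → ∀ c → c +ℕ j ≤ℕ k → z t j c ≡ z s j c
          same zero _ c le = subst (λ c → z t 0 c ≡ z s 0 c) (toℕ-fromℕ< c<) (trans (z-zero t (fromℕ< c<)) (sym (z-zero s (fromℕ< c<))))
            where
            c< : c <ℕ suc N
            c< = s≤s (ℕₚ.≤-trans (ℕₚ.≤-trans (ℕₚ.m≤m+n c 0) le) k≤n)
          same (suc j) j< c le = subst (λ j → z t (suc j) c ≡ z s (suc j) c) (toℕ-fromℕ< j<) (go c (subst (λ j → c +ℕ suc j ≤ℕ k) (sym (toℕ-fromℕ< j<)) le))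
            where
            x : Fin N
            x = fromℕ< j<
            IH : ∀ c → c +ℕ toℕ x ≤ℕ k → z t (toℕ x) c ≡ z s (toℕ x) c
            IH c le = subst (λ j → z t j c ≡ z s j c) (sym (toℕ-fromℕ< j<)) (same j (ℕₚ.≤-trans (ℕₚ.n≤1+n j) j<) c (subst (λ j → c +ℕ j ≤ℕ k) (toℕ-fromℕ< j<) le))
            unsplit : ∀ r → z r (toℕ x) 0 ≡ z r (suc (toℕ x)) 0
            unsplit r = trans (z-split r x 0) (trans (cong (z r (suc (toℕ x)) 0 +ℕ_) (xc-zero r x)) (ℕₚ.+-identityʳ _))
            go : ∀ c → c +ℕ suc (toℕ x) ≤ℕ k → z t (suc (toℕ x)) c ≡ z s (suc (toℕ x)) c
            go zero le = trans (sym (unsplit t)) (trans (IH 0 (ℕₚ.≤-trans (ℕₚ.n≤1+n _) le)) (unsplit s))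
            go (suc c) le = proj₁ (step x IH c (ℕₚ.≤-trans (ℕₚ.+-monoʳ-≤ (suc c) (ℕₚ.n≤1+n (toℕ x))) le))

        raise-shifted : ∀ x {τ} → IS t τ ≡ true → zeros (suc (toℕ x)) τ ≡ true → ∣ τ ∣ +ℕ suc (toℕ x) ≤ℕ k → IS t (τ [ x ]≔ true) ≡ true
        raise-shifted x {τ} p zr le = raise-from-count t x ∣ τ ∣
          (proj₂ (step x (λ c le → same (toℕ x) (ℕₚ.<⇒≤ (toℕ<n x)) c le) ∣ τ ∣ (ℕₚ.≤-trans (ℕₚ.≤-reflexive (sym (ℕₚ.+-suc ∣ τ ∣ (toℕ x)))) le))) p refl zr

      low : ∀ {m} → ℕ → Subset m → Subset m
      low zero σ = σ
      low (suc j) [] = []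
      low (suc j) (b ∷ σ) = false ∷ low j σ

      low-down : ∀ {m} (P : Subset m → Bool) → DownClosed P → ∀ j {σ} → P σ ≡ true → P (low j σ) ≡ true
      low-down P down zero p = p
      low-down P down (suc j) {[]} p = p
      low-down P down (suc j) {false ∷ σ} p = low-down (λ τ → P (false ∷ τ)) (λ a → down (there a)) j p
      low-down P down (suc j) {true ∷ σ} p = low-down (λ τ → P (false ∷ τ)) (λ a → down (there a)) j (down here p)

      data Prefix : ∀ {m} → ℕ → Subset m → Set where
        stop : ∀ {m} {σ : Subset m} → Prefix 0 σ
        next : ∀ {m j} {σ : Subset m} → Prefix j σ → Prefix (suc j) (true ∷ σ)

      zeros-low : ∀ {m} j (σ : Subset m) → zeros j (low j σ) ≡ true
      zeros-low zero σ = refl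
      zeros-low (suc j) [] = refl
      zeros-low (suc j) (b ∷ σ) = zeros-low j σ

      low-step : ∀ {m j} {σ : Subset m} → Prefix (suc j) σ → ∃ λ x → toℕ x ≡ j × low (suc j) σ [ x ]≔ true ≡ low j σ × ∣ low (suc j) σ ∣ +ℕ suc j ≡ ∣ σ ∣ × Prefix j σ
      low-step {j = zero} {true ∷ σ} (next pr) = zero , refl , refl , ℕₚ.+-comm ∣ σ ∣ 1 , stop
      low-step {j = suc j} {true ∷ σ} (next pr) with low-step pr
      ... | x , e , f , g , pr′ = suc x , cong suc e , cong (false ∷_) f , trans (ℕₚ.+-suc ∣ low (suc j) σ ∣ (suc j)) (cong suc g) , next pr′

      first-gap : ∀ {m} (σ : Subset m) → ∣ σ ∣ <ℕ m → ∃ λ τ → Add σ τ × ∃ λ j → Prefix j τ × low j τ ≡ low j σ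
      first-gap (false ∷ σ) _ = true ∷ σ , here , 1 , next stop , refl
      first-gap (true ∷ σ) (s≤s lt) with first-gap σ lt
      ... | τ , a , j , pr , e = true ∷ τ , there a , suc j , next pr , cong (false ∷_) e

      -- A word is extended at its first gap: remove the block before the gap, then insert the gap
      -- and the positions of the block from right to left. Each inserted position then precedes
      -- everything present, as `raise` demands, and the size bound is that of the completed word.
      extendable : ∀ (P : Subset N → Bool) → DownClosed P →
        (∀ x {τ} → P τ ≡ true → zeros (suc (toℕ x)) τ ≡ true → ∣ τ ∣ +ℕ suc (toℕ x) ≤ℕ k → P (τ [ x ]≔ true) ≡ true) → Extendable k P
      extendable P down raise σ p lt with first-gap σ (ℕₚ.<-≤-trans lt k≤n)
      ... | τ , a , j , pr , e = τ , a , fill j pr (subst (λ ρ → P ρ ≡ true) (sym e) (low-down P down j p))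
        where
        fill : ∀ j → Prefix j τ → P (low j τ) ≡ true → P τ ≡ true
        fill zero _ q = q
        fill (suc j) pr q with low-step pr
        ... | x , refl , f , g , pr′ = fill j pr′ (subst (λ ρ → P ρ ≡ true) f (raise x q (zeros-low (suc j) τ) (ℕₚ.≤-trans (ℕₚ.≤-reflexive (trans g (add-size a))) lt)))

      ∧-basis : ∀ {m} (P Q : Subset m → Set) → (∀ σ τ → P σ → Q τ → 1 ≤ℕ ∣ σ ∩ τ ∣) → ∀ {u w : Λ m} → Sup P u → Sup Q w → u ∧Λ w ≡ 𝟎
      ∧-basis P Q meet {u} {w} iu iw = trans (cong (_∧Λ w) (expand u)) (trans (lin-sumS (∧-linearˡ w) (λ σ → at u σ · e σ)) (sumS-𝟎 λ σ →
        trans (lin-· (∧-linearˡ w) (at u σ) (e σ)) (trans (cong (λ z → at u σ · (e σ ∧Λ z)) (expand w)) (trans (cong (at u σ ·_) (lin-sumS (∧-linearʳ (e σ)) (λ τ → at w τ · e τ)))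
          (trans (cong (at u σ ·_) (sumS-cong (λ τ → lin-· (∧-linearʳ (e σ)) (at w τ) (e τ)))) (entries σ (sup iu σ)))))))
        where
        e-∧-e : ∀ {m} (σ τ : Subset m) → 1 ≤ℕ ∣ σ ∩ τ ∣ → e σ ∧Λ e τ ≡ 𝟎
        e-∧-e [] [] ()
        e-∧-e (true ∷ σ) (true ∷ τ) le = cong₂ _∥_ (lin-𝟎 (∧-linearˡ 𝟎)) (trans (cong₂ _⊕_ (lin-𝟎 (∧-linearʳ (e σ))) (trans (cong (_∧Λ e τ) (lin-𝟎 bar-linear)) (lin-𝟎 (∧-linearˡ (e τ))))) (⊕-identityˡ 𝟎))
        e-∧-e (true ∷ σ) (false ∷ τ) le = cong₂ _∥_ (lin-𝟎 (∧-linearˡ (e τ))) (trans (cong₂ _⊕_ (e-∧-e σ τ le) (lin-𝟎 (∧-linearʳ (bar 𝟎)))) (⊕-identityˡ 𝟎))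
        e-∧-e (false ∷ σ) (true ∷ τ) le = cong₂ _∥_ (lin-𝟎 (∧-linearʳ (e σ))) (trans (cong₂ _⊕_ (lin-𝟎 (∧-linearˡ 𝟎)) (bar-e σ τ (e-∧-e σ τ le))) (⊕-identityˡ 𝟎))
          where
          bar-scalar : ∀ {m} (σ : Subset m) → ∃ λ a → bar (e σ) ≡ a · e σ
          bar-scalar [] = 1ℚ , refl
          bar-scalar (false ∷ σ) with bar-scalar σ
          ... | a , eq = a , cong₂ _∥_ eq (trans (cong ⊝_ (lin-𝟎 bar-linear)) (trans ⊝𝟎 (sym (a·𝟎 a))))
          bar-scalar (true ∷ σ) with bar-scalar σ
          ... | a , eq = ℚ.- a , cong₂ _∥_ (trans (lin-𝟎 bar-linear) (sym (a·𝟎 (ℚ.- a)))) (trans (cong ⊝_ eq) (trans (solve 2 (λ a u → :- (a :* u) := (:- a) :* u) refl (κ a) (e σ)) (cong (_⊗ e σ) (sym (κ-neg a)))))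
          bar-e : ∀ {m} (σ τ : Subset m) → e σ ∧Λ e τ ≡ 𝟎 → bar (e σ) ∧Λ e τ ≡ 𝟎
          bar-e σ τ z with bar-scalar σ
          ... | a , eq = trans (cong (_∧Λ e τ) eq) (trans (lin-· (∧-linearˡ (e τ)) a (e σ)) (trans (cong (a ·_) z) (a·𝟎 a)))
        e-∧-e (false ∷ σ) (false ∷ τ) le = cong₂ _∥_ (e-∧-e σ τ le) (trans (cong₂ _⊕_ (lin-𝟎 (∧-linearˡ (e τ))) (lin-𝟎 (∧-linearʳ (bar (e σ))))) (⊕-identityˡ 𝟎))
        entries : ∀ σ → P σ ⊎ at u σ ≡ 0ℚ → at u σ · sumS (λ τ → at w τ · (e σ ∧Λ e τ)) ≡ 𝟎
        entries σ (inj₂ z) = trans (cong (_· sumS (λ τ → at w τ · (e σ ∧Λ e τ))) z) (0·u _)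
        entries σ (inj₁ p) = trans (cong (at u σ ·_) (sumS-𝟎 (λ τ → entry τ (sup iw τ)))) (a·𝟎 (at u σ))
          where
          entry : ∀ τ → Q τ ⊎ at w τ ≡ 0ℚ → at w τ · (e σ ∧Λ e τ) ≡ 𝟎
          entry τ (inj₁ q) = trans (cong (at w τ ·_) (e-∧-e σ τ (meet σ τ p q))) (a·𝟎 (at w τ))
          entry τ (inj₂ z) = trans (cong (_· (e σ ∧Λ e τ)) z) (0·u _)

      add-∩ : ∀ {m} {σ τ : Subset m} (ρ : Subset m) → Add σ τ → ∣ τ ∩ ρ ∣ ≤ℕ suc ∣ σ ∩ ρ ∣
      add-∩ (true ∷ ρ) here = ℕₚ.≤-refl
      add-∩ (false ∷ ρ) here = ℕₚ.n≤1+n _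
      add-∩ (true ∷ ρ) (there {b = true} a) = s≤s (add-∩ ρ a)
      add-∩ (false ∷ ρ) (there {b = true} a) = add-∩ ρ a
      add-∩ (_ ∷ ρ) (there {b = false} a) = add-∩ ρ a

      -- Contraction removes one vertex from each set in the support, and members of `A` have two
      -- vertices in common.
      i-∧-basis : ∀ φ {u w : Λ N} → In A u → In A w → i φ u ∧Λ w ≡ 𝟎
      i-∧-basis φ iu iw = ∧-basis (λ σ → ∃ λ τ → Add σ τ × A τ ≡ true) (λ σ → A σ ≡ true)
        (λ σ ρ (τ , a , p) q → ℕₚ.≤-pred (ℕₚ.≤-trans (A2 τ ρ p q) (add-∩ ρ a))) (sup-i φ (λ a p → _ , a , p) iu) iw

      bound-for : ∀ (t : St) → Shifted V sub t → Extendable k (IS t) → ∀ {Y} → Leads (Image (flag t) (In W)) Y → ∀ {σ₀} → A σ₀ ≡ true → count A +ℕ count W <ℕ count (ofSize q L)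
      bound-for t shifted ext {Y} LY {σ₀} a₀ = begin-strict
        count A +ℕ count W ≤⟨ ℕₚ.+-mono-≤ (leads-lower-bound (flag t) (separating t) A (isLeads t zero)) (leads-lower-bound (flag t) (separating t) W LY) ⟩
        count X +ℕ count Y <⟨ shifted-bound N q config (proj₂ X-nonempty) ⟩
        count (ofSize q (IS t)) ≤⟨ count-mono (λ σ p → IS⇒IC t qF (∧-true⁻ˡ p) (trans (≡ᵇ-true⁻ (∧-true⁻ʳ {IS t σ} p)) (sym toℕ-qF))) ⟩
        count (I t (suc qF)) ≤⟨ leads-upper-bound (flag t) (ofSize (toℕ qF) L) (isLeads t (suc qF)) ⟩
        count (ofSize (toℕ qF) L) ≡⟨ cong (λ q → count (ofSize q L)) toℕ-qF ⟩
        count (ofSize q L) ∎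
        where
        open ℕₚ.≤-Reasoning
        X = I t zero
        q<N : q <ℕ suc N
        q<N = s≤s (ℕₚ.≤-trans (ℕₚ.≤-trans (ℕₚ.m≤n*m q 2) (ℕₚ.≤-trans (ℕₚ.m≤m+n (2 *ℕ q) 2) q≤k)) k≤n)
        qF : Fin (suc N)
        qF = fromℕ< q<N
        toℕ-qF : toℕ qF ≡ q
        toℕ-qF = toℕ-fromℕ< q<N
        A-chain : ∀ {u} → In A u → Chain L (suc q) u
        A-chain = sup-mono A⊆L
        W-chain : ∀ {u} → In W u → Chain L q u
        W-chain = sup-mono W⊆L
        X⁻ : ∀ {σ} → X σ ≡ true → ∃ λ u → In A u × Lead (coords (flag t) u) σ
        X⁻ {σ} p = unpack (leads⁻ (isLeads t zero) p)
          where
          unpack : (∃ λ w → Image (flag t) (In A) w × Lead w σ) → ∃ λ u → In A u × Lead (coords (flag t) u) σ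
          unpack (_ , (u , v , refl) , l) = u , v , l
        Y⁻ : ∀ {σ} → Y σ ≡ true → ∃ λ u → In W u × Lead (coords (flag t) u) σ
        Y⁻ {σ} p = unpack (leads⁻ LY p)
          where
          unpack : (∃ λ w → Image (flag t) (In W) w × Lead w σ) → ∃ λ u → In W u × Lead (coords (flag t) u) σ
          unpack (_ , (u , v , refl) , l) = u , v , l
        X-nonempty : ∃ λ σ → X σ ≡ true
        X-nonempty = positive X (ℕₚ.<-≤-trans (count-pos A a₀) (leads-lower-bound (flag t) (separating t) A (isLeads t zero)))
          where
          positive : ∀ {m} (P : Subset m → Bool) → 0 <ℕ count P → ∃ λ σ → P σ ≡ true
          positive P pos with elems P in eq
          ... | [] = ⊥-elim (ℕₚ.n≮0 (subst (0 <ℕ_) (trans (sym (length-elems P)) (cong length eq)) pos))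
          ... | σ ∷ _ = σ , ∈-elems⁻ P (subst (σ ∈ˡ_) (sym eq) (Any.here refl))
        config : Config N q (IS t) X Y
        config = record
          { down = IS-down t
          ; shift = λ {σ} {τ} a p → proj₁ (IC⇒IS t (sizeF σ) (shifted (suc (sizeF σ)) a p))
          ; ext = λ σ p lt → ext σ p (ℕₚ.<-≤-trans lt q≤k)
          ; X⊆S = λ σ p → let (u , iu , l) = X⁻ p in IS⁺ t (A-chain iu) l
          ; Xsize = λ σ p → let (u , iu , l) = X⁻ p in lead-size t (A-chain iu) l
          ; Xshift = shifted zero
          ; X2 = λ σ τ p p′ → let (u , iu , l) = X⁻ p ; (w , iw , l′) = X⁻ p′ in
              leads-meet-twice l l′ (trans (sym (coords-∧ (flag t) u w)) (trans (cong (coords (flag t)) (∧-basis (λ σ → A σ ≡ true) (λ σ → A σ ≡ true) (λ σ τ a b → ℕₚ.≤-trans (s≤s z≤n) (A2 σ τ a b)) iu iw)) (lin-𝟎 (coords-linear (flag t)))))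
                (λ x → trans (cong (_∧Λ coords (flag t) w) (sym (coords-δ (flag t) x u))) (trans (sym (coords-∧ (flag t) (i (lookup (flag t) x) u) w)) (trans (cong (coords (flag t)) (i-∧-basis (lookup (flag t) x) iu iw)) (lin-𝟎 (coords-linear (flag t))))))
          ; Y⊆S = λ σ p → let (u , iu , l) = Y⁻ p in IS⁺ t (W-chain iu) l
          ; Ysize = λ σ p → let (u , iu , l) = Y⁻ p in lead-size t (W-chain iu) l
          ; XY = λ σ τ p p′ → let (u , iu , l) = X⁻ p ; (w , iw , l′) = Y⁻ p′ in
              leads-meet l l′ (trans (sym (coords-∧ (flag t) u w)) (trans (cong (coords (flag t)) (∧-basis (λ σ → A σ ≡ true) (λ σ → W σ ≡ true) AW iu iw)) (lin-𝟎 (coords-linear (flag t))))) }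

      start : ¬ ¬ (∃ λ (s : St) → flag s ≡ newton pts ones pts)
      start = ¬¬-fin (λ j → ¬¬-leads (Image (newton pts ones pts) (V j))) >>= λ masks → return
        (record { flag = newton pts ones pts ; separating = newton-separating pts ones distinct (λ x eq → 1≢0 (trans (sym (lookup-ones x)) eq))
                ; I = λ j → proj₁ (masks j) ; isLeads = λ j → proj₂ (masks j) } , refl)

    intersecting-bound : ∀ {σ₀} → A σ₀ ≡ true → count A +ℕ count W <ℕ count (ofSize q L)
    intersecting-bound a₀ with count A +ℕ count W ℕ.<? count (ofSize q L)
    ... | yes lt = lt
    ... | no nlt = ⊥-elim ((start >>= λ (s , e) → shift V sub s >>= λ (t , t⊑s , shifted) → ¬¬-leads (Image (flag t) (In W)) >>= λ (Y , LY) →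
            return (bound-for t shifted (extendable (IS t) (IS-down t) (raise-shifted s t e t⊑s)) LY a₀)) nlt)

-- Primitive integer vectors

module PrimitiveVectors where

  open IntegerMap
  open PolynomialMaps using (inverseʳ; module ℚSolver)
  open import Data.Integer using (+_; -[1+_])
  open import Data.Nat.Coprimality using (coprime-Bézout; Coprime)
  open import Data.Nat.GCD using (module Bézout)
  open import Data.Rational using (mkℚ; toℚᵘ; _*_; ↥_; ↧_)
  open import Data.Rational.Unnormalised as ℚᵘ using (mkℚᵘ; *≡*; _≃_)
  import Data.Rational.Unnormalised.Properties as ℚᵘₚ
  open import Relation.Binary.PropositionalEquality

  open FromℤTo ℚₚ.+-*-commutativeRing public using () renaming (fromℤ to ιℚ; fromℤ-+ to ιℚ-+; fromℤ-* to ιℚ-*; fromℤ-neg to ιℚ-neg; fromℤ-1 to ιℚ-1)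
  open FromℤTo ℤₚ.+-*-commutativeRing using (module Solver)
  open Solver using (solve; _:=_; _:+_; _:*_; :-_; con)

  private
    toℚᵘ-ι⁺ : ∀ n → toℚᵘ (ιℚ (+ n)) ≃ mkℚᵘ (+ n) 0
    toℚᵘ-ι⁺ zero = ℚᵘₚ.≃-refl
    toℚᵘ-ι⁺ (suc n) = ℚᵘₚ.≃-trans (ℚₚ.toℚᵘ-homo-+ 1ℚ (ιℚ (+ n))) (ℚᵘₚ.≃-trans (ℚᵘₚ.+-congʳ (toℚᵘ 1ℚ) (toℚᵘ-ι⁺ n))
      (*≡* (solve 1 (λ n → (con (+ 1) :* con (+ 1) :+ n :* con (+ 1)) :* con (+ 1) := (con (+ 1) :+ n) :* (con (+ 1) :* con (+ 1))) refl (+ n))))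

    toℚᵘ-ι : ∀ z → toℚᵘ (ιℚ z) ≃ mkℚᵘ z 0
    toℚᵘ-ι (+ n) = toℚᵘ-ι⁺ n
    toℚᵘ-ι -[1+ n ] = ℚᵘₚ.≃-trans (ℚₚ.toℚᵘ-homo‿- (ιℚ (+ suc n))) (ℚᵘₚ.-‿cong (toℚᵘ-ι⁺ (suc n)))

  ιℚ-injective : ∀ {z} → ιℚ z ≡ 0ℚ → z ≡ + 0
  ιℚ-injective {z} p with ℚᵘₚ.≃-trans (ℚᵘₚ.≃-sym (toℚᵘ-ι z)) (ℚᵘₚ.≃-reflexive (cong toℚᵘ p))
  ... | *≡* e = trans (sym (ℤₚ.*-identityʳ z)) e

  ι-fraction : ∀ ρ → ρ * ιℚ (↧ ρ) ≡ ιℚ (↥ ρ)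
  ι-fraction ρ@(mkℚ a b-1 c) = ℚₚ.toℚᵘ-injective (ℚᵘₚ.≃-trans (ℚₚ.toℚᵘ-homo-* ρ (ιℚ (↧ ρ))) (ℚᵘₚ.≃-trans (ℚᵘₚ.*-congˡ {toℚᵘ ρ} (toℚᵘ-ι (↧ ρ)))
    (ℚᵘₚ.≃-trans (*≡* (solve 2 (λ a b → (a :* b) :* con (+ 1) := a :* (b :* con (+ 1))) refl a (+ suc b-1))) (ℚᵘₚ.≃-sym (toℚᵘ-ι a)))))

  bezout : ∀ a b → Coprime ℤ.∣ a ∣ b → ∃ λ s → ∃ λ t → s ℤ.* a ℤ.+ t ℤ.* + b ≡ + 1
  bezout a b cop = signed a (natural (coprime-Bézout cop))
    where
    natural : Bézout.Identity 1 ℤ.∣ a ∣ b → ∃ λ s → ∃ λ t → s ℤ.* + ℤ.∣ a ∣ ℤ.+ t ℤ.* + b ≡ + 1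
    natural (Bézout.+- x y e) = + x , ℤ.- (+ y) , trans (cong (ℤ._+ ℤ.- (+ y) ℤ.* + b) (trans (sym (ℤₚ.pos-* x ℤ.∣ a ∣)) (trans (cong +_ (sym e)) (trans (ℤₚ.pos-+ 1 (y ℕ.* b)) (cong (λ z → + 1 ℤ.+ z) (ℤₚ.pos-* y b))))))
      (solve 2 (λ y b → (con (+ 1) :+ y :* b) :+ (:- y) :* b := con (+ 1)) refl (+ y) (+ b))
    natural (Bézout.-+ x y e) = ℤ.- (+ x) , + y , trans (cong (λ z → ℤ.- (+ x) ℤ.* + ℤ.∣ a ∣ ℤ.+ z) (trans (sym (ℤₚ.pos-* y b)) (trans (cong +_ (sym e)) (trans (ℤₚ.pos-+ 1 (x ℕ.* ℤ.∣ a ∣)) (cong (λ z → + 1 ℤ.+ z) (ℤₚ.pos-* x ℤ.∣ a ∣))))))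
      (solve 2 (λ x a → (:- x) :* a :+ (con (+ 1) :+ x :* a) := con (+ 1)) refl (+ x) (+ ℤ.∣ a ∣))
    signed : ∀ a → (∃ λ s → ∃ λ t → s ℤ.* + ℤ.∣ a ∣ ℤ.+ t ℤ.* + b ≡ + 1) → ∃ λ s → ∃ λ t → s ℤ.* a ℤ.+ t ℤ.* + b ≡ + 1
    signed (+ n) r = r
    signed -[1+ n ] (s , t , e) = ℤ.- s , t , trans (cong (ℤ._+ t ℤ.* + b) (solve 2 (λ s m → (:- s) :* (:- m) := s :* m) refl s (+ suc n))) e

  sumℤ : ∀ {m} → (Subset m → ℤ) → ℤ
  sumℤ {zero} f = f []
  sumℤ {suc m} f = sumℤ (λ σ → f (false ∷ σ)) ℤ.+ sumℤ (λ σ → f (true ∷ σ))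

  sumℤ-* : ∀ {m} a (f : Subset m → ℤ) → sumℤ (λ σ → a ℤ.* f σ) ≡ a ℤ.* sumℤ f
  sumℤ-* {zero} a f = refl
  sumℤ-* {suc m} a f = trans (cong₂ ℤ._+_ (sumℤ-* a (λ σ → f (false ∷ σ))) (sumℤ-* a (λ σ → f (true ∷ σ)))) (sym (ℤₚ.*-distribˡ-+ a _ _))

  sumℤ-cong : ∀ {m} {f g : Subset m → ℤ} → (∀ σ → f σ ≡ g σ) → sumℤ f ≡ sumℤ g
  sumℤ-cong {zero} e = e []
  sumℤ-cong {suc m} e = cong₂ ℤ._+_ (sumℤ-cong (λ σ → e (false ∷ σ))) (sumℤ-cong (λ σ → e (true ∷ σ)))

  sumℤ-0 : ∀ {m} → sumℤ {m} (λ _ → + 0) ≡ + 0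
  sumℤ-0 {zero} = refl
  sumℤ-0 {suc m} = cong₂ ℤ._+_ (sumℤ-0 {m}) (sumℤ-0 {m})

  -- A rational vector is zero or a multiple of an integer vector whose entries generate the unit ideal.
  record Primitive {m} (c : Subset m → ℚ) : Set where
    field
      scale : ℚ
      scale≢0 : scale ≢ 0ℚ
      z u : Subset m → ℤ
      c≡ : ∀ σ → c σ ≡ scale * ιℚ (z σ)
      unit : sumℤ (λ σ → u σ ℤ.* z σ) ≡ + 1

  primitive? : ∀ {m} (c : Subset m → ℚ) → (∀ σ → c σ ≡ 0ℚ) ⊎ Primitive c
  primitive? {zero} c with c [] ℚₚ.≟ 0ℚ
  ... | yes p = inj₁ λ { [] → p }
  ... | no p = inj₂ record { scale = c [] ; scale≢0 = p ; z = λ _ → + 1 ; u = λ _ → + 1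
                           ; c≡ = λ { [] → sym (trans (cong (c [] *_) ιℚ-1) (ℚₚ.*-identityʳ (c []))) } ; unit = refl }
  primitive? {suc m} c with primitive? (λ σ → c (false ∷ σ)) | primitive? (λ σ → c (true ∷ σ))
  ... | inj₁ p | inj₁ q = inj₁ λ { (false ∷ σ) → p σ ; (true ∷ σ) → q σ }
  ... | inj₂ P | inj₁ q = inj₂ record
    { scale = scale ; scale≢0 = scale≢0
    ; z = λ { (false ∷ σ) → z σ ; (true ∷ σ) → + 0 } ; u = λ { (false ∷ σ) → u σ ; (true ∷ σ) → + 0 }
    ; c≡ = λ { (false ∷ σ) → c≡ σ ; (true ∷ σ) → trans (q σ) (sym (ℚₚ.*-zeroʳ scale)) }
    ; unit = cong₂ ℤ._+_ unit (sumℤ-0 {m}) }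
    where open Primitive P
  ... | inj₁ p | inj₂ Q = inj₂ record
    { scale = scale ; scale≢0 = scale≢0
    ; z = λ { (false ∷ σ) → + 0 ; (true ∷ σ) → z σ } ; u = λ { (false ∷ σ) → + 0 ; (true ∷ σ) → u σ }
    ; c≡ = λ { (false ∷ σ) → trans (p σ) (sym (ℚₚ.*-zeroʳ scale)) ; (true ∷ σ) → c≡ σ }
    ; unit = cong₂ ℤ._+_ (sumℤ-0 {m}) unit }
    where open Primitive Q
  ... | inj₂ P | inj₂ Q = inj₂ combined
    where
    module P = Primitive P
    module Q = Primitive Q
    q⁻¹ = proj₁ (inverseʳ Q.scale≢0)
    qq⁻¹ : Q.scale * q⁻¹ ≡ 1ℚ
    qq⁻¹ = proj₂ (inverseʳ Q.scale≢0)
    -- Write the ratio of the two scales in lowest terms as a / b. With the new scale `Q.scale` / b,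
    -- the halves become a and b times their integer vectors, and a Bezout relation for a and b
    -- joins the two unit relations.
    ρ = P.scale * q⁻¹
    coprime : ∀ ρ → ∃ λ s → ∃ λ t → s ℤ.* ↥ ρ ℤ.+ t ℤ.* ↧ ρ ≡ + 1
    coprime (mkℚ a b-1 cop) = bezout a (suc b-1) (λ {i} → recomputed {i})
      where
      open import Relation.Nullary.Decidable.Core using (recompute)
      open import Data.Nat.Coprimality using (coprime?)
      -- The coprimality proof stored in a rational is irrelevant; it is recovered by deciding the
      -- property.
      recomputed : Coprime ℤ.∣ a ∣ (suc b-1)
      recomputed = recompute (coprime? ℤ.∣ a ∣ (suc b-1)) cop
    s = proj₁ (coprime ρ)
    t = proj₁ (proj₂ (coprime ρ))
    b≢0 : ιℚ (↧ ρ) ≢ 0ℚ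
    b≢0 p = pos≢0 ρ (ιℚ-injective p)
      where
      pos≢0 : ∀ ρ → ↧ ρ ≡ + 0 → ⊥
      pos≢0 (mkℚ _ _ _) ()
    b⁻¹ = proj₁ (inverseʳ b≢0)
    bb⁻¹ : ιℚ (↧ ρ) * b⁻¹ ≡ 1ℚ
    bb⁻¹ = proj₂ (inverseʳ b≢0)
    w = Q.scale * b⁻¹
    module R = ℚSolver
    w-b : w * ιℚ (↧ ρ) ≡ Q.scale
    w-b = trans (R.solve 3 (λ q b i → (q R.:* i) R.:* b R.:= q R.:* (b R.:* i)) refl Q.scale (ιℚ (↧ ρ)) b⁻¹) (trans (cong (Q.scale *_) bb⁻¹) (ℚₚ.*-identityʳ Q.scale))
    w-a : w * ιℚ (↥ ρ) ≡ P.scale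
    w-a = trans (cong (w *_) (sym (ι-fraction ρ))) (trans (R.solve 5 (λ q i p r b → (q R.:* i) R.:* ((p R.:* r) R.:* b) R.:= p R.:* ((q R.:* r) R.:* (b R.:* i))) refl Q.scale b⁻¹ P.scale q⁻¹ (ιℚ (↧ ρ)))
      (trans (cong₂ (λ x y → P.scale * (x * y)) qq⁻¹ bb⁻¹) (trans (cong (P.scale *_) (ℚₚ.*-identityˡ 1ℚ)) (ℚₚ.*-identityʳ P.scale))))
    rescaled : ∀ {x} a y → w * ιℚ a ≡ x → x * ιℚ y ≡ w * ιℚ (a ℤ.* y)
    rescaled a y e = trans (cong (_* ιℚ y) (sym e)) (trans (ℚₚ.*-assoc w (ιℚ a) (ιℚ y)) (cong (w *_) (sym (ιℚ-* a y))))
    combined : Primitive c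
    combined = record
      { scale = w
      ; scale≢0 = λ e → Q.scale≢0 (trans (sym w-b) (trans (cong (_* ιℚ (↧ ρ)) e) (ℚₚ.*-zeroˡ (ιℚ (↧ ρ)))))
      ; z = λ { (false ∷ σ) → ↥ ρ ℤ.* P.z σ ; (true ∷ σ) → ↧ ρ ℤ.* Q.z σ }
      ; u = λ { (false ∷ σ) → s ℤ.* P.u σ ; (true ∷ σ) → t ℤ.* Q.u σ }
      ; c≡ = λ { (false ∷ σ) → trans (P.c≡ σ) (rescaled (↥ ρ) (P.z σ) w-a) ; (true ∷ σ) → trans (Q.c≡ σ) (rescaled (↧ ρ) (Q.z σ) w-b) }
      ; unit = trans (cong₂ ℤ._+_ (half s (↥ ρ) P.u P.z P.unit) (half t (↧ ρ) Q.u Q.z Q.unit)) (proj₂ (proj₂ (coprime ρ))) }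
      where
      half : ∀ s a (u z : Subset m → ℤ) → sumℤ (λ σ → u σ ℤ.* z σ) ≡ + 1 → sumℤ (λ σ → (s ℤ.* u σ) ℤ.* (a ℤ.* z σ)) ≡ s ℤ.* a
      half s a u z e = trans (sumℤ-cong (λ σ → solve 4 (λ s u a z → (s :* u) :* (a :* z) := (s :* a) :* (u :* z)) refl s (u σ) a (z σ)))
        (trans (sumℤ-* (s ℤ.* a) (λ σ → u σ ℤ.* z σ)) (trans (cong ((s ℤ.* a) ℤ.*_) e) (ℤₚ.*-identityʳ (s ℤ.* a))))

-- From vanishing homology over the given field to fillings over ℚ

module Transfer where

  open import Defs
  open IntegerMap
  open Counting
  open ShiftedFamilies using (Add; here; there; DownClosed; add-size; ofSize; ≡ᵇ-true⁺; ≡ᵇ-true⁻)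
  open Exterior using (Λ; sc; _∥_; at; e; i; _·_; 𝟎; at-ext; at-⊕; at-⊝; at-·; at-κ; lin-⊕; lin-·; i-i; 1·u)
  open PolynomialMaps using (inverseʳ; *-nonzero; module ℚSolver)
  open Depth using (mkSup; sup; Chain; ones; Section)
  open Exactness using (mkΛ; at-mkΛ)
  open LinearAlgebra
  open Leading using (ℚ-field; module ℚFn; mkΛ-⊕; mkΛ-·)
  open PrimitiveVectors
  open import Data.Fin.Subset using (∣_∣)
  open import Data.Fin.Subset.Properties using (∪-identityʳ; _∈?_)
  open import Data.Integer using (+_)
  open import Data.List using ([]; _∷_)
  open import Data.List.Membership.Propositional using (_∈_)
  open import Data.List.Relation.Unary.Any using (here; there)
  open import Data.Nat using (_≤_)
  open import Data.Vec using (tabulate)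
  open import Relation.Binary.PropositionalEquality as ≡ using (_≡_; _≢_; cong; cong₂)
  import Level

  module ℚS = ℚSolver

  module Boundary {a ℓ} (R : CommutativeRing a ℓ) where
    open CommutativeRing R
    open FromℤTo R using (module Solver; fromℤ; fromℤ-+; fromℤ-neg)
    open Solver using (solve; _:=_; _:+_; _:*_; :-_; con)

    -- The simplicial boundary of the full simplex by recursion on the vertices. It makes sense over
    -- ℤ, ℚ and `F` alike and has the recursion of `i ones`, which links all versions of the
    -- boundary.
    bd : ∀ {n} → (Subset n → Carrier) → Subset n → Carrier
    bd c [] = 0#
    bd c (false ∷ σ) = bd (λ τ → c (false ∷ τ)) σ + c (true ∷ σ)
    bd c (true ∷ σ) = - bd (λ τ → c (true ∷ τ)) σ

    bd-local : ∀ {n} {c d : Subset n → Carrier} σ → (∀ τ → Add σ τ → c τ ≈ d τ) → bd c σ ≈ bd d σ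
    bd-local [] p = refl
    bd-local (false ∷ σ) p = +-cong (bd-local σ (λ τ x → p _ (there x))) (p _ here)
    bd-local (true ∷ σ) p = -‿cong (bd-local σ (λ τ x → p _ (there x)))

    bd-cong : ∀ {n} {c d : Subset n → Carrier} → (∀ τ → c τ ≈ d τ) → ∀ σ → bd c σ ≈ bd d σ
    bd-cong p σ = bd-local σ (λ τ _ → p τ)

    bd-0 : ∀ {n} σ → bd {n} (λ _ → 0#) σ ≈ 0#
    bd-0 [] = refl
    bd-0 (false ∷ σ) = trans (+-congʳ (bd-0 σ)) (+-identityˡ 0#)
    bd-0 (true ∷ σ) = trans (-‿cong (bd-0 σ)) (solve 0 (:- con (+ 0) := con (+ 0)) refl)

    bd-+ : ∀ {n} (c d : Subset n → Carrier) σ → bd (λ τ → c τ + d τ) σ ≈ bd c σ + bd d σ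
    bd-+ c d [] = sym (+-identityˡ 0#)
    bd-+ c d (false ∷ σ) = trans (+-congʳ (bd-+ (λ τ → c (false ∷ τ)) (λ τ → d (false ∷ τ)) σ))
      (solve 4 (λ x y z w → (x :+ y) :+ (z :+ w) := (x :+ z) :+ (y :+ w)) refl _ _ _ _)
    bd-+ c d (true ∷ σ) = trans (-‿cong (bd-+ (λ τ → c (true ∷ τ)) (λ τ → d (true ∷ τ)) σ))
      (solve 2 (λ x y → :- (x :+ y) := :- x :+ :- y) refl _ _)

    bd-* : ∀ {n} x (c : Subset n → Carrier) σ → bd (λ τ → x * c τ) σ ≈ x * bd c σ
    bd-* x c [] = sym (zeroʳ x)
    bd-* x c (false ∷ σ) = trans (+-congʳ (bd-* x (λ τ → c (false ∷ τ)) σ)) (sym (distribˡ x _ _))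
    bd-* x c (true ∷ σ) = trans (-‿cong (bd-* x (λ τ → c (true ∷ τ)) σ)) (solve 2 (λ x y → :- (x :* y) := x :* (:- y)) refl x _)

  bdℤ : ∀ {n} → (Subset n → ℤ) → Subset n → ℤ
  bdℤ = Boundary.bd ℤₚ.+-*-commutativeRing

  module ℚ∂ = Boundary ℚₚ.+-*-commutativeRing

  bdℚ : ∀ {n} → (Subset n → ℚ) → Subset n → ℚ
  bdℚ = ℚ∂.bd

  module _ {a ℓ} (R : CommutativeRing a ℓ) where
    open CommutativeRing R
    open FromℤTo R using (fromℤ; fromℤ-+; fromℤ-neg)
    open Boundary R

    fromℤ-bd : ∀ {n} (z : Subset n → ℤ) σ → fromℤ (bdℤ z σ) ≈ bd (λ τ → fromℤ (z τ)) σ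
    fromℤ-bd z [] = refl
    fromℤ-bd z (false ∷ σ) = trans (fromℤ-+ (bdℤ (λ τ → z (false ∷ τ)) σ) (z (true ∷ σ))) (+-congʳ (fromℤ-bd (λ τ → z (false ∷ τ)) σ))
    fromℤ-bd z (true ∷ σ) = trans (fromℤ-neg (bdℤ (λ τ → z (true ∷ τ)) σ)) (-‿cong (fromℤ-bd (λ τ → z (true ∷ τ)) σ))

  at-i-ones : ∀ {n} (u : Λ n) σ → at (i ones u) σ ≡ bdℚ (at u) σ
  at-i-ones (sc u) [] = ≡.refl
  at-i-ones (u ∥ v) (false ∷ σ) = ≡.trans (at-⊕ (i ones u) (1ℚ · v) σ) (cong₂ ℚ._+_ (at-i-ones u σ) (cong (λ w → at w σ) (1·u v)))
  at-i-ones (u ∥ v) (true ∷ σ) = ≡.trans (at-⊝ (i ones v) σ) (cong ℚ.-_ (at-i-ones v σ))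

  bdbd : ∀ {n} (c : Subset n → ℚ) σ → bdℚ (bdℚ c) σ ≡ 0ℚ
  bdbd c σ = ≡.trans (ℚ∂.bd-cong (λ τ → ≡.trans (ℚ∂.bd-cong (λ ρ → ≡.sym (at-mkΛ c ρ)) τ) (≡.sym (at-i-ones (mkΛ c) τ))) σ)
    (≡.trans (≡.sym (at-i-ones (i ones (mkΛ c)) σ)) (≡.trans (cong (λ u → at u σ) (i-i ones (mkΛ c))) (at-κ 0ℚ σ)))

  insert : ∀ {m} → (Subset m → Bool) → Subset m → Subset m → Bool
  insert I σ τ with σ ≟S τ
  ... | yes _ = true
  ... | no _ = I τ

  insert-same : ∀ {m} (I : Subset m → Bool) σ → insert I σ σ ≡ true
  insert-same I σ with σ ≟S σ
  ... | yes _ = ≡.refl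
  ... | no ne = ⊥-elim (ne ≡.refl)

  insert-other : ∀ {m} (I : Subset m → Bool) {σ τ} → σ ≢ τ → insert I σ τ ≡ I τ
  insert-other I {σ} {τ} ne with σ ≟S τ
  ... | yes eq = ⊥-elim (ne eq)
  ... | no _ = ≡.refl

  insert-true⁻ : ∀ {m} (I : Subset m → Bool) {σ τ} → insert I σ τ ≡ true → σ ≡ τ ⊎ I τ ≡ true
  insert-true⁻ I {σ} {τ} p with σ ≟S τ
  ... | yes eq = inj₁ eq
  ... | no _ = inj₂ p

  module OverField {a ℓ} (F : Field a ℓ) where
    open Field F hiding (zero)
    open Functions F
    open Boundary commutativeRing
    open FromℤTo commutativeRing using (module Solver; fromℤ; fromℤ-+; fromℤ-*; fromℤ-1)
    open Solver using (solve; _:=_; _:+_; _:*_; :-_; con)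

    bd-linear : ∀ {n} → LinearFn (bd {n})
    bd-linear = record { fn-cong = bd-cong ; fn-+ = bd-+ ; fn-* = bd-* }

    Independent : ∀ {m l} → (Fn m → Fn l) → (Subset m → Bool) → Set (a Level.⊔ ℓ)
    Independent T I = ∀ c → Supported I c → (∀ τ → T c τ ≈ 0#) → ∀ σ → ¬ ¬ (c σ ≈ 0#)

    Spanned : ∀ {m l} → (Fn m → Fn l) → (Subset m → Bool) → Subset m → Set (a Level.⊔ ℓ)
    Spanned T I σ = ∃ λ c → Supported I c × (∀ τ → T c τ ≈ T (basis σ) τ)

    -- A greedy pass over the members of `M`, enlarging `I` whenever the next basis vector has an
    -- image outside the span. Membership in the span is decided under double negation.
    maximal-independent : ∀ {m l} {T : Fn m → Fn l} → LinearFn T → (M : Subset m → Bool) →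
      ¬ ¬ (∃ λ I → (∀ σ → I σ ≡ true → M σ ≡ true) × Independent T I × (∀ σ → M σ ≡ true → Spanned T I σ))
    maximal-independent {m} {T = T} lin M = greedy (elems M) >>= λ (I , sub , ind , span) →
      return (I , (λ σ p → ∈-elems⁻ M (sub σ p)) , ind , λ σ p → span σ (∈-elems⁺ M p))
      where
      Basis : List (Subset m) → Set _
      Basis xs = ∃ λ I → (∀ σ → I σ ≡ true → σ ∈ xs) × Independent T I × (∀ σ → σ ∈ xs → Spanned T I σ)
      module Extend (I : Subset m → Bool) (x : Subset m) where
        weaken : ∀ {c} → Supported I c → Supported (insert I x) c
        weaken {c} s σ p = s σ (¬true⇒false λ q → true≢false q (≡.trans (≡.sym (insert-other I {x} {σ} (λ { ≡.refl → true≢false (insert-same I x) p }))) p))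
        dependent : ∀ c → Supported (insert I x) c → (∀ τ → T c τ ≈ 0#) → ¬ (c x ≈ 0#) → Spanned T I x
        dependent c s z nz = c′ , supported , image
          where
          y = proj₁ (inverse (c x) nz)
          c′ : Fn m
          c′ ρ = (- y) * c ρ + basis x ρ
          supported : Supported I c′
          supported ρ p with x ≟S ρ
          ... | yes ≡.refl = trans (+-cong (trans (solve 2 (λ y c → (:- y) :* c := :- (c :* y)) refl y (c x)) (-‿cong (proj₂ (inverse (c x) nz)))) (basis-same x)) (-‿inverseˡ 1#)
          ... | no ne = trans (+-cong (trans (*-congˡ (s ρ (≡.trans (insert-other I ne) p))) (zeroʳ _)) (basis-other ne)) (+-identityˡ 0#)
          image : ∀ τ → T c′ τ ≈ T (basis x) τ
          image τ = trans (fn-+ lin (λ ρ → (- y) * c ρ) (basis x) τ) (trans (+-congʳ (trans (fn-* lin (- y) c τ) (trans (*-congˡ (z τ)) (zeroʳ _)))) (+-identityˡ _))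
        restricted : ∀ c → Supported (insert I x) c → c x ≈ 0# → Supported I c
        restricted c s z ρ p with x ≟S ρ
        ... | yes ≡.refl = z
        ... | no ne = s ρ (≡.trans (insert-other I ne) p)
      greedy : ∀ xs → ¬ ¬ Basis xs
      greedy [] = return ((λ _ → false) , (λ _ ()) , (λ c s _ σ → return (s σ ≡.refl)) , λ _ ())
      greedy (x ∷ xs) = greedy xs >>= λ (I , sub , ind , span) → em {A = Spanned T I x} >>= cases I sub ind span
        where
        cases : ∀ I → (∀ σ → I σ ≡ true → σ ∈ xs) → Independent T I → (∀ σ → σ ∈ xs → Spanned T I σ) → Dec (Spanned T I x) → ¬ ¬ Basis (x ∷ xs)
        cases I sub ind span (yes s) = return (I , (λ σ p → there (sub σ p)) , ind , λ { σ (here ≡.refl) → s ; σ (there p) → span σ p })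
        cases I sub ind span (no ns) = return (insert I x , sub′ , ind′ , span′)
          where
          open Extend I x
          sub′ : ∀ σ → insert I x σ ≡ true → σ ∈ x ∷ xs
          sub′ σ p with insert-true⁻ I {x} {σ} p
          ... | inj₁ ≡.refl = here ≡.refl
          ... | inj₂ q = there (sub σ q)
          ind′ : Independent T (insert I x)
          ind′ c s z σ = em {A = c x ≈ 0#} >>= λ
            { (yes cx) → ind c (restricted c s cx) z σ
            ; (no nz) → ⊥-elim (ns (dependent c s z nz)) }
          span′ : ∀ σ → σ ∈ x ∷ xs → Spanned T (insert I x) σ
          span′ σ (here ≡.refl) = basis x , basis-supported (insert I x) (insert-same I x) , λ τ → refl
          span′ σ (there p) = let (c , s , t) = span σ p in c , weaken s , t

    fromℤ-sum : ∀ {m} (z : Subset m → ℤ) → fromℤ (sumℤ z) ≈ sumF (λ σ → fromℤ (z σ))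
    fromℤ-sum {zero} z = refl
    fromℤ-sum {suc m} z = trans (fromℤ-+ (sumℤ (λ σ → z (false ∷ σ))) (sumℤ (λ σ → z (true ∷ σ)))) (+-cong (fromℤ-sum (λ σ → z (false ∷ σ))) (fromℤ-sum (λ σ → z (true ∷ σ))))

    -- A rational dependency can be taken primitive over ℤ, so that it stays nontrivial in F.
    independent-ℚ : ∀ {m} {I : Subset m → Bool} → Independent bd I →
      ∀ (c : Subset m → ℚ) → (∀ σ → I σ ≡ false → c σ ≡ 0ℚ) → (∀ τ → bdℚ c τ ≡ 0ℚ) → ∀ σ → c σ ≡ 0ℚ
    independent-ℚ {m} {I} ind c s cyc = cases (primitive? c)
      where
      cases : (∀ σ → c σ ≡ 0ℚ) ⊎ Primitive c → ∀ σ → c σ ≡ 0ℚ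
      cases (inj₁ p) = p
      cases (inj₂ P) = ⊥-elim (¬¬-subsets (ind zF supported cycle) λ z≈0 → 1≉0 (trans (sym fromℤ-1) (trans (reflexive (cong fromℤ (≡.sym unit)))
          (trans (fromℤ-sum (λ σ → u σ ℤ.* z σ)) (sumF-0 (λ σ → trans (fromℤ-* (u σ) (z σ)) (trans (*-congˡ (z≈0 σ)) (zeroʳ _))))))))
        where
        open Primitive P
        zF : Fn m
        zF σ = fromℤ (z σ)
        cancel : ∀ {y} → scale ℚ.* y ≡ 0ℚ → y ≡ 0ℚ
        cancel {y} p with y ℚₚ.≟ 0ℚ
        ... | yes q = q
        ... | no ne = ⊥-elim (*-nonzero scale≢0 ne p)
        supported : Supported I zF
        supported σ p = reflexive (cong fromℤ (ιℚ-injective {z σ} (cancel (≡.trans (≡.sym (c≡ σ)) (s σ p)))))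
        cycle : ∀ τ → bd zF τ ≈ 0#
        cycle τ = trans (sym (fromℤ-bd commutativeRing z τ)) (reflexive (cong fromℤ (ιℚ-injective {bdℤ z τ} (≡.trans (fromℤ-bd ℚₚ.+-*-commutativeRing z τ)
          (cancel (≡.trans (≡.sym (ℚ∂.bd-* scale (λ σ → ιℚ (z σ)) τ)) (≡.trans (ℚ∂.bd-cong (λ σ → ≡.sym (c≡ σ)) τ) (cyc τ))))))))

    restrict : ∀ {n} → (Subset n → Bool) → Fn n → Fn n
    restrict L c σ = if L σ then c σ else 0#

    private
      sumFin-cong : ∀ {n n′ m} {f g : Fin m → Carrier} → (∀ v → f v ≈ g v) → Homology.sumFin F {n} f ≈ Homology.sumFin F {n′} g
      sumFin-cong {m = zero} p = refl
      sumFin-cong {n} {n′} {m = suc m} p = +-cong (p zero) (sumFin-cong {n} {n′} (λ v → p (suc v)))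

      sumFin-neg : ∀ {n m} (f : Fin m → Carrier) → Homology.sumFin F {n} (λ v → - f v) ≈ - Homology.sumFin F {n} f
      sumFin-neg {m = zero} f = solve 0 (con (+ 0) := :- con (+ 0)) refl
      sumFin-neg {n} {m = suc m} f = trans (+-congˡ (sumFin-neg {n} (λ v → f (suc v)))) (solve 2 (λ x y → :- x :+ :- y := :- (x :+ y)) refl _ _)

      negPow-irr : ∀ {n n′} p → Homology.negPow F {n} p ≈ Homology.negPow F {n′} p
      negPow-irr zero = refl
      negPow-irr {n} {n′} (suc p) = -‿cong (negPow-irr {n} {n′} p)

      if-cong : ∀ b {x y : Carrier} → x ≈ y → (if b then x else 0#) ≈ (if b then y else 0#)
      if-cong true p = p
      if-cong false p = refl

      if-neg : ∀ b {x y : Carrier} → x ≈ - y → (if b then x else 0#) ≈ - (if b then y else 0#)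
      if-neg true p = p
      if-neg false p = solve 0 (con (+ 0) := :- con (+ 0)) refl

      ∩-none : ∀ {n} (σ : Subset n) → ∣ σ ∩ tabulate (λ _ → false) ∣ ≡ 0
      ∩-none [] = ≡.refl
      ∩-none (false ∷ σ) = ∩-none σ
      ∩-none (true ∷ σ) = ∩-none σ

    -- Setting the chain to zero off `L` absorbs the test for cofaces in `L`, after which signs and
    -- sums follow the recursion on the first vertex.
    ∂≈bd : ∀ {n} L (ch : Fn n) σ → Homology.∂ F L ch σ ≈ bd (restrict L ch) σ
    ∂≈bd L ch [] = refl
    ∂≈bd {suc n} L ch (false ∷ σ) = trans (+-cong first (trans (sumFin-cong {suc n} {n} {n} (λ v → if-cong _ (*-congʳ (negPow-irr {suc n} {n} ∣ σ ∩ Homology.below F v ∣))))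
        (∂≈bd (λ τ → L (false ∷ τ)) (λ τ → ch (false ∷ τ)) σ))) (+-comm _ _)
      where
      first : (if L (true ∷ (σ ∪ ∅)) then Homology.negPow F {suc n} ∣ σ ∩ tabulate (λ _ → false) ∣ * ch (true ∷ (σ ∪ ∅)) else 0#) ≈ restrict L ch (true ∷ σ)
      first rewrite ∪-identityʳ σ | ∩-none σ = if-cong (L (true ∷ σ)) (*-identityˡ _)
    ∂≈bd {suc n} L ch (true ∷ σ) = trans (+-identityˡ _) (trans (sumFin-cong {suc n} {n} {n}
        {g = λ v → - (if not (does (v ∈? σ)) ∧ L (true ∷ (σ ∪ ⁅ v ⁆)) then Homology.negPow F {n} ∣ σ ∩ Homology.below F v ∣ * ch (true ∷ (σ ∪ ⁅ v ⁆)) else 0#)}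
        (λ v → if-neg _ (trans (*-congʳ (-‿cong (negPow-irr {suc n} {n} ∣ σ ∩ Homology.below F v ∣))) (solve 2 (λ p x → (:- p) :* x := :- (p :* x)) refl _ _))))
      (trans (sumFin-neg {n} {n} _) (-‿cong (∂≈bd (λ τ → L (true ∷ τ)) (λ τ → ch (true ∷ τ)) σ))))

    combination : ∀ {m l} → (Subset m → Fn l) → Fn m → Fn l
    combination coef c ρ = sumF (λ σ → c σ * coef σ ρ)

    combination-supported : ∀ {m l} {I : Subset l → Bool} {coef : Subset m → Fn l} → (∀ σ → Supported I (coef σ)) → ∀ c → Supported I (combination coef c)
    combination-supported s c ρ p = sumF-0 (λ σ → trans (*-congˡ (s σ ρ p)) (zeroʳ _))

    combination-linear : ∀ {m l} (coef : Subset m → Fn l) → LinearFn (combination coef)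
    combination-linear coef = record
      { fn-cong = λ e τ → sumF-cong (λ σ → *-congʳ (e σ))
      ; fn-+ = λ c d τ → trans (sumF-cong (λ σ → distribʳ (coef σ τ) (c σ) (d σ))) (sumF-+ (λ σ → c σ * coef σ τ) (λ σ → d σ * coef σ τ))
      ; fn-* = λ x c τ → trans (sumF-cong (λ σ → *-assoc x (c σ) (coef σ τ))) (sumF-* x (λ σ → c σ * coef σ τ)) }

    fn-sumF : ∀ {k m l} {T : Fn m → Fn l} → LinearFn T → ∀ (g : Subset k → Fn m) τ → T (λ ρ → sumF (λ σ → g σ ρ)) τ ≈ sumF (λ σ → T (g σ) τ)
    fn-sumF {zero} lin g τ = refl
    fn-sumF {suc k} lin g τ = trans (fn-+ lin _ _ τ) (+-cong (fn-sumF lin (λ σ → g (false ∷ σ)) τ) (fn-sumF lin (λ σ → g (true ∷ σ)) τ))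

    id-linearFn : ∀ {m} → LinearFn {m} (λ c → c)
    id-linearFn = record { fn-cong = λ e → e ; fn-+ = λ _ _ _ → refl ; fn-* = λ _ _ _ → refl }

    map-combination : ∀ {k m l} {M : Subset k → Bool} {T : Fn m → Fn l} {S : Fn k → Fn l} → LinearFn T → LinearFn S →
      (coef : Subset k → Fn m) → (∀ σ → M σ ≡ true → ∀ τ → T (coef σ) τ ≈ S (basis σ) τ) →
      ∀ c → Supported M c → ∀ τ → T (combination coef c) τ ≈ S c τ
    map-combination {M = M} {T} {S} lin lin′ coef p c s τ = trans (fn-sumF lin (λ σ ρ → c σ * coef σ ρ) τ)
      (trans (sumF-cong (λ σ → trans (fn-* lin (c σ) (coef σ) τ) (term σ (bool-cases (M σ))))) (sym (fn-expand lin′ c τ)))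
      where
      term : ∀ σ → M σ ≡ true ⊎ M σ ≡ false → c σ * T (coef σ) τ ≈ c σ * S (basis σ) τ
      term σ (inj₁ q) = *-congˡ (p σ q τ)
      term σ (inj₂ q) = trans (*-congʳ (s σ q)) (trans (zeroˡ _) (sym (trans (*-congʳ (s σ q)) (zeroˡ _))))

    choose : ∀ {m l q} {I : Subset l → Bool} (M : Subset m → Bool) {Q : Subset m → Fn l → Set q} →
      (∀ σ → M σ ≡ true → ∃ λ c → Supported I c × Q σ c) →
      ∃ λ (coef : Subset m → Fn l) → (∀ σ → Supported I (coef σ)) × (∀ σ → M σ ≡ true → Q σ (coef σ))
    choose {I = I} M {Q} f = (λ σ → proj₁ (pick σ (bool-cases (M σ)))) , (λ σ → proj₁ (proj₂ (pick σ (bool-cases (M σ))))) , λ σ → proj₂ (proj₂ (pick σ (bool-cases (M σ))))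
      where
      pick : ∀ σ → M σ ≡ true ⊎ M σ ≡ false → ∃ λ c → Supported I c × (M σ ≡ true → Q σ c)
      pick σ (inj₁ p) = let (c , s , q) = f σ p in c , s , λ _ → q
      pick σ (inj₂ p) = (λ _ → 0#) , (λ _ _ → refl) , λ p′ → true≢false p′ p

    -- The map (γ , b) ↦ ∂b + γ, with the two arguments packed into one function.
    bd⊕ : ∀ {n} → Fn (suc n) → Fn n
    bd⊕ c τ = bd (λ ρ → c (true ∷ ρ)) τ + c (false ∷ τ)

    bd⊕-linear : ∀ {n} → LinearFn (bd⊕ {n})
    bd⊕-linear = record
      { fn-cong = λ e τ → +-cong (bd-cong (λ ρ → e (true ∷ ρ)) τ) (e (false ∷ τ))
      ; fn-+ = λ c d τ → trans (+-congʳ (bd-+ (λ ρ → c (true ∷ ρ)) (λ ρ → d (true ∷ ρ)) τ)) (solve 4 (λ x y z w → (x :+ y) :+ (z :+ w) := (x :+ z) :+ (y :+ w)) refl _ _ _ _)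
      ; fn-* = λ x c τ → trans (+-congʳ (bd-* x (λ ρ → c (true ∷ ρ)) τ)) (sym (distribˡ x _ _)) }

    bd-supported : ∀ {n k} {L : Subset n → Bool} → DownClosed L → ∀ {c} → Supported (ofSize (suc k) L) c → Supported (ofSize k L) (bd c)
    bd-supported {k = k} {L} down {c} s σ p = trans (bd-local σ (λ τ x → s τ (¬true⇒false λ q → true≢false
      (∧-true⁺ (down x (∧-true⁻ˡ q)) (≡ᵇ-true⁺ (ℕₚ.suc-injective (≡.trans (≡.sym (add-size x)) (≡ᵇ-true⁻ (∧-true⁻ʳ {L τ} q)))))) p))) (bd-0 σ)

    -- The hypothesis controls a filling only through its boundary on faces with k vertices. Cutting
    -- it down to faces with k + 1 vertices leaves this part unchanged and makes the rest of the
    -- boundary vanish.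
    fill : ∀ {n k} {L : Subset n → Bool} → DownClosed L → Homology.ReducedHomologyVanishes F L k →
      ∀ c → Supported (ofSize k L) c → (∀ τ → bd c τ ≈ 0#) → ∃ λ b → Supported (ofSize (suc k) L) b × (∀ τ → bd b τ ≈ c τ)
    fill {n} {k} {L} down vanishes c s cyc = b′ , b′-supported , λ τ → filled τ (bool-cases (ofSize k L τ))
      where
      c-restricted : ∀ τ → restrict L c τ ≈ c τ
      c-restricted τ = by (bool-cases (L τ))
        where
        by : L τ ≡ true ⊎ L τ ≡ false → restrict L c τ ≈ c τ
        by (inj₁ p) rewrite p = refl
        by (inj₂ p) = trans (reflexive (cong (if_then c τ else 0#) p)) (sym (s τ (cong (_∧ (∣ τ ∣ ≡ᵇ k)) p)))
      filling : ∃ λ b → ∀ τ → L τ ≡ true → ∣ τ ∣ ≡ k → Homology.∂ F L b τ ≈ c τ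
      filling = vanishes c λ σ _ _ → trans (∂≈bd L c σ) (trans (bd-cong c-restricted σ) (cyc σ))
      b = proj₁ filling
      b′ = restrict (ofSize (suc k) L) b
      b′-supported : Supported (ofSize (suc k) L) b′
      b′-supported σ p = reflexive (cong (if_then b σ else 0#) p)
      filled : ∀ τ → ofSize k L τ ≡ true ⊎ ofSize k L τ ≡ false → bd b′ τ ≈ c τ
      filled τ (inj₁ p) = trans (bd-local τ same) (trans (sym (∂≈bd L b τ)) (proj₂ filling τ (∧-true⁻ˡ p) ∣τ∣≡k))
        where
        ∣τ∣≡k : ∣ τ ∣ ≡ k
        ∣τ∣≡k = ≡ᵇ-true⁻ (∧-true⁻ʳ {L τ} p)
        same : ∀ ρ → Add τ ρ → b′ ρ ≈ restrict L b ρ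
        same ρ x = reflexive (cong (if_then b ρ else 0#) (≡.trans (cong (L ρ ∧_) (≡ᵇ-true⁺ (≡.trans (add-size x) (cong suc ∣τ∣≡k)))) (∧-identityʳ (L ρ))))
      filled τ (inj₂ p) = trans (bd-supported down b′-supported τ p) (sym (s τ p))

  pack : ∀ {n} → (Subset n → Bool) → (Subset n → Bool) → Subset (suc n) → Bool
  pack J I (false ∷ σ) = J σ
  pack J I (true ∷ σ) = I σ

  module ToℚSection {a ℓ} (F : Field a ℓ) where
    module 𝔽 = OverField F
    module 𝔽n = Functions F
    module 𝔽∂ = Boundary (Field.commutativeRing F)
    module ℚ′ = OverField ℚ-field
    open Field F using () renaming (_≈_ to _≈F_; 0# to 0F; 1# to 1F)

    module _ {n k : ℕ} {L : Subset n → Bool} (down : DownClosed L) (vanishes : Homology.ReducedHomologyVanishes F L k)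
      {J : Subset n → Bool} (J⊆ : ∀ σ → J σ ≡ true → ofSize k L σ ≡ true) (J-ind : 𝔽.Independent 𝔽∂.bd J)
      (J-span : ∀ σ → ofSize k L σ ≡ true → 𝔽.Spanned 𝔽∂.bd J σ)
      {I : Subset n → Bool} (I⊆ : ∀ σ → I σ ≡ true → ofSize (suc k) L σ ≡ true) (I-ind : 𝔽.Independent 𝔽∂.bd I)
      (I-span : ∀ σ → ofSize (suc k) L σ ≡ true → 𝔽.Spanned 𝔽∂.bd I σ) where
      private
        M = ofSize k L
        N = ofSize (suc k) L

        -- Over `F`, a face differs by a cycle from a combination of `J` with the same boundary.
        -- This cycle bounds, and its filling may be replaced by one supported on `I`.
        decomposed : ∀ σ → M σ ≡ true → ∃ λ c → 𝔽n.Supported (pack J I) c × (∀ τ → 𝔽.bd⊕ c τ ≈F 𝔽n.basis σ τ)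
        decomposed σ σ∈ = c , supported , image
          where
          open Field F hiding (zero)
          open Boundary commutativeRing
          open FromℤTo commutativeRing using (module Solver)
          open Solver using (solve; _:=_; _:+_; _:*_; :-_; con)
          γ = proj₁ (J-span σ σ∈)
          γ-supported = proj₁ (proj₂ (J-span σ σ∈))
          z : 𝔽n.Fn n
          z τ = 𝔽n.basis σ τ + - 1# * γ τ
          z-cycle : ∀ τ → bd z τ ≈ 0#
          z-cycle τ = trans (bd-+ (𝔽n.basis σ) (λ τ → - 1# * γ τ) τ) (trans (+-congˡ (trans (bd-* (- 1#) γ τ) (*-congˡ (proj₂ (proj₂ (J-span σ σ∈)) τ))))
            (trans (+-congˡ (solve 2 (λ o x → :- o :* x := :- (o :* x)) refl 1# _)) (trans (+-congˡ (-‿cong (*-identityˡ _))) (-‿inverseʳ _))))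
          z-supported : 𝔽n.Supported M z
          z-supported τ p = trans (+-cong (𝔽n.basis-supported M σ∈ τ p) (trans (*-congˡ (γ-supported τ (¬true⇒false λ q → true≢false (J⊆ τ q) p))) (zeroʳ _))) (+-identityˡ 0#)
          filled = 𝔽.fill down vanishes z z-supported z-cycle
          b = proj₁ filled
          chosen = 𝔽.choose {I = I} N {λ ρ c → ∀ τ → bd c τ ≈ bd (𝔽n.basis ρ) τ} I-span
          b′ = 𝔽.combination (proj₁ chosen) b
          c : 𝔽n.Fn (suc n)
          c (false ∷ τ) = γ τ
          c (true ∷ τ) = b′ τ
          supported : 𝔽n.Supported (pack J I) c
          supported (false ∷ τ) = γ-supported τ
          supported (true ∷ τ) = 𝔽.combination-supported (proj₁ (proj₂ chosen)) b τ
          image : ∀ τ → 𝔽.bd⊕ c τ ≈ 𝔽n.basis σ τ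
          image τ = trans (+-congʳ (trans (𝔽.map-combination 𝔽.bd-linear 𝔽.bd-linear (proj₁ chosen) (proj₂ (proj₂ chosen)) b (proj₁ (proj₂ filled)) τ) (proj₂ (proj₂ filled) τ)))
            (trans (+-congʳ (+-congˡ (trans (solve 2 (λ o x → :- o :* x := :- (o :* x)) refl 1# _) (-‿cong (*-identityˡ _))))) (solve 2 (λ x y → (x :+ :- y) :+ y := x) refl _ _))

        -- So over `F` boundaries from `I` and chains on `J` together span all chains on `M`; the
        -- conclusion is a statement about cardinalities, free of the field.
        enough : count M ≤ count (pack J I)
        enough = 𝔽n.dimension M (pack J I) (𝔽.combination coef) (𝔽.combination-linear coef) λ c s z σ → return
            (trans (sym (𝔽.map-combination 𝔽.bd⊕-linear 𝔽.id-linearFn coef (proj₂ (proj₂ chosen)) c s σ))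
              (𝔽n.fn-0 𝔽.bd⊕-linear (λ ρ → all-zero c z ρ (bool-cases (pack J I ρ))) σ))
          where
          open Field F using (trans; sym; _≈_; 0#)
          chosen = 𝔽.choose {I = pack J I} M {λ σ c → ∀ τ → 𝔽.bd⊕ c τ ≈ 𝔽n.basis σ τ} decomposed
          coef = proj₁ chosen
          all-zero : ∀ c → (∀ ρ → pack J I ρ ≡ true → 𝔽.combination coef c ρ ≈ 0#) → ∀ ρ → pack J I ρ ≡ true ⊎ pack J I ρ ≡ false → 𝔽.combination coef c ρ ≈ 0#
          all-zero c z ρ (inj₁ p) = z ρ p
          all-zero c z ρ (inj₂ p) = 𝔽.combination-supported (proj₁ (proj₂ chosen)) c ρ p

        Qℚ : (Subset (suc n) → ℚ) → Set
        Qℚ = ℚFn.Supported (pack J I)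

        false-half : ∀ c → Qℚ c → (∀ τ → bdℚ (ℚ′.bd⊕ c) τ ≡ 0ℚ) → ∀ τ → c (false ∷ τ) ≡ 0ℚ
        false-half c s z = 𝔽.independent-ℚ {I = J} J-ind (λ τ → c (false ∷ τ)) (λ τ → s (false ∷ τ)) λ τ →
          ≡.trans (≡.sym (ℚₚ.+-identityˡ _)) (≡.trans (cong (ℚ._+ bdℚ (λ τ → c (false ∷ τ)) τ) (≡.sym (bdbd (λ τ → c (true ∷ τ)) τ)))
            (≡.trans (≡.sym (ℚ∂.bd-+ (bdℚ (λ τ → c (true ∷ τ))) (λ τ → c (false ∷ τ)) τ)) (z τ)))

        -- Taking boundaries of ∂b + γ = 0 leaves ∂γ = 0; independence of `J`, which persists over
        -- ℚ, gives γ = 0, and then that of `I` gives b = 0.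
        injective : ∀ c → Qℚ c → (∀ τ → ℚ′.bd⊕ c τ ≡ 0ℚ) → ∀ ρ → c ρ ≡ 0ℚ
        injective c s z = λ { (false ∷ τ) → γ≡0 τ ; (true ∷ τ) → 𝔽.independent-ℚ {I = I} I-ind (λ τ → c (true ∷ τ)) (λ τ → s (true ∷ τ))
            (λ τ → ≡.trans (≡.sym (ℚₚ.+-identityʳ _)) (≡.trans (cong (bdℚ (λ τ → c (true ∷ τ)) τ ℚ.+_) (≡.sym (γ≡0 τ))) (z τ))) τ }
          where
          γ≡0 : ∀ τ → c (false ∷ τ) ≡ 0ℚ
          γ≡0 = false-half c s (λ τ → ≡.trans (ℚ∂.bd-cong z τ) (ℚ∂.bd-0 τ))

        bd⊕-supported : ∀ c → Qℚ c → ℚFn.Supported M (ℚ′.bd⊕ c)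
        bd⊕-supported c s τ p = ≡.trans (cong₂ ℚ._+_ (ℚ′.bd-supported down {λ ρ → c (true ∷ ρ)} (λ ρ q → s (true ∷ ρ) (¬true⇒false λ r → true≢false (I⊆ ρ r) q)) τ p)
          (s (false ∷ τ) (¬true⇒false λ r → true≢false (J⊆ τ r) p))) (ℚₚ.+-identityˡ 0ℚ)

        -- If `σ` were not in the image, adjoining it through the additional index `true ∷ ∅` would
        -- give an injective map from a space of dimension greater than |M| into the chains on `M`.
        spanning : ∀ σ → M σ ≡ true → ¬ ¬ (∃ λ c → Qℚ c × (∀ τ → ℚ′.bd⊕ c τ ≡ ℚFn.basis σ τ))
        spanning σ σ∈ none = ℕₚ.<⇒≱ larger (ℚFn.dimension mask M T lin λ c s z ρ → return (inj c s z ρ))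
          where
          mask : Subset (suc (suc n)) → Bool
          mask (false ∷ ρ) = pack J I ρ
          mask (true ∷ ρ) = insert (λ _ → false) ∅ ρ
          larger : count M ℕ.< count mask
          larger = ℕₚ.≤-trans (ℕ.s≤s enough) (ℕₚ.≤-trans (ℕₚ.≤-reflexive (ℕₚ.+-comm 1 _)) (ℕₚ.+-monoʳ-≤ (count (pack J I)) (count-pos {suc n} (insert (λ _ → false) ∅) {∅} (insert-same {suc n} (λ _ → false) ∅))))
          T : ℚFn.Fn (suc (suc n)) → ℚFn.Fn n
          T c τ = ℚ′.bd⊕ (λ ρ → c (false ∷ ρ)) τ ℚ.+ c (true ∷ ∅) ℚ.* ℚFn.basis σ τ
          lin : ℚFn.LinearFn T
          lin = record
            { fn-cong = λ e τ → cong₂ ℚ._+_ (ℚFn.fn-cong ℚ′.bd⊕-linear (λ ρ → e (false ∷ ρ)) τ) (cong (ℚ._* ℚFn.basis σ τ) (e (true ∷ ∅)))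
            ; fn-+ = λ c d τ → ≡.trans (cong (ℚ._+ (c (true ∷ ∅) ℚ.+ d (true ∷ ∅)) ℚ.* ℚFn.basis σ τ) (ℚFn.fn-+ ℚ′.bd⊕-linear (λ ρ → c (false ∷ ρ)) (λ ρ → d (false ∷ ρ)) τ))
                (ℚS.solve 5 (λ x y c d b → (x ℚS.:+ y) ℚS.:+ (c ℚS.:+ d) ℚS.:* b ℚS.:= (x ℚS.:+ c ℚS.:* b) ℚS.:+ (y ℚS.:+ d ℚS.:* b)) ≡.refl (ℚ′.bd⊕ (λ ρ → c (false ∷ ρ)) τ) (ℚ′.bd⊕ (λ ρ → d (false ∷ ρ)) τ) (c (true ∷ ∅)) (d (true ∷ ∅)) (ℚFn.basis σ τ))
            ; fn-* = λ x c τ → ≡.trans (cong (ℚ._+ (x ℚ.* c (true ∷ ∅)) ℚ.* ℚFn.basis σ τ) (ℚFn.fn-* ℚ′.bd⊕-linear x (λ ρ → c (false ∷ ρ)) τ))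
                (ℚS.solve 4 (λ x y c b → x ℚS.:* y ℚS.:+ (x ℚS.:* c) ℚS.:* b ℚS.:= x ℚS.:* (y ℚS.:+ c ℚS.:* b)) ≡.refl x (ℚ′.bd⊕ (λ ρ → c (false ∷ ρ)) τ) (c (true ∷ ∅)) (ℚFn.basis σ τ)) }
          inj : ∀ c → ℚFn.Supported mask c → (∀ τ → M τ ≡ true → T c τ ≡ 0ℚ) → ∀ ρ → c ρ ≡ 0ℚ
          inj c s z = cases (x ℚₚ.≟ 0ℚ)
            where
            x = c (true ∷ ∅)
            d : ℚFn.Fn (suc n)
            d ρ = c (false ∷ ρ)
            Tc : ∀ τ → M τ ≡ true ⊎ M τ ≡ false → T c τ ≡ 0ℚ
            Tc τ (inj₁ p) = z τ p
            Tc τ (inj₂ p) = ≡.trans (cong₂ ℚ._+_ (bd⊕-supported d (λ ρ → s (false ∷ ρ)) τ p) (≡.trans (cong (x ℚ.*_) (ℚFn.basis-supported M σ∈ τ p)) (ℚₚ.*-zeroʳ x))) (ℚₚ.+-identityˡ 0ℚ)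
            cases : Dec (x ≡ 0ℚ) → ∀ ρ → c ρ ≡ 0ℚ
            cases (yes x≡0) (false ∷ ρ) = injective d (λ ρ → s (false ∷ ρ)) (λ τ → ≡.trans (≡.sym (≡.trans (cong (ℚ′.bd⊕ d τ ℚ.+_) (≡.trans (cong (ℚ._* ℚFn.basis σ τ) x≡0) (ℚₚ.*-zeroˡ (ℚFn.basis σ τ)))) (ℚₚ.+-identityʳ _))) (Tc τ (bool-cases (M τ)))) ρ
            cases (yes x≡0) (true ∷ ρ) with ∅ ≟S ρ
            ... | yes ≡.refl = x≡0
            ... | no ne = s (true ∷ ρ) (insert-other (λ _ → false) ne)
            cases (no x≢0) ρ = ⊥-elim (none ((λ ρ → (ℚ.- y) ℚ.* d ρ) , (λ ρ p → ≡.trans (cong ((ℚ.- y) ℚ.*_) (s (false ∷ ρ) p)) (ℚₚ.*-zeroʳ (ℚ.- y))) , λ τ →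
                ≡.trans (ℚFn.fn-* ℚ′.bd⊕-linear (ℚ.- y) d τ)
                  (≡.trans (ℚS.solve 4 (λ y t x b → (ℚS.:- y) ℚS.:* t ℚS.:= (ℚS.:- y) ℚS.:* (t ℚS.:+ x ℚS.:* b) ℚS.:+ (x ℚS.:* y) ℚS.:* b) ≡.refl y (ℚ′.bd⊕ d τ) x (ℚFn.basis σ τ))
                  (≡.trans (cong₂ (λ p q → (ℚ.- y) ℚ.* p ℚ.+ q ℚ.* ℚFn.basis σ τ) (Tc τ (bool-cases (M τ))) (proj₂ (inverseʳ x≢0)))
                  (ℚS.solve 2 (λ y b → (ℚS.:- y) ℚS.:* ℚS.con (+ 0) ℚS.:+ ℚS.con (+ 1) ℚS.:* b ℚS.:= b) ≡.refl y (ℚFn.basis σ τ))))))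
              where y = proj₁ (inverseʳ x≢0)

      section : ¬ ¬ Section L k
      section = ¬¬-subsets (λ σ → spanned σ (bool-cases (M σ))) >>= λ span → return (build span)
        where
        spanned : ∀ σ → M σ ≡ true ⊎ M σ ≡ false → ¬ ¬ (M σ ≡ true → ∃ λ c → Qℚ c × (∀ τ → ℚ′.bd⊕ c τ ≡ ℚFn.basis σ τ))
        spanned σ (inj₁ p) = spanning σ p >>= λ r → return λ _ → r
        spanned σ (inj₂ p) = return λ q → true≢false q p
        build : (∀ σ → M σ ≡ true → ∃ λ c → Qℚ c × (∀ τ → ℚ′.bd⊕ c τ ≡ ℚFn.basis σ τ)) → Section L k
        build span = record
          { h = h
          ; linear = record
            { lin-⊕ = λ u v → ≡.trans (mkΛ-cong λ τ → ≡.trans (ℚFn.fn-cong comb-linear (at-⊕ u v) (true ∷ τ)) (ℚFn.fn-+ comb-linear (at u) (at v) (true ∷ τ))) (mkΛ-⊕ _ _)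
            ; lin-· = λ x u → ≡.trans (mkΛ-cong λ τ → ≡.trans (ℚFn.fn-cong comb-linear (at-· x u) (true ∷ τ)) (ℚFn.fn-* comb-linear x (at u) (true ∷ τ))) (mkΛ-· x _) }
          ; into = λ {u} _ → mkSup λ τ → chain u τ (bool-cases (I τ))
          ; bounds = bounds }
          where
          chosen = ℚ′.choose {I = pack J I} M {λ σ c → ∀ τ → ℚ′.bd⊕ c τ ≡ ℚFn.basis σ τ} span
          coef = proj₁ chosen
          comb = ℚ′.combination coef
          comb-linear = ℚ′.combination-linear coef
          h : Λ n → Λ n
          h u = mkΛ (λ τ → comb (at u) (true ∷ τ))
          mkΛ-cong : ∀ {c d : Subset n → ℚ} → (∀ τ → c τ ≡ d τ) → mkΛ c ≡ mkΛ d
          mkΛ-cong {c} {d} p = at-ext λ τ → ≡.trans (at-mkΛ c τ) (≡.trans (p τ) (≡.sym (at-mkΛ d τ)))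
          chain : ∀ u τ → I τ ≡ true ⊎ I τ ≡ false → (L τ ≡ true × ∣ τ ∣ ≡ suc k) ⊎ at (h u) τ ≡ 0ℚ
          chain u τ (inj₁ p) = inj₁ (∧-true⁻ˡ (I⊆ τ p) , ≡ᵇ-true⁻ (∧-true⁻ʳ {L τ} (I⊆ τ p)))
          chain u τ (inj₂ p) = inj₂ (≡.trans (at-mkΛ _ τ) (ℚ′.combination-supported (proj₁ (proj₂ chosen)) (at u) (true ∷ τ) p))
          bounds : ∀ {u} → Chain L k u → i ones u ≡ 𝟎 → i ones (h u) ≡ u
          bounds {u} ch cyc = at-ext λ τ → ≡.trans (at-i-ones (h u) τ) (≡.trans (ℚ∂.bd-cong (at-mkΛ (λ τ → comb (at u) (true ∷ τ))) τ)
              (≡.trans (≡.sym (≡.trans (cong (bdℚ (λ τ → comb (at u) (true ∷ τ)) τ ℚ.+_) (rest τ)) (ℚₚ.+-identityʳ _))) (image τ)))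
            where
            u-supported : ℚFn.Supported M (at u)
            u-supported τ p = by (sup ch τ)
              where
              by : (L τ ≡ true × ∣ τ ∣ ≡ k) ⊎ at u τ ≡ 0ℚ → at u τ ≡ 0ℚ
              by (inj₁ (q , r)) = true≢false (∧-true⁺ q (≡ᵇ-true⁺ r)) p
              by (inj₂ q) = q
            image : ∀ τ → ℚ′.bd⊕ (comb (at u)) τ ≡ at u τ
            image = ℚ′.map-combination ℚ′.bd⊕-linear ℚ′.id-linearFn coef (proj₂ (proj₂ chosen)) (at u) u-supported
            -- For a cycle the component on `J` has zero boundary, hence vanishes, and the component
            -- on `I` alone is a filling.
            rest : ∀ τ → comb (at u) (false ∷ τ) ≡ 0ℚ
            rest = false-half (comb (at u)) (ℚ′.combination-supported (proj₁ (proj₂ chosen)) (at u)) λ τ →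
              ≡.trans (ℚ∂.bd-cong image τ) (≡.trans (≡.sym (at-i-ones u τ)) (≡.trans (cong (λ v → at v τ) cyc) (at-κ 0ℚ τ)))

    vanishing⇒section : ∀ {n k} {L : Subset n → Bool} → DownClosed L → Homology.ReducedHomologyVanishes F L k → ¬ ¬ Section L k
    vanishing⇒section {k = k} {L} down vanishes = 𝔽.maximal-independent 𝔽.bd-linear (ofSize k L) >>= λ (J , J⊆ , J-ind , J-span) →
      𝔽.maximal-independent 𝔽.bd-linear (ofSize (suc k) L) >>= λ (I , I⊆ , I-ind , I-span) → section down vanishes J⊆ J-ind J-span I⊆ I-ind I-span

-- Strong connectivity from depth

module Connectivity where

  open Counting
  open ShiftedFamilies using (Add; here; there; DownClosed; add-size)
  open Exterior
  open PolynomialMaps using (sub-⊕; sub-⊝)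
  open Depth
  open Transfer using (module ℚ∂; bdℚ; bdbd; at-i-ones)
  open import Data.Fin.Subset using (∣_∣)
  open import Data.Fin.Subset.Properties using (x∈⁅y⁆⇒x≡y; ∣⊥∣≡0)
  open import Data.Nat using (_≤_; _<_)
  open import Data.Vec using (tabulate)
  open import Data.Vec.Properties using (lookup∘tabulate; lookup⇒[]=)
  open import Relation.Binary.PropositionalEquality

  private variable
    n : ℕ

  infix 4 _⊑_
  _⊑_ : Subset n → Subset n → Set
  σ ⊑ τ = ∀ x → lookup σ x ≡ true → lookup τ x ≡ true

  subset-ext : {σ τ : Subset n} → (∀ x → lookup σ x ≡ lookup τ x) → σ ≡ τ
  subset-ext {σ = []} {[]} p = refl
  subset-ext {σ = _ ∷ _} {_ ∷ _} p = cong₂ _∷_ (p zero) (subset-ext (λ x → p (suc x)))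

  ∈⇒size : ∀ {x} (σ : Subset n) → lookup σ x ≡ true → 1 ≤ ∣ σ ∣
  ∈⇒size {x = zero} (true ∷ σ) p = s≤s z≤n
  ∈⇒size {x = suc x} (true ∷ σ) p = s≤s z≤n
  ∈⇒size {x = suc x} (false ∷ σ) p = ∈⇒size {x = x} σ p

  size⇒∈ : (σ : Subset n) → 1 ≤ ∣ σ ∣ → ∃ λ x → lookup σ x ≡ true
  size⇒∈ (true ∷ σ) p = zero , refl
  size⇒∈ (false ∷ σ) p with size⇒∈ σ p
  ... | x , q = suc x , q

  size-0 : (σ : Subset n) → ∣ σ ∣ ≡ 0 → σ ≡ ∅
  size-0 [] p = refl
  size-0 (false ∷ σ) p = cong (false ∷_) (size-0 σ p)

  size-remove : ∀ {x} {σ : Subset n} → lookup σ x ≡ true → ∣ σ ∣ ≡ suc ∣ σ [ x ]≔ false ∣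
  size-remove {x = x} {σ} p = add-size (addAt⇒add (addAt-remove x σ p))

  size-insert : ∀ {x} {σ : Subset n} → lookup σ x ≡ false → ∣ σ [ x ]≔ true ∣ ≡ suc ∣ σ ∣
  size-insert {x = x} {σ} p = add-size (addAt⇒add (addAt-insert x σ p))

  two-members : ∀ {x y} {σ : Subset n} → x ≢ y → lookup σ x ≡ true → lookup σ y ≡ true → 2 ≤ ∣ σ ∣
  two-members {x = x} {y} {σ} ne p q = subst (2 ≤_) (sym (size-remove {x = x} {σ} p))
    (s≤s (∈⇒size {x = y} (σ [ x ]≔ false) (trans (lookup∘update′ (λ e → ne (sym e)) σ false) q)))

  add-⊑ : {σ τ : Subset n} → Add σ τ → σ ⊑ τ
  add-⊑ here (suc x) p = p
  add-⊑ (there a) zero p = p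
  add-⊑ (there a) (suc x) p = add-⊑ a x p

  addAt-singleton : (x : Fin n) → AddAt x ∅ ⁅ x ⁆
  addAt-singleton zero = here
  addAt-singleton (suc x) = there (addAt-singleton x)

  ∈-singleton : ∀ {x y : Fin n} → lookup ⁅ x ⁆ y ≡ true → y ≡ x
  ∈-singleton {x = x} {y} p = x∈⁅y⁆⇒x≡y x (lookup⇒[]= y ⁅ x ⁆ p)

  singleton-∈ : (x : Fin n) → lookup ⁅ x ⁆ x ≡ true
  singleton-∈ x = addAt-∈ (addAt-singleton x)

  lookup-∩ : ∀ x (σ τ : Subset n) → lookup (σ ∩ τ) x ≡ lookup σ x ∧ lookup τ x
  lookup-∩ x σ τ = lookup-zipWith _∧_ x σ τ

  ∩-∈⁻ : ∀ (σ τ : Subset n) x → lookup (σ ∩ τ) x ≡ true → lookup σ x ≡ true × lookup τ x ≡ true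
  ∩-∈⁻ σ τ x p = ∧-true⁻ˡ (trans (sym (lookup-∩ x σ τ)) p) , ∧-true⁻ʳ {lookup σ x} (trans (sym (lookup-∩ x σ τ)) p)

  ∩-∈⁺ : ∀ (σ τ : Subset n) x → lookup σ x ≡ true → lookup τ x ≡ true → lookup (σ ∩ τ) x ≡ true
  ∩-∈⁺ σ τ x p q = trans (lookup-∩ x σ τ) (∧-true⁺ p q)

  private
    i-e-∅ : i ones (e (∅ {n})) ≡ 𝟎
    i-e-∅ {zero} = refl
    i-e-∅ {suc n} = cong₂ _∥_ (trans (cong₂ _⊕_ i-e-∅ (a·𝟎 1ℚ)) (⊕-identityˡ 𝟎)) (trans (cong ⊝_ (lin-𝟎 (i-linear ones))) ⊝𝟎)

    i-e-singleton : (x : Fin n) → i ones (e ⁅ x ⁆) ≡ e ∅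
    i-e-singleton zero = cong₂ _∥_ (trans (cong₂ _⊕_ (lin-𝟎 (i-linear ones)) (1·u (e ∅))) (⊕-identityˡ (e ∅))) (trans (cong ⊝_ i-e-∅) ⊝𝟎)
    i-e-singleton (suc x) = cong₂ _∥_ (trans (cong₂ _⊕_ (i-e-singleton x) (a·𝟎 1ℚ)) (⊕-identityʳ (e ∅))) (trans (cong ⊝_ (lin-𝟎 (i-linear ones))) ⊝𝟎)

  -- The empty face is a cycle, and without vertices nothing could fill it.
  section-vertex : {L : Subset n → Bool} → Section L 0 → L ∅ ≡ true → ∃ λ x → L ⁅ x ⁆ ≡ true
  section-vertex {n} {L} s p with any? (λ x → L ⁅ x ⁆ ≟B true)
  ... | yes v = v
  ... | no none = ⊥-elim (1≢0 (trans (sym (at-e-same (∅ {n}))) (trans (cong (λ u → at u ∅) e∅≡𝟎) (at-κ 0ℚ (∅ {n})))))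
    where
    open Section s
    ch : Chain L 0 (e ∅)
    ch = chain-e p (∣⊥∣≡0 n)
    empty : ∀ σ → ¬ (L σ ≡ true × ∣ σ ∣ ≡ 1)
    empty σ (q , r) with size⇒∈ σ (ℕₚ.≤-reflexive (sym r))
    ... | x , x∈ = none (x , subst (λ ρ → L ρ ≡ true) (trans (addAt-τ (addAt-remove x σ x∈)) (trans (cong (λ ρ → (ρ [ x ]≔ true)) rest) (sym (addAt-τ (addAt-singleton x))))) q)
      where
      rest : σ [ x ]≔ false ≡ ∅
      rest = size-0 _ (ℕₚ.suc-injective (trans (sym (size-remove {x = x} {σ} x∈)) r))
    e∅≡𝟎 : e (∅ {n}) ≡ 𝟎
    e∅≡𝟎 = trans (sym (bounds ch i-e-∅)) (trans (cong (i ones) (sup-empty empty (into ch))) (lin-𝟎 (i-linear ones)))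

  -- If χ were not constant, the part of a 1-chain bounded by x − y that lies on edges of colour χ x would be bounded by x alone.
  module _ {n : ℕ} {L : Subset n → Bool} (s : Section L 1) (χ : Fin n → Bool)
    (edges : ∀ τ → L τ ≡ true → ∣ τ ∣ ≡ 2 → ∀ v w → lookup τ v ≡ true → lookup τ w ≡ true → χ v ≡ χ w) where
    open Section s

    private
      no-cut : ∀ x y → L ⁅ x ⁆ ≡ true → L ⁅ y ⁆ ≡ true → χ x ≡ true → χ y ≡ false → ⊥
      no-cut x y Lx Ly χx χy = 1≢0 (trans (sym (at-e-same (∅ {n}))) (trans (cong (λ w → at w ∅) (sym (i-e-singleton x)))
          (trans (at-i-ones (e ⁅ x ⁆) ∅) (trans (ℚ∂.bd-cong (λ σ → sym (bd-c₁ σ)) ∅) (bdbd c₁ ∅)))))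
        where
        u = e ⁅ x ⁆ ⊕ ⊝ e ⁅ y ⁆
        ch : Chain L 1 u
        ch = sub-⊕ sup-subspace (chain-e Lx (∣⁅x⁆∣≡1 x)) (sub-⊝ sup-subspace (chain-e Ly (∣⁅x⁆∣≡1 y)))
        cyc : i ones u ≡ 𝟎
        cyc = trans (lin-⊕ (i-linear ones) _ _) (trans (cong₂ _⊕_ (i-e-singleton x) (trans (lin-⊝ (i-linear ones) _) (cong ⊝_ (i-e-singleton y)))) (⊝-inverseʳ (e ∅)))
        c : Subset n → ℚ
        c = at (h u)
        bd-c : ∀ σ → bdℚ c σ ≡ at u σ
        bd-c σ = trans (sym (at-i-ones (h u) σ)) (cong (λ w → at w σ) (bounds ch cyc))
        coloured : Subset n → Bool
        coloured τ = not (∣ τ ∩ tabulate χ ∣ ≡ᵇ 0)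
        c₁ : Subset n → ℚ
        c₁ τ = if coloured τ then c τ else 0ℚ
        coloured⁺ : ∀ τ v → lookup τ v ≡ true → χ v ≡ true → coloured τ ≡ true
        coloured⁺ τ v p q = positive (∈⇒size {x = v} (τ ∩ tabulate χ) (∩-∈⁺ τ (tabulate χ) v p (trans (lookup∘tabulate χ v) q)))
          where
          positive : ∀ {k} → 1 ≤ k → not (k ≡ᵇ 0) ≡ true
          positive (s≤s _) = refl
        coloured⁻ : ∀ τ → coloured τ ≡ true → ∃ λ v → lookup τ v ≡ true × χ v ≡ true
        coloured⁻ τ p with size⇒∈ (τ ∩ tabulate χ) (positive p)
          where
          positive : ∀ {k} → not (k ≡ᵇ 0) ≡ true → 1 ≤ k
          positive {suc k} _ = s≤s z≤n
        ... | v , q = v , proj₁ (∩-∈⁻ τ (tabulate χ) v q) , trans (sym (lookup∘tabulate χ v)) (proj₂ (∩-∈⁻ τ (tabulate χ) v q))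
        c₁-0 : ∀ τ → c τ ≡ 0ℚ → c₁ τ ≡ 0ℚ
        c₁-0 τ p with coloured τ
        ... | true = p
        ... | false = refl
        vanish : ∀ σ → (∀ τ → Add σ τ → c₁ τ ≡ 0ℚ) → bdℚ c₁ σ ≡ 0ℚ
        vanish σ p = trans (ℚ∂.bd-local σ p) (ℚ∂.bd-0 σ)
        not-singleton : ∀ σ z → σ ≢ ⁅ z ⁆ → at (e ⁅ z ⁆) σ ≡ 0ℚ
        not-singleton σ z ne = at-e-other {σ = ⁅ z ⁆} {σ} (λ p → ne (sym p))
        bd-c₁ : ∀ σ → bdℚ c₁ σ ≡ at (e ⁅ x ⁆) σ
        bd-c₁ σ = by-size (∣ σ ∣ ℕ.≟ 1)
          where
          by-size : Dec (∣ σ ∣ ≡ 1) → bdℚ c₁ σ ≡ at (e ⁅ x ⁆) σ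
          by-size (no ne) = trans (vanish σ λ τ a → c₁-0 τ (wrong-size τ a (sup (into ch) τ))) (sym (not-singleton σ x λ { refl → ne (∣⁅x⁆∣≡1 x) }))
            where
            wrong-size : ∀ τ → Add σ τ → (L τ ≡ true × ∣ τ ∣ ≡ 2) ⊎ c τ ≡ 0ℚ → c τ ≡ 0ℚ
            wrong-size τ a (inj₁ (_ , q)) = ⊥-elim (ne (ℕₚ.suc-injective (trans (sym (add-size a)) q)))
            wrong-size τ a (inj₂ q) = q
          by-size (yes one) = by-colour (bool-cases (χ v))
            where
            v = proj₁ (size⇒∈ σ (ℕₚ.≤-reflexive (sym one)))
            v∈ = proj₂ (size⇒∈ σ (ℕₚ.≤-reflexive (sym one)))
            differs : ∀ z → χ v ≢ χ z → σ ≢ ⁅ z ⁆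
            differs z ne eq = ne (cong χ (∈-singleton (subst (λ ρ → lookup ρ v ≡ true) eq v∈)))
            by-colour : χ v ≡ true ⊎ χ v ≡ false → bdℚ c₁ σ ≡ at (e ⁅ x ⁆) σ
            by-colour (inj₁ χv) = trans (ℚ∂.bd-local σ (λ τ a → cong (if_then c τ else 0ℚ) (coloured⁺ τ v (add-⊑ a v v∈) χv)))
              (trans (bd-c σ) (trans (at-⊕ (e ⁅ x ⁆) (⊝ e ⁅ y ⁆) σ) (trans (cong (at (e ⁅ x ⁆) σ ℚ.+_) (trans (at-⊝ (e ⁅ y ⁆) σ)
                (cong ℚ.-_ (not-singleton σ y (differs y λ p → true≢false χv (trans p χy)))))) (ℚₚ.+-identityʳ (at (e ⁅ x ⁆) σ)))))
            by-colour (inj₂ χv) = trans (vanish σ λ τ a → wrong-colour τ a (bool-cases (coloured τ)) (sup (into ch) τ))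
                (sym (not-singleton σ x (differs x λ p → true≢false χx (trans (sym p) χv))))
              where
              wrong-colour : ∀ τ → Add σ τ → coloured τ ≡ true ⊎ coloured τ ≡ false → (L τ ≡ true × ∣ τ ∣ ≡ 2) ⊎ c τ ≡ 0ℚ → c₁ τ ≡ 0ℚ
              wrong-colour τ a (inj₂ q) _ = cong (if_then c τ else 0ℚ) q
              wrong-colour τ a (inj₁ q) (inj₂ r) = c₁-0 τ r
              wrong-colour τ a (inj₁ q) (inj₁ (Lτ , two)) with coloured⁻ τ q
              ... | w , w∈ , χw = true≢false (trans (edges τ Lτ two v w (add-⊑ a v v∈) w∈) χw) χv

    connected : ∀ x y → L ⁅ x ⁆ ≡ true → L ⁅ y ⁆ ≡ true → χ x ≡ χ y
    connected x y Lx Ly with χ x in χx | χ y in χy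
    ... | true | true = refl
    ... | false | false = refl
    ... | true | false = ⊥-elim (no-cut x y Lx Ly χx χy)
    ... | false | true = ⊥-elim (no-cut y x Ly Lx χy χx)

  -- The empty face extends by `section-vertex`; any other face is extended inside the link of one
  -- of its vertices, where both its size and the depth are one less.
  extend : ∀ k {L : Subset n → Bool} → Depth≥ L k → ∀ σ → L σ ≡ true → ∣ σ ∣ < k → ∃ λ τ → Add σ τ × L τ ≡ true
  extend {n} (suc k) {L} (sec , lks) σ p lt = by-size (∣ σ ∣ ℕ.≟ 0)
    where
    by-size : Dec (∣ σ ∣ ≡ 0) → ∃ λ τ → Add σ τ × L τ ≡ true
    by-size (yes z) with section-vertex (sec 0 z≤n) (subst (λ ρ → L ρ ≡ true) (size-0 σ z) p)
    ... | x , Lx = ⁅ x ⁆ , subst (λ ρ → Add ρ ⁅ x ⁆) (sym (size-0 σ z)) (addAt⇒add (addAt-singleton x)) , Lx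
    by-size (no nz) = grow (extend k (lks x) ρ (∧-true⁺ (cong not (lookup∘update x σ false)) (subst (λ ρ → L ρ ≡ true) σ≡ p)) (ℕₚ.≤-pred (subst (_< suc k) (size-remove {x = x} {σ} x∈) lt)))
      where
      x = proj₁ (size⇒∈ σ (ℕₚ.n≢0⇒n>0 nz))
      x∈ = proj₂ (size⇒∈ σ (ℕₚ.n≢0⇒n>0 nz))
      ρ = σ [ x ]≔ false
      σ≡ : σ ≡ ρ [ x ]≔ true
      σ≡ = addAt-τ (addAt-remove x σ x∈)
      grow : (∃ λ τ → Add ρ τ × lk L x τ ≡ true) → ∃ λ τ → Add σ τ × L τ ≡ true
      grow (τ , a , q) with add⇒addAt a
      ... | y , b = τ [ x ]≔ true , subst (λ ρ → Add ρ (τ [ x ]≔ true)) (sym σ≡) (addAt⇒add (addAt-update y≢x b)) , ∧-true⁻ʳ {not (lookup τ x)} q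
        where
        y≢x : y ≢ x
        y≢x eq = true≢false (addAt-∈ b) (trans (cong (lookup τ) eq) (not-true (∧-true⁻ˡ q)))

  extend-to : ∀ k {L : Subset n → Bool} → Depth≥ L k → ∀ g σ → L σ ≡ true → ∣ σ ∣ ℕ.+ g ≤ k → ∃ λ τ → σ ⊑ τ × L τ ≡ true × ∣ τ ∣ ≡ ∣ σ ∣ ℕ.+ g
  extend-to k dep zero σ p le = σ , (λ _ q → q) , p , sym (ℕₚ.+-identityʳ _)
  extend-to k {L} dep (suc g) σ p le = step (extend k dep σ p (ℕₚ.≤-trans (ℕₚ.≤-trans (ℕₚ.≤-reflexive (ℕₚ.+-comm 1 ∣ σ ∣)) (ℕₚ.+-monoʳ-≤ ∣ σ ∣ (s≤s z≤n))) le))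
    where
    step : (∃ λ τ → Add σ τ × L τ ≡ true) → ∃ λ τ → σ ⊑ τ × L τ ≡ true × ∣ τ ∣ ≡ ∣ σ ∣ ℕ.+ suc g
    step (τ , a , q) with extend-to k dep g τ q (ℕₚ.≤-trans (ℕₚ.≤-reflexive (trans (cong (ℕ._+ g) (add-size a)) (sym (ℕₚ.+-suc ∣ σ ∣ g)))) le)
    ... | ρ , sub , r , size = ρ , (λ x x∈ → sub x (add-⊑ a x x∈)) , r , trans size (trans (cong (ℕ._+ g) (add-size a)) (sym (ℕₚ.+-suc ∣ σ ∣ g)))

  -- By induction in the links of vertices, the colour of a face through `x` depends on `x` only.
  -- The ends of an edge lie in a common face with s + 2 vertices, and removing either end gives
  -- adjacent faces through the other. So the colour is constant along edges, and `connected`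
  -- finishes.
  strongly-connected : ∀ s k {L : Subset n → Bool} → DownClosed L → Depth≥ L k → suc s ≤ k → (χ : Subset n → Bool) →
    (∀ {G G′ T} → L T ≡ true → ∣ T ∣ ≡ suc s → Add G T → Add G′ T → χ G ≡ χ G′) →
    ∀ G G′ → L G ≡ true → L G′ ≡ true → ∣ G ∣ ≡ s → ∣ G′ ∣ ≡ s → χ G ≡ χ G′
  strongly-connected zero k down dep le χ adj G G′ _ _ p q = cong χ (trans (size-0 G p) (sym (size-0 G′ q)))
  strongly-connected {n} (suc s) (suc k) {L} down dep@(sec , lks) (s≤s le) χ adj G G′ LG LG′ p q =
    trans (coloured x G LG p x∈) (trans (connected (sec 1 (ℕₚ.≤-trans (s≤s z≤n) le)) ψ edges x y (vertex G LG x x∈) (vertex G′ LG′ y y∈)) (sym (coloured y G′ LG′ q y∈)))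
    where
    x = proj₁ (size⇒∈ G (subst (1 ≤_) (sym p) (s≤s z≤n)))
    x∈ = proj₂ (size⇒∈ G (subst (1 ≤_) (sym p) (s≤s z≤n)))
    y = proj₁ (size⇒∈ G′ (subst (1 ≤_) (sym q) (s≤s z≤n)))
    y∈ = proj₂ (size⇒∈ G′ (subst (1 ≤_) (sym q) (s≤s z≤n)))
    through : ∀ x → L ⁅ x ⁆ ≡ true → ∃ λ T → ⁅ x ⁆ ⊑ T × L T ≡ true × ∣ T ∣ ≡ ∣ ⁅ x ⁆ ∣ ℕ.+ s
    through x Lx = extend-to (suc k) dep s ⁅ x ⁆ Lx (ℕₚ.≤-trans (ℕₚ.≤-reflexive (cong (ℕ._+ s) (∣⁅x⁆∣≡1 x))) (ℕₚ.m≤n⇒m≤1+n le))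
    ψ-at : ∀ x → L ⁅ x ⁆ ≡ true ⊎ L ⁅ x ⁆ ≡ false → Bool
    ψ-at x (inj₁ Lx) = χ (proj₁ (through x Lx))
    -- An arbitrary colour for points that are not vertices; only vertices are compared.
    ψ-at x (inj₂ _) = false
    ψ : Fin n → Bool
    ψ x = ψ-at x (bool-cases (L ⁅ x ⁆))
    vertex : ∀ T → L T ≡ true → ∀ x → lookup T x ≡ true → L ⁅ x ⁆ ≡ true
    vertex T LT x x∈ = shrink ∣ T ∣ T LT refl x∈
      where
      shrink : ∀ m T → L T ≡ true → ∣ T ∣ ≡ m → lookup T x ≡ true → L ⁅ x ⁆ ≡ true
      shrink zero T LT r x∈ with subst (1 ≤_) r (∈⇒size {x = x} T x∈)
      ... | ()
      shrink (suc m) T LT r x∈ with ∣ T [ x ]≔ false ∣ ℕ.≟ 0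
      ... | yes z = subst (λ ρ → L ρ ≡ true) (trans (addAt-τ (addAt-remove x T x∈)) (trans (cong (λ ρ → (ρ [ x ]≔ true)) (size-0 _ z)) (sym (addAt-τ (addAt-singleton x))))) LT
      ... | no nz with size⇒∈ (T [ x ]≔ false) (ℕₚ.n≢0⇒n>0 nz)
      ...   | z , z∈ with z ≟F x
      ...     | yes refl = true≢false z∈ (lookup∘update x T false)
      ...     | no z≢x = shrink m (T [ z ]≔ false) (down (addAt⇒add (addAt-remove z T zT)) LT) (ℕₚ.suc-injective (trans (sym (size-remove {x = z} {T} zT)) r)) (trans (lookup∘update′ (λ e → z≢x (sym e)) T false) x∈)
        where
        zT : lookup T z ≡ true
        zT = trans (sym (lookup∘update′ z≢x T false)) z∈
    same : ∀ x T T′ → L T ≡ true → L T′ ≡ true → ∣ T ∣ ≡ suc s → ∣ T′ ∣ ≡ suc s → lookup T x ≡ true → lookup T′ x ≡ true → χ T ≡ χ T′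
    same x T T′ LT LT′ r r′ x∈ x∈′ = trans (cong χ (addAt-τ (addAt-remove x T x∈)))
      (trans (strongly-connected s k (lk-down down) (lks x) le (λ ρ → χ (ρ [ x ]≔ true)) adj′ (T [ x ]≔ false) (T′ [ x ]≔ false)
          (member T LT x∈) (member T′ LT′ x∈′) (ℕₚ.suc-injective (trans (sym (size-remove {x = x} {T} x∈)) r)) (ℕₚ.suc-injective (trans (sym (size-remove {x = x} {T′} x∈′)) r′)))
        (cong χ (sym (addAt-τ (addAt-remove x T′ x∈′)))))
      where
      member : ∀ T → L T ≡ true → lookup T x ≡ true → lk L x (T [ x ]≔ false) ≡ true
      member T LT x∈ = ∧-true⁺ (cong not (lookup∘update x T false)) (subst (λ ρ → L ρ ≡ true) (addAt-τ (addAt-remove x T x∈)) LT)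
      adj′ : ∀ {G G′ T} → lk L x T ≡ true → ∣ T ∣ ≡ suc s → Add G T → Add G′ T → χ (G [ x ]≔ true) ≡ χ (G′ [ x ]≔ true)
      adj′ {T = T} LT r a b = adj (∧-true⁻ʳ {not (lookup T x)} LT) (trans (size-insert {x = x} {T} Tx) (cong suc r)) (lift a) (lift b)
        where
        Tx : lookup T x ≡ false
        Tx = not-true (∧-true⁻ˡ LT)
        lift : ∀ {G} → Add G T → Add (G [ x ]≔ true) (T [ x ]≔ true)
        lift a with add⇒addAt a
        ... | z , b = addAt⇒add (addAt-update (λ e → true≢false (trans (cong (lookup T) (sym e)) (addAt-∈ b)) Tx) b)
    coloured : ∀ x T → L T ≡ true → ∣ T ∣ ≡ suc s → lookup T x ≡ true → χ T ≡ ψ x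
    coloured x T LT r x∈ = by (bool-cases (L ⁅ x ⁆))
      where
      by : (c : L ⁅ x ⁆ ≡ true ⊎ L ⁅ x ⁆ ≡ false) → χ T ≡ ψ-at x c
      by (inj₁ Lx) = let (T′ , sub , LT′ , r′) = through x Lx in same x T T′ LT LT′ r (trans r′ (cong (ℕ._+ s) (∣⁅x⁆∣≡1 x))) x∈ (sub x (singleton-∈ x))
      by (inj₂ ¬Lx) = true≢false (vertex T LT x x∈) ¬Lx
    edges : ∀ τ → L τ ≡ true → ∣ τ ∣ ≡ 2 → ∀ v w → lookup τ v ≡ true → lookup τ w ≡ true → ψ v ≡ ψ w
    edges τ Lτ two v w v∈ w∈ with v ≟F w
    ... | yes refl = refl
    ... | no v≢w = facet (extend-to (suc k) dep s τ Lτ (ℕₚ.≤-trans (ℕₚ.≤-reflexive (cong (ℕ._+ s) two)) (s≤s le)))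
      where
      facet : (∃ λ T → τ ⊑ T × L T ≡ true × ∣ T ∣ ≡ ∣ τ ∣ ℕ.+ s) → ψ v ≡ ψ w
      facet (T , sub , LT , r) = trans (sym (coloured v (T [ w ]≔ false) (down (addAt⇒add -w) LT) (size w wT) (trans (lookup∘update′ v≢w T false) vT)))
        (trans (adj LT r′ (addAt⇒add -w) (addAt⇒add -v)) (coloured w (T [ v ]≔ false) (down (addAt⇒add -v) LT) (size v vT) (trans (lookup∘update′ (λ e → v≢w (sym e)) T false) wT)))
        where
        vT = sub v v∈
        wT = sub w w∈
        -v = addAt-remove v T vT
        -w = addAt-remove w T wT
        r′ : ∣ T ∣ ≡ suc (suc s)
        r′ = trans r (cong (ℕ._+ s) two)
        size : ∀ z → lookup T z ≡ true → ∣ T [ z ]≔ false ∣ ≡ suc s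
        size z z∈ = ℕₚ.suc-injective (trans (sym (size-remove {x = z} {T} z∈)) r′)

-- Purity and depth of links in a Cohen-Macaulay complex

module Links where

  open import Defs
  open Counting
  open ShiftedFamilies using (≡ᵇ-true⁺; ≡ᵇ-true⁻)
  open Depth
  open LinearAlgebra
  open Shifting using (¬¬-fin)
  open Transfer using (module ToℚSection)
  open Connectivity
  open import Data.Fin using (fromℕ<)
  open import Data.Fin.Properties using (all?; toℕ-fromℕ<)
  open import Data.Fin.Subset using (∣_∣; ∁)
  open import Data.Fin.Subset.Properties using (anySubset?)
  open import Data.Nat using (_≤_; _<_)
  open import Data.Vec.Properties using (lookup-map; lookup-replicate)
  open import Relation.Binary.PropositionalEquality
  open import Relation.Nullary.Decidable using (dec-true; _×-dec_; _→-dec_)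

  private variable
    n : ℕ

  bool-ext : ∀ {a b} → (a ≡ true → b ≡ true) → (b ≡ true → a ≡ true) → a ≡ b
  bool-ext {true} {b} f g = sym (f refl)
  bool-ext {false} {true} f g = g refl
  bool-ext {false} {false} f g = refl

  ∪-∈⁻ : ∀ (σ τ : Subset n) x → lookup (σ ∪ τ) x ≡ true → lookup σ x ≡ true ⊎ lookup τ x ≡ true
  ∪-∈⁻ σ τ x p = ∨-true⁻ (trans (sym (lookup-zipWith _∨_ x σ τ)) p)

  ∪-∈ˡ : ∀ (σ τ : Subset n) x → lookup σ x ≡ true → lookup (σ ∪ τ) x ≡ true
  ∪-∈ˡ σ τ x p = trans (lookup-zipWith _∨_ x σ τ) (cong (_∨ lookup τ x) p)

  ∪-∈ʳ : ∀ (σ τ : Subset n) x → lookup τ x ≡ true → lookup (σ ∪ τ) x ≡ true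
  ∪-∈ʳ σ τ x p = trans (lookup-zipWith _∨_ x σ τ) (trans (cong (lookup σ x ∨_) p) (∨-zeroʳ (lookup σ x)))

  insert-∈⁻ : ∀ (σ : Subset n) x y → lookup (σ [ x ]≔ true) y ≡ true → y ≡ x ⊎ lookup σ y ≡ true
  insert-∈⁻ σ x y p with y ≟F x
  ... | yes eq = inj₁ eq
  ... | no ne = inj₂ (trans (sym (lookup∘update′ ne σ true)) p)

  insert-⊑ : ∀ (σ : Subset n) x → σ ⊑ σ [ x ]≔ true
  insert-⊑ σ x y p with y ≟F x
  ... | yes refl = lookup∘update x σ true
  ... | no ne = trans (lookup∘update′ ne σ true) p

  ⊑-antisym : {σ τ : Subset n} → σ ⊑ τ → τ ⊑ σ → σ ≡ τ
  ⊑-antisym p q = subset-ext λ x → bool-ext (p x) (q x)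

  size-mono : (σ τ : Subset n) → σ ⊑ τ → ∣ σ ∣ ≤ ∣ τ ∣
  size-mono [] [] p = z≤n
  size-mono (true ∷ σ) (true ∷ τ) p = s≤s (size-mono σ τ (λ x → p (suc x)))
  size-mono (true ∷ σ) (false ∷ τ) p with () ← p zero refl
  size-mono (false ∷ σ) (true ∷ τ) p = ℕₚ.m≤n⇒m≤1+n (size-mono σ τ (λ x → p (suc x)))
  size-mono (false ∷ σ) (false ∷ τ) p = size-mono σ τ (λ x → p (suc x))

  infixl 7 _∖_
  _∖_ : Subset n → Subset n → Subset n
  τ ∖ σ = τ ∩ ∁ σ

  ∖-∈⁻ : ∀ (τ σ : Subset n) x → lookup (τ ∖ σ) x ≡ true → lookup τ x ≡ true × lookup σ x ≡ false
  ∖-∈⁻ τ σ x p = proj₁ (∩-∈⁻ τ (∁ σ) x p) , not-true (trans (sym (lookup-map x not σ)) (proj₂ (∩-∈⁻ τ (∁ σ) x p)))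

  size-∖ : (σ τ : Subset n) → σ ⊑ τ → ∣ σ ∣ ℕ.+ ∣ τ ∖ σ ∣ ≡ ∣ τ ∣
  size-∖ [] [] p = refl
  size-∖ (true ∷ σ) (true ∷ τ) p = cong suc (size-∖ σ τ (λ x → p (suc x)))
  size-∖ (true ∷ σ) (false ∷ τ) p with () ← p zero refl
  size-∖ (false ∷ σ) (true ∷ τ) p = trans (ℕₚ.+-suc ∣ σ ∣ _) (cong suc (size-∖ σ τ (λ x → p (suc x))))
  size-∖ (false ∷ σ) (false ∷ τ) p = size-∖ σ τ (λ x → p (suc x))

  ∈-∖ : (σ τ : Subset n) → σ ⊑ τ → ∣ σ ∣ < ∣ τ ∣ → ∃ λ x → lookup τ x ≡ true × lookup σ x ≡ false
  ∈-∖ σ τ sub lt = let (x , p) = size⇒∈ (τ ∖ σ) (ℕₚ.+-cancelˡ-≤ ∣ σ ∣ 1 _ (subst₂ _≤_ (ℕₚ.+-comm 1 ∣ σ ∣) (sym (size-∖ σ τ sub)) lt)) in x , ∖-∈⁻ τ σ x p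

  ∅-∈ : ∀ (x : Fin n) {a} {X : Set a} → lookup ∅ x ≡ true → X
  ∅-∈ x p = true≢false p (lookup-replicate x false)

  -- Closure under arbitrary subsets; DownClosed only removes one element at a time.
  Down : (Subset n → Bool) → Set
  Down P = ∀ {σ τ} → σ ⊑ τ → P τ ≡ true → P σ ≡ true

  link⁻-disjoint : ∀ (P : Subset n → Bool) A B → link P A B ≡ true → ∀ x → lookup A x ≡ true → lookup B x ≡ true → ⊥
  link⁻-disjoint P A B p x a b with subst (1 ≤_) (≡ᵇ-true⁻ (∧-true⁻ˡ p)) (∈⇒size {x = x} (A ∩ B) (∩-∈⁺ A B x a b))
  ... | ()

  link⁻-face : ∀ (P : Subset n → Bool) A B → link P A B ≡ true → P (A ∪ B) ≡ true
  link⁻-face P A B p = ∧-true⁻ʳ {∣ A ∩ B ∣ ≡ᵇ 0} p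

  link⁺ : ∀ (P : Subset n → Bool) A B → (∀ x → lookup A x ≡ true → lookup B x ≡ true → ⊥) → P (A ∪ B) ≡ true → link P A B ≡ true
  link⁺ P A B disj p = ∧-true⁺ (≡ᵇ-true⁺ (none (∣ A ∩ B ∣ ℕ.≟ 0))) p
    where
    none : Dec (∣ A ∩ B ∣ ≡ 0) → ∣ A ∩ B ∣ ≡ 0
    none (yes z) = z
    none (no nz) with size⇒∈ (A ∩ B) (ℕₚ.n≢0⇒n>0 nz)
    ... | x , q = ⊥-elim (disj x (proj₁ (∩-∈⁻ A B x q)) (proj₂ (∩-∈⁻ A B x q)))

  link-down : {P : Subset n → Bool} → Down P → ∀ A → Down (link P A)
  link-down {P = P} down A {σ} {τ} sub p = link⁺ P A σ (λ x a b → link⁻-disjoint P A τ p x a (sub x b)) (down inside (link⁻-face P A τ p))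
    where
    inside : A ∪ σ ⊑ A ∪ τ
    inside x q with ∪-∈⁻ A σ x q
    ... | inj₁ r = ∪-∈ˡ A τ x r
    ... | inj₂ r = ∪-∈ʳ A τ x (sub x r)

  does⁻ : ∀ {a} {A : Set a} (A? : Dec A) → does A? ≡ true → A
  does⁻ (yes a) _ = a

  AllSections : ∀ {n} → (Subset n → Bool) → Set
  AllSections P = ∀ A k → P A ≡ true → HasFaceOfSize≥ (link P A) (suc k) → Section (link P A) k

  -- A link has no face with more than n vertices, so finitely many pairs of a face and a size are
  -- involved and double negation can be moved outside.
  all-sections : ∀ {c ℓ} (F : Field c ℓ) {P : Subset n → Bool} → Down P → Homology.CohenMacaulay F P → ¬ ¬ AllSections P
  all-sections {n} F {P} down cm = ¬¬-subsets (λ A → ¬¬-fin {suc n} (λ k → one A (toℕ k))) >>= λ all → return λ A k p f →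
      subst (λ k → P A ≡ true → HasFaceOfSize≥ (link P A) (suc k) → Section (link P A) k) (toℕ-fromℕ< (bound f)) (all A (fromℕ< (bound f))) p f
    where
    bound : ∀ {A k} → HasFaceOfSize≥ (link P A) (suc k) → k < suc n
    bound (B , _ , le) = ℕₚ.≤-trans le (ℕₚ.m≤n⇒m≤1+n (∣p∣≤n B))
    one : ∀ A k → ¬ ¬ (P A ≡ true → HasFaceOfSize≥ (link P A) (suc k) → Section (link P A) k)
    one A k = em {A = P A ≡ true × HasFaceOfSize≥ (link P A) (suc k)} >>= λ
      { (yes (p , f)) → ToℚSection.vanishing⇒section F {L = link P A} (λ {σ} {τ} a → link-down {P = P} down A {σ} {τ} (add-⊑ a)) (cm A p k f) >>= λ s → return λ _ _ → s
      ; (no none) → return λ p f → ⊥-elim (none (p , f)) }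

  module PureOf {n : ℕ} {P : Subset n → Bool} {d : ℕ} (down : Down P) (small : ∀ A → P A ≡ true → ∣ A ∣ ≤ d)
    (sections : AllSections P) where

    Extends : Subset n → Set
    Extends B = ∃ λ C → B ⊑ C × P C ≡ true × ∣ C ∣ ≡ d

    extends? : ∀ B → Dec (Extends B)
    extends? B = anySubset? λ C → all? (λ x → (lookup B x ≟B true) →-dec (lookup C x ≟B true)) ×-dec (P C ≟B true) ×-dec (∣ C ∣ ℕ.≟ d)

    extends-⊑ : ∀ A B → A ⊑ B → Extends B → Extends A
    extends-⊑ A B sub (C , sub′ , r) = C , (λ x p → sub′ x (sub x p)) , r

    private
      top : ∀ A → P A ≡ true → ∣ A ∣ ≡ d → Extends A
      top A p q = A , (λ _ r → r) , p , q

      ∖-link : ∀ A C → A ⊑ C → P C ≡ true → link P A (C ∖ A) ≡ true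
      ∖-link A C sub p = link⁺ P A (C ∖ A) (λ x a b → true≢false a (proj₂ (∖-∈⁻ C A x b))) (down inside p)
        where
        inside : A ∪ (C ∖ A) ⊑ C
        inside x q with ∪-∈⁻ A (C ∖ A) x q
        ... | inj₁ r = sub x r
        ... | inj₂ r = proj₁ (∖-∈⁻ C A x r)

    -- Go up from `A` by a vertex of `B`. Whether `A` with a vertex added extends to size d is
    -- constant along edges of the link of `A`, by induction applied to the larger face; the link is
    -- connected, and the answer is positive for the vertices of the known extension.
    pure : ∀ g A → ∣ A ∣ ℕ.+ g ≡ d → P A ≡ true → Extends A → ∀ B → A ⊑ B → P B ≡ true → Extends B
    pure zero A eq PA ext B sub PB = top B PB (ℕₚ.≤-antisym (small B PB) (subst (_≤ ∣ B ∣) (trans (sym (ℕₚ.+-identityʳ _)) eq) (size-mono A B sub)))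
    pure (suc g) A eq PA ext@(C , A⊑C , PC , ∣C∣) B sub PB = by-size (∣ A ∣ ℕ.<? ∣ B ∣)
      where
      ∣A∣<∣C∣ : ∣ A ∣ < ∣ C ∣
      ∣A∣<∣C∣ = subst (∣ A ∣ <_) (trans eq (sym ∣C∣)) (ℕₚ.m<m+n ∣ A ∣ (s≤s z≤n))
      size′ : ∀ x → lookup A x ≡ false → ∣ A [ x ]≔ true ∣ ℕ.+ g ≡ d
      size′ x x∉ = trans (cong (ℕ._+ g) (size-insert {x = x} {A} x∉)) (trans (sym (ℕₚ.+-suc ∣ A ∣ g)) eq)
      insert⊑ : ∀ D x → A ⊑ D → lookup D x ≡ true → A [ x ]≔ true ⊑ D
      insert⊑ D x s r y q with insert-∈⁻ A x y q
      ... | inj₁ refl = r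
      ... | inj₂ q′ = s y q′
      up : ∀ x → lookup A x ≡ false → Extends (A [ x ]≔ true) → ∀ D → A ⊑ D → lookup D x ≡ true → P D ≡ true → Extends D
      up x x∉ ext D s r PD = pure g (A [ x ]≔ true) (size′ x x∉) (down (insert⊑ D x s r) PD) ext D (insert⊑ D x s r) PD
      χ : Fin n → Bool
      χ x = does (extends? (A [ x ]≔ true))
      edges : ∀ τ → link P A τ ≡ true → ∣ τ ∣ ≡ 2 → ∀ v w → lookup τ v ≡ true → lookup τ w ≡ true → χ v ≡ χ w
      edges τ Lτ _ v w v∈ w∈ = bool-ext (along v w v∈ w∈) (along w v w∈ v∈)
        where
        along : ∀ v w → lookup τ v ≡ true → lookup τ w ≡ true → χ v ≡ true → χ w ≡ true
        along v w v∈ w∈ p = dec-true (extends? (A [ w ]≔ true)) (extends-⊑ (A [ w ]≔ true) (A ∪ τ) (insert⊑ (A ∪ τ) w (∪-∈ˡ A τ) (∪-∈ʳ A τ w w∈))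
          (up v (¬true⇒false λ a → link⁻-disjoint P A τ Lτ v a v∈) (does⁻ (extends? (A [ v ]≔ true)) p) (A ∪ τ) (∪-∈ˡ A τ) (∪-∈ʳ A τ v v∈) (link⁻-face P A τ Lτ)))
      vertex : ∀ {D} x → A ⊑ D → lookup A x ≡ false → lookup D x ≡ true → P D ≡ true → link P A ⁅ x ⁆ ≡ true
      vertex {D} x s x∉ x∈ PD = link⁺ P A ⁅ x ⁆ (λ y a b → true≢false (subst (λ z → lookup A z ≡ true) (∈-singleton b) a) x∉) (down inside PD)
        where
        inside : A ∪ ⁅ x ⁆ ⊑ D
        inside y q with ∪-∈⁻ A ⁅ x ⁆ y q
        ... | inj₁ r = s y r
        ... | inj₂ r = subst (λ z → lookup D z ≡ true) (sym (∈-singleton r)) x∈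
      by-size : Dec (∣ A ∣ < ∣ B ∣) → Extends B
      by-size (no nlt) = extends-⊑ B A (λ x p → ¬¬-bool (lookup A x) λ x∉ → nlt (subst (_≤ ∣ B ∣) (size-insert {x = x} {A} x∉) (size-mono (A [ x ]≔ true) B (insert⊑ B x sub p)))) ext
        where
        ¬¬-bool : ∀ b → ¬ (b ≡ false) → b ≡ true
        ¬¬-bool true _ = refl
        ¬¬-bool false f = ⊥-elim (f refl)
      by-size (yes lt) = up y y∉ (at-y (g ℕ.≟ 0)) B sub y∈ PB
        where
        x = proj₁ (∈-∖ A C A⊑C ∣A∣<∣C∣)
        x∈ = proj₁ (proj₂ (∈-∖ A C A⊑C ∣A∣<∣C∣))
        x∉ = proj₂ (proj₂ (∈-∖ A C A⊑C ∣A∣<∣C∣))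
        y = proj₁ (∈-∖ A B sub lt)
        y∈ = proj₁ (proj₂ (∈-∖ A B sub lt))
        y∉ = proj₂ (proj₂ (∈-∖ A B sub lt))
        at-y : Dec (g ≡ 0) → Extends (A [ y ]≔ true)
        -- With a single vertex missing the link need not be connected, but `A` with `y` added
        -- already has d vertices.
        at-y (yes g≡0) = top (A [ y ]≔ true) (down (insert⊑ B y sub y∈) PB) (trans (sym (ℕₚ.+-identityʳ _)) (trans (cong (∣ A [ y ]≔ true ∣ ℕ.+_) (sym g≡0)) (size′ y y∉)))
        at-y (no g≢0) = does⁻ (extends? (A [ y ]≔ true)) (trans (sym (connected (sections A 1 PA (C ∖ A , ∖-link A C A⊑C PC , two)) χ edges x y (vertex x A⊑C x∉ x∈ PC) (vertex y sub y∉ y∈ PB)))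
            (dec-true (extends? (A [ x ]≔ true)) (C , insert⊑ C x A⊑C x∈ , PC , ∣C∣)))
          where
          two : 2 ≤ ∣ C ∖ A ∣
          two = ℕₚ.≤-trans (s≤s (ℕₚ.n≢0⇒n>0 g≢0)) (ℕₚ.≤-reflexive (ℕₚ.+-cancelˡ-≡ (∣ A ∣) (suc g) (∣ C ∖ A ∣) (trans eq (sym (trans (size-∖ A C A⊑C) ∣C∣)))))

    module _ (facet : ∃ λ C → P C ≡ true × ∣ C ∣ ≡ d) where

      extends : ∀ A → P A ≡ true → Extends A
      extends A PA = pure d ∅ (cong (ℕ._+ d) (∣∅∣ n)) (down (λ x p → ∅-∈ x p) PA) (proj₁ facet , (λ x p → ∅-∈ x p) , proj₂ facet) A (λ x p → ∅-∈ x p) PA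
        where
        ∣∅∣ : ∀ n → ∣ ∅ {n} ∣ ≡ 0
        ∣∅∣ zero = refl
        ∣∅∣ (suc n) = ∣∅∣ n

      -- Cohen-Macaulayness yields fillings only below the dimension of the link; purity provides a
      -- face of the link large enough. Links of vertices in a link are links of larger faces.
      depth-link : ∀ k A → P A ≡ true → ∣ A ∣ ℕ.+ k ≤ d → Depth≥ (link P A) k
      depth-link zero A PA le = tt
      depth-link (suc k) A PA le = (λ c c≤k → sections A c PA (C ∖ A , ∖-link A C A⊑C PC , ℕₚ.≤-trans (s≤s c≤k) (ℕₚ.+-cancelˡ-≤ ∣ A ∣ (suc k) _ (subst (∣ A ∣ ℕ.+ suc k ≤_) (sym (trans (size-∖ A C A⊑C) ∣C∣)) le)))) ,
          λ x → by x (bool-cases (lookup A x)) (bool-cases (P (A [ x ]≔ true)))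
        where
        C = proj₁ (extends A PA)
        A⊑C = proj₁ (proj₂ (extends A PA))
        PC = proj₁ (proj₂ (proj₂ (extends A PA)))
        ∣C∣ = proj₂ (proj₂ (proj₂ (extends A PA)))
        by : ∀ x → lookup A x ≡ true ⊎ lookup A x ≡ false → P (A [ x ]≔ true) ≡ true ⊎ P (A [ x ]≔ true) ≡ false → Depth≥ (lk (link P A) x) k
        by x (inj₁ x∈) _ = depth-empty k λ σ → ¬true⇒false λ p → link⁻-disjoint P A (σ [ x ]≔ true) (∧-true⁻ʳ {not (lookup σ x)} p) x x∈ (lookup∘update x σ true)
        by x (inj₂ x∉) (inj₂ ¬P) = depth-empty k λ σ → ¬true⇒false λ p → true≢false (down (inside σ) (link⁻-face P A (σ [ x ]≔ true) (∧-true⁻ʳ {not (lookup σ x)} p))) ¬P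
          where
          inside : ∀ σ → A [ x ]≔ true ⊑ A ∪ (σ [ x ]≔ true)
          inside σ y q with insert-∈⁻ A x y q
          ... | inj₁ refl = ∪-∈ʳ A (σ [ x ]≔ true) x (lookup∘update x σ true)
          ... | inj₂ r = ∪-∈ˡ A (σ [ x ]≔ true) y r
        by x (inj₂ x∉) (inj₁ p) = depth-cong k same (depth-link k (A [ x ]≔ true) p (subst (_≤ d) (trans (ℕₚ.+-suc ∣ A ∣ k) (cong (ℕ._+ k) (sym (size-insert {x = x} {A} x∉)))) le))
          where
          union : ∀ σ → (A [ x ]≔ true) ∪ σ ≡ A ∪ (σ [ x ]≔ true)
          union σ = ⊑-antisym forth back
            where
            forth : (A [ x ]≔ true) ∪ σ ⊑ A ∪ (σ [ x ]≔ true)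
            forth y q with ∪-∈⁻ (A [ x ]≔ true) σ y q
            ... | inj₂ r = ∪-∈ʳ A (σ [ x ]≔ true) y (insert-⊑ σ x y r)
            ... | inj₁ r with insert-∈⁻ A x y r
            ...   | inj₁ refl = ∪-∈ʳ A (σ [ x ]≔ true) x (lookup∘update x σ true)
            ...   | inj₂ r′ = ∪-∈ˡ A (σ [ x ]≔ true) y r′
            back : A ∪ (σ [ x ]≔ true) ⊑ (A [ x ]≔ true) ∪ σ
            back y q with ∪-∈⁻ A (σ [ x ]≔ true) y q
            ... | inj₁ r = ∪-∈ˡ (A [ x ]≔ true) σ y (insert-⊑ A x y r)
            ... | inj₂ r with insert-∈⁻ σ x y r
            ...   | inj₁ refl = ∪-∈ˡ (A [ x ]≔ true) σ x (lookup∘update x A true)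
            ...   | inj₂ r′ = ∪-∈ʳ (A [ x ]≔ true) σ y r′
          same : ∀ σ → link P (A [ x ]≔ true) σ ≡ lk (link P A) x σ
          same σ = bool-ext
            (λ q → ∧-true⁺ (cong not (¬true⇒false λ r → link⁻-disjoint P (A [ x ]≔ true) σ q x (lookup∘update x A true) r))
              (link⁺ P A (σ [ x ]≔ true) (λ y a b → away y a q (insert-∈⁻ σ x y b)) (trans (cong P (sym (union σ))) (link⁻-face P (A [ x ]≔ true) σ q))))
            (λ q → link⁺ P (A [ x ]≔ true) σ (λ y a b → away′ y b (∧-true⁻ˡ q) (∧-true⁻ʳ {not (lookup σ x)} q) (insert-∈⁻ A x y a))
              (trans (cong P (union σ)) (link⁻-face P A (σ [ x ]≔ true) (∧-true⁻ʳ {not (lookup σ x)} q))))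
            where
            away : ∀ y → lookup A y ≡ true → link P (A [ x ]≔ true) σ ≡ true → y ≡ x ⊎ lookup σ y ≡ true → ⊥
            away y a q (inj₁ refl) = true≢false a x∉
            away y a q (inj₂ b) = link⁻-disjoint P (A [ x ]≔ true) σ q y (insert-⊑ A x y a) b
            away′ : ∀ y → lookup σ y ≡ true → not (lookup σ x) ≡ true → link P A (σ [ x ]≔ true) ≡ true → y ≡ x ⊎ lookup A y ≡ true → ⊥
            away′ y b x∉σ q (inj₁ refl) = true≢false b (not-true x∉σ)
            away′ y b x∉σ q (inj₂ a) = link⁻-disjoint P A (σ [ x ]≔ true) q y a (insert-⊑ σ x y b)

-- Compression of intersecting families towards a vertex

module NearCone where

  open import Defs using (link; skelSize)
  open Counting
  open ShiftedFamilies using (Add; DownClosed; add-size; ofSize; ≡ᵇ-true⁺; ≡ᵇ-true⁻)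
  open Depth
  open Connectivity
  open Links
  open ExteriorShift using (intersecting-bound)
  open import Data.Fin.Subset using (∣_∣)
  open import Data.Fin.Subset.Properties using (anySubset?)
  open import Data.Nat using (_+_; _*_; _≤_; _<_; _≤ᵇ_)
  open import Data.Nat.Tactic.RingSolver using (solve-∀)
  open import Relation.Binary.PropositionalEquality
  open import Relation.Nullary.Decidable using (map′; _×-dec_)

  ≤ᵇ-true⁺ : ∀ {m k} → m ≤ k → (m ≤ᵇ k) ≡ true
  ≤ᵇ-true⁺ z≤n = refl
  ≤ᵇ-true⁺ (s≤s z≤n) = refl
  ≤ᵇ-true⁺ (s≤s (s≤s p)) = ≤ᵇ-true⁺ (s≤s p)

  ≤ᵇ-true⁻ : ∀ {m k} → (m ≤ᵇ k) ≡ true → m ≤ k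
  ≤ᵇ-true⁻ {zero} p = z≤n
  ≤ᵇ-true⁻ {suc zero} {suc k} p = s≤s z≤n
  ≤ᵇ-true⁻ {suc (suc m)} {suc k} p = s≤s (≤ᵇ-true⁻ {suc m} p)

  Meet : ∀ {n} → Subset n → Subset n → Set
  Meet A B = ∃ λ x → lookup A x ≡ true × lookup B x ≡ true

  module Swap {n : ℕ} (a v : Fin n) (v≢a : v ≢ a) where

    sw : Subset n → Subset n
    sw A = (A [ a ]≔ lookup A v) [ v ]≔ lookup A a

    sw-v : ∀ A → lookup (sw A) v ≡ lookup A a
    sw-v A = lookup∘update v (A [ a ]≔ lookup A v) (lookup A a)

    sw-a : ∀ A → lookup (sw A) a ≡ lookup A v
    sw-a A = trans (lookup∘update′ (λ e → v≢a (sym e)) (A [ a ]≔ lookup A v) (lookup A a)) (lookup∘update a A (lookup A v))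

    sw-other : ∀ A {x} → x ≢ a → x ≢ v → lookup (sw A) x ≡ lookup A x
    sw-other A {x} x≢a x≢v = trans (lookup∘update′ x≢v (A [ a ]≔ lookup A v) (lookup A a)) (lookup∘update′ x≢a A (lookup A v))

    by-coordinates : ∀ {A B : Subset n} → lookup A a ≡ lookup B a → lookup A v ≡ lookup B v → (∀ {x} → x ≢ a → x ≢ v → lookup A x ≡ lookup B x) → A ≡ B
    by-coordinates {A} {B} p q r = subset-ext eq
      where
      eq : ∀ x → lookup A x ≡ lookup B x
      eq x with x ≟F a
      ... | yes refl = p
      ... | no x≢a with x ≟F v
      ...   | yes refl = q
      ...   | no x≢v = r x≢a x≢v

    sw-sw : ∀ A → sw (sw A) ≡ A
    sw-sw A = by-coordinates (trans (sw-a (sw A)) (sw-v A)) (trans (sw-v (sw A)) (sw-a A)) (λ p q → trans (sw-other (sw A) p q) (sw-other A p q))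

    sw-same : ∀ A → lookup A a ≡ lookup A v → sw A ≡ A
    sw-same A p = by-coordinates (trans (sw-a A) (sym p)) (trans (sw-v A) p) (sw-other A)

    sw-size : ∀ A → ∣ sw A ∣ ≡ ∣ A ∣
    sw-size A = by (bool-cases (lookup A a)) (bool-cases (lookup A v))
      where
      moved : ∀ A → lookup A a ≡ true → lookup A v ≡ false → ∣ sw A ∣ ≡ ∣ A ∣
      moved A p q = trans (cong ∣_∣ (cong₂ (λ x y → (A [ a ]≔ x) [ v ]≔ y) q p))
        (trans (size-insert {x = v} {A [ a ]≔ false} (trans (lookup∘update′ v≢a A false) q)) (sym (size-remove {x = a} {A} p)))
      by : lookup A a ≡ true ⊎ lookup A a ≡ false → lookup A v ≡ true ⊎ lookup A v ≡ false → ∣ sw A ∣ ≡ ∣ A ∣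
      by (inj₁ p) (inj₁ q) = cong ∣_∣ (sw-same A (trans p (sym q)))
      by (inj₂ p) (inj₂ q) = cong ∣_∣ (sw-same A (trans p (sym q)))
      by (inj₁ p) (inj₂ q) = moved A p q
      by (inj₂ p) (inj₁ q) = sym (trans (cong ∣_∣ (sym (sw-sw A))) (moved (sw A) (trans (sw-a A) q) (trans (sw-v A) p)))

    sw-meet : ∀ A B → Meet (sw A) (sw B) → Meet A B
    sw-meet A B (x , p , q) with x ≟F a
    ... | yes refl = v , trans (sym (sw-a A)) p , trans (sym (sw-a B)) q
    ... | no x≢a with x ≟F v
    ...   | yes refl = a , trans (sym (sw-v A)) p , trans (sym (sw-v B)) q
    ...   | no x≢v = x , trans (sym (sw-other A x≢a x≢v)) p , trans (sym (sw-other B x≢a x≢v)) q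

  -- Here k stands for d - 1 and q for r - 1, so `q≤k` is the inequality 2r < d. `cone` places every
  -- face with q + 1 vertices avoiding `a` in the link of `a`, so that members avoiding `a` and
  -- traces of members through `a` can be counted in the same complex.
  module Families {n : ℕ} (Δ : Subset (suc n) → Bool) (down : Down Δ) (a : Fin (suc n))
    (shifted : ∀ B w → Δ B ≡ true → lookup B w ≡ true → Δ ((B [ w ]≔ false) [ a ]≔ true) ≡ true)
    {k q : ℕ} (k≤n : k ≤ suc n) (q≤k : 2 * q + 2 ≤ k)
    (cone : ∀ B → Δ B ≡ true → ∣ B ∣ ≤ k → Δ (B [ a ]≔ true) ≡ true)
    (depth : Depth≥ (link (skelSize (suc k) Δ) ⁅ a ⁆) k) where

    Family Intersecting Maximum : (Subset (suc n) → Bool) → Set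
    Family α = ∀ A → α A ≡ true → Δ A ≡ true × ∣ A ∣ ≡ suc q
    Intersecting α = ∀ A B → α A ≡ true → α B ≡ true → Meet A B
    Maximum α = ∀ β → Family β → Intersecting β → count β ≤ count α

    private
      P = skelSize (suc k) Δ
      L = link P ⁅ a ⁆

      q+1≤k : suc q ≤ k
      q+1≤k = ℕₚ.≤-trans (ℕₚ.≤-trans (ℕₚ.m≤m+n (suc q) (suc q)) (ℕₚ.≤-reflexive (double q))) q≤k
        where
        double : ∀ q → suc q + suc q ≡ 2 * q + 2
        double = solve-∀

      a∪ : ∀ σ → ⁅ a ⁆ ∪ σ ≡ σ [ a ]≔ true
      a∪ σ = ⊑-antisym forth back
        where
        forth : ⁅ a ⁆ ∪ σ ⊑ σ [ a ]≔ true
        forth y p with ∪-∈⁻ ⁅ a ⁆ σ y p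
        ... | inj₁ r = subst (λ z → lookup (σ [ a ]≔ true) z ≡ true) (sym (∈-singleton r)) (lookup∘update a σ true)
        ... | inj₂ r = insert-⊑ σ a y r
        back : σ [ a ]≔ true ⊑ ⁅ a ⁆ ∪ σ
        back y p with insert-∈⁻ σ a y p
        ... | inj₁ refl = ∪-∈ˡ ⁅ a ⁆ σ a (singleton-∈ a)
        ... | inj₂ r = ∪-∈ʳ ⁅ a ⁆ σ y r

      L⁺ : ∀ σ → lookup σ a ≡ false → Δ (σ [ a ]≔ true) ≡ true → ∣ σ ∣ ≤ k → L σ ≡ true
      L⁺ σ p r le = link⁺ P ⁅ a ⁆ σ (λ x y z → true≢false (subst (λ w → lookup σ w ≡ true) (∈-singleton y) z) p)
        (trans (cong P (a∪ σ)) (∧-true⁺ (≤ᵇ-true⁺ (subst (_≤ suc k) (sym (size-insert {x = a} {σ} p)) (s≤s le))) r))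

      L⁻-a : ∀ σ → L σ ≡ true → lookup σ a ≡ false
      L⁻-a σ p = ¬true⇒false (link⁻-disjoint P ⁅ a ⁆ σ p a (singleton-∈ a))

      L⁻-face : ∀ σ → L σ ≡ true → Δ (σ [ a ]≔ true) ≡ true
      L⁻-face σ p = trans (cong Δ (sym (a∪ σ))) (∧-true⁻ʳ {∣ ⁅ a ⁆ ∪ σ ∣ ≤ᵇ suc k} (link⁻-face P ⁅ a ⁆ σ p))

      P-down : Down P
      P-down {σ} {τ} sub p = ∧-true⁺ (≤ᵇ-true⁺ (ℕₚ.≤-trans (size-mono σ τ sub) (≤ᵇ-true⁻ (∧-true⁻ˡ p)))) (down sub (∧-true⁻ʳ {∣ τ ∣ ≤ᵇ suc k} p))

      L-Down : Down L
      L-Down {σ} {τ} = link-down {P = P} P-down ⁅ a ⁆ {σ} {τ}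

      L-down : DownClosed L
      L-down {σ} {τ} x = L-Down {σ} {τ} (add-⊑ x)

    star : Subset (suc n) → Bool
    star σ = lookup σ a ∧ ofSize (suc q) Δ σ

    star-family : Family star
    star-family A p = ∧-true⁻ˡ (∧-true⁻ʳ {lookup A a} p) , ≡ᵇ-true⁻ (∧-true⁻ʳ {Δ A} (∧-true⁻ʳ {lookup A a} p))

    star⁺ : ∀ {α} → Family α → ∀ A → α A ≡ true → lookup A a ≡ true → star A ≡ true
    star⁺ fam A p r = ∧-true⁺ r (∧-true⁺ (proj₁ (fam A p)) (≡ᵇ-true⁺ (proj₂ (fam A p))))

    star-intersecting : Intersecting star
    star-intersecting A B p r = a , ∧-true⁻ˡ p , ∧-true⁻ˡ r

    outside-a : (Subset (suc n) → Bool) → Subset (suc n) → Bool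
    outside-a α A = α A ∧ not (lookup A a)

    restore : ∀ A → lookup A a ≡ true → (A [ a ]≔ false) [ a ]≔ true ≡ A
    restore A p = sym (addAt-τ (addAt-remove a A p))

    trace : (Subset (suc n) → Bool) → Subset (suc n) → Bool
    trace α σ = not (lookup σ a) ∧ α (σ [ a ]≔ true)

    Compressed : (Subset (suc n) → Bool) → Set
    Compressed α = ∀ A v (v≢a : v ≢ a) → α A ≡ true → lookup A a ≡ false → lookup A v ≡ true → α (Swap.sw a v v≢a A) ≡ true

    compressed-star : ∀ α → Family α → Intersecting α → Maximum α → Compressed α → ∀ A → α A ≡ true → lookup A a ≡ true
    compressed-star α fam int max comp A₀ A₀∈ = by (bool-cases (lookup A₀ a))
      where
      X W : Subset (suc n) → Bool
      X = outside-a α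
      W = trace α
      X⊆L : ∀ σ → X σ ≡ true → L σ ≡ true × ∣ σ ∣ ≡ suc q
      X⊆L σ p = L⁺ σ (not-true (∧-true⁻ʳ {α σ} p)) (cone σ (proj₁ f) le) le , proj₂ f
        where
        f = fam σ (∧-true⁻ˡ p)
        le : ∣ σ ∣ ≤ k
        le = subst (_≤ k) (sym (proj₂ f)) q+1≤k
      W⊆L : ∀ σ → W σ ≡ true → L σ ≡ true × ∣ σ ∣ ≡ q
      W⊆L σ p = L⁺ σ a∉ (proj₁ f) (subst (_≤ k) (sym size) (ℕₚ.<⇒≤ q+1≤k)) , size
        where
        a∉ = not-true (∧-true⁻ˡ p)
        f = fam (σ [ a ]≔ true) (∧-true⁻ʳ {not (lookup σ a)} p)
        size : ∣ σ ∣ ≡ q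
        size = ℕₚ.suc-injective (trans (sym (size-insert {x = a} {σ} a∉)) (proj₂ f))
      -- Replace a common point of the two sets by `a` in one of them; the result is again a member
      -- and must meet the other set, which avoids `a`, in a further point.
      XX : ∀ σ τ → X σ ≡ true → X τ ≡ true → 2 ≤ ∣ σ ∩ τ ∣
      XX σ τ p r = two (int σ τ σ∈ τ∈)
        where
        σ∈ = ∧-true⁻ˡ p
        τ∈ = ∧-true⁻ˡ r
        a∉σ = not-true (∧-true⁻ʳ {α σ} p)
        a∉τ = not-true (∧-true⁻ʳ {α τ} r)
        two : Meet σ τ → 2 ≤ ∣ σ ∩ τ ∣
        two (x , x∈σ , x∈τ) = second (int (sw σ) τ (comp σ x x≢a σ∈ a∉σ x∈σ) τ∈)
          where
          x≢a : x ≢ a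
          x≢a refl = true≢false x∈σ a∉σ
          open Swap a x x≢a
          second : Meet (sw σ) τ → 2 ≤ ∣ σ ∩ τ ∣
          second (y , y∈sw , y∈τ) = two-members {x = x} {y} {σ ∩ τ} (λ e → y≢x (sym e)) (∩-∈⁺ σ τ x x∈σ x∈τ) (∩-∈⁺ σ τ y (trans (sym (sw-other σ y≢a y≢x)) y∈sw) y∈τ)
            where
            y≢a : y ≢ a
            y≢a refl = true≢false y∈τ a∉τ
            y≢x : y ≢ x
            y≢x refl = true≢false (trans (sym (sw-v σ)) y∈sw) a∉σ
      XW : ∀ σ τ → X σ ≡ true → W τ ≡ true → 1 ≤ ∣ σ ∩ τ ∣
      XW σ τ p r = one (int σ (τ [ a ]≔ true) (∧-true⁻ˡ p) (∧-true⁻ʳ {not (lookup τ a)} r))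
        where
        one : Meet σ (τ [ a ]≔ true) → 1 ≤ ∣ σ ∩ τ ∣
        one (x , x∈σ , x∈τ) = ∈⇒size {x = x} (σ ∩ τ) (∩-∈⁺ σ τ x x∈σ (trans (sym (lookup∘update′ x≢a τ true)) x∈τ))
          where
          x≢a : x ≢ a
          x≢a refl = true≢false x∈σ (not-true (∧-true⁻ʳ {α σ} p))
      inside≤ : count (λ A → α A ∧ not (not (lookup A a))) ≤ count W
      inside≤ = count-injection {P = λ A → α A ∧ not (not (lookup A a))} {Q = W} (λ A → A [ a ]≔ false)
        (λ A p → ∧-true⁺ (cong not (lookup∘update a A false)) (trans (cong α (restore A (a∈ A p))) (∧-true⁻ˡ p)))
        (λ A B p r e → trans (sym (restore A (a∈ A p))) (trans (cong (λ C → (C [ a ]≔ true)) e) (restore B (a∈ B r))))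
        where
        a∈ : ∀ A → α A ∧ not (not (lookup A a)) ≡ true → lookup A a ≡ true
        a∈ A p = not-not (∧-true⁻ʳ {α A} p)
          where
          not-not : ∀ {b} → not (not b) ≡ true → b ≡ true
          not-not {true} _ = refl
      L≤star : count (ofSize q L) ≤ count star
      L≤star = count-injection {P = ofSize q L} {Q = star} (λ σ → σ [ a ]≔ true)
        (λ σ p → ∧-true⁺ (lookup∘update a σ true) (∧-true⁺ (L⁻-face σ (∧-true⁻ˡ p)) (≡ᵇ-true⁺ (trans (size-insert {x = a} {σ} (L⁻-a σ (∧-true⁻ˡ p))) (cong suc (≡ᵇ-true⁻ (∧-true⁻ʳ {L σ} p)))))))
        (λ σ τ p r e → trans (addAt-σ (addAt-insert a σ (L⁻-a σ (∧-true⁻ˡ p)))) (trans (cong (λ C → (C [ a ]≔ false)) e) (sym (addAt-σ (addAt-insert a τ (L⁻-a τ (∧-true⁻ˡ r)))))))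
      by : lookup A₀ a ≡ true ⊎ lookup A₀ a ≡ false → lookup A₀ a ≡ true
      by (inj₁ p) = p
      by (inj₂ p) = ⊥-elim (ℕₚ.<-irrefl refl (begin-strict
        count α ≡⟨ count-split α (λ A → not (lookup A a)) ⟨
        count X + count (λ A → α A ∧ not (not (lookup A a))) ≤⟨ ℕₚ.+-monoʳ-≤ (count X) inside≤ ⟩
        count X + count W <⟨ intersecting-bound {L = L} L-down depth k≤n q≤k {X} {W} X⊆L W⊆L XX XW {A₀} (∧-true⁺ A₀∈ (cong not p)) ⟩
        count (ofSize q L) ≤⟨ L≤star ⟩
        count star ≤⟨ max star star-family star-intersecting ⟩
        count α ∎))
        where open ℕₚ.≤-Reasoning

    module Compress (v : Fin (suc n)) (v≢a : v ≢ a) (α : Subset (suc n) → Bool) (fam : Family α) (int : Intersecting α) where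
      open Swap a v v≢a

      -- The compression of the family that trades `v` for `a`, described setwise: a pair of swapped
      -- sets of which one is a member keeps the set containing `a`. Sets containing both or neither
      -- are fixed by the swap and unaffected.
      β : Subset (suc n) → Bool
      β A = if lookup A a then α A ∨ α (sw A) else α A ∧ α (sw A)

      β-in : ∀ A → lookup A a ≡ true → β A ≡ α A ∨ α (sw A)
      β-in A p = cong (if_then α A ∨ α (sw A) else α A ∧ α (sw A)) p

      β-out : ∀ A → lookup A a ≡ false → β A ≡ α A ∧ α (sw A)
      β-out A p = cong (if_then α A ∨ α (sw A) else α A ∧ α (sw A)) p

      β⁻ : ∀ A → β A ≡ true → α A ≡ true ⊎ (lookup A a ≡ true × α (sw A) ≡ true)
      β⁻ A p = by (bool-cases (lookup A a))
        where
        by : lookup A a ≡ true ⊎ lookup A a ≡ false → α A ≡ true ⊎ (lookup A a ≡ true × α (sw A) ≡ true)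
        by (inj₂ r) = inj₁ (∧-true⁻ˡ (trans (sym (β-out A r)) p))
        by (inj₁ r) with ∨-true⁻ (trans (sym (β-in A r)) p)
        ... | inj₁ s = inj₁ s
        ... | inj₂ s = inj₂ (r , s)

      moved : ∀ A → α A ≡ true → β A ≡ false → lookup A a ≡ false × α (sw A) ≡ false × lookup A v ≡ true × β (sw A) ≡ true
      moved A A∈ A∉ = a∉ , sw∉ , v∈ , trans (β-in (sw A) (trans (sw-a A) v∈)) (trans (cong (α (sw A) ∨_) (trans (cong α (sw-sw A)) A∈)) (∨-zeroʳ _))
        where
        a∉ : lookup A a ≡ false
        a∉ = ¬true⇒false λ p → true≢false (trans (β-in A p) (cong (_∨ α (sw A)) A∈)) A∉
        sw∉ : α (sw A) ≡ false
        sw∉ = ¬true⇒false λ p → true≢false (trans (β-out A a∉) (∧-true⁺ A∈ p)) A∉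
        v∈ : lookup A v ≡ true
        v∈ = by (bool-cases (lookup A v))
          where
          by : lookup A v ≡ true ⊎ lookup A v ≡ false → lookup A v ≡ true
          by (inj₁ p) = p
          by (inj₂ p) = true≢false (trans (cong α (sw-same A (trans a∉ (sym p)))) A∈) sw∉

      β-family : Family β
      β-family A p = by (β⁻ A p) (bool-cases (lookup A v))
        where
        by : α A ≡ true ⊎ (lookup A a ≡ true × α (sw A) ≡ true) → lookup A v ≡ true ⊎ lookup A v ≡ false → Δ A ≡ true × ∣ A ∣ ≡ suc q
        by (inj₁ r) _ = fam A r
        by (inj₂ (a∈ , r)) (inj₁ v∈) = fam A (trans (cong α (sym (sw-same A (trans a∈ (sym v∈))))) r)
        by (inj₂ (a∈ , r)) (inj₂ v∉) = trans (cong Δ (sym back)) (shifted (sw A) v (proj₁ (fam (sw A) r)) (trans (sw-v A) a∈)) , trans (sym (sw-size A)) (proj₂ (fam (sw A) r))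
          where
          back : (sw A [ v ]≔ false) [ a ]≔ true ≡ A
          back = by-coordinates (trans (lookup∘update a (sw A [ v ]≔ false) true) (sym a∈))
            (trans (lookup∘update′ v≢a (sw A [ v ]≔ false) true) (trans (lookup∘update v (sw A) false) (sym v∉)))
            (λ p q → trans (lookup∘update′ p (sw A [ v ]≔ false) true) (trans (lookup∘update′ q (sw A) false) (sw-other A p q)))

      -- Two sets through `a` meet there. A set of the compressed family avoiding `a` lies in the
      -- old family together with its swap, so it offers the right partner whether the other set or
      -- the swap of the other set is an old member.
      β-intersecting : Intersecting β
      β-intersecting A B A∈ B∈ = by (bool-cases (lookup A a)) (bool-cases (lookup B a))
        where
        either : ∀ A B → β A ≡ true → lookup B a ≡ false → β B ≡ true → Meet A B
        either A B A∈ a∉ B∈ with β⁻ A A∈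
        ... | inj₁ r = int A B r (∧-true⁻ˡ (trans (sym (β-out B a∉)) B∈))
        ... | inj₂ (_ , r) = sw-meet A B (int (sw A) (sw B) r (∧-true⁻ʳ {α B} (trans (sym (β-out B a∉)) B∈)))
        by : lookup A a ≡ true ⊎ lookup A a ≡ false → lookup B a ≡ true ⊎ lookup B a ≡ false → Meet A B
        by (inj₁ p) (inj₁ r) = a , p , r
        by _ (inj₂ r) = either A B A∈ r B∈
        by (inj₂ p) (inj₁ r) = let (x , s , t) = either B A B∈ p A∈ in x , t , s

      count≤ : count α ≤ count β
      count≤ = count-injection {P = α} {Q = β} f (λ A p → into A p (bool-cases (β A))) (λ A B p r → inj A B p r (bool-cases (β A)) (bool-cases (β B)))
        where
        f : Subset (suc n) → Subset (suc n)
        f A = if β A then A else sw A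
        f-stay : ∀ A → β A ≡ true → f A ≡ A
        f-stay A p = cong (if_then A else sw A) p
        f-move : ∀ A → β A ≡ false → f A ≡ sw A
        f-move A p = cong (if_then A else sw A) p
        into : ∀ A → α A ≡ true → β A ≡ true ⊎ β A ≡ false → β (f A) ≡ true
        into A A∈ (inj₁ p) = trans (cong β (f-stay A p)) p
        into A A∈ (inj₂ p) = trans (cong β (f-move A p)) (proj₂ (proj₂ (proj₂ (moved A A∈ p))))
        mixed : ∀ A B → α A ≡ true → α B ≡ true → β B ≡ false → A ≡ sw B → A ≡ B
        mixed A B A∈ B∈ B∉ e = true≢false (trans (cong α (sym e)) A∈) (proj₁ (proj₂ (moved B B∈ B∉)))
        inj : ∀ A B → α A ≡ true → α B ≡ true → β A ≡ true ⊎ β A ≡ false → β B ≡ true ⊎ β B ≡ false → f A ≡ f B → A ≡ B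
        inj A B A∈ B∈ (inj₁ p) (inj₁ r) e = trans (sym (f-stay A p)) (trans e (f-stay B r))
        inj A B A∈ B∈ (inj₁ p) (inj₂ r) e = mixed A B A∈ B∈ r (trans (sym (f-stay A p)) (trans e (f-move B r)))
        inj A B A∈ B∈ (inj₂ p) (inj₁ r) e = sym (mixed B A B∈ A∈ p (trans (sym (f-stay B r)) (trans (sym e) (f-move A p))))
        inj A B A∈ B∈ (inj₂ p) (inj₂ r) e = trans (sym (sw-sw A)) (trans (cong sw (trans (sym (f-move A p)) (trans e (f-move B r)))) (sw-sw B))

      fewer : ∀ {A} → α A ≡ true → lookup A a ≡ false → α (sw A) ≡ false → count (outside-a β) < count (outside-a α)
      fewer {A} A∈ a∉ sw∉ = count-strict {P = outside-a β} {Q = outside-a α}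
        (λ B p → ∧-true⁺ (∧-true⁻ˡ (trans (sym (β-out B (not-true (∧-true⁻ʳ {β B} p)))) (∧-true⁻ˡ p))) (∧-true⁻ʳ {β B} p))
        A (∧-true⁺ A∈ (cong not a∉)) (cong (_∧ not (lookup A a)) (trans (β-out A a∉) (trans (cong (α A ∧_) sw∉) (cong (_∧ false) A∈))))

      -- If the compressed family is the full star of a, each face G of link a avoiding v carries exactly one of G ∪ {a}, G ∪ {v};
      -- the choice agrees on disjoint faces, hence is constant.
      uncompress : Maximum α → ∀ {A₀} → α A₀ ≡ true → lookup A₀ a ≡ false → lookup A₀ v ≡ true → α (sw A₀) ≡ false →
        (∃ λ c → ∀ A → β A ≡ true → lookup A c ≡ true) → ∃ λ c → ∀ A → α A ≡ true → lookup A c ≡ true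
      uncompress max {A₀} A₀∈ a∉ v∈ sw∉ (c , common) = by (c ≟F a) (c ≟F v)
        where
        β-swA₀ : β (sw A₀) ≡ true
        β-swA₀ = proj₂ (proj₂ (proj₂ (moved A₀ A₀∈ (trans (β-out A₀ a∉) (trans (cong (α A₀ ∧_) sw∉) (cong (_∧ false) A₀∈))))))
        at-a : c ≡ a → ∀ A → α A ≡ true → lookup A v ≡ true
        at-a refl A A∈ = member (bool-cases (lookup A a)) (bool-cases (lookup A v))
          where
          out-β : ∀ A → lookup A a ≡ false → β A ≡ false
          out-β A p = ¬true⇒false λ r → true≢false (common A r) p
          -- The compressed family lies in the star of `a` and is at least as large, because the
          -- original family is maximum; hence the two coincide.
          β-star : ∀ σ → star σ ≡ true → β σ ≡ true
          β-star σ p = full (bool-cases (β σ))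
            where
            full : β σ ≡ true ⊎ β σ ≡ false → β σ ≡ true
            full (inj₁ r) = r
            full (inj₂ r) = ⊥-elim (ℕₚ.<⇒≱ (count-strict {P = β} {Q = star} (λ A s → star⁺ β-family A s (common A s)) σ p r)
              (ℕₚ.≤-trans (max star star-family star-intersecting) count≤))
          -- Faces of the link of `a` that avoid `v`. Deleting `v` costs one unit of depth, leaving
          -- k - 1, and this is still at least 2q + 1.
          K = del L v
          G⁺ : ∀ G → K G ≡ true → ∣ G ∣ ≡ q → star (G [ a ]≔ true) ≡ true
          G⁺ G p size = ∧-true⁺ (lookup∘update a G true) (∧-true⁺ (L⁻-face G LG) (≡ᵇ-true⁺ (trans (size-insert {x = a} {G} (L⁻-a G LG)) (cong suc size))))
            where LG = ∧-true⁻ʳ {not (lookup G v)} p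
          χ : Subset (suc n) → Bool
          χ G = α (G [ a ]≔ true)
          one-way : ∀ G H → K G ≡ true → K H ≡ true → ∣ G ∣ ≡ q → ∣ H ∣ ≡ q → (∀ x → lookup G x ≡ true → lookup H x ≡ true → ⊥) → χ G ≡ true → χ H ≡ true
          one-way G H KG KH ∣G∣ ∣H∣ disj G∈ with ∨-true⁻ (trans (sym (β-in (H [ a ]≔ true) (lookup∘update a H true))) (β-star (H [ a ]≔ true) (G⁺ H KH ∣H∣)))
          ... | inj₁ r = r
          -- Otherwise `H` with `v` would be a member, yet it is disjoint from the member `G` with
          -- `a`.
          ... | inj₂ r = clash (int (G [ a ]≔ true) (sw (H [ a ]≔ true)) G∈ r)
            where
            v∉ : ∀ G → K G ≡ true → lookup (G [ a ]≔ true) v ≡ false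
            v∉ G KG = trans (lookup∘update′ v≢a G true) (not-true (∧-true⁻ˡ KG))
            clash : Meet (G [ a ]≔ true) (sw (H [ a ]≔ true)) → χ H ≡ true
            clash (x , p , s) with x ≟F a
            ... | yes refl = true≢false (trans (sym (sw-a (H [ a ]≔ true))) s) (v∉ H KH)
            ... | no x≢a with x ≟F v
            ...   | yes refl = true≢false p (v∉ G KG)
            ...   | no x≢v = ⊥-elim (disj x (trans (sym (lookup∘update′ x≢a G true)) p) (trans (sym (lookup∘update′ x≢a H true)) (trans (sym (sw-other (H [ a ]≔ true) x≢a x≢v)) s)))
          disjoint-equal : ∀ G H → K G ≡ true → K H ≡ true → ∣ G ∣ ≡ q → ∣ H ∣ ≡ q → (∀ x → lookup G x ≡ true → lookup H x ≡ true → ⊥) → χ G ≡ χ H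
          disjoint-equal G H KG KH ∣G∣ ∣H∣ disj = bool-ext (one-way G H KG KH ∣G∣ ∣H∣ disj) (one-way H G KH KG ∣H∣ ∣G∣ (λ x p r → disj x r p))
          K-depth : ∀ j → suc j ≡ k → Depth≥ K j
          K-depth j refl = depth-del j L-down v depth
          j = ℕ.pred k
          j+1≡k : suc j ≡ k
          j+1≡k = ℕₚ.suc-pred k {{ℕ.>-nonZero (ℕₚ.≤-trans (s≤s z≤n) q+1≤k)}}
          room : suc q + q ≤ j
          room = ℕₚ.≤-pred (ℕₚ.≤-trans (ℕₚ.≤-reflexive (lemma q)) (ℕₚ.≤-trans q≤k (ℕₚ.≤-reflexive (sym j+1≡k))))
            where
            lemma : ∀ q → suc (suc q + q) ≡ 2 * q + 2
            lemma = solve-∀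
          K-down : DownClosed K
          K-down = del-down L-down
          -- Extend `T` to a face with 2q + 1 vertices: the q vertices outside `T` form a face
          -- disjoint from both `G` and `G′`, so all three have the same colour.
          adjacent : ∀ {G G′ T} → K T ≡ true → ∣ T ∣ ≡ suc q → Add G T → Add G′ T → χ G ≡ χ G′
          adjacent {G} {G′} {T} KT ∣T∣ x y = through (extend-to j (K-depth j j+1≡k) q T KT (subst (_≤ j) (cong (_+ q) (sym ∣T∣)) room))
            where
            size : ∀ {G} → Add G T → ∣ G ∣ ≡ q
            size x = ℕₚ.suc-injective (trans (sym (add-size x)) ∣T∣)
            through : (∃ λ U → T ⊑ U × K U ≡ true × ∣ U ∣ ≡ ∣ T ∣ + q) → χ G ≡ χ G′
            through (U , sub , KU , ∣U∣) = trans (disjoint-equal G H (K-down x KT) KH (size x) ∣H∣ (apart x)) (sym (disjoint-equal G′ H (K-down y KT) KH (size y) ∣H∣ (apart y)))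
              where
              H = U ∖ T
              ∣H∣ : ∣ H ∣ ≡ q
              ∣H∣ = ℕₚ.+-cancelˡ-≡ (∣ T ∣) (∣ H ∣) q (trans (size-∖ T U sub) ∣U∣)
              KH : K H ≡ true
              KH = ∧-true⁺ (cong not (¬true⇒false λ p → true≢false (proj₁ (∖-∈⁻ U T v p)) (not-true (∧-true⁻ˡ KU))))
                (L-Down {H} {U} (λ x p → proj₁ (∖-∈⁻ U T x p)) (∧-true⁻ʳ {not (lookup U v)} KU))
              apart : ∀ {G} → Add G T → ∀ x → lookup G x ≡ true → lookup H x ≡ true → ⊥
              apart a x p r = true≢false (add-⊑ a x p) (proj₂ (∖-∈⁻ U T x r))
          constant : ∀ G H → K G ≡ true → K H ≡ true → ∣ G ∣ ≡ q → ∣ H ∣ ≡ q → χ G ≡ χ H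
          constant = strongly-connected q j K-down (K-depth j j+1≡k) (ℕₚ.≤-trans (ℕₚ.m≤m+n (suc q) q) room) χ adjacent
          base : ∀ B → β B ≡ true → lookup B v ≡ false → K (B [ a ]≔ false) ≡ true × ∣ B [ a ]≔ false ∣ ≡ q
          base B p v∉ = ∧-true⁺ (cong not (trans (lookup∘update′ v≢a B false) v∉)) (L⁺ (B [ a ]≔ false) (lookup∘update a B false) (trans (cong Δ (restore B a∈)) (proj₁ f)) (subst (_≤ k) (sym size) (ℕₚ.<⇒≤ q+1≤k))) , size
            where
            a∈ = common B p
            f = β-family B p
            size : ∣ B [ a ]≔ false ∣ ≡ q
            size = ℕₚ.suc-injective (trans (sym (size-remove {x = a} {B} a∈)) (proj₂ f))
          member : lookup A a ≡ true ⊎ lookup A a ≡ false → lookup A v ≡ true ⊎ lookup A v ≡ false → lookup A v ≡ true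
          member _ (inj₁ p) = p
          member (inj₂ r) (inj₂ p) = proj₁ (proj₂ (proj₂ (moved A A∈ (out-β A r))))
          -- A member through `a` without `v` would have colour true, whereas `sw A₀`, also through
          -- `a` without `v`, is not in `α` and has colour false.
          member (inj₁ r) (inj₂ p) = true≢false (trans (cong α (restore A r)) A∈)
              (trans (constant (A [ a ]≔ false) (sw A₀ [ a ]≔ false) (proj₁ b) (proj₁ b₀) (proj₂ b) (proj₂ b₀)) (trans (cong α (restore (sw A₀) (common (sw A₀) β-swA₀))) sw∉))
            where
            b = base A (trans (β-in A r) (cong (_∨ α (sw A)) A∈)) p
            b₀ = base (sw A₀) β-swA₀ (trans (sw-v A₀) a∉)
        by : Dec (c ≡ a) → Dec (c ≡ v) → ∃ λ c → ∀ A → α A ≡ true → lookup A c ≡ true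
        by (yes e) _ = v , at-a e
        by (no c≢a) (yes refl) = true≢false (common (sw A₀) β-swA₀) (trans (sw-v A₀) a∉)
        by (no c≢a) (no c≢v) = c , λ A A∈ → other A A∈ (bool-cases (β A))
          where
          other : ∀ A → α A ≡ true → β A ≡ true ⊎ β A ≡ false → lookup A c ≡ true
          other A A∈ (inj₁ p) = common A p
          other A A∈ (inj₂ p) = trans (sym (sw-other A c≢a c≢v)) (common (sw A) (proj₂ (proj₂ (proj₂ (moved A A∈ p)))))

    -- Each effective compression lowers the number of members avoiding `a`, which is bounded by
    -- `N`; it preserves maximality, and `uncompress` carries a common element back.
    maximum-star : ∀ N α → count (outside-a α) < N → Family α → Intersecting α → Maximum α → ∃ λ c → ∀ A → α A ≡ true → lookup A c ≡ true
    maximum-star (suc N) α lt fam int max = by (anySubset? λ A → any? λ v → uncompressed? A v)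
      where
      Uncompressed : Subset (suc n) → Fin (suc n) → Set
      Uncompressed A v = ∃ λ (v≢a : v ≢ a) → α A ≡ true × lookup A a ≡ false × lookup A v ≡ true × α (Swap.sw a v v≢a A) ≡ false
      uncompressed? : ∀ A v → Dec (Uncompressed A v)
      uncompressed? A v with v ≟F a
      ... | yes e = no λ (ne , _) → ne e
      ... | no ne = map′ (λ r → ne , r) (λ { (_ , r) → r }) ((α A ≟B true) ×-dec (lookup A a ≟B false) ×-dec (lookup A v ≟B true) ×-dec (α (Swap.sw a v ne A) ≟B false))
      by : Dec (∃ λ A → ∃ λ v → Uncompressed A v) → ∃ λ c → ∀ A → α A ≡ true → lookup A c ≡ true
      by (no none) = a , compressed-star α fam int max λ A v v≢a A∈ a∉ v∈ → ¬false (α (Swap.sw a v v≢a A)) λ s → none (A , v , v≢a , A∈ , a∉ , v∈ , s)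
        where
        ¬false : ∀ b → ¬ (b ≡ false) → b ≡ true
        ¬false true _ = refl
        ¬false false f = ⊥-elim (f refl)
      by (yes (A , v , v≢a , A∈ , a∉ , v∈ , s)) = uncompress max A∈ a∉ v∈ s
          (maximum-star N β (ℕₚ.<-≤-trans (fewer A∈ a∉ s) (ℕₚ.≤-pred lt)) β-family β-intersecting (λ γ f g → ℕₚ.≤-trans (max γ f g) count≤))
        where open Compress v v≢a α fam int

-- From the hypotheses of the theorem to the compression argument

open import Defs
open Counting
open Depth using (Depth≥)
open LinearAlgebra using (_>>=_; return; _≟S_)
open Connectivity
open Links
open NearCone
open import Data.Fin.Subset using (∣_∣; _-_)
open import Data.Fin.Subset.Properties using (_∈?_; x∈p∧x≢y⇒x∈p-y; x∈p∩q⁻; x∈p∩q⁺)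
open import Data.List.Membership.Propositional using () renaming (_∈_ to _∈ˡ_)
open import Data.List.Membership.DecPropositional using () renaming (_∈?_ to member?)
import Data.List.Relation.Unary.All as All
open import Data.Nat using (_+_; _*_; _≤_; _<_; _≤ᵇ_)
open import Data.Nat.Tactic.RingSolver using (solve-∀)
open import Data.Vec.Properties using (lookup⇒[]=; []=⇒lookup)
open import Level using (Level)
open import Relation.Binary.PropositionalEquality
open import Relation.Nullary.Decidable using (map′; decidable-stable; dec-true)

shrink : ∀ {n} (σ : Subset n) m → m ≤ ∣ σ ∣ → ∃ λ τ → τ ⊑ σ × ∣ τ ∣ ≡ m
shrink [] zero le = [] , (λ x p → p) , refl
shrink (false ∷ σ) m le with shrink σ m le
... | τ , sub , size = false ∷ τ , (λ { zero p → p ; (suc x) p → sub x p }) , size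
shrink (true ∷ σ) zero le with shrink σ zero z≤n
... | τ , sub , size = false ∷ τ , (λ { zero p → refl ; (suc x) p → sub x p }) , size
shrink (true ∷ σ) (suc m) (s≤s le) with shrink σ m le
... | τ , sub , size = true ∷ τ , (λ { zero p → refl ; (suc x) p → sub x p }) , cong suc size

module Skeleton {n : ℕ} (Δ : SimplicialComplex (suc n)) (a : Fin (suc n)) (shifted : ShiftedWrt (SimplicialComplex.face Δ) a)
  (k : ℕ) (large : HasFaceOfSize≥ (SimplicialComplex.face Δ) (suc k)) where
  open SimplicialComplex Δ using (face)

  Δ-down : Down face
  Δ-down {σ} {τ} sub = SimplicialComplex.down Δ τ σ λ {x} p → lookup⇒[]= x τ (sub x ([]=⇒lookup p))

  Δ-shifted : ∀ B w → face B ≡ true → lookup B w ≡ true → face ((B [ w ]≔ false) [ a ]≔ true) ≡ true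
  Δ-shifted B w p w∈ = Δ-down inside (shifted B w p (lookup⇒[]= w B w∈))
    where
    inside : (B [ w ]≔ false) [ a ]≔ true ⊑ (B - w) ∪ ⁅ a ⁆
    inside x q with insert-∈⁻ (B [ w ]≔ false) a x q
    ... | inj₁ refl = ∪-∈ʳ (B - w) ⁅ a ⁆ x (singleton-∈ x)
    ... | inj₂ r with x ≟F w
    ...   | yes refl = true≢false r (lookup∘update w B false)
    ...   | no x≢w = ∪-∈ˡ (B - w) ⁅ a ⁆ x ([]=⇒lookup (x∈p∧x≢y⇒x∈p-y (lookup⇒[]= x B (trans (sym (lookup∘update′ x≢w B false)) r)) x≢w))

  P : Subset (suc n) → Bool
  P = skelSize (suc k) face

  P⁺ : ∀ σ → ∣ σ ∣ ≤ suc k → face σ ≡ true → P σ ≡ true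
  P⁺ σ le p = ∧-true⁺ (≤ᵇ-true⁺ le) p

  P⁻-size : ∀ σ → P σ ≡ true → ∣ σ ∣ ≤ suc k
  P⁻-size σ p = ≤ᵇ-true⁻ (∧-true⁻ˡ p)

  P⁻-face : ∀ σ → P σ ≡ true → face σ ≡ true
  P⁻-face σ p = ∧-true⁻ʳ {∣ σ ∣ ≤ᵇ suc k} p

  P-down : Down P
  P-down {σ} {τ} sub p = P⁺ σ (ℕₚ.≤-trans (size-mono σ τ sub) (P⁻-size τ p)) (Δ-down sub (P⁻-face τ p))

  facet : ∃ λ C → P C ≡ true × ∣ C ∣ ≡ suc k
  facet = let (B , p , le) = large ; (C , sub , size) = shrink B (suc k) le in C , P⁺ C (ℕₚ.≤-reflexive size) (Δ-down sub p) , size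

  module _ (sections : AllSections P) where
    open PureOf P-down P⁻-size sections using (extends; depth-link)

    -- Shifting any vertex of a facet to `a` produces a face through `a`.
    a-vertex : P ⁅ a ⁆ ≡ true
    a-vertex = P⁺ ⁅ a ⁆ (subst (_≤ suc k) (sym (∣⁅x⁆∣≡1 a)) (s≤s z≤n)) (Δ-down inside (Δ-shifted C w (P⁻-face C (proj₁ (proj₂ facet))) (proj₂ vertex)))
      where
      C = proj₁ facet
      vertex = size⇒∈ C (subst (1 ≤_) (sym (proj₂ (proj₂ facet))) (s≤s z≤n))
      w = proj₁ vertex
      inside : ⁅ a ⁆ ⊑ (C [ w ]≔ false) [ a ]≔ true
      inside x p = subst (λ y → lookup ((C [ w ]≔ false) [ a ]≔ true) y ≡ true) (sym (∈-singleton p)) (lookup∘update a (C [ w ]≔ false) true)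

    depth : Depth≥ (link P ⁅ a ⁆) k
    depth = depth-link facet k ⁅ a ⁆ a-vertex (ℕₚ.≤-reflexive (cong (_+ k) (∣⁅x⁆∣≡1 a)))

    -- By purity `B` lies in a face with k + 1 vertices, hence with a vertex outside `B`. If that
    -- face lacks `a`, shifting the spare vertex to `a` keeps `B` intact.
    cone : ∀ B → face B ≡ true → ∣ B ∣ ≤ k → face (B [ a ]≔ true) ≡ true
    cone B p le = by (bool-cases (lookup C a))
      where
      extension = extends facet B (P⁺ B (ℕₚ.m≤n⇒m≤1+n le) p)
      C = proj₁ extension
      B⊑C = proj₁ (proj₂ extension)
      C-face = P⁻-face C (proj₁ (proj₂ (proj₂ extension)))
      new = ∈-∖ B C B⊑C (subst (∣ B ∣ <_) (sym (proj₂ (proj₂ (proj₂ extension)))) (s≤s le))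
      w = proj₁ new
      by : lookup C a ≡ true ⊎ lookup C a ≡ false → face (B [ a ]≔ true) ≡ true
      by (inj₁ a∈) = Δ-down inside C-face
        where
        inside : B [ a ]≔ true ⊑ C
        inside x q with insert-∈⁻ B a x q
        ... | inj₁ refl = a∈
        ... | inj₂ r = B⊑C x r
      by (inj₂ _) = Δ-down inside (Δ-shifted C w C-face (proj₁ (proj₂ new)))
        where
        inside : B [ a ]≔ true ⊑ (C [ w ]≔ false) [ a ]≔ true
        inside x q with insert-∈⁻ B a x q
        ... | inj₁ refl = lookup∘update x (C [ w ]≔ false) true
        ... | inj₂ r = insert-⊑ (C [ w ]≔ false) a x (trans (lookup∘update′ (λ { refl → true≢false r (proj₂ (proj₂ new)) }) C false) (B⊑C x r))

    strictly-EKR : ∀ q → 2 * suc q < suc k → StrictlyEKR face (suc q)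
    strictly-EKR q (s≤s lt) 𝒜 ((unique , faces) , int , max) = let (c , common) = maximum-star (suc (count (outside-a α))) α ℕₚ.≤-refl α-family α-int α-max in
        c , λ A A∈ → lookup⇒[]= c A (common A (dec-true (_∈ᵈ_ A) A∈))
      where
      double : ∀ q → 2 * q + 2 ≡ 2 * suc q
      double = solve-∀
      open Families face Δ-down a Δ-shifted {k} {q} (ℕₚ.<⇒≤ (ℕₚ.≤-trans (proj₂ (proj₂ large)) (∣p∣≤n (proj₁ large)))) (ℕₚ.≤-trans (ℕₚ.≤-reflexive (double q)) lt) cone depth
        renaming (Family to RFamily; Intersecting to Intersecting′)
      _∈ᵈ_ : ∀ A → Dec (A ∈ˡ 𝒜)
      _∈ᵈ_ A = member? _≟S_ A 𝒜
      α : Subset (suc n) → Bool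
      α A = does (_∈ᵈ_ A)
      α⁻ : ∀ A → α A ≡ true → A ∈ˡ 𝒜
      α⁻ A = does⁻ (_∈ᵈ_ A)
      α-family : RFamily α
      α-family A p = faces A (α⁻ A p)
      α-int : Intersecting′ α
      α-int A B p r = let (x , x∈) = int A B (α⁻ A p) (α⁻ B r) ; (l , m) = x∈p∩q⁻ A B x∈ in x , []=⇒lookup l , []=⇒lookup m
      α-max : Maximum α
      α-max β fam β-int = begin
        count β ≡⟨ length-elems β ⟨
        length (elems β) ≤⟨ max (elems β) (elems-unique β , λ A A∈ → fam A (∈-elems⁻ β A∈)) meet ⟩
        length 𝒜 ≤⟨ unique-⊆-length unique (λ {A} A∈ → ∈-elems⁺ α (dec-true (_∈ᵈ_ A) A∈)) ⟩
        length (elems α) ≡⟨ length-elems α ⟩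
        count α ∎
        where
        open ℕₚ.≤-Reasoning
        meet : Intersecting (elems β)
        meet A B p r = let (x , l , m) = β-int A B (∈-elems⁻ β p) (∈-elems⁻ β r) in x , x∈p∩q⁺ (lookup⇒[]= x A l , lookup⇒[]= x B m)

theorem1p3 : ∀ {c ℓ : Level} (F : Field c ℓ) {n : ℕ}
  (Δ : SimplicialComplex n) (d r : ℕ) (a : Fin n) →
  Homology.DepthEq F (SimplicialComplex.face Δ) d →
  0 < r → 2 * r < d →
  ShiftedWrt (SimplicialComplex.face Δ) a →
  StrictlyEKR (SimplicialComplex.face Δ) r
theorem1p3 F {suc n} Δ (suc k) (suc q) a (cm , large , _) _ lt shifted 𝒜 max = decidable-stable
  (any? λ v → map′ (λ all A A∈ → All.lookup all A∈) (λ f → All.tabulate (λ {A} → f A)) (All.all? (v ∈?_) 𝒜))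
  (all-sections F P-down cm >>= λ sections → return (strictly-EKR sections q lt 𝒜 max))
  where open Skeleton Δ a shifted k large
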